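{- Let $\zeta_3$ be a primitive cube root of unity. Then, as power series in $q$, $$\frac{1}{(q;q)_\infty}\left(\sum_{n=-\infty}^\infty\frac{q^{6n^2+2n}}{(1-\zeta_3q^{3n})(1-\zeta_3^{ -1}q^{3n})}-\sum_{n=-\infty}^\infty \frac{q^{6n^2+8n+2}}{(1-\zeta_3q^{3n+1})(1-\zeta_3^{ -1}q^{3n+1})}\right)=A_{130}(q^3)+qA_{131}(q^3)+q^2A_{132}(q^3),$$ where $$A_{130}(q)=\frac13\frac{(q^9;q^9)_\infty^2[q^4;q^9]_\infty^2}{(q;q)_\infty}+\frac23 q\frac{(q^9;q^9)_\infty^2[q,q^2;q^9]_\infty}{(q;q)_\infty},$$ $$A_{131}(q)=\frac{q}{(q^9;q^9)_\infty[q^4;q^9]_\infty}\Big(S(-3,-28,9)-q^{28}S(11,28,9)\Big)+\frac13\frac{(q^9;q^9)_\infty^2[q^2,q^4;q^9]_\infty}{(q;q)_\infty}+\frac13 q\frac{(q^9;q^9)_\infty^2[q;q^9]_\infty^2}{(q;q)_\infty},$$ $$A_{132}(q)=-\frac{q^2}{(q^9;q^9)_\infty[q;q^9]_\infty}\Big(S(3,-2,9)-q^{2}S(4,2,9)\Big)+\frac13\frac{(q^9;q^9)_\infty^2[q,q^4;q^9]_\infty}{(q;q)_\infty}-\frac23\frac{(q^9;q^9)_\infty^2[q^2;q^9]_\infty^2}{(q;q)_\infty}.$$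
   Context: $(a;q)_\infty=\prod_{j\ge0}(1-aq^j)$; $[z;q]_\infty=(z;q)_\infty(q/z;q)_\infty$ and $[z_1,\dots,z_k;q]_\infty=[z_1;q]_\infty\cdots[z_k;q]_\infty$. For $z,w$, $S(z,w,q)=\sum_{n=-\infty}^\infty \frac{q^{2n(n+1)}w^n}{1-zq^n}$, and for integers $a,b,c$ one writes $S(a,b,c)=S(q^a,q^b,q^c)$. -}

module Defs where

open import Data.Nat as ℕ using (ℕ; zero; suc)
open import Data.Integer as ℤ using (ℤ; +_; -[1+_])
open import Data.Rational as ℚ using (ℚ; 0ℚ; 1ℚ)
open import Data.Rational.Properties as ℚP using ()
open import Relation.Nullary using (yes; no)
open import Relation.Binary.PropositionalEquality using (_≡_)

-- The field K = ℚ(ζ), ζ a primitive cube root of unity: ζ² = -1 - ζ.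
-- An element  re + im·ζ .

record K : Set where
  constructor mkK
  field
    re im : ℚ

0K 1K ζ : K
0K = mkK 0ℚ 0ℚ
1K = mkK 1ℚ 0ℚ
ζ  = mkK 0ℚ 1ℚ

fromℚ : ℚ → K
fromℚ a = mkK a 0ℚ

infixl 6 _+K_ _-K_
infixl 7 _*K_

_+K_ : K → K → K
mkK a b +K mkK c d = mkK (a ℚ.+ c) (b ℚ.+ d)

-K_ : K → K
-K mkK a b = mkK (ℚ.- a) (ℚ.- b)

_-K_ : K → K → K
x -K y = x +K (-K y)

-- (a + bζ)(c + dζ) = (ac - bd) + (ad + bc - bd)ζ   using ζ² = -1 - ζ
_*K_ : K → K → K
mkK a b *K mkK c d = mkK (a ℚ.* c ℚ.- b ℚ.* d) (a ℚ.* d ℚ.+ b ℚ.* c ℚ.- b ℚ.* d)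

-- multiplicative inverse (with the convention 0⁻¹ = 0):
-- (a + bζ)⁻¹ = ((a - b) - bζ) / (a² - ab + b²)
invK : K → K
invK (mkK a b) with a ℚ.* a ℚ.- a ℚ.* b ℚ.+ b ℚ.* b ℚP.≟ 0ℚ
... | yes _ = 0K
... | no n≢0 = mkK ((a ℚ.- b) ℚ.÷ n) ((ℚ.- b) ℚ.÷ n)
  where
  n = a ℚ.* a ℚ.- a ℚ.* b ℚ.+ b ℚ.* b
  instance
    _ : ℚ.NonZero n
    _ = ℚ.≢-nonZero n≢0

_^K_ : K → ℕ → K
x ^K zero  = 1K
x ^K suc k = x *K (x ^K k)

sumK : ℕ → (ℕ → K) → K
sumK zero    f = 0K
sumK (suc n) f = f n +K sumK n f

δ : ℕ → ℕ → K
δ m n with m ℕ.≟ n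
... | yes _ = 1K
... | no _  = 0K

PS : Set
PS = ℕ → K

infixl 6 _+P_ _-P_
infixl 7 _*P_

_+P_ _-P_ _*P_ : PS → PS → PS
(f +P g) n = f n +K g n
(f -P g) n = f n -K g n
(f *P g) n = sumK (suc n) (λ j → f j *K g (n ℕ.∸ j))

scaleP : K → PS → PS
scaleP c f n = c *K f n

X^ : ℕ → PS
X^ m n = δ m n

oneP : PS
oneP = X^ 0

constP : K → PS
constP c = scaleP c oneP

powP : PS → ℕ → PS
powP f zero    = oneP
powP f (suc k) = f *P powP f k

-- inverse of a power series with constant term 1:  1/f = Σ_k (1 - f)^k
inv1 : PS → PS
inv1 f n = sumK (suc n) (λ k → powP (oneP -P f) k n)

finPoch : ℕ → ℕ → ℕ → PS
finPoch a b zero    = oneP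
finPoch a b (suc m) = (oneP -P X^ (a ℕ.+ b ℕ.* m)) *P finPoch a b m

-- (q^a ; q^b)_∞ = Π_{j ≥ 0} (1 - q^(a + b j))   (for a, b ≥ 1; the
-- coefficient of q^n only involves the factors with j ≤ n)
poch : ℕ → ℕ → PS
poch a b n = finPoch a b (suc n) n

-- [q^a ; q^b]_∞ = (q^a ; q^b)_∞ (q^(b-a) ; q^b)_∞   (for 0 < a < b)
theta : ℕ → ℕ → PS
theta a b = poch a b *P poch (b ℕ.∸ a) b

-- Σ_{j ≥ 0} c^j q^(d j)  = 1/(1 - c q^d)   (d ≥ 1)
geo : K → ℕ → PS
geo c d n = sumK (suc n) (λ j → (c ^K j) *K δ (d ℕ.* j) n)

-- The expansion in K((q)) of 1/(1 - c q^m), m ∈ ℤ (c ≠ 0; c ≠ 1 if m = 0):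
--   m > 0 :  Σ_{j≥0} c^j q^(mj)
--   m = 0 :  (1 - c)⁻¹
--   m < 0 :  1/(1 - c q^(-d)) = -c⁻¹q^d/(1 - c⁻¹q^d) = 1 - Σ_{j≥0} c^(-j) q^(dj)
geomInv : K → ℤ → PS
geomInv c (+ zero)    = constP (invK (1K -K c))
geomInv c (+ suc k)   = geo c (suc k)
geomInv c (-[1+ k ])  = oneP -P geo (invK c) (suc k)

-- substitution q ↦ q^d  (d ≥ 1)
substP : ℕ → PS → PS
substP d f n = sumK (suc n) (λ j → f j *K δ (d ℕ.* j) n)

-- Formal Laurent series: q^(-low) · ser

record Laurent : Set where
  constructor lau
  field
    low : ℕ
    ser : PS

coeffL : Laurent → ℤ → K
coeffL (lau L f) k with k ℤ.+ + L
... | + n      = f n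
... | -[1+ _ ] = 0K

fromPS : PS → Laurent
fromPS f = lau 0 f

mono : ℤ → Laurent
mono (+ n)     = lau 0 (X^ n)
mono -[1+ n ]  = lau (suc n) oneP

infixl 6 _+L_ _-L_
infixl 7 _*L_

_+L_ _-L_ _*L_ : Laurent → Laurent → Laurent
lau L f +L lau M g = lau (L ℕ.+ M) (X^ M *P f +P X^ L *P g)
lau L f -L lau M g = lau (L ℕ.+ M) (X^ M *P f -P X^ L *P g)
lau L f *L lau M g = lau (L ℕ.+ M) (f *P g)

scaleL : K → Laurent → Laurent
scaleL c (lau L f) = lau L (scaleP c f)

substL : ℕ → Laurent → Laurent
substL d (lau L f) = lau (L ℕ.* d) (substP d f)

symSum : ℕ → (ℤ → K) → K
symSum M t = sumK (suc (M ℕ.+ M)) (λ i → t (+ i ℤ.- + M))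

-- Bilateral sum Σ_{n ∈ ℤ} t n of Laurent series, all of whose terms
-- vanish below q^(-L).  The coefficient of q^(N-L) is the (stable) value of
-- the truncated sum over |n| ≤ N + L + 30; for every family used below the
-- terms with |n| > N + L + 30 have q-adic valuation > N - L.
bisum : ℕ → (ℤ → Laurent) → Laurent
bisum L t = lau L (λ N → symSum (N ℕ.+ L ℕ.+ 30) (λ n → coeffL (t n) (+ N ℤ.- + L)))

-- S(a,b,c) = S(q^a, q^b, q^c) = Σ_n q^(2c n(n+1)) q^(bn) / (1 - q^(a + cn)),
-- as a Laurent series with terms vanishing below q^(-L).
S : ℕ → ℤ → ℤ → ℤ → Laurent
S L a b c = bisum L (λ n →
  mono (c ℤ.* (+ 2 ℤ.* n ℤ.* (n ℤ.+ + 1)) ℤ.+ b ℤ.* n) *L fromPS (geomInv 1K (a ℤ.+ c ℤ.* n)))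

ζ⁻¹ : K
ζ⁻¹ = invK ζ

third twoThirds : K
third     = fromℚ (+ 1 ℚ./ 3)
twoThirds = fromℚ (+ 2 ℚ./ 3)

invQQ : PS
invQQ = inv1 (poch 1 1)

sum1 : Laurent
sum1 = bisum 0 (λ n →
  mono (+ 6 ℤ.* n ℤ.* n ℤ.+ + 2 ℤ.* n)
  *L fromPS (geomInv ζ (+ 3 ℤ.* n) *P geomInv ζ⁻¹ (+ 3 ℤ.* n)))

sum2 : Laurent
sum2 = bisum 0 (λ n →
  mono (+ 6 ℤ.* n ℤ.* n ℤ.+ + 8 ℤ.* n ℤ.+ + 2)
  *L fromPS (geomInv ζ (+ 3 ℤ.* n ℤ.+ + 1) *P geomInv ζ⁻¹ (+ 3 ℤ.* n ℤ.+ + 1)))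

LHS : Laurent
LHS = fromPS invQQ *L (sum1 -L sum2)

E : PS
E = poch 9 9 *P poch 9 9 *P invQQ

A130 : Laurent
A130 = fromPS (scaleP third (E *P theta 4 9 *P theta 4 9)
           +P scaleP twoThirds (X^ 1 *P E *P theta 1 9 *P theta 2 9))

A131 : Laurent
A131 = (fromPS (X^ 1 *P inv1 (poch 9 9 *P theta 4 9))
          *L (S 0 (ℤ.- + 3) (ℤ.- + 28) (+ 9) -L mono (+ 28) *L S 28 (+ 11) (+ 28) (+ 9)))
       +L fromPS (scaleP third (E *P theta 2 9 *P theta 4 9)
                  +P scaleP third (X^ 1 *P E *P theta 1 9 *P theta 1 9))

A132 : Laurent
A132 = (scaleL (-K 1K) (fromPS (X^ 2 *P inv1 (poch 9 9 *P theta 1 9)))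
          *L (S 0 (+ 3) (ℤ.- + 2) (+ 9) -L mono (+ 2) *L S 0 (+ 4) (+ 2) (+ 9)))
       +L fromPS (scaleP third (E *P theta 1 9 *P theta 4 9)
                  -P scaleP twoThirds (E *P theta 2 9 *P theta 2 9))

RHS : Laurent
RHS = substL 3 A130 +L mono (+ 1) *L substL 3 A131 +L mono (+ 2) *L substL 3 A132

_≈L_ : Laurent → Laurent → Set
f ≈L g = ∀ (k : ℤ) → coeffL f k ≡ coeffL g k

-- Write J = (q⁹;q⁹)∞ and u, v, w for [q], [q²], [q⁴] in base q⁹. Since (1 - ζx)(1 - ζ⁻¹x) = (1 - x³)/(1 - x), the two
-- bilateral sums are combinations of Lambert series Σ q^(6n² + Bn + C)/(1 - q^(9n + 3a)), whose 3-dissections consist of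
-- Lambert series of the form Σ q^(18n² + Bn + C)/(1 - q^(9n + a)) in q³. By the triple product
-- (q;q)∞ = (J w)(q³) - q (J v)(q³) - q² (J u)(q³), so multiplication by (q;q)∞ turns the theorem into three identities between
-- such series, one for each residue modulo 3. They follow from the partial fraction expansion of 1/([x q^a₁][x q^a₂][x q^a₃][x q^a₄]),
-- from its degenerate case, the constant term at x = 1 of that of 1/([x][x q^a₁][x q^a₂][x q^a₃]), and from the expression of
-- an Eisenstein series of weight one by theta quotients. All expansions are limits of finite ones, and these come from
-- U(a) U(b) = U(b - a) U(a) + U(a - b) U(b) for U(a) = 1/(1 - q^a), a ∈ ℤ.

module Submission where

open import Defs
open import Level using (Level; _⊔_; 0ℓ)
open import Data.Nat as ℕ using (ℕ; zero; suc; s≤s; z≤n)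
import Data.Nat.Properties as ℕP
import Data.Nat.DivMod as ℕD
import Data.Nat.Solver
open import Data.Integer as ℤ using (ℤ; +_; -[1+_])
import Data.Integer.Properties as ℤP
import Data.Integer.Solver
open import Data.Rational using (0ℚ; 1ℚ)
import Data.Rational.Properties as ℚP
import Data.Rational.Solver
open import Data.Maybe using (just; nothing)
open import Data.Empty using (⊥-elim)
open import Data.Sum using (inj₁; inj₂)
open import Data.Product using (_×_; _,_; proj₁; proj₂; ∃; Σ)
open import Data.List using (List; []; _∷_; _++_; map)
open import Data.List.Relation.Unary.All as All using (All; []; _∷_)
import Data.List.Relation.Unary.All.Properties as AllP
open import Relation.Nullary using (yes; no)
open import Relation.Binary.Definitions using (tri<; tri≈; tri>)
open import Relation.Binary.PropositionalEquality as ≡ using (_≡_; _≢_)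
open import Algebra.Bundles using (CommutativeRing)
import Algebra.Solver.Ring
import Algebra.Solver.Ring.AlmostCommutativeRing as ACR
import Algebra.Properties.Ring
import Algebra.Properties.AbelianGroup
import Algebra.Properties.Semiring.Mult.TCOptimised
import Relation.Binary.Reasoning.Setoid

module RingKit {c ℓ : Level} (R : CommutativeRing c ℓ) where
  open CommutativeRing R public hiding (zero)
  open Algebra.Properties.Ring ring public
    using (-‿distribˡ-*; -‿distribʳ-*; -0#≈0#; -‿involutive)
  open Algebra.Properties.AbelianGroup +-abelianGroup using (⁻¹-∙-comm)
  open Algebra.Properties.Semiring.Mult.TCOptimised semiring using (1+×; ×-homo-+; ×1-homo-*) renaming (_×_ to _⊠_)
  open Relation.Binary.Reasoning.Setoid setoid

  infix 4 _≋_
  _≋_ : Carrier → Carrier → Set ℓ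
  _≋_ = _≈_

  fromℤ : ℤ → Carrier
  fromℤ (+ n)    = n ⊠ 1#
  fromℤ -[1+ n ] = - (suc n ⊠ 1#)

  private
    cancel-suc : ∀ o x y → (o + x) + - (o + y) ≈ x + - y
    cancel-suc o x y = begin
      (o + x) + - (o + y)       ≈⟨ +-congˡ (sym (⁻¹-∙-comm o y)) ⟩
      (o + x) + (- o + - y)     ≈⟨ +-congʳ (+-comm o x) ⟩
      (x + o) + (- o + - y)     ≈⟨ +-assoc x o _ ⟩
      x + (o + (- o + - y))     ≈⟨ +-congˡ (sym (+-assoc o _ _)) ⟩
      x + ((o + - o) + - y)     ≈⟨ +-congˡ (+-congʳ (-‿inverseʳ o)) ⟩
      x + (0# + - y)            ≈⟨ +-congˡ (+-identityˡ _) ⟩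
      x + - y                   ∎

    from-neg : ∀ n → fromℤ (ℤ.- + n) ≈ - (n ⊠ 1#)
    from-neg zero    = sym -0#≈0#
    from-neg (suc n) = refl

    from-⊖ : ∀ m n → fromℤ (m ℤ.⊖ n) ≈ m ⊠ 1# + - (n ⊠ 1#)
    from-⊖ zero zero = sym (trans (+-congˡ -0#≈0#) (+-identityʳ _))
    from-⊖ zero (suc n) = sym (+-identityˡ _)
    from-⊖ (suc m) zero = sym (trans (+-congˡ -0#≈0#) (+-identityʳ _))
    from-⊖ (suc m) (suc n) =
      trans (reflexive (≡.cong fromℤ (ℤP.[1+m]⊖[1+n]≡m⊖n m n)))
        (trans (from-⊖ m n) (sym (trans (+-cong (1+× m 1#) (-‿cong (1+× n 1#))) (cancel-suc 1# _ _))))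

    +-homo : ∀ i j → fromℤ (i ℤ.+ j) ≈ fromℤ i + fromℤ j
    +-homo (+ m) (+ n) = ×-homo-+ 1# m n
    +-homo (+ m) -[1+ n ] = from-⊖ m (suc n)
    +-homo -[1+ m ] (+ n) = trans (from-⊖ n (suc m)) (+-comm _ _)
    +-homo -[1+ m ] -[1+ n ] = begin
      - (suc (suc (m ℕ.+ n)) ⊠ 1#)       ≈⟨ -‿cong (reflexive (≡.cong (_⊠ 1#) (≡.cong suc (≡.sym (ℕP.+-suc m n))))) ⟩
      - ((suc m ℕ.+ suc n) ⊠ 1#)         ≈⟨ -‿cong (×-homo-+ 1# (suc m) (suc n)) ⟩
      - (suc m ⊠ 1# + suc n ⊠ 1#)        ≈⟨ sym (⁻¹-∙-comm _ _) ⟩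
      - (suc m ⊠ 1#) + - (suc n ⊠ 1#)    ∎

    neg*neg : ∀ x y → (- x) * (- y) ≈ x * y
    neg*neg x y = begin
      (- x) * (- y)  ≈⟨ sym (-‿distribˡ-* x (- y)) ⟩
      - (x * (- y))  ≈⟨ -‿cong (sym (-‿distribʳ-* x y)) ⟩
      - - (x * y)    ≈⟨ -‿involutive _ ⟩
      x * y          ∎

    *-homo : ∀ i j → fromℤ (i ℤ.* j) ≈ fromℤ i * fromℤ j
    *-homo (+ m) (+ n) = trans (reflexive (≡.cong fromℤ (ℤP.+◃n≡+n (m ℕ.* n)))) (×1-homo-* m n)
    *-homo (+ m) -[1+ n ] = trans (reflexive (≡.cong fromℤ (ℤP.-◃n≡-n (m ℕ.* suc n))))
      (trans (from-neg (m ℕ.* suc n)) (trans (-‿cong (×1-homo-* m (suc n))) (-‿distribʳ-* _ _)))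
    *-homo -[1+ m ] (+ n) = trans (reflexive (≡.cong fromℤ (ℤP.-◃n≡-n (suc m ℕ.* n))))
      (trans (from-neg (suc m ℕ.* n)) (trans (-‿cong (×1-homo-* (suc m) n)) (-‿distribˡ-* _ _)))
    *-homo -[1+ m ] -[1+ n ] = trans (reflexive (≡.cong fromℤ (ℤP.+◃n≡+n (suc m ℕ.* suc n))))
      (trans (×1-homo-* (suc m) (suc n)) (sym (neg*neg _ _)))

    -homo : ∀ i → fromℤ (ℤ.- i) ≈ - fromℤ i
    -homo (+ n)    = from-neg n
    -homo -[1+ n ] = sym (-‿involutive _)

    acr : ACR.AlmostCommutativeRing c ℓ
    acr = ACR.fromCommutativeRing R

    morphism : ACR._-Raw-AlmostCommutative⟶_ ℤ.+-*-rawRing acr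
    morphism = record
      { ⟦_⟧ = fromℤ ; +-homo = +-homo ; *-homo = *-homo ; -‿homo = -homo
      ; 0-homo = refl ; 1-homo = refl }

    weak : ∀ i j → Data.Maybe.Maybe (fromℤ i ≈ fromℤ j)
    weak i j with i ℤ.≟ j
    ... | yes ≡.refl = just refl
    ... | no _       = nothing

  open Algebra.Solver.Ring ℤ.+-*-rawRing acr morphism weak public
    using (solve; _:=_; _:+_; _:*_; _:-_; :-_; con; Polynomial)

  :0 :1 : ∀ {n} → Polynomial n
  :0 = con (+ 0)
  :1 = con (+ 1)

  Σ< Π< : ℕ → (ℕ → Carrier) → Carrier
  Σ< zero f = 0#
  Σ< (suc n) f = Σ< n f + f n
  Π< zero f = 1#
  Π< (suc n) f = Π< n f * f n

  Σ-cong< : ∀ n {f g} → (∀ i → i ℕ.< n → f i ≈ g i) → Σ< n f ≈ Σ< n g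
  Σ-cong< zero h = refl
  Σ-cong< (suc n) h = +-cong (Σ-cong< n (λ i p → h i (ℕP.m≤n⇒m≤1+n p))) (h n ℕP.≤-refl)

  Σ-cong : ∀ n {f g} → (∀ i → f i ≈ g i) → Σ< n f ≈ Σ< n g
  Σ-cong n h = Σ-cong< n (λ i _ → h i)

  Π-cong< : ∀ n {f g} → (∀ i → i ℕ.< n → f i ≈ g i) → Π< n f ≈ Π< n g
  Π-cong< zero h = refl
  Π-cong< (suc n) h = *-cong (Π-cong< n (λ i p → h i (ℕP.m≤n⇒m≤1+n p))) (h n ℕP.≤-refl)

  Π-cong : ∀ n {f g} → (∀ i → f i ≈ g i) → Π< n f ≈ Π< n g
  Π-cong n h = Π-cong< n (λ i _ → h i)

  Σ-+ : ∀ n f g → Σ< n (λ i → f i + g i) ≈ Σ< n f + Σ< n g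
  Σ-+ zero f g = sym (+-identityʳ _)
  Σ-+ (suc n) f g = trans (+-congʳ (Σ-+ n f g))
    (solve 4 (λ a b x y → (a :+ b) :+ (x :+ y) := (a :+ x) :+ (b :+ y)) refl _ _ _ _)

  Σ-neg : ∀ n f → Σ< n (λ i → - f i) ≈ - Σ< n f
  Σ-neg zero f = sym -0#≈0#
  Σ-neg (suc n) f = trans (+-congʳ (Σ-neg n f)) (solve 2 (λ a b → :- a :+ :- b := :- (a :+ b)) refl _ _)

  Σ-*ˡ : ∀ n x f → Σ< n (λ i → x * f i) ≈ x * Σ< n f
  Σ-*ˡ zero x f = sym (zeroʳ x)
  Σ-*ˡ (suc n) x f = trans (+-congʳ (Σ-*ˡ n x f)) (sym (distribˡ x _ _))

  Σ-zero : ∀ n → Σ< n (λ _ → 0#) ≈ 0#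
  Σ-zero zero = refl
  Σ-zero (suc n) = trans (+-identityʳ _) (Σ-zero n)

  Σ-split : ∀ m n f → Σ< (m ℕ.+ n) f ≈ Σ< m f + Σ< n (λ i → f (m ℕ.+ i))
  Σ-split m zero f = trans (reflexive (≡.cong (λ k → Σ< k f) (ℕP.+-identityʳ m))) (sym (+-identityʳ _))
  Σ-split m (suc n) f = trans (reflexive (≡.cong (λ k → Σ< k f) (ℕP.+-suc m n)))
    (trans (+-congʳ (Σ-split m n f)) (+-assoc _ _ _))

  Σ-front : ∀ n f → Σ< (suc n) f ≈ f 0 + Σ< n (λ i → f (suc i))
  Σ-front n f = trans (Σ-split 1 n f) (+-congʳ (+-identityˡ _))

  Π-* : ∀ n f g → Π< n (λ i → f i * g i) ≈ Π< n f * Π< n g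
  Π-* zero f g = sym (*-identityʳ _)
  Π-* (suc n) f g = trans (*-congʳ (Π-* n f g))
    (solve 4 (λ a b x y → (a :* b) :* (x :* y) := (a :* x) :* (b :* y)) refl _ _ _ _)

  Π-one : ∀ n → Π< n (λ _ → 1#) ≈ 1#
  Π-one zero = refl
  Π-one (suc n) = trans (*-identityʳ _) (Π-one n)

  Π-split : ∀ m n f → Π< (m ℕ.+ n) f ≈ Π< m f * Π< n (λ i → f (m ℕ.+ i))
  Π-split m zero f = trans (reflexive (≡.cong (λ k → Π< k f) (ℕP.+-identityʳ m))) (sym (*-identityʳ _))
  Π-split m (suc n) f = trans (reflexive (≡.cong (λ k → Π< k f) (ℕP.+-suc m n)))
    (trans (*-congʳ (Π-split m n f)) (*-assoc _ _ _))

  Π-front : ∀ n f → Π< (suc n) f ≈ f 0 * Π< n (λ i → f (suc i))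
  Π-front n f = trans (Π-split 1 n f) (*-congʳ (*-identityˡ _))

  Π-rev : ∀ n f → Π< n (λ i → f (n ℕ.∸ suc i)) ≈ Π< n f
  Π-rev zero f = refl
  Π-rev (suc n) f = trans (Π-front n _) (trans (*-comm _ _) (*-congʳ (Π-rev n f)))

  Σ-rev : ∀ n f → Σ< n (λ i → f (n ℕ.∸ suc i)) ≈ Σ< n f
  Σ-rev zero f = refl
  Σ-rev (suc n) f = trans (Σ-front n _) (trans (+-comm _ _) (+-congʳ (Σ-rev n f)))

0ℤ : ℤ
0ℤ = + 0

module PartialFractions {c ℓ : Level} (R : CommutativeRing c ℓ)
  (U : ℤ → CommutativeRing.Carrier R)
  (U-mul : ∀ a b → a ≢ 0ℤ → b ≢ 0ℤ → a ≢ b →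
     RingKit._≋_ R (RingKit._*_ R (U a) (U b))
       (RingKit._+_ R (RingKit._*_ R (U (b ℤ.- a)) (U a)) (RingKit._*_ R (U (a ℤ.- b)) (U b))))
  (U-neg : ∀ a → a ≢ 0ℤ → RingKit._≋_ R (U (ℤ.- a)) (RingKit._-_ R (RingKit.1# R) (U a)))
  where
  open RingKit R
  open Relation.Binary.Reasoning.Setoid setoid

  -- fn is the product, const and poles its claimed partial fraction expansion
  -- const + Σ r U(e + τ) over (r , e) in poles.
  record PF : Set c where
    field
      fn    : ℤ → Carrier
      const : Carrier
      poles : List (Carrier × ℤ)
  open PF public

  sumL : ∀ {a} {A : Set a} → List A → (A → Carrier) → Carrier
  sumL [] f = 0#
  sumL (x ∷ xs) f = f x + sumL xs f

  sumL-cong : ∀ {a} {A : Set a} {xs : List A} {f g : A → Carrier} → All (λ x → f x ≈ g x) xs → sumL xs f ≈ sumL xs g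
  sumL-cong [] = refl
  sumL-cong (p ∷ ps) = +-cong p (sumL-cong ps)

  sumL-cong′ : ∀ {a} {A : Set a} (xs : List A) {f g : A → Carrier} → (∀ x → f x ≈ g x) → sumL xs f ≈ sumL xs g
  sumL-cong′ xs h = sumL-cong (All.universal h xs)

  sumL-++ : ∀ {a} {A : Set a} (xs ys : List A) f → sumL (xs ++ ys) f ≈ sumL xs f + sumL ys f
  sumL-++ [] ys f = sym (+-identityˡ _)
  sumL-++ (x ∷ xs) ys f = trans (+-congˡ (sumL-++ xs ys f)) (sym (+-assoc _ _ _))

  sumL-map : ∀ {a b} {A : Set a} {B : Set b} (h : A → B) xs f → sumL (map h xs) f ≈ sumL xs (λ x → f (h x))
  sumL-map h [] f = refl
  sumL-map h (x ∷ xs) f = +-congˡ (sumL-map h xs f)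

  sumL-+ : ∀ {a} {A : Set a} (xs : List A) f g → sumL xs (λ x → f x + g x) ≈ sumL xs f + sumL xs g
  sumL-+ [] f g = sym (+-identityʳ _)
  sumL-+ (x ∷ xs) f g = trans (+-congˡ (sumL-+ xs f g))
    (solve 4 (λ a b x y → (a :+ b) :+ (x :+ y) := (a :+ x) :+ (b :+ y)) refl _ _ _ _)

  sumL-*ˡ : ∀ {a} {A : Set a} (xs : List A) k f → sumL xs (λ x → k * f x) ≈ k * sumL xs f
  sumL-*ˡ [] k f = sym (zeroʳ k)
  sumL-*ˡ (x ∷ xs) k f = trans (+-congˡ (sumL-*ˡ xs k f)) (sym (distribˡ k _ _))

  sumL-zero : ∀ {a} {A : Set a} (xs : List A) → sumL xs (λ _ → 0#) ≈ 0#
  sumL-zero [] = refl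
  sumL-zero (x ∷ xs) = trans (+-identityˡ _) (sumL-zero xs)

  sumL-swap : ∀ {a b} {A : Set a} {B : Set b} (xs : List A) (ys : List B) (f : A → B → Carrier) →
    sumL xs (λ x → sumL ys (f x)) ≈ sumL ys (λ y → sumL xs (λ x → f x y))
  sumL-swap [] ys f = sym (sumL-zero ys)
  sumL-swap (x ∷ xs) ys f = trans (+-congˡ (sumL-swap xs ys f)) (sym (sumL-+ ys _ _))

  wsum : PF → (ℤ → Carrier) → Carrier
  wsum P φ = sumL (poles P) (λ p → proj₁ p * φ (proj₂ p))

  Loc : ∀ {x} → (ℤ → Set x) → PF → Set (c ⊔ x)
  Loc Q P = All (λ p → Q (proj₂ p)) (poles P)

  wsum-cong : ∀ {x P} {Q : ℤ → Set x} {φ ψ} → Loc Q P → (∀ e → Q e → φ e ≈ ψ e) → wsum P φ ≈ wsum P ψ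
  wsum-cong l h = sumL-cong (All.map (λ q → *-congˡ (h _ q)) l)

  wsum-cong′ : ∀ P {φ ψ} → (∀ e → φ e ≈ ψ e) → wsum P φ ≈ wsum P ψ
  wsum-cong′ P h = sumL-cong′ (poles P) (λ p → *-congˡ (h _))

  Regular : PF → ℤ → Set c
  Regular P τ = Loc (λ e → e ℤ.+ τ ≢ 0ℤ) P

  Sound : PF → ℤ → Set ℓ
  Sound P τ = fn P τ ≈ const P + wsum P (λ e → U (e ℤ.+ τ))

  Good : PF → Set _
  Good P = ∀ τ → Regular P τ → Sound P τ

  Disjoint : PF → PF → Set c
  Disjoint P Q = Loc (λ e → Loc (λ f → e ≢ f) Q) P

  mulPF : PF → PF → PF
  mulPF P Q = record
    { fn    = λ τ → fn P τ * fn Q τ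
    ; const = const P * const Q
    ; poles = map (λ p → proj₁ p * fn Q (ℤ.- proj₂ p) , proj₂ p) (poles P)
           ++ map (λ q → proj₁ q * fn P (ℤ.- proj₂ q) , proj₂ q) (poles Q) }

  wsum-mul : ∀ P Q φ → wsum (mulPF P Q) φ ≈
    wsum P (λ e → fn Q (ℤ.- e) * φ e) + wsum Q (λ e → fn P (ℤ.- e) * φ e)
  wsum-mul P Q φ = trans (sumL-++ (map _ (poles P)) _ _)
    (+-cong (trans (sumL-map _ (poles P) _) (sumL-cong′ (poles P) (λ p → *-assoc _ _ _)))
            (trans (sumL-map _ (poles Q) _) (sumL-cong′ (poles Q) (λ p → *-assoc _ _ _))))

  Loc-mul : ∀ {x} {X : ℤ → Set x} {P Q} → Loc X P → Loc X Q → Loc X (mulPF P Q)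
  Loc-mul p q = AllP.++⁺ (AllP.map⁺ p) (AllP.map⁺ q)

  Loc-mulˡ : ∀ {x} {X : ℤ → Set x} {P Q} → Loc X (mulPF P Q) → Loc X P
  Loc-mulˡ {P = P} l = AllP.map⁻ (AllP.++⁻ˡ (map _ (poles P)) l)

  Loc-mulʳ : ∀ {x} {X : ℤ → Set x} {P Q} → Loc X (mulPF P Q) → Loc X Q
  Loc-mulʳ {P = P} l = AllP.map⁻ (AllP.++⁻ʳ (map _ (poles P)) l)

  Loc-map : ∀ {X Y : ℤ → Set} {P} → (∀ e → X e → Y e) → Loc X P → Loc Y P
  Loc-map h = All.map (h _)

  Disjoint-classes : ∀ {X Y : ℤ → Set} {P Q} → Loc X P → Loc Y Q → (∀ e f → X e → Y f → e ≢ f) → Disjoint P Q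
  Disjoint-classes {Y = Y} {Q = Q} p q h = All.map (λ {x} a → All.map (λ {y} b → h _ _ a b) q) p

  -- Both the value and the derivative of a product are the case A, B of one bilinear identity.
  private
    bilinear : ∀ P Q (A : ℤ → Carrier) (B : ℤ → ℤ → Carrier) →
      Loc (λ e → Loc (λ f → U (f ℤ.- e) * A e + U (e ℤ.- f) * A f ≈ B e f) Q) P →
      wsum P (λ e → wsum Q (λ f → U (f ℤ.- e)) * A e) + wsum Q (λ f → wsum P (λ e → U (e ℤ.- f)) * A f)
      ≈ wsum P (λ e → wsum Q (λ f → B e f))
    bilinear P Q A B h = trans (+-cong lhs₁ lhs₂) (trans (sym (sumL-+ (poles P) _ _)) (sumL-cong (All.map step h)))
      where
      lhs₁ : wsum P (λ e → wsum Q (λ f → U (f ℤ.- e)) * A e)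
             ≈ sumL (poles P) (λ p → sumL (poles Q) (λ q → proj₁ p * (proj₁ q * (U (proj₂ q ℤ.- proj₂ p) * A (proj₂ p)))))
      lhs₁ = sumL-cong′ (poles P) λ p → trans (*-congˡ (trans (*-comm _ _) (sym (sumL-*ˡ (poles Q) _ _))))
        (trans (sym (sumL-*ˡ (poles Q) _ _)) (sumL-cong′ (poles Q) (λ q →
          solve 4 (λ r s u a → r :* (a :* (s :* u)) := r :* (s :* (u :* a))) refl _ _ _ _)))
      lhs₂ : wsum Q (λ f → wsum P (λ e → U (e ℤ.- f)) * A f)
             ≈ sumL (poles P) (λ p → sumL (poles Q) (λ q → proj₁ p * (proj₁ q * (U (proj₂ p ℤ.- proj₂ q) * A (proj₂ q)))))
      lhs₂ = trans (sumL-cong′ (poles Q) λ q → trans (*-congˡ (trans (*-comm _ _) (sym (sumL-*ˡ (poles P) _ _))))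
        (trans (sym (sumL-*ˡ (poles P) _ _)) (sumL-cong′ (poles P) (λ p →
          solve 4 (λ s r u a → s :* (a :* (r :* u)) := r :* (s :* (u :* a))) refl _ _ _ _))))
        (sumL-swap (poles Q) (poles P) _)
      step : ∀ {p} → All (λ q → U (proj₂ q ℤ.- proj₂ p) * A (proj₂ p) + U (proj₂ p ℤ.- proj₂ q) * A (proj₂ q) ≈ B (proj₂ p) (proj₂ q)) (poles Q) →
        sumL (poles Q) (λ q → proj₁ p * (proj₁ q * (U (proj₂ q ℤ.- proj₂ p) * A (proj₂ p)))) +
        sumL (poles Q) (λ q → proj₁ p * (proj₁ q * (U (proj₂ p ℤ.- proj₂ q) * A (proj₂ q))))
        ≈ proj₁ p * wsum Q (λ f → B (proj₂ p) f)
      step {p} l = trans (sym (sumL-+ (poles Q) _ _)) (trans (sumL-cong (All.map (λ {q} b →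
          trans (solve 4 (λ r s x y → r :* (s :* x) :+ r :* (s :* y) := r :* (s :* (x :+ y))) refl _ _ _ _)
                (*-congˡ (*-congˡ b))) l))
        (sumL-*ˡ (poles Q) _ _))

    wsum-+ : ∀ P φ ψ → wsum P (λ e → φ e + ψ e) ≈ wsum P φ + wsum P ψ
    wsum-+ P φ ψ = trans (sumL-cong′ (poles P) (λ p → distribˡ _ _ _)) (sumL-+ (poles P) _ _)

    wsum-*ˡ : ∀ P k φ → wsum P (λ e → k * φ e) ≈ k * wsum P φ
    wsum-*ˡ P k φ = trans (sumL-cong′ (poles P) (λ p → solve 3 (λ r k a → r :* (k :* a) := k :* (r :* a)) refl _ _ _))
      (sumL-*ˡ (poles P) _ _)

    flip-Disjoint : ∀ {P Q} → Disjoint P Q → Disjoint Q P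
    flip-Disjoint {P} {Q} d = All.tabulate λ i → All.tabulate λ j eq → All.lookup (All.lookup d j) i (≡.sym eq)

    minus≢0 : ∀ e f → f ≢ e → e ℤ.+ ℤ.- f ≢ 0ℤ
    minus≢0 e f ne eq = ne (≡.sym (ℤP.i-j≡0⇒i≡j e f eq))

    regular-cross : ∀ {P Q} → Disjoint P Q → Loc (λ e → Regular Q (ℤ.- e)) P
    regular-cross d = All.map (λ {p} l → All.map (λ {q} ne → minus≢0 (proj₂ q) (proj₂ p) ne) l) d

    cross : ∀ {P Q} (A : ℤ → Carrier) → Good Q → Disjoint P Q →
      wsum P (λ e → fn Q (ℤ.- e) * A e) ≈ const Q * wsum P A + wsum P (λ e → wsum Q (λ f → U (f ℤ.- e)) * A e)
    cross {P} {Q} A g d = trans (wsum-cong {P = P} (regular-cross {P} {Q} d) (λ e r →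
        trans (*-congʳ (g (ℤ.- e) r)) (distribʳ _ _ _)))
      (trans (wsum-+ P _ _) (+-congʳ (wsum-*ˡ P _ _)))

    bilinear-mul : ∀ P Q (A : ℤ → Carrier) (B : ℤ → ℤ → Carrier) → Good P → Good Q → Disjoint P Q →
      Loc (λ e → Loc (λ f → U (f ℤ.- e) * A e + U (e ℤ.- f) * A f ≈ B e f) Q) P →
      wsum (mulPF P Q) A ≈ const Q * wsum P A + const P * wsum Q A + wsum P (λ e → wsum Q (λ f → B e f))
    bilinear-mul P Q A B gP gQ d h = begin
      wsum (mulPF P Q) A ≈⟨ wsum-mul P Q A ⟩
      _ ≈⟨ +-cong (cross {P} {Q} A gQ d) (cross {Q} {P} A gP (flip-Disjoint {P} {Q} d)) ⟩
      _ ≈⟨ solve 4 (λ a x b y → (a :+ x) :+ (b :+ y) := (a :+ b) :+ (x :+ y)) refl _ _ _ _ ⟩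
      _ ≈⟨ +-congˡ (bilinear P Q A B h) ⟩
      _ ∎

    wsum-prod : ∀ P Q (A B : ℤ → Carrier) → wsum P (λ e → wsum Q (λ f → A e * B f)) ≈ wsum P A * wsum Q B
    wsum-prod P Q A B = trans (wsum-cong′ P (λ e → trans (wsum-*ˡ Q (A e) B) (*-comm _ _)))
      (trans (wsum-*ˡ P _ A) (*-comm _ _))

    shift-diff : ∀ a b t → (b ℤ.+ t) ℤ.- (a ℤ.+ t) ≡ b ℤ.- a
    shift-diff = S.solve 3 (λ a b t → (b S.:+ t) S.:- (a S.:+ t) S.:= b S.:- a) ≡.refl
      where module S = Data.Integer.Solver.+-*-Solver

    neg-diff : ∀ e f → e ℤ.- f ≡ ℤ.- (f ℤ.- e)
    neg-diff = S.solve 2 (λ e f → e S.:- f S.:= S.:- (f S.:- e)) ≡.refl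
      where module S = Data.Integer.Solver.+-*-Solver

    both : ∀ {a p q} {A : Set a} {X : A → Set p} {Y : A → Set q} {Z : A → Set ℓ} {xs} →
      (∀ {x} → X x → Y x → Z x) → All X xs → All Y xs → All Z xs
    both h [] [] = []
    both h (x ∷ xs) (y ∷ ys) = h x y ∷ both h xs ys

  mul-Good : ∀ {P Q} → Good P → Good Q → Disjoint P Q → Good (mulPF P Q)
  mul-Good {P} {Q} gP gQ d τ reg = begin
    fn P τ * fn Q τ ≈⟨ *-cong (gP τ rP) (gQ τ rQ) ⟩
    _ ≈⟨ solve 4 (λ a x b y → (a :+ x) :* (b :+ y) := (a :* b) :+ (b :* x :+ a :* y :+ x :* y)) refl _ _ _ _ ⟩
    _ ≈⟨ +-congˡ (+-congˡ (sym (wsum-prod P Q V V))) ⟩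
    _ ≈⟨ +-congˡ (sym (bilinear-mul P Q V (λ e f → V e * V f) gP gQ d rel)) ⟩
    const P * const Q + wsum (mulPF P Q) V ∎
    where
    V : ℤ → Carrier
    V e = U (e ℤ.+ τ)
    rP = Loc-mulˡ {P = P} {Q} reg
    rQ = Loc-mulʳ {P = P} {Q} reg
    rel : Loc (λ e → Loc (λ f → U (f ℤ.- e) * V e + U (e ℤ.- f) * V f ≈ V e * V f) Q) P
    rel = both′ d rP
      where
      pt : ∀ {e f} → e ≢ f → e ℤ.+ τ ≢ 0ℤ → f ℤ.+ τ ≢ 0ℤ → U (f ℤ.- e) * V e + U (e ℤ.- f) * V f ≈ V e * V f
      pt {e} {f} ne re rf = sym (trans (U-mul _ _ re rf (λ eq → ne (ℤP.i-j≡0⇒i≡j e f (≡.trans (≡.sym (shift-diff f e τ)) (ℤP.i≡j⇒i-j≡0 eq)))))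
        (+-cong (*-congʳ (reflexive (≡.cong U (shift-diff e f τ)))) (*-congʳ (reflexive (≡.cong U (shift-diff f e τ))))))
      inner : ∀ {e} {qs} → e ℤ.+ τ ≢ 0ℤ → All (λ q → e ≢ proj₂ q) qs → All (λ q → proj₂ q ℤ.+ τ ≢ 0ℤ) qs →
        All (λ q → U (proj₂ q ℤ.- e) * V e + U (e ℤ.- proj₂ q) * V (proj₂ q) ≈ V e * V (proj₂ q)) qs
      inner re ds rs = both (λ ne rf → pt ne re rf) ds rs
      both′ : ∀ {ps} → All (λ p → All (λ q → proj₂ p ≢ proj₂ q) (poles Q)) ps → All (λ p → proj₂ p ℤ.+ τ ≢ 0ℤ) ps →
        All (λ p → All (λ q → U (proj₂ q ℤ.- proj₂ p) * V (proj₂ p) + U (proj₂ p ℤ.- proj₂ q) * V (proj₂ q) ≈ V (proj₂ p) * V (proj₂ q)) (poles Q)) ps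
      both′ [] [] = []
      both′ (x ∷ xs) (y ∷ ys) = inner y x rQ ∷ both′ xs ys

  -- q d/dq^e of 1/(1 - q^e), i.e. U² - U.
  U′ : ℤ → Carrier
  U′ e = - (U e * U (ℤ.- e))

  U′-≈ : ∀ e → e ≢ 0ℤ → U′ e ≈ U e * U e - U e
  U′-≈ e ne = trans (-‿cong (*-congˡ (U-neg e ne))) (solve 1 (λ u → :- (u :* (:1 :- u)) := u :* u :- u) refl (U e))

  U′-mul : ∀ e f → e ≢ 0ℤ → f ≢ 0ℤ → e ≢ f → U (f ℤ.- e) * U′ e + U (e ℤ.- f) * U′ f ≈ U′ e * U f + U e * U′ f
  U′-mul e f e0 f0 ne = begin
    U (f ℤ.- e) * U′ e + U (e ℤ.- f) * U′ f
      ≈⟨ +-cong (*-congˡ (U′-≈ e e0)) (*-cong flip (U′-≈ f f0)) ⟩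
    a * (x * x - x) + (1# - a) * (y * y - y)
      ≈⟨ solve 3 (λ a x y → a :* (x :* x :- x) :+ (:1 :- a) :* (y :* y :- y) :=
           (a :* x :+ (:1 :- a) :* y) :* (x :+ y :- :1) :- x :* y) refl a x y ⟩
    (a * x + (1# - a) * y) * (x + y - 1#) - x * y
      ≈⟨ +-congʳ (*-congʳ (sym prod)) ⟩
    (x * y) * (x + y - 1#) - x * y
      ≈⟨ solve 2 (λ x y → (x :* y) :* (x :+ y :- :1) :- x :* y := (x :* x :- x) :* y :+ x :* (y :* y :- y)) refl x y ⟩
    (x * x - x) * y + x * (y * y - y) ≈⟨ sym (+-cong (*-congʳ (U′-≈ e e0)) (*-congˡ (U′-≈ f f0))) ⟩
    U′ e * U f + U e * U′ f ∎
    where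
    a = U (f ℤ.- e)
    x = U e
    y = U f
    flip : U (e ℤ.- f) ≈ 1# - a
    flip = trans (reflexive (≡.cong U (neg-diff e f))) (U-neg _ (minus≢0 f e ne))
    prod : x * y ≈ a * x + (1# - a) * y
    prod = trans (U-mul e f e0 f0 ne) (+-congˡ (*-congʳ flip))

  DSound : PF → Carrier → Set ℓ
  DSound P x = x ≈ wsum P U′

  Nonzero : PF → Set c
  Nonzero = Loc (λ e → e ≢ 0ℤ)

  private
    Nonzero-Regular : ∀ {P} → Nonzero P → Regular P 0ℤ
    Nonzero-Regular {P} = Loc-map {P = P} (λ e ne eq → ne (≡.trans (≡.sym (ℤP.+-identityʳ e)) eq))

  fn-zero : ∀ {P} → Good P → Nonzero P → fn P 0ℤ ≈ const P + wsum P U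
  fn-zero {P} g nz = trans (g 0ℤ (Nonzero-Regular {P} nz))
    (+-congˡ (wsum-cong′ P (λ e → reflexive (≡.cong U (ℤP.+-identityʳ e)))))

  mul-DSound : ∀ {P Q x y} → Good P → Good Q → Disjoint P Q → Nonzero P → Nonzero Q → DSound P x → DSound Q y →
    DSound (mulPF P Q) (x * fn Q 0ℤ + fn P 0ℤ * y)
  mul-DSound {P} {Q} {x} {y} gP gQ d zP zQ dx dy = begin
    x * fn Q 0ℤ + fn P 0ℤ * y
      ≈⟨ +-cong (*-cong dx (fn-zero {Q} gQ zQ)) (*-cong (fn-zero {P} gP zP) dy) ⟩
    _ ≈⟨ solve 6 (λ p′ cq q cp p q′ → p′ :* (cq :+ q) :+ (cp :+ p) :* q′ := (cq :* p′ :+ cp :* q′) :+ (p′ :* q :+ p :* q′))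
           refl _ _ _ _ _ _ ⟩
    _ ≈⟨ +-congˡ (sym (+-cong (wsum-prod P Q U′ U) (wsum-prod P Q U U′))) ⟩
    _ ≈⟨ +-congˡ (trans (sym (wsum-+ P _ _)) (wsum-cong′ P (λ e → sym (wsum-+ Q _ _)))) ⟩
    _ ≈⟨ sym (bilinear-mul P Q U′ (λ e f → U′ e * U f + U e * U′ f) gP gQ d (rel d zP)) ⟩
    wsum (mulPF P Q) U′ ∎
    where
    rel : ∀ {ps} → All (λ p → All (λ q → proj₂ p ≢ proj₂ q) (poles Q)) ps → All (λ p → proj₂ p ≢ 0ℤ) ps →
      All (λ p → All (λ q → U (proj₂ q ℤ.- proj₂ p) * U′ (proj₂ p) + U (proj₂ p ℤ.- proj₂ q) * U′ (proj₂ q)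
                            ≈ U′ (proj₂ p) * U (proj₂ q) + U (proj₂ p) * U′ (proj₂ q)) (poles Q)) ps
    rel [] [] = []
    rel (x ∷ xs) (y ∷ ys) = both (λ ne rf → U′-mul _ _ y rf ne) x zQ ∷ rel xs ys

  onePF : PF
  onePF = record { fn = λ _ → 1# ; const = 1# ; poles = [] }

  prodPF : (ℕ → PF) → ℕ → PF
  prodPF p zero    = onePF
  prodPF p (suc n) = mulPF (prodPF p n) (p n)

  fn-prod : ∀ p n τ → fn (prodPF p n) τ ≈ Π< n (λ i → fn (p i) τ)
  fn-prod p zero τ = refl
  fn-prod p (suc n) τ = *-congʳ (fn-prod p n τ)

  Loc-prod : ∀ {X : ℤ → Set} {p} → (∀ i → Loc X (p i)) → ∀ n → Loc X (prodPF p n)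
  Loc-prod h zero = []
  Loc-prod {p = p} h (suc n) = Loc-mul {P = prodPF p n} {p n} (Loc-prod {p = p} h n) (h n)

  prod-Disjoint : ∀ {p Q} n → (∀ i → i ℕ.< n → Disjoint (p i) Q) → Disjoint (prodPF p n) Q
  prod-Disjoint zero h = []
  prod-Disjoint {p} {Q} (suc n) h = AllP.++⁺ (AllP.map⁺ (prod-Disjoint {p} {Q} n (λ i l → h i (ℕP.m≤n⇒m≤1+n l)))) (AllP.map⁺ (h n ℕP.≤-refl))

  prod-Good : ∀ {p} → (∀ i → Good (p i)) → (∀ i j → i ℕ.< j → Disjoint (p i) (p j)) → ∀ n → Good (prodPF p n)
  prod-Good g d zero τ _ = sym (+-identityʳ _)
  prod-Good {p} g d (suc n) = mul-Good {prodPF p n} {p n} (prod-Good {p} g d n) (g n)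
    (prod-Disjoint {p} {p n} n (λ i l → d i n l))

  except : (ℕ → Carrier) → ℕ → ℕ → Carrier
  except f n i = Π< i f * Π< (n ℕ.∸ suc i) (λ j → f (suc i ℕ.+ j))

  except-suc : ∀ f n i → i ℕ.< n → except f n i * f n ≈ except f (suc n) i
  except-suc f n i l = trans (*-assoc _ _ _) (*-congˡ (trans (*-congˡ (reflexive (≡.cong f (≡.sym (ℕP.m+[n∸m]≡n l)))))
    (reflexive (≡.cong (λ k → Π< k (λ j → f (suc i ℕ.+ j))) (≡.sym (ℕP.+-∸-assoc 1 l))))))

  except-last : ∀ f n → Π< n f ≈ except f (suc n) n
  except-last f n = trans (sym (*-identityʳ _)) (*-congˡ (reflexive (≡.cong (λ k → Π< k (λ j → f (suc n ℕ.+ j))) (≡.sym (ℕP.n∸n≡0 n)))))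

  wsum-prodPF : ∀ p n φ → wsum (prodPF p n) φ ≈ Σ< n (λ i → wsum (p i) (λ e → except (λ k → fn (p k) (ℤ.- e)) n i * φ e))
  wsum-prodPF p zero φ = refl
  wsum-prodPF p (suc n) φ = trans (wsum-mul (prodPF p n) (p n) φ) (+-cong
    (trans (wsum-prodPF p n _) (Σ-cong< n (λ i l → wsum-cong′ (p i) (λ e →
       trans (sym (*-assoc _ _ _)) (*-congʳ (except-suc _ n i l))))))
    (wsum-cong′ (p n) (λ e → *-congʳ (trans (fn-prod p n _) (except-last _ n)))))

  pt⁺ pt⁻ : ℤ → PF
  pt⁺ e = record { fn = λ τ → U (e ℤ.+ τ) ; const = 0# ; poles = (1# , e) ∷ [] }
  pt⁻ e = record { fn = λ τ → U (ℤ.- (e ℤ.+ τ)) ; const = 1# ; poles = (- 1# , e) ∷ [] }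

  pt⁺-Good : ∀ e → Good (pt⁺ e)
  pt⁺-Good e τ _ = solve 1 (λ x → x := :0 :+ (:1 :* x :+ :0)) refl _

  pt⁻-Good : ∀ e → Good (pt⁻ e)
  pt⁻-Good e τ (r ∷ []) = trans (U-neg _ r) (solve 1 (λ x → :1 :- x := :1 :+ (:- :1 :* x :+ :0)) refl _)

  block : Carrier → ℤ → ℤ → PF
  block A e f = record { fn = λ τ → 1# + A * (U (e ℤ.+ τ) - U (f ℤ.+ τ)) ; const = 1# ; poles = (A , e) ∷ (- A , f) ∷ [] }

  block-Good : ∀ A e f → Good (block A e f)
  block-Good A e f τ _ = solve 3 (λ a x y → :1 :+ a :* (x :- y) := :1 :+ (a :* x :+ ((:- a) :* y :+ :0))) refl _ _ _

module KRing where
  private module S = Data.Rational.Solver.+-*-Solver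
  open S using (_:+_; _:*_; _:-_; :-_; con) renaming (_:=_ to _:≡_)

  +K-assoc : ∀ x y z → (x +K y) +K z ≡ x +K (y +K z)
  +K-assoc (mkK a b) (mkK c d) (mkK e f) = ≡.cong₂ mkK (ℚP.+-assoc a c e) (ℚP.+-assoc b d f)

  +K-comm : ∀ x y → x +K y ≡ y +K x
  +K-comm (mkK a b) (mkK c d) = ≡.cong₂ mkK (ℚP.+-comm a c) (ℚP.+-comm b d)

  +K-identityˡ : ∀ x → 0K +K x ≡ x
  +K-identityˡ (mkK a b) = ≡.cong₂ mkK (ℚP.+-identityˡ a) (ℚP.+-identityˡ b)

  +K-inverseˡ : ∀ x → (-K x) +K x ≡ 0K
  +K-inverseˡ (mkK a b) = ≡.cong₂ mkK (ℚP.+-inverseˡ a) (ℚP.+-inverseˡ b)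

  *K-comm : ∀ x y → x *K y ≡ y *K x
  *K-comm (mkK a b) (mkK c d) = ≡.cong₂ mkK
    (S.solve 4 (λ a b c d → a :* c :- b :* d :≡ c :* a :- d :* b) ≡.refl a b c d)
    (S.solve 4 (λ a b c d → a :* d :+ b :* c :- b :* d :≡ c :* b :+ d :* a :- d :* b) ≡.refl a b c d)

  *K-assoc : ∀ x y z → (x *K y) *K z ≡ x *K (y *K z)
  *K-assoc (mkK a b) (mkK c d) (mkK e f) = ≡.cong₂ mkK
    (S.solve 6 (λ a b c d e f → (a :* c :- b :* d) :* e :- (a :* d :+ b :* c :- b :* d) :* f
       :≡ a :* (c :* e :- d :* f) :- b :* (c :* f :+ d :* e :- d :* f)) ≡.refl a b c d e f)
    (S.solve 6 (λ a b c d e f → (a :* c :- b :* d) :* f :+ (a :* d :+ b :* c :- b :* d) :* e :- (a :* d :+ b :* c :- b :* d) :* f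
       :≡ a :* (c :* f :+ d :* e :- d :* f) :+ b :* (c :* e :- d :* f) :- b :* (c :* f :+ d :* e :- d :* f)) ≡.refl a b c d e f)

  *K-identityˡ : ∀ x → 1K *K x ≡ x
  *K-identityˡ (mkK a b) = ≡.cong₂ mkK
    (S.solve 2 (λ a b → con 1ℚ :* a :- con 0ℚ :* b :≡ a) ≡.refl a b)
    (S.solve 2 (λ a b → con 1ℚ :* b :+ con 0ℚ :* a :- con 0ℚ :* b :≡ b) ≡.refl a b)

  *K-distribˡ : ∀ x y z → x *K (y +K z) ≡ (x *K y) +K (x *K z)
  *K-distribˡ (mkK a b) (mkK c d) (mkK e f) = ≡.cong₂ mkK
    (S.solve 6 (λ a b c d e f → a :* (c :+ e) :- b :* (d :+ f) :≡ (a :* c :- b :* d) :+ (a :* e :- b :* f)) ≡.refl a b c d e f)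
    (S.solve 6 (λ a b c d e f → a :* (d :+ f) :+ b :* (c :+ e) :- b :* (d :+ f)
       :≡ (a :* d :+ b :* c :- b :* d) :+ (a :* f :+ b :* e :- b :* f)) ≡.refl a b c d e f)

  ring : CommutativeRing 0ℓ 0ℓ
  ring = record
    { Carrier = K ; _≈_ = _≡_ ; _+_ = _+K_ ; _*_ = _*K_ ; -_ = λ x → -K x ; 0# = 0K ; 1# = 1K
    ; isCommutativeRing = record
      { isRing = record
        { +-isAbelianGroup = record
          { isGroup = record
            { isMonoid = record
              { isSemigroup = record
                { isMagma = record { isEquivalence = ≡.isEquivalence ; ∙-cong = ≡.cong₂ _+K_ }
                ; assoc = +K-assoc }
              ; identity = +K-identityˡ , λ x → ≡.trans (+K-comm x 0K) (+K-identityˡ x) }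
            ; inverse = +K-inverseˡ , λ x → ≡.trans (+K-comm x (-K x)) (+K-inverseˡ x)
            ; ⁻¹-cong = ≡.cong (λ x → -K x) }
          ; comm = +K-comm }
        ; *-cong = ≡.cong₂ _*K_
        ; *-assoc = *K-assoc
        ; *-identity = *K-identityˡ , λ x → ≡.trans (*K-comm x 1K) (*K-identityˡ x)
        ; distrib = *K-distribˡ , λ x y z → ≡.trans (*K-comm (y +K z) x)
            (≡.trans (*K-distribˡ x y z) (≡.cong₂ _+K_ (*K-comm x y) (*K-comm x z))) }
      ; *-comm = *K-comm } }

module KK = RingKit KRing.ring

-- Power series over R; the Cauchy product enters only through its recursion on the coefficient index.
module Series {c ℓ : Level} (R : CommutativeRing c ℓ)
  (_⊛_ : (ℕ → CommutativeRing.Carrier R) → (ℕ → CommutativeRing.Carrier R) → (ℕ → CommutativeRing.Carrier R))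
  (⊛-zero : ∀ f g → CommutativeRing._≈_ R ((f ⊛ g) 0) (CommutativeRing._*_ R (f 0) (g 0)))
  (⊛-suc : ∀ f g n → CommutativeRing._≈_ R ((f ⊛ g) (suc n))
     (CommutativeRing._+_ R (CommutativeRing._*_ R (f 0) (g (suc n))) (((λ k → f (suc k)) ⊛ g) n)))
  where
  open RingKit R
  open Relation.Binary.Reasoning.Setoid setoid

  Ser : Set c
  Ser = ℕ → Carrier

  tail : Ser → Ser
  tail f k = f (suc k)

  infix 4 _≈[_]_ _≈S_
  _≈[_]_ : Ser → ℕ → Ser → Set ℓ
  f ≈[ M ] g = ∀ n → n ℕ.< M → f n ≈ g n

  _≈S_ : Ser → Ser → Set ℓ
  f ≈S g = ∀ n → f n ≈ g n

  ⊛-cong-M : ∀ M f f′ g g′ → f ≈[ M ] f′ → g ≈[ M ] g′ → (f ⊛ g) ≈[ M ] (f′ ⊛ g′)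
  ⊛-cong-M M f f′ g g′ p q zero l = trans (⊛-zero f g) (trans (*-cong (p 0 l) (q 0 l)) (sym (⊛-zero f′ g′)))
  ⊛-cong-M (suc M) f f′ g g′ p q (suc n) (s≤s l) = trans (⊛-suc f g n) (trans (+-cong (*-cong (p 0 (s≤s z≤n)) (q (suc n) (s≤s l)))
    (⊛-cong-M M (tail f) (tail f′) g g′ (λ k m → p (suc k) (s≤s m)) (λ k m → q k (ℕP.m≤n⇒m≤1+n m)) n l)) (sym (⊛-suc f′ g′ n)))

  ⊛-cong : ∀ f f′ g g′ → f ≈S f′ → g ≈S g′ → (f ⊛ g) ≈S (f′ ⊛ g′)
  ⊛-cong f f′ g g′ p q n = ⊛-cong-M (suc n) f f′ g g′ (λ k _ → p k) (λ k _ → q k) n ℕP.≤-refl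

  ⊛-suc′ : ∀ f g n → (f ⊛ g) (suc n) ≈ (f ⊛ tail g) n + f (suc n) * g 0
  ⊛-suc′ f g zero = trans (⊛-suc f g 0) (+-cong (sym (⊛-zero f (tail g))) (⊛-zero (tail f) g))
  ⊛-suc′ f g (suc n) = begin
    (f ⊛ g) (suc (suc n))                                            ≈⟨ ⊛-suc f g (suc n) ⟩
    f 0 * g (suc (suc n)) + (tail f ⊛ g) (suc n)                     ≈⟨ +-congˡ (⊛-suc′ (tail f) g n) ⟩
    f 0 * g (suc (suc n)) + ((tail f ⊛ tail g) n + f (suc (suc n)) * g 0) ≈⟨ sym (+-assoc _ _ _) ⟩
    (f 0 * g (suc (suc n)) + (tail f ⊛ tail g) n) + f (suc (suc n)) * g 0 ≈⟨ +-congʳ (sym (⊛-suc f (tail g) n)) ⟩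
    (f ⊛ tail g) (suc n) + f (suc (suc n)) * g 0 ∎

  ⊛-comm : ∀ f g → (f ⊛ g) ≈S (g ⊛ f)
  ⊛-comm f g zero = trans (⊛-zero f g) (trans (*-comm _ _) (sym (⊛-zero g f)))
  ⊛-comm f g (suc n) = trans (⊛-suc f g n) (trans (+-comm _ _)
    (trans (+-cong (⊛-comm (tail f) g n) (*-comm _ _)) (sym (⊛-suc′ g f n))))

  ⊛-distribʳ : ∀ h f g → ((λ n → f n + g n) ⊛ h) ≈S (λ n → (f ⊛ h) n + (g ⊛ h) n)
  ⊛-distribʳ h f g zero = trans (⊛-zero _ h) (trans (distribʳ _ _ _) (sym (+-cong (⊛-zero f h) (⊛-zero g h))))
  ⊛-distribʳ h f g (suc n) = begin
    _ ≈⟨ ⊛-suc _ h n ⟩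
    _ ≈⟨ +-congˡ (⊛-distribʳ h (tail f) (tail g) n) ⟩
    _ ≈⟨ solve 5 (λ a b x y z → (a :+ b) :* x :+ (y :+ z) := (a :* x :+ y) :+ (b :* x :+ z)) refl _ _ _ _ _ ⟩
    _ ≈⟨ sym (+-cong (⊛-suc f h n) (⊛-suc g h n)) ⟩
    _ ∎

  scale-⊛ : ∀ k f g → ((λ n → k * f n) ⊛ g) ≈S (λ n → k * (f ⊛ g) n)
  scale-⊛ k f g zero = trans (⊛-zero _ g) (trans (*-assoc _ _ _) (*-congˡ (sym (⊛-zero f g))))
  scale-⊛ k f g (suc n) = begin
    _ ≈⟨ ⊛-suc _ g n ⟩
    _ ≈⟨ +-congˡ (scale-⊛ k (tail f) g n) ⟩
    _ ≈⟨ solve 4 (λ k a b c → (k :* a) :* b :+ k :* c := k :* (a :* b :+ c)) refl _ _ _ _ ⟩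
    _ ≈⟨ *-congˡ (sym (⊛-suc f g n)) ⟩
    _ ∎

  ⊛-assoc : ∀ f g h → ((f ⊛ g) ⊛ h) ≈S (f ⊛ (g ⊛ h))
  ⊛-assoc f g h zero = trans (⊛-zero _ h) (trans (*-congʳ (⊛-zero f g)) (trans (*-assoc _ _ _)
    (sym (trans (⊛-zero f _) (*-congˡ (⊛-zero g h))))))
  ⊛-assoc f g h (suc n) = begin
    _ ≈⟨ ⊛-suc (f ⊛ g) h n ⟩
    _ ≈⟨ +-cong (*-congʳ (⊛-zero f g)) (⊛-cong (tail (f ⊛ g)) (λ k → f 0 * tail g k + (tail f ⊛ g) k) h h (⊛-suc f g) (λ _ → refl) n) ⟩
    _ ≈⟨ +-congˡ (⊛-distribʳ h _ _ n) ⟩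
    _ ≈⟨ +-congˡ (+-cong (scale-⊛ (f 0) (tail g) h n) (⊛-assoc (tail f) g h n)) ⟩
    _ ≈⟨ solve 5 (λ a b c d e → a :* b :* c :+ (a :* d :+ e) := a :* (b :* c :+ d) :+ e) refl (f 0) (g 0) (h (suc n)) _ _ ⟩
    _ ≈⟨ +-congʳ (*-congˡ (sym (⊛-suc g h n))) ⟩
    _ ≈⟨ sym (⊛-suc f (g ⊛ h) n) ⟩
    _ ∎

  zero-⊛ : ∀ f g → (∀ n → f n ≈ 0#) → ∀ n → (f ⊛ g) n ≈ 0#
  zero-⊛ f g h zero = trans (⊛-zero f g) (trans (*-congʳ (h 0)) (zeroˡ _))
  zero-⊛ f g h (suc n) = trans (⊛-suc f g n) (trans (+-cong (trans (*-congʳ (h 0)) (zeroˡ _)) (zero-⊛ (tail f) g (λ k → h (suc k)) n)) (+-identityˡ _))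

  scalar-⊛ : ∀ k f g → f 0 ≈ k → (∀ n → f (suc n) ≈ 0#) → (f ⊛ g) ≈S (λ n → k * g n)
  scalar-⊛ k f g e h zero = trans (⊛-zero f g) (*-congʳ e)
  scalar-⊛ k f g e h (suc n) = trans (⊛-suc f g n) (trans (+-cong (*-congʳ e) (zero-⊛ (tail f) g h n)) (+-identityʳ _))

  module _ (one : Ser) (one-zero : one 0 ≈ 1#) (one-suc : ∀ n → one (suc n) ≈ 0#) where

    one-⊛ : ∀ f → (one ⊛ f) ≈S f
    one-⊛ f n = trans (scalar-⊛ 1# one f one-zero one-suc n) (*-identityˡ _)

    seriesRing : CommutativeRing c ℓ
    seriesRing = record
      { Carrier = Ser ; _≈_ = _≈S_ ; _+_ = λ f g n → f n + g n ; _*_ = _⊛_ ; -_ = λ f n → - f n ; 0# = λ _ → 0# ; 1# = one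
      ; isCommutativeRing = record
        { isRing = record
          { +-isAbelianGroup = record
            { isGroup = record
              { isMonoid = record
                { isSemigroup = record
                  { isMagma = record { isEquivalence = record { refl = λ _ → refl ; sym = λ h n → sym (h n) ; trans = λ h k n → trans (h n) (k n) } ; ∙-cong = λ p q n → +-cong (p n) (q n) }
                  ; assoc = λ f g h n → +-assoc _ _ _ }
                ; identity = (λ f n → +-identityˡ _) , (λ f n → +-identityʳ _) }
              ; inverse = (λ f n → -‿inverseˡ _) , (λ f n → -‿inverseʳ _)
              ; ⁻¹-cong = λ p n → -‿cong (p n) }
            ; comm = λ f g n → +-comm _ _ }
          ; *-cong = λ {f} {f′} {g} {g′} → ⊛-cong f f′ g g′
          ; *-assoc = ⊛-assoc
          ; *-identity = one-⊛ , (λ f n → trans (⊛-comm f one n) (one-⊛ f n))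
          ; distrib = (λ h f g n → trans (⊛-comm h _ n) (trans (⊛-distribʳ h f g n) (+-cong (⊛-comm f h n) (⊛-comm g h n))))
                    , ⊛-distribʳ }
        ; *-comm = ⊛-comm } }

sumK-Σ : ∀ n (f : ℕ → K) → sumK n f ≡ KK.Σ< n f
sumK-Σ zero f = ≡.refl
sumK-Σ (suc n) f = ≡.trans (KK.+-comm (f n) (sumK n f)) (≡.cong (λ x → x +K f n) (sumK-Σ n f))

*P-zero : ∀ f g → (f *P g) 0 ≡ f 0 *K g 0
*P-zero f g = KK.+-identityʳ (f 0 *K g 0)

*P-suc : ∀ f g n → (f *P g) (suc n) ≡ (f 0 *K g (suc n)) +K ((λ k → f (suc k)) *P g) n
*P-suc f g n = ≡.trans (sumK-Σ (suc (suc n)) (λ j → f j *K g (suc n ℕ.∸ j)))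
  (≡.trans (KK.Σ-front (suc n) (λ j → f j *K g (suc n ℕ.∸ j)))
    (≡.cong (λ x → (f 0 *K g (suc n)) +K x) (≡.sym (sumK-Σ (suc n) (λ j → f (suc j) *K g (n ℕ.∸ j))))))

module PS′ = Series KRing.ring _*P_ *P-zero *P-suc

record QSeries : Set₁ where
  field
    seriesRing : CommutativeRing 0ℓ 0ℓ
  open CommutativeRing seriesRing
  field
    _≈[_]_    : Carrier → ℕ → Carrier → Set
    fine      : ∀ {M f g} → f ≈ g → f ≈[ M ] g
    mod-sym   : ∀ {M f g} → f ≈[ M ] g → g ≈[ M ] f
    mod-trans : ∀ {M f g h} → f ≈[ M ] g → g ≈[ M ] h → f ≈[ M ] h
    mod-+     : ∀ {M f f′ g g′} → f ≈[ M ] f′ → g ≈[ M ] g′ → (f + g) ≈[ M ] (f′ + g′)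
    mod-*     : ∀ {M f f′ g g′} → f ≈[ M ] f′ → g ≈[ M ] g′ → (f * g) ≈[ M ] (f′ * g′)
    mod-neg   : ∀ {M f g} → f ≈[ M ] g → (- f) ≈[ M ] (- g)
    mod-mono  : ∀ {M N f g} → M ℕ.≤ N → f ≈[ N ] g → f ≈[ M ] g
    separated : ∀ {f g} → (∀ M → f ≈[ M ] g) → f ≈ g
    lim       : (ℕ → Carrier) → Carrier
    lim-≈     : ∀ F → (∀ k → F (suc k) ≈[ k ] F k) → ∀ M m → M ℕ.≤ m → F m ≈[ M ] lim F
    X         : ℕ → Carrier
    X-zero    : X 0 ≈ 1#
    X-+       : ∀ a b → X (a ℕ.+ b) ≈ X a * X b
    X-small   : ∀ e → X e ≈[ e ] 0#
    X-cancel  : ∀ e f g → X e * f ≈ X e * g → f ≈ g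
    W         : ℕ → Carrier
    W-inv     : ∀ e → (1# - X (suc e)) * W (suc e) ≈ 1#

module NS = Data.Nat.Solver.+-*-Solver
module ZS = Data.Integer.Solver.+-*-Solver

pos-⊖ : ∀ x y z → y ≡ x ℕ.+ z → + y ℤ.- + x ≡ + z
pos-⊖ x y z e = ≡.trans (ℤP.m-n≡m⊖n y x) (≡.trans (≡.cong (ℤ._⊖ x) e)
  (≡.trans (ℤP.⊖-≥ (ℕP.m≤m+n x z)) (≡.cong +_ (ℕP.m+n∸m≡n x z))))

neg-⊖ : ∀ x y z → x ≡ y ℕ.+ suc z → + y ℤ.- + x ≡ -[1+ z ]
neg-⊖ x y z e = ≡.trans (≡.sym (≡.trans (≡.cong ℤ.-_ (≡.refl {x = + x ℤ.- + y})) (ZS.solve 2 (λ a b → ZS.:- (a ZS.:- b) ZS.:= b ZS.:- a) ≡.refl (+ x) (+ y))))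
  (≡.cong ℤ.-_ (pos-⊖ y x (suc z) e))

Class : ℕ → ℤ → Set
Class a e = ∃ λ k → e ≡ + a ℤ.+ + 9 ℤ.* k

Apart : ℕ → ℕ → Set
Apart a b = ℤ.∣ + a ℤ.- + b ∣ ℕ.% 9 ≢ 0

apart : ∀ {a b} → Apart a b → ∀ e f → Class a e → Class b f → e ≢ f
apart {a} {b} ne e f (k , p) (l , q) eq = ne (≡.trans (≡.cong (λ z → ℤ.∣ z ∣ ℕ.% 9) d)
  (≡.trans (≡.cong (ℕ._% 9) (≡.trans (ℤP.abs-* (+ 9) (l ℤ.- k)) (ℕP.*-comm 9 ℤ.∣ l ℤ.- k ∣))) (ℕD.m*n%n≡0 ℤ.∣ l ℤ.- k ∣ 9)))
  where
  d : + a ℤ.- + b ≡ + 9 ℤ.* (l ℤ.- k)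
  d = ≡.trans (ZS.solve 3 (λ a b k → a ZS.:- b ZS.:= (a ZS.:+ ZS.con (+ 9) ZS.:* k) ZS.:- (b ZS.:+ ZS.con (+ 9) ZS.:* k)) ≡.refl (+ a) (+ b) k)
    (≡.trans (≡.cong (ℤ._- (+ b ℤ.+ + 9 ℤ.* k)) (≡.trans (≡.sym p) (≡.trans eq q)))
      (ZS.solve 3 (λ b l k → (b ZS.:+ ZS.con (+ 9) ZS.:* l) ZS.:- (b ZS.:+ ZS.con (+ 9) ZS.:* k) ZS.:= ZS.con (+ 9) ZS.:* (l ZS.:- k)) ≡.refl (+ b) l k))

class⁺ : ∀ a n → Class a (+ (a ℕ.+ 9 ℕ.* n))
class⁺ a n = + n , ≡.cong (λ z → + a ℤ.+ z) (ℤP.pos-* 9 n)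

class⁻ : ∀ a b m → a ℕ.+ b ≡ 9 ℕ.* m → ∀ k → Class a (ℤ.- + (b ℕ.+ 9 ℕ.* k))
class⁻ a b m e k = ℤ.- + (m ℕ.+ k) , ≡.sym (≡.trans (≡.cong (λ z → z ℤ.+ + 9 ℤ.* ℤ.- + (m ℕ.+ k)) a-eq)
  (≡.trans (ZS.solve 3 (λ m k b → (ZS.con (+ 9) ZS.:* m ZS.:- b) ZS.:+ ZS.con (+ 9) ZS.:* (ZS.:- (m ZS.:+ k)) ZS.:= ZS.:- (b ZS.:+ ZS.con (+ 9) ZS.:* k)) ≡.refl (+ m) (+ k) (+ b))
    (≡.cong (λ z → ℤ.- (+ b ℤ.+ z)) (≡.sym (ℤP.pos-* 9 k)))))
  where
  a-eq : + a ≡ + 9 ℤ.* + m ℤ.- + b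
  a-eq = ≡.trans (ZS.solve 2 (λ a b → a ZS.:= (a ZS.:+ b) ZS.:- b) ≡.refl (+ a) (+ b))
    (≡.cong (ℤ._- + b) (≡.trans (≡.cong +_ e) (ℤP.pos-* 9 m)))

-- expo S n = 18n² + (S - 18)n.
expo : ℕ → ℕ → ℕ
expo S zero    = 0
expo S (suc n) = expo S n ℕ.+ (S ℕ.+ 36 ℕ.* n)

expo-shift : ∀ S d n → expo (S ℕ.+ d) n ≡ expo S n ℕ.+ d ℕ.* n
expo-shift S d zero = ≡.sym (ℕP.*-zeroʳ d)
expo-shift S d (suc n) = ≡.trans (≡.cong (ℕ._+ (S ℕ.+ d ℕ.+ 36 ℕ.* n)) (expo-shift S d n))
  (≡.trans (NS.solve 4 (λ e S d n → (e NS.:+ d NS.:* n) NS.:+ (S NS.:+ d NS.:+ NS.con 36 NS.:* n) NS.:= (e NS.:+ (S NS.:+ NS.con 36 NS.:* n)) NS.:+ (d NS.:+ d NS.:* n)) ≡.refl (expo S n) S d n)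
    (≡.cong (λ z → expo S n ℕ.+ (S ℕ.+ 36 ℕ.* n) ℕ.+ z) (≡.sym (ℕP.*-suc d n))))

expo-front : ∀ S n → expo S (suc n) ≡ S ℕ.+ expo (S ℕ.+ 36) n
expo-front S zero = ≡.cong (S ℕ.+_) ≡.refl
expo-front S (suc n) = ≡.trans (≡.cong (ℕ._+ (S ℕ.+ 36 ℕ.* suc n)) (expo-front S n))
  (NS.solve 3 (λ S e n → (S NS.:+ e) NS.:+ (S NS.:+ NS.con 36 NS.:* (NS.con 1 NS.:+ n)) NS.:= S NS.:+ (e NS.:+ (S NS.:+ NS.con 36 NS.:+ NS.con 36 NS.:* n))) ≡.refl S (expo (S ℕ.+ 36) n) n)

n≤E : ∀ S → 1 ℕ.≤ S → ∀ n → n ℕ.≤ expo S n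
n≤E S l zero = z≤n
n≤E S l (suc n) = ≡.subst (ℕ._≤ expo S n ℕ.+ (S ℕ.+ 36 ℕ.* n)) (ℕP.+-comm n 1) (ℕP.+-mono-≤ (n≤E S l n) (ℕP.≤-trans l (ℕP.m≤m+n S _)))

cancel-+ : ∀ c u v → c ℤ.+ u ≡ c ℤ.+ v → u ≡ v
cancel-+ c u v e = ≡.trans (ZS.solve 2 (λ c u → u ZS.:= (c ZS.:+ u) ZS.:- c) ≡.refl c u)
  (≡.trans (≡.cong (ℤ._- c) e) (ZS.solve 2 (λ c v → (c ZS.:+ v) ZS.:- c ZS.:= v) ≡.refl c v))

record Dilation (Q : QSeries) : Set where
  open QSeries Q
  open RingKit seriesRing
  field
    σ      : Carrier → Carrier
    σ-cong : ∀ {f g} → f ≈ g → σ f ≈ σ g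
    σ-mod  : ∀ {M f g} → f ≈[ M ] g → σ f ≈[ M ] σ g
    σ-+    : ∀ f g → σ (f + g) ≈ σ f + σ g
    σ-*    : ∀ f g → σ (f * g) ≈ σ f * σ g
    σ-neg  : ∀ f → σ (- f) ≈ - σ f
    σ-one  : σ 1# ≈ 1#
    σ-X    : ∀ e → σ (X e) ≈ X (3 ℕ.* e)

module Theory (Q : QSeries) (Dil : Dilation Q) (⅓ : RingKit.Carrier (QSeries.seriesRing Q))
  (⅓-inv : RingKit._≋_ (QSeries.seriesRing Q) (RingKit._+_ (QSeries.seriesRing Q) (RingKit._+_ (QSeries.seriesRing Q) ⅓ ⅓) ⅓) (RingKit.1# (QSeries.seriesRing Q)))
  where
  open Dilation Dil public
  open QSeries Q public
  open RingKit seriesRing public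
  private module R≈ = Relation.Binary.Reasoning.Setoid setoid

  Σ-cong-mod : ∀ {M} n {f g} → (∀ i → i ℕ.< n → f i ≈[ M ] g i) → Σ< n f ≈[ M ] Σ< n g
  Σ-cong-mod zero h = fine refl
  Σ-cong-mod (suc n) h = mod-+ (Σ-cong-mod n (λ i p → h i (ℕP.m≤n⇒m≤1+n p))) (h n ℕP.≤-refl)

  X-cong : ∀ {a b} → a ≡ b → X a ≈ X b
  X-cong e = reflexive (≡.cong X e)

  W-cong : ∀ {a b} → a ≡ b → W a ≈ W b
  W-cong e = reflexive (≡.cong W e)

  *-small : ∀ {M f} g → f ≈[ M ] 0# → (f * g) ≈[ M ] 0#
  *-small {M} g h = mod-trans (mod-* h (fine refl)) (fine (zeroˡ g))

  X-small′ : ∀ {M e} → M ℕ.≤ e → X e ≈[ M ] 0#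
  X-small′ l = mod-mono l (X-small _)

  W-unfold : ∀ e → W (suc e) ≈ 1# + X (suc e) * W (suc e)
  W-unfold e = trans (solve 2 (λ x w → w := (:1 :- x) :* w :+ x :* w) refl (X (suc e)) (W (suc e))) (+-congʳ (W-inv e))

  W-one : ∀ e M → M ℕ.≤ suc e → W (suc e) ≈[ M ] 1#
  W-one e M l = mod-trans (fine (W-unfold e)) (mod-trans (mod-+ (fine refl) (*-small _ (X-small′ l))) (fine (+-identityʳ _)))

  inverse-unique : ∀ a b c → a * b ≈ 1# → a * c ≈ 1# → b ≈ c
  inverse-unique a b c p q = begin
    b           ≈⟨ sym (*-identityʳ b) ⟩
    b * 1#      ≈⟨ *-congˡ (sym q) ⟩
    b * (a * c) ≈⟨ solve 3 (λ a b c → b :* (a :* c) := (a :* b) :* c) refl a b c ⟩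
    (a * b) * c ≈⟨ *-congʳ p ⟩
    1# * c      ≈⟨ *-identityˡ c ⟩
    c           ∎
    where open R≈

  U : ℤ → Carrier
  U (+ n)    = W n
  U -[1+ n ] = 1# - W (suc n)

  U-neg : ∀ a → a ≢ 0ℤ → U (ℤ.- a) ≈ 1# - U a
  U-neg (+ zero) ne = ⊥-elim (ne ≡.refl)
  U-neg (+ suc n) ne = refl
  U-neg -[1+ n ] ne = solve 1 (λ w → w := :1 :- (:1 :- w)) refl _

  -- The value 1/(1 - q^(p - n)) = q^n/(q^n - q^p), free of negative exponents.
  private
    cancel-diff : ∀ p n → p ≢ n → ∀ f g → (X n - X p) * f ≈ (X n - X p) * g → f ≈ g
    cancel-diff p n ne f g h with ℕP.<-cmp p n
    ... | tri≈ _ eq _ = ⊥-elim (ne eq)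
    ... | tri< lt _ _ = trans (sym (unit f)) (trans (*-congʳ (fine′ f g h)) (unit g))
      where
      d = n ℕ.∸ suc p
      split : X n ≈ X p * X (suc d)
      split = trans (X-cong (≡.sym (≡.trans (ℕP.+-suc p d) (ℕP.m+[n∸m]≡n lt)))) (X-+ p (suc d))
      fine′ : ∀ f g → (X n - X p) * f ≈ (X n - X p) * g → (1# - X (suc d)) * f ≈ (1# - X (suc d)) * g
      fine′ f g h = X-cancel p _ _ (trans (shape f) (trans (-‿cong h) (sym (shape g))))
        where
        shape : ∀ f → X p * ((1# - X (suc d)) * f) ≈ - ((X n - X p) * f)
        shape f = trans (solve 3 (λ p d f → p :* ((:1 :- d) :* f) := :- ((p :* d :- p) :* f)) refl (X p) (X (suc d)) f)
          (-‿cong (*-congʳ (+-congʳ (sym split))))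
      unit : ∀ f → (1# - X (suc d)) * f * W (suc d) ≈ f
      unit f = trans (solve 3 (λ a f w → a :* f :* w := (a :* w) :* f) refl _ f _) (trans (*-congʳ (W-inv d)) (*-identityˡ f))
    ... | tri> _ _ lt = trans (sym (unit f)) (trans (*-congʳ (fine′ f g h)) (unit g))
      where
      d = p ℕ.∸ suc n
      split : X p ≈ X n * X (suc d)
      split = trans (X-cong (≡.sym (≡.trans (ℕP.+-suc n d) (ℕP.m+[n∸m]≡n lt)))) (X-+ n (suc d))
      fine′ : ∀ f g → (X n - X p) * f ≈ (X n - X p) * g → (1# - X (suc d)) * f ≈ (1# - X (suc d)) * g
      fine′ f g h = X-cancel n _ _ (trans (shape f) (trans h (sym (shape g))))
        where
        shape : ∀ f → X n * ((1# - X (suc d)) * f) ≈ (X n - X p) * f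
        shape f = trans (solve 3 (λ p d f → p :* ((:1 :- d) :* f) := (p :- p :* d) :* f) refl (X n) (X (suc d)) f)
          (*-congʳ (+-congˡ (-‿cong (sym split))))
      unit : ∀ f → (1# - X (suc d)) * f * W (suc d) ≈ f
      unit f = trans (solve 3 (λ a f w → a :* f :* w := (a :* w) :* f) refl _ f _) (trans (*-congʳ (W-inv d)) (*-identityˡ f))

    U-value : ∀ p n → p ≢ n → (X n - X p) * U (p ℤ.⊖ n) ≈ X n
    U-value p n ne with ℕP.<-cmp p n
    ... | tri≈ _ eq _ = ⊥-elim (ne eq)
    ... | tri> _ _ lt = begin
        (X n - X p) * U (p ℤ.⊖ n) ≈⟨ *-cong (+-congˡ (-‿cong split)) (reflexive (≡.cong U (≡.trans (ℤP.⊖-≥ (ℕP.<⇒≤ lt)) (≡.cong +_ eq)))) ⟩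
        (X n - X n * X (suc d)) * W (suc d) ≈⟨ solve 3 (λ n d w → (n :- n :* d) :* w := n :* ((:1 :- d) :* w)) refl _ _ _ ⟩
        X n * ((1# - X (suc d)) * W (suc d)) ≈⟨ *-congˡ (W-inv d) ⟩
        X n * 1# ≈⟨ *-identityʳ _ ⟩
        X n ∎
      where
      open R≈
      d = p ℕ.∸ suc n
      eq : p ℕ.∸ n ≡ suc d
      eq = ≡.trans (≡.cong (ℕ._∸ n) (≡.sym (ℕP.m+[n∸m]≡n lt))) (≡.trans (≡.cong (ℕ._∸ n) (≡.sym (ℕP.+-suc n d))) (ℕP.m+n∸m≡n n (suc d)))
      split : X p ≈ X n * X (suc d)
      split = trans (X-cong (≡.sym (≡.trans (ℕP.+-suc n d) (ℕP.m+[n∸m]≡n lt)))) (X-+ n (suc d))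
    ... | tri< lt _ _ = begin
        (X n - X p) * U (p ℤ.⊖ n) ≈⟨ *-cong (+-congʳ split) (reflexive (≡.cong U (≡.trans (ℤP.⊖-< lt) (≡.cong (λ k → ℤ.- + k) eq)))) ⟩
        (X p * X (suc d) - X p) * (1# - W (suc d)) ≈⟨ solve 3 (λ p d w → (p :* d :- p) :* (:1 :- w) := p :* ((:1 :- d) :* w) :- p :* (:1 :- d)) refl _ _ _ ⟩
        X p * ((1# - X (suc d)) * W (suc d)) - X p * (1# - X (suc d)) ≈⟨ +-congʳ (*-congˡ (W-inv d)) ⟩
        X p * 1# - X p * (1# - X (suc d)) ≈⟨ solve 2 (λ p d → p :* :1 :- p :* (:1 :- d) := p :* d) refl _ _ ⟩
        X p * X (suc d) ≈⟨ sym split ⟩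
        X n ∎
      where
      open R≈
      d = n ℕ.∸ suc p
      eq : n ℕ.∸ p ≡ suc d
      eq = ≡.trans (≡.cong (ℕ._∸ p) (≡.sym (ℕP.m+[n∸m]≡n lt))) (≡.trans (≡.cong (ℕ._∸ p) (≡.sym (ℕP.+-suc p d))) (ℕP.m+n∸m≡n p (suc d)))
      split : X n ≈ X p * X (suc d)
      split = trans (X-cong (≡.sym (≡.trans (ℕP.+-suc p d) (ℕP.m+[n∸m]≡n lt)))) (X-+ p (suc d))

    U-mul′ : ∀ x y z → x ≢ z → y ≢ z → x ≢ y →
      U (x ℤ.⊖ z) * U (y ℤ.⊖ z) ≈ U (y ℤ.⊖ x) * U (x ℤ.⊖ z) + U (x ℤ.⊖ y) * U (y ℤ.⊖ z)
    U-mul′ x y z xz yz xy = cancel-diff x z xz _ _ (cancel-diff y z yz _ _ (cancel-diff y x (λ e → xy (≡.sym e)) _ _ (begin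
      (A - B) * ((C - B) * ((C - A) * (a * b)))
        ≈⟨ solve 5 (λ A B C a b → (A :- B) :* ((C :- B) :* ((C :- A) :* (a :* b))) := (A :- B) :* (((C :- A) :* a) :* ((C :- B) :* b))) refl A B C a b ⟩
      (A - B) * (((C - A) * a) * ((C - B) * b)) ≈⟨ *-congˡ (*-cong (U-value x z xz) (U-value y z yz)) ⟩
      (A - B) * (C * C) ≈⟨ solve 3 (λ A B C → (A :- B) :* (C :* C) := (C :- B) :* (A :* C) :- (C :- A) :* (B :* C)) refl A B C ⟩
      (C - B) * (A * C) - (C - A) * (B * C)
        ≈⟨ sym (+-cong (*-congˡ (*-cong (U-value y x (λ e → xy (≡.sym e))) (U-value x z xz)))
             (-‿cong (*-congˡ (*-cong (U-value x y xy) (U-value y z yz))))) ⟩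
      (C - B) * (((A - B) * c) * ((C - A) * a)) - (C - A) * (((B - A) * d) * ((C - B) * b))
        ≈⟨ solve 7 (λ A B C a b c d → (C :- B) :* (((A :- B) :* c) :* ((C :- A) :* a)) :- (C :- A) :* (((B :- A) :* d) :* ((C :- B) :* b))
             := (A :- B) :* ((C :- B) :* ((C :- A) :* (c :* a :+ d :* b)))) refl A B C a b c d ⟩
      (A - B) * ((C - B) * ((C - A) * (c * a + d * b))) ∎)))
      where
      open R≈
      A = X x
      B = X y
      C = X z
      a = U (x ℤ.⊖ z)
      b = U (y ℤ.⊖ z)
      c = U (y ℤ.⊖ x)
      d = U (x ℤ.⊖ y)

    pair : ∀ a b → Σ ℕ λ x → Σ ℕ λ y → Σ ℕ λ z → (a ≡ x ℤ.⊖ z) × (b ≡ y ℤ.⊖ z)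
    pair (+ m) (+ n) = m , n , 0 , ≡.refl , ≡.refl
    pair (+ m) -[1+ n ] = m ℕ.+ suc n , 0 , suc n , ≡.sym (≡.trans (ℤP.⊖-≥ (ℕP.m≤n+m (suc n) m)) (≡.cong +_ (ℕP.m+n∸n≡m m (suc n)))) , ≡.refl
    pair -[1+ m ] (+ n) = 0 , n ℕ.+ suc m , suc m , ≡.refl , ≡.sym (≡.trans (ℤP.⊖-≥ (ℕP.m≤n+m (suc m) n)) (≡.cong +_ (ℕP.m+n∸n≡m n (suc m))))
    pair -[1+ m ] -[1+ n ] = n , m , suc m ℕ.+ n , lem m n , ≡.trans (lem n m) (≡.cong (m ℤ.⊖_) (≡.cong suc (ℕP.+-comm n m)))
      where
      lem : ∀ m n → -[1+ m ] ≡ n ℤ.⊖ (suc m ℕ.+ n)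
      lem m n = ≡.sym (≡.trans (ℤP.⊖-< (s≤s (ℕP.m≤n+m n m))) (≡.cong (λ k → ℤ.- + k) (ℕP.m+n∸n≡m (suc m) n)))

    diff : ∀ x y z → (x ℤ.⊖ z) ℤ.- (y ℤ.⊖ z) ≡ x ℤ.⊖ y
    diff x y z = ≡.trans (≡.cong₂ ℤ._-_ (≡.sym (ℤP.m-n≡m⊖n x z)) (≡.sym (ℤP.m-n≡m⊖n y z)))
      (≡.trans (S.solve 3 (λ x y z → (x S.:- z) S.:- (y S.:- z) S.:= x S.:- y) ≡.refl (+ x) (+ y) (+ z)) (ℤP.m-n≡m⊖n x y))
      where module S = Data.Integer.Solver.+-*-Solver

    ⊖-ne : ∀ x z → x ℤ.⊖ z ≢ 0ℤ → x ≢ z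
    ⊖-ne x .x ne ≡.refl = ne (ℤP.n⊖n≡0 x)

  U-mul : ∀ a b → a ≢ 0ℤ → b ≢ 0ℤ → a ≢ b → U a * U b ≈ U (b ℤ.- a) * U a + U (a ℤ.- b) * U b
  U-mul a b a0 b0 ne with pair a b
  ... | x , y , z , ≡.refl , ≡.refl = trans (U-mul′ x y z (⊖-ne x z a0) (⊖-ne y z b0) (λ e → ne (≡.cong (ℤ._⊖ z) e)))
    (sym (+-cong (*-congʳ (reflexive (≡.cong U (diff y x z)))) (*-congʳ (reflexive (≡.cong U (diff x y z))))))

  open PartialFractions seriesRing U U-mul U-neg public

  U-negative : ∀ e → U -[1+ e ] ≈ - (X (suc e) * W (suc e))
  U-negative e = trans (+-congˡ (-‿cong (W-unfold e))) (solve 1 (λ w → :1 :- (:1 :+ w) := :- w) refl _)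

  Pr : ℕ → ℕ → ℕ → Carrier
  Pr c s m = Π< m (λ j → W (s ℕ.+ c ℕ.* j))

  Pr∞ : ℕ → ℕ → Carrier
  Pr∞ c s = lim (Pr c s)

  ≤-index : ∀ c s j → 1 ℕ.≤ c → 1 ℕ.≤ s → suc j ℕ.≤ s ℕ.+ c ℕ.* j
  ≤-index (suc c) s j _ l = ℕP.+-mono-≤ l (ℕP.m≤m+n j (c ℕ.* j))

  W-one′ : ∀ e M → 1 ℕ.≤ e → M ℕ.≤ e → W e ≈[ M ] 1#
  W-one′ (suc e) M _ l = W-one e M l

  Pr-≈ : ∀ c s → 1 ℕ.≤ c → 1 ℕ.≤ s → ∀ M m → M ℕ.≤ m → Pr c s m ≈[ M ] Pr∞ c s
  Pr-≈ c s lc ls = lim-≈ (Pr c s) λ k → mod-trans (mod-* (fine refl)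
    (W-one′ _ k (ℕP.≤-trans (s≤s z≤n) (≤-index c s k lc ls)) (ℕP.≤-trans (ℕP.n≤1+n k) (≤-index c s k lc ls)))) (fine (*-identityʳ _))

  Σ∞ : (ℕ → Carrier) → Carrier
  Σ∞ f = lim (λ m → Σ< m f)

  Summable : (ℕ → Carrier) → Set
  Summable f = ∀ k → f k ≈[ k ] 0#

  Σ∞-≈ : ∀ {f} → Summable f → ∀ M m → M ℕ.≤ m → Σ< m f ≈[ M ] Σ∞ f
  Σ∞-≈ {f} h = lim-≈ (λ m → Σ< m f) λ k → mod-trans (mod-+ (fine refl) (h k)) (fine (+-identityʳ _))

  X*-small : ∀ {M e} f → M ℕ.≤ e → (X e * f) ≈[ M ] 0#
  X*-small f l = *-small f (X-small′ l)

  -- Tannery's theorem for terms whose q-adic valuation grows.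
  Σ-limit : ∀ (e : ℕ → ℕ) (F : ℕ → ℕ → Carrier) C (w : ℕ → Carrier) → (∀ n → n ℕ.≤ e n) →
    (∀ M N n → n ℕ.+ M ℕ.< N → F N n ≈[ M ] C) → ∀ M →
    Σ< (M ℕ.+ M) (λ n → X (e n) * (F (M ℕ.+ M) n * w n)) ≈[ M ] (C * Σ∞ (λ n → X (e n) * w n))
  Σ-limit e F C w he hF M = mod-trans (Σ-cong-mod (M ℕ.+ M) term)
    (mod-trans (fine (Σ-*ˡ (M ℕ.+ M) C _)) (mod-* (fine refl) (Σ∞-≈ (λ k → X*-small (w k) (he k)) M (M ℕ.+ M) (ℕP.m≤m+n M M))))
    where
    term : ∀ n → n ℕ.< M ℕ.+ M → (X (e n) * (F (M ℕ.+ M) n * w n)) ≈[ M ] (C * (X (e n) * w n))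
    term n _ with ℕP.<-≤-connex n M
    ... | inj₁ l = mod-trans (mod-* (fine refl) (mod-* (hF M (M ℕ.+ M) n (ℕP.+-monoˡ-< M l)) (fine refl)))
      (fine (solve 3 (λ x c w → x :* (c :* w) := c :* (x :* w)) refl _ _ _))
    ... | inj₂ l = mod-trans (X*-small _ (ℕP.≤-trans l (he n)))
      (mod-sym (mod-trans (fine (solve 3 (λ c x w → c :* (x :* w) := x :* (c :* w)) refl _ _ _)) (X*-small _ (ℕP.≤-trans l (he n)))))

  famP famN : ℕ → ℕ → PF
  famP a = prodPF (λ n → pt⁺ (+ (a ℕ.+ 9 ℕ.* n)))
  famN b = prodPF (λ k → pt⁻ (ℤ.- + (b ℕ.+ 9 ℕ.* k)))

  Bi : ℕ → ℕ → ℕ → PF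
  Bi a b N = mulPF (famP a N) (famN b N)

  U-pos : ∀ x y z → y ≡ x ℕ.+ z → U (+ y ℤ.- + x) ≈ W z
  U-pos x y z e = reflexive (≡.cong U (pos-⊖ x y z e))

  U-below : ∀ x y z → x ≡ y ℕ.+ suc z → U (+ y ℤ.- + x) ≈ - (X (suc z) * W (suc z))
  U-below x y z e = trans (reflexive (≡.cong U (neg-⊖ x y z e))) (U-negative z)

  H : ℕ → ℕ → ℕ → ℕ → Carrier
  H a b N x = Π< N (λ i → U (+ (a ℕ.+ 9 ℕ.* i) ℤ.- + x)) * Π< N (λ k → W (b ℕ.+ 9 ℕ.* k ℕ.+ x))

  fnB⁺ : ∀ a b N x → fn (Bi a b N) (ℤ.- + x) ≈ H a b N x
  fnB⁺ a b N x = *-cong (fn-prod _ N _) (trans (fn-prod _ N _) (Π-cong N (λ k → reflexive (≡.cong U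
    (ZS.solve 2 (λ y x → ZS.:- (ZS.:- y ZS.:+ ZS.:- x) ZS.:= y ZS.:+ x) ≡.refl (+ (b ℕ.+ 9 ℕ.* k)) (+ x))))))

  fnB⁻ : ∀ a b N y → fn (Bi a b N) (ℤ.- (ℤ.- + y)) ≈ H b a N y
  fnB⁻ a b N y = trans (*-cong
      (trans (fn-prod _ N _) (Π-cong N (λ i → reflexive (≡.cong U (≡.cong (λ z → + (a ℕ.+ 9 ℕ.* i) ℤ.+ z) (ℤP.neg-involutive (+ y)))))))
      (trans (fn-prod _ N _) (Π-cong N (λ k → reflexive (≡.cong U
        (ZS.solve 2 (λ z y → ZS.:- (ZS.:- z ZS.:+ ZS.:- (ZS.:- y)) ZS.:= z ZS.:- y) ≡.refl (+ (b ℕ.+ 9 ℕ.* k)) (+ y)))))))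
    (*-comm _ _)

  fnB⁰ : ∀ a b N → fn (Bi a b N) 0ℤ ≈ Pr 9 a N * Pr 9 b N
  fnB⁰ a b N = *-cong (trans (fn-prod _ N _) (Π-cong N (λ i → W-cong (ℕP.+-identityʳ _))))
    (trans (fn-prod _ N _) (Π-cong N (λ k → reflexive (≡.cong U
       (ZS.solve 1 (λ z → ZS.:- (ZS.:- z ZS.:+ ZS.con (+ 0)) ZS.:= z) ≡.refl (+ (b ℕ.+ 9 ℕ.* k)))))))

  sgn : ℕ → ℕ → Carrier
  sgn s n = Π< n (λ j → - X (s ℕ.+ 9 ℕ.* j))

  Pr-split : ∀ s n m → Pr 9 s (n ℕ.+ m) ≈ Pr 9 s n * Pr 9 (s ℕ.+ 9 ℕ.* n) m
  Pr-split s n m = trans (Π-split n m _) (*-congˡ (Π-cong m (λ j → W-cong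
    (NS.solve 3 (λ s n j → s NS.:+ NS.con 9 NS.:* (n NS.:+ j) NS.:= s NS.:+ NS.con 9 NS.:* n NS.:+ NS.con 9 NS.:* j) ≡.refl s n j))))

  lower : ∀ a a′ s n → suc s ℕ.+ a ≡ 9 ℕ.+ a′ →
    Π< n (λ i → U (+ (a ℕ.+ 9 ℕ.* i) ℤ.- + (a′ ℕ.+ 9 ℕ.* n))) ≈ sgn (suc s) n * Pr 9 (suc s) n
  lower a a′ s n e = trans (sym (Π-rev n _)) (trans (Π-cong< n term) (Π-* n _ _))
    where
    term : ∀ j → j ℕ.< n → U (+ (a ℕ.+ 9 ℕ.* (n ℕ.∸ suc j)) ℤ.- + (a′ ℕ.+ 9 ℕ.* n)) ≈ (- X (suc s ℕ.+ 9 ℕ.* j)) * W (suc s ℕ.+ 9 ℕ.* j)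
    term j l = trans (U-below (a′ ℕ.+ 9 ℕ.* n) (a ℕ.+ 9 ℕ.* (n ℕ.∸ suc j)) (s ℕ.+ 9 ℕ.* j) eq) (-‿distribˡ-* _ _)
      where
      i = n ℕ.∸ suc j
      n≡ : n ≡ suc j ℕ.+ i
      n≡ = ≡.sym (ℕP.m+[n∸m]≡n l)
      eq : a′ ℕ.+ 9 ℕ.* n ≡ a ℕ.+ 9 ℕ.* i ℕ.+ suc (s ℕ.+ 9 ℕ.* j)
      eq = ≡.trans (≡.cong (λ z → a′ ℕ.+ 9 ℕ.* z) n≡)
        (≡.trans (NS.solve 3 (λ a j i → a NS.:+ NS.con 9 NS.:* (NS.con 1 NS.:+ j NS.:+ i) NS.:= (NS.con 9 NS.:+ a) NS.:+ (NS.con 9 NS.:* i NS.:+ NS.con 9 NS.:* j)) ≡.refl a′ j i)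
        (≡.trans (≡.cong (ℕ._+ (9 ℕ.* i ℕ.+ 9 ℕ.* j)) (≡.sym e))
          (NS.solve 4 (λ s a i j → (NS.con 1 NS.:+ s NS.:+ a) NS.:+ (NS.con 9 NS.:* i NS.:+ NS.con 9 NS.:* j) NS.:= a NS.:+ NS.con 9 NS.:* i NS.:+ (NS.con 1 NS.:+ (s NS.:+ NS.con 9 NS.:* j))) ≡.refl s a i j)))

  upper : ∀ a a′ s n k → s ℕ.+ a′ ≡ 9 ℕ.+ a →
    Π< k (λ j → U (+ (a ℕ.+ 9 ℕ.* (suc n ℕ.+ j)) ℤ.- + (a′ ℕ.+ 9 ℕ.* n))) ≈ Pr 9 s k
  upper a a′ s n k e = Π-cong k (λ j → U-pos (a′ ℕ.+ 9 ℕ.* n) (a ℕ.+ 9 ℕ.* (suc n ℕ.+ j)) (s ℕ.+ 9 ℕ.* j)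
    (≡.trans (NS.solve 3 (λ a n j → a NS.:+ NS.con 9 NS.:* (NS.con 1 NS.:+ n NS.:+ j) NS.:= (NS.con 9 NS.:+ a) NS.:+ (NS.con 9 NS.:* n NS.:+ NS.con 9 NS.:* j)) ≡.refl a n j)
      (≡.trans (≡.cong (ℕ._+ (9 ℕ.* n ℕ.+ 9 ℕ.* j)) (≡.sym e))
        (NS.solve 4 (λ s a n j → (s NS.:+ a) NS.:+ (NS.con 9 NS.:* n NS.:+ NS.con 9 NS.:* j) NS.:= a NS.:+ NS.con 9 NS.:* n NS.:+ (s NS.:+ NS.con 9 NS.:* j)) ≡.refl s a′ n j))))

  row : ∀ a a′ s s′ N n → n ℕ.< N → suc s ℕ.+ a ≡ 9 ℕ.+ a′ → s′ ℕ.+ a′ ≡ 9 ℕ.+ a →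
    Π< N (λ i → U (+ (a ℕ.+ 9 ℕ.* i) ℤ.- + (a′ ℕ.+ 9 ℕ.* n)))
    ≈ (sgn (suc s) n * Pr 9 (suc s) n) * (U (+ a ℤ.- + a′) * Pr 9 s′ (N ℕ.∸ suc n))
  row a a′ s s′ N n l e e′ = begin
    Π< N f                       ≈⟨ reflexive (≡.cong (λ z → Π< z f) N≡) ⟩
    Π< (n ℕ.+ suc k) f           ≈⟨ Π-split n (suc k) f ⟩
    Π< n f * Π< (suc k) (λ j → f (n ℕ.+ j)) ≈⟨ *-cong (lower a a′ s n e) (Π-front k _) ⟩
    _ * (f (n ℕ.+ 0) * Π< k (λ j → f (n ℕ.+ suc j)))
      ≈⟨ *-congˡ (*-cong (reflexive (≡.cong U mid)) (Π-cong k (λ j → reflexive (≡.cong f (ℕP.+-suc n j))))) ⟩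
    _ * (U (+ a ℤ.- + a′) * Π< k (λ j → f (suc n ℕ.+ j))) ≈⟨ *-congˡ (*-congˡ (upper a a′ s′ n k e′)) ⟩
    _ ∎
    where
    open R≈
    f : ℕ → Carrier
    f i = U (+ (a ℕ.+ 9 ℕ.* i) ℤ.- + (a′ ℕ.+ 9 ℕ.* n))
    k = N ℕ.∸ suc n
    N≡ : N ≡ n ℕ.+ suc k
    N≡ = ≡.trans (≡.sym (ℕP.m+[n∸m]≡n l)) (≡.sym (ℕP.+-suc n k))
    mid : + (a ℕ.+ 9 ℕ.* (n ℕ.+ 0)) ℤ.- + (a′ ℕ.+ 9 ℕ.* n) ≡ + a ℤ.- + a′
    mid = ≡.trans (≡.cong (λ z → + (a ℕ.+ 9 ℕ.* z) ℤ.- + (a′ ℕ.+ 9 ℕ.* n)) (ℕP.+-identityʳ n))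
      (ZS.solve 3 (λ a b c → (a ZS.:+ c) ZS.:- (b ZS.:+ c) ZS.:= a ZS.:- b) ≡.refl (+ a) (+ a′) (+ (9 ℕ.* n)))

  column : ∀ b a′ s N n → b ℕ.+ a′ ≡ s → Π< N (λ k → W (b ℕ.+ 9 ℕ.* k ℕ.+ (a′ ℕ.+ 9 ℕ.* n))) ≈ Pr 9 (s ℕ.+ 9 ℕ.* n) N
  column b a′ s N n e = Π-cong N (λ k → W-cong (≡.trans
    (NS.solve 4 (λ b k a n → b NS.:+ NS.con 9 NS.:* k NS.:+ (a NS.:+ NS.con 9 NS.:* n) NS.:= (b NS.:+ a) NS.:+ NS.con 9 NS.:* n NS.:+ NS.con 9 NS.:* k) ≡.refl b k a′ n)
    (≡.cong (λ z → z ℕ.+ 9 ℕ.* n ℕ.+ 9 ℕ.* k) e)))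

  H-value : ∀ a b a′ b′ N n → n ℕ.< N → a ℕ.+ b ≡ 9 → a′ ℕ.+ b′ ≡ 9 → 1 ℕ.≤ b →
    H a b N (a′ ℕ.+ 9 ℕ.* n)
    ≈ sgn (b ℕ.+ a′) n * (U (+ a ℤ.- + a′) * (Pr 9 (a ℕ.+ b′) (N ℕ.∸ suc n) * Pr 9 (b ℕ.+ a′) (n ℕ.+ N)))
  H-value a (suc b) a′ b′ N n l e e′ _ = trans (*-cong
      (row a a′ (b ℕ.+ a′) (a ℕ.+ b′) N n l
        (≡.trans (NS.solve 3 (λ a b c → (NS.con 1 NS.:+ (b NS.:+ c)) NS.:+ a NS.:= (a NS.:+ (NS.con 1 NS.:+ b)) NS.:+ c) ≡.refl a b a′) (≡.cong (ℕ._+ a′) e))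
        (≡.trans (NS.solve 3 (λ a b c → (a NS.:+ b) NS.:+ c NS.:= (c NS.:+ b) NS.:+ a) ≡.refl a b′ a′) (≡.cong (ℕ._+ a) e′)))
      (column (suc b) a′ (suc b ℕ.+ a′) N n ≡.refl))
    (trans (solve 5 (λ m p u q r → ((m :* p) :* (u :* q)) :* r := m :* (u :* (q :* (p :* r)))) refl _ _ _ _ _)
      (*-congˡ (*-congˡ (*-congˡ (sym (Pr-split (suc b ℕ.+ a′) n N))))))

  own : ℕ → ℕ → Carrier
  own n N = sgn 9 n * (Pr 9 9 n * Pr 9 9 (N ℕ.∸ suc n))

  private
    except-own : ∀ a N n → n ℕ.< N → except (λ i → U (+ (a ℕ.+ 9 ℕ.* i) ℤ.- + (a ℕ.+ 9 ℕ.* n))) N n ≈ own n N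
    except-own a N n l = trans (*-cong (lower a a 8 n ≡.refl) (upper a a 9 n (N ℕ.∸ suc n) ≡.refl)) (*-assoc _ _ _)

  wsum-famP : ∀ a N φ → wsum (famP a N) φ ≈ Σ< N (λ n → own n N * φ (+ (a ℕ.+ 9 ℕ.* n)))
  wsum-famP a N φ = trans (wsum-prodPF _ N φ) (Σ-cong< N (λ n l →
    trans (trans (+-identityʳ _) (*-identityˡ _)) (*-congʳ (except-own a N n l))))

  wsum-famN : ∀ b N φ → wsum (famN b N) φ ≈ - Σ< N (λ k → own k N * φ (ℤ.- + (b ℕ.+ 9 ℕ.* k)))
  wsum-famN b N φ = trans (wsum-prodPF _ N φ) (trans (Σ-cong< N (λ k l →
    trans (solve 1 (λ x → (:- :1) :* x :+ :0 := :- x) refl _) (-‿cong (*-congʳ (trans (except-cong k) (except-own b N k l))))))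
    (Σ-neg N _))
    where
    flip : ∀ i k → U (ℤ.- (ℤ.- + (b ℕ.+ 9 ℕ.* i) ℤ.+ ℤ.- (ℤ.- + (b ℕ.+ 9 ℕ.* k)))) ≈ U (+ (b ℕ.+ 9 ℕ.* i) ℤ.- + (b ℕ.+ 9 ℕ.* k))
    flip i k = reflexive (≡.cong U (ZS.solve 2 (λ z y → ZS.:- (ZS.:- z ZS.:+ ZS.:- (ZS.:- y)) ZS.:= z ZS.:- y) ≡.refl (+ (b ℕ.+ 9 ℕ.* i)) (+ (b ℕ.+ 9 ℕ.* k))))
    except-cong : ∀ k → _ ≈ except (λ i → U (+ (b ℕ.+ 9 ℕ.* i) ℤ.- + (b ℕ.+ 9 ℕ.* k))) N k
    except-cong k = *-cong (Π-cong k (λ i → flip i k)) (Π-cong (N ℕ.∸ suc k) (λ j → flip (suc k ℕ.+ j) k))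

  wsum-Bi : ∀ a b N φ → wsum (Bi a b N) φ ≈
    Σ< N (λ n → own n N * (Π< N (λ k → W (b ℕ.+ 9 ℕ.* k ℕ.+ (a ℕ.+ 9 ℕ.* n))) * φ (+ (a ℕ.+ 9 ℕ.* n))))
    - Σ< N (λ k → own k N * (Π< N (λ n → W (a ℕ.+ 9 ℕ.* n ℕ.+ (b ℕ.+ 9 ℕ.* k))) * φ (ℤ.- + (b ℕ.+ 9 ℕ.* k))))
  wsum-Bi a b N φ = trans (wsum-mul (famP a N) (famN b N) φ) (+-cong
    (trans (wsum-famP a N _) (Σ-cong N (λ n → *-congˡ (*-congʳ (trans (fn-prod _ N _) (Π-cong N (λ k → reflexive (≡.cong U
      (ZS.solve 2 (λ y x → ZS.:- (ZS.:- y ZS.:+ ZS.:- x) ZS.:= y ZS.:+ x) ≡.refl (+ (b ℕ.+ 9 ℕ.* k)) (+ (a ℕ.+ 9 ℕ.* n)))))))))))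
    (trans (wsum-famN b N _) (-‿cong (Σ-cong N (λ k → *-congˡ (*-congʳ (trans (fn-prod _ N _) (Π-cong N (λ n → reflexive (≡.cong U
      (≡.cong (λ z → + (a ℕ.+ 9 ℕ.* n) ℤ.+ z) (ℤP.neg-involutive (+ (b ℕ.+ 9 ℕ.* k))))))))))))))

  famP-distinct : ∀ a i j → i ℕ.< j → + (a ℕ.+ 9 ℕ.* i) ≢ + (a ℕ.+ 9 ℕ.* j)
  famP-distinct a i j l e = ℕP.<⇒≢ l (ℕP.*-cancelˡ-≡ i j 9 (ℕP.+-cancelˡ-≡ a _ _ (ℤP.+-injective e)))

  famP-Good : ∀ a N → Good (famP a N)
  famP-Good a = prod-Good {λ n → pt⁺ (+ (a ℕ.+ 9 ℕ.* n))} (λ n → pt⁺-Good _) (λ i j l → (famP-distinct a i j l ∷ []) ∷ [])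

  famN-Good : ∀ b N → Good (famN b N)
  famN-Good b = prod-Good {λ n → pt⁻ (ℤ.- + (b ℕ.+ 9 ℕ.* n))} (λ n → pt⁻-Good _) (λ i j l → ((λ e → famP-distinct b i j l (ℤP.neg-injective e)) ∷ []) ∷ [])

  Positive Negative : ℤ → Set
  Positive e = ∃ λ n → e ≡ + suc n
  Negative e = ∃ λ n → e ≡ -[1+ n ]

  famP-Positive : ∀ a N → Loc Positive (famP (suc a) N)
  famP-Positive a = Loc-prod {p = λ n → pt⁺ (+ (suc a ℕ.+ 9 ℕ.* n))} (λ n → (_ , ≡.refl) ∷ [])

  famN-Negative : ∀ b N → Loc Negative (famN (suc b) N)
  famN-Negative b = Loc-prod {p = λ n → pt⁻ (ℤ.- + (suc b ℕ.+ 9 ℕ.* n))} (λ n → (_ , ≡.refl) ∷ [])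

  Bi-Good : ∀ a b N → Good (Bi (suc a) (suc b) N)
  Bi-Good a b N = mul-Good {famP (suc a) N} {famN (suc b) N} (famP-Good (suc a) N) (famN-Good (suc b) N)
    (Disjoint-classes {P = famP (suc a) N} {famN (suc b) N} (famP-Positive a N) (famN-Negative b N) (λ { e f (m , ≡.refl) (n , ≡.refl) () }))

  Bi-Nonzero : ∀ a b N → Nonzero (Bi (suc a) (suc b) N)
  Bi-Nonzero a b N = Loc-mul {P = famP (suc a) N} {famN (suc b) N}
    (Loc-map {P = famP (suc a) N} (λ { e (n , ≡.refl) () }) (famP-Positive a N))
    (Loc-map {P = famN (suc b) N} (λ { e (n , ≡.refl) () }) (famN-Negative b N))

  Bi-Class : ∀ a b m N → a ℕ.+ b ≡ 9 ℕ.* m → Loc (Class a) (Bi a b N)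
  Bi-Class a b m N e = Loc-mul {P = famP a N} {famN b N}
    (Loc-prod {p = λ n → pt⁺ (+ (a ℕ.+ 9 ℕ.* n))} (λ n → class⁺ a n ∷ []) N)
    (Loc-prod {p = λ n → pt⁻ (ℤ.- + (b ℕ.+ 9 ℕ.* n))} (λ n → class⁻ a b m e n ∷ []) N)

  const-famP : ∀ a N → const (famP a (suc N)) ≈ 0#
  const-famP a N = zeroʳ _

  lam : ℕ → ℕ → Carrier
  lam tot a = Σ∞ (λ n → X (expo tot n) * W (a ℕ.+ 9 ℕ.* n))

  rho : ℕ → Carrier
  rho a = Σ∞ (λ n → X (a ℕ.+ 9 ℕ.* n) * W (a ℕ.+ 9 ℕ.* n))

  J⁻² : Carrier
  J⁻² = Pr∞ 9 9 * Pr∞ 9 9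

  cc : ℕ → ℕ → ℕ → ℕ → Carrier
  cc a b a′ b′ = U (+ a ℤ.- + a′) * (Pr∞ 9 (a ℕ.+ b′) * Pr∞ 9 (b ℕ.+ a′))

  sgn-front : ∀ s n → sgn s (suc n) ≈ (- X s) * sgn (s ℕ.+ 9) n
  sgn-front s n = trans (Π-front n _) (*-cong (-‿cong (X-cong (ℕP.+-identityʳ s)))
    (Π-cong n (λ j → -‿cong (X-cong (NS.solve 2 (λ s j → s NS.:+ NS.con 9 NS.:* (NS.con 1 NS.:+ j) NS.:= s NS.:+ NS.con 9 NS.:+ NS.con 9 NS.:* j) ≡.refl s j)))))

  sgn-4 : ∀ s₀ s₁ s₂ s₃ n → sgn s₀ n * (sgn s₁ n * (sgn s₂ n * sgn s₃ n)) ≈ X (expo (s₀ ℕ.+ s₁ ℕ.+ s₂ ℕ.+ s₃) n)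
  sgn-4 s₀ s₁ s₂ s₃ zero = trans (solve 0 (:1 :* (:1 :* (:1 :* :1)) := :1) refl) (sym X-zero)
  sgn-4 s₀ s₁ s₂ s₃ (suc n) = begin
    _ ≈⟨ solve 8 (λ a b c d w x y z → (a :* (:- w)) :* ((b :* (:- x)) :* ((c :* (:- y)) :* (d :* (:- z)))) := (a :* (b :* (c :* d))) :* (w :* (x :* (y :* z)))) refl _ _ _ _ _ _ _ _ ⟩
    _ ≈⟨ *-cong (sgn-4 s₀ s₁ s₂ s₃ n) (sym (trans (X-+ (s₀ ℕ.+ 9 ℕ.* n) _) (*-congˡ (trans (X-+ (s₁ ℕ.+ 9 ℕ.* n) _) (*-congˡ (X-+ (s₂ ℕ.+ 9 ℕ.* n) (s₃ ℕ.+ 9 ℕ.* n))))))) ⟩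
    _ ≈⟨ sym (X-+ _ _) ⟩
    _ ≈⟨ X-cong (≡.cong (expo tot n ℕ.+_) (NS.solve 5 (λ a b c d n → (a NS.:+ NS.con 9 NS.:* n) NS.:+ ((b NS.:+ NS.con 9 NS.:* n) NS.:+ ((c NS.:+ NS.con 9 NS.:* n) NS.:+ (d NS.:+ NS.con 9 NS.:* n)))
           NS.:= (a NS.:+ b NS.:+ c NS.:+ d) NS.:+ NS.con 36 NS.:* n) ≡.refl s₀ s₁ s₂ s₃ n)) ⟩
    _ ∎
    where
    open R≈
    tot = s₀ ℕ.+ s₁ ℕ.+ s₂ ℕ.+ s₃

  ≤-∸ : ∀ M N n → n ℕ.+ M ℕ.< N → M ℕ.≤ N ℕ.∸ suc n
  ≤-∸ M N n h = ℕP.m+n≤o⇒m≤o∸n M (≡.subst (ℕ._≤ N) (ℕP.+-comm (suc n) M) h)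

  conv-∸ : ∀ s M N n → 1 ℕ.≤ s → n ℕ.+ M ℕ.< N → Pr 9 s (N ℕ.∸ suc n) ≈[ M ] Pr∞ 9 s
  conv-∸ s M N n l h = Pr-≈ 9 s (s≤s z≤n) l M _ (≤-∸ M N n h)

  conv-+ : ∀ s M N n → 1 ℕ.≤ s → n ℕ.+ M ℕ.< N → Pr 9 s (n ℕ.+ N) ≈[ M ] Pr∞ 9 s
  conv-+ s M N n l h = Pr-≈ 9 s (s≤s z≤n) l M _ (ℕP.≤-trans (ℕP.m≤n+m M (suc n)) (ℕP.≤-trans h (ℕP.m≤n+m N n)))

  conv-∸′ : ∀ s M N n → 1 ℕ.≤ s → n ℕ.+ M ℕ.< N → Pr 9 s (suc (N ℕ.∸ suc n)) ≈[ M ] Pr∞ 9 s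
  conv-∸′ s M N n l h = Pr-≈ 9 s (s≤s z≤n) l M _ (ℕP.m≤n⇒m≤1+n (≤-∸ M N n h))

  conv-+′ : ∀ s M N n → 1 ℕ.≤ s → n ℕ.+ M ℕ.< N → Pr 9 s (suc n ℕ.+ N) ≈[ M ] Pr∞ 9 s
  conv-+′ s M N n l h = Pr-≈ 9 s (s≤s z≤n) l M _ (ℕP.m≤n⇒m≤1+n (ℕP.≤-trans (ℕP.m≤n+m M (suc n)) (ℕP.≤-trans h (ℕP.m≤n+m N n))))

  series : ∀ (e : ℕ → ℕ) (F : ℕ → ℕ → Carrier) C a → (∀ n → n ℕ.≤ e n) → (∀ M N n → n ℕ.+ M ℕ.< N → F N n ≈[ M ] C) →
    ∀ M (t : ℕ → Carrier) → (∀ n → n ℕ.< M ℕ.+ M → t n ≈ X (e n) * (F (M ℕ.+ M) n * W (a ℕ.+ 9 ℕ.* n))) →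
    Σ< (M ℕ.+ M) t ≈[ M ] (C * Σ∞ (λ n → X (e n) * W (a ℕ.+ 9 ℕ.* n)))
  series e F C a he hF M t ht = mod-trans (fine (Σ-cong< (M ℕ.+ M) ht)) (Σ-limit e F C (λ n → W (a ℕ.+ 9 ℕ.* n)) he hF M)

  own-column : ∀ n N → own n N * Pr 9 (9 ℕ.+ 9 ℕ.* n) N ≈ sgn 9 n * (Pr 9 9 (N ℕ.∸ suc n) * Pr 9 9 (n ℕ.+ N))
  own-column n N = trans (solve 4 (λ m p q r → (m :* (p :* q)) :* r := m :* (q :* (p :* r))) refl _ _ _ _)
    (*-congˡ (*-congˡ (sym (Pr-split 9 n N))))

  H-factor : ℕ → ℕ → ℕ → ℕ → ℕ → ℕ → Carrier
  H-factor a b a′ b′ N n = U (+ a ℤ.- + a′) * (Pr 9 (a ℕ.+ b′) (N ℕ.∸ suc n) * Pr 9 (b ℕ.+ a′) (n ℕ.+ N))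

  H-factor-≈ : ∀ a b a′ b′ M N n → 1 ℕ.≤ a → 1 ℕ.≤ b → n ℕ.+ M ℕ.< N → H-factor a b a′ b′ N n ≈[ M ] cc a b a′ b′
  H-factor-≈ a b a′ b′ M N n la lb h = mod-* (fine refl) (mod-* (conv-∸ (a ℕ.+ b′) M N n (ℕP.≤-trans la (ℕP.m≤m+n a b′)) h)
    (conv-+ (b ℕ.+ a′) M N n (ℕP.≤-trans lb (ℕP.m≤m+n b a′)) h))

  U-minus : ∀ x → 1 ℕ.≤ x → U (ℤ.- + x) ≈ - (X x * W x)
  U-minus (suc x) _ = U-negative x

  record Res (a b : ℕ) : Set where
    constructor res
    field
      sum  : a ℕ.+ b ≡ 9
      posˡ : 1 ℕ.≤ a
      posʳ : 1 ℕ.≤ b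
  open Res public

  swap : ∀ {a b} → Res a b → Res b a
  swap {a} {b} (res s p q) = res (≡.trans (ℕP.+-comm b a) s) q p

  term-R : ∀ d {a₀ b₀ a₁ b₁ a₂ b₂ a₃ b₃} → Res a₀ b₀ → Res a₁ b₁ → Res a₂ b₂ → Res a₃ b₃ → ∀ M →
    Σ< (M ℕ.+ M) (λ n → own n (M ℕ.+ M) * (Π< (M ℕ.+ M) (λ k → W (b₀ ℕ.+ 9 ℕ.* k ℕ.+ (a₀ ℕ.+ 9 ℕ.* n)))
      * ((H a₁ b₁ (M ℕ.+ M) (a₀ ℕ.+ 9 ℕ.* n) * (H a₂ b₂ (M ℕ.+ M) (a₀ ℕ.+ 9 ℕ.* n) * H a₃ b₃ (M ℕ.+ M) (a₀ ℕ.+ 9 ℕ.* n)))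
         * (X (d ℕ.* n) * W (a₀ ℕ.+ 9 ℕ.* n)))))
    ≈[ M ] ((J⁻² * (cc a₁ b₁ a₀ b₀ * (cc a₂ b₂ a₀ b₀ * cc a₃ b₃ a₀ b₀)))
            * lam (9 ℕ.+ (b₁ ℕ.+ a₀) ℕ.+ (b₂ ℕ.+ a₀) ℕ.+ (b₃ ℕ.+ a₀) ℕ.+ d) a₀)
  term-R d {a₀} {b₀} {a₁} {b₁} {a₂} {b₂} {a₃} {b₃} r₀ r₁ r₂ r₃ M = series (expo (tot ℕ.+ d))
    (λ N n → (Pr 9 9 (N ℕ.∸ suc n) * Pr 9 9 (n ℕ.+ N)) * (H-factor a₁ b₁ a₀ b₀ N n * (H-factor a₂ b₂ a₀ b₀ N n * H-factor a₃ b₃ a₀ b₀ N n)))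
    _ a₀ (n≤E _ (s≤s z≤n))
    (λ M N n h → mod-* (mod-* (conv-∸ 9 M N n (s≤s z≤n) h) (conv-+ 9 M N n (s≤s z≤n) h))
      (mod-* (H-factor-≈ a₁ b₁ a₀ b₀ M N n (posˡ r₁) (posʳ r₁) h) (mod-* (H-factor-≈ a₂ b₂ a₀ b₀ M N n (posˡ r₂) (posʳ r₂) h) (H-factor-≈ a₃ b₃ a₀ b₀ M N n (posˡ r₃) (posʳ r₃) h))))
    M _ term
    where
    tot = 9 ℕ.+ (b₁ ℕ.+ a₀) ℕ.+ (b₂ ℕ.+ a₀) ℕ.+ (b₃ ℕ.+ a₀)
    N = M ℕ.+ M
    term : ∀ n → n ℕ.< N → _ ≈ _
    term n l = begin
      _ ≈⟨ *-congˡ (*-cong (column b₀ a₀ 9 N n (≡.trans (ℕP.+-comm b₀ a₀) (sum r₀)))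
             (*-congʳ (*-cong (H-value a₁ b₁ a₀ b₀ N n l (sum r₁) (sum r₀) (posʳ r₁))
               (*-cong (H-value a₂ b₂ a₀ b₀ N n l (sum r₂) (sum r₀) (posʳ r₂)) (H-value a₃ b₃ a₀ b₀ N n l (sum r₃) (sum r₀) (posʳ r₃)))))) ⟩
      _ ≈⟨ sym (*-assoc _ _ _) ⟩
      _ ≈⟨ *-congʳ (own-column n N) ⟩
      _ ≈⟨ solve 10 (λ m₀ p m₁ v₁ m₂ v₂ m₃ v₃ x w → (m₀ :* p) :* (((m₁ :* v₁) :* ((m₂ :* v₂) :* (m₃ :* v₃))) :* (x :* w))
             := ((m₀ :* (m₁ :* (m₂ :* m₃))) :* x) :* ((p :* (v₁ :* (v₂ :* v₃))) :* w)) refl _ _ _ _ _ _ _ _ _ _ ⟩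
      _ ≈⟨ *-congʳ (trans (*-congʳ (sgn-4 9 (b₁ ℕ.+ a₀) (b₂ ℕ.+ a₀) (b₃ ℕ.+ a₀) n)) (trans (sym (X-+ _ _)) (X-cong (≡.sym (expo-shift tot d n))))) ⟩
      _ ∎
      where open R≈

  -- The contribution of the poles in the classes of a₀ to a partial fraction expansion.
  block-R : ∀ {a₀ b₀ a₁ b₁ a₂ b₂ a₃ b₃} → Res a₀ b₀ → Res a₁ b₁ → Res a₂ b₂ → Res a₃ b₃ → Carrier
  block-R {a₀} {b₀} {a₁} {b₁} {a₂} {b₂} {a₃} {b₃} _ _ _ _ =
    (J⁻² * (cc a₁ b₁ a₀ b₀ * (cc a₂ b₂ a₀ b₀ * cc a₃ b₃ a₀ b₀))) * lam (9 ℕ.+ (b₁ ℕ.+ a₀) ℕ.+ (b₂ ℕ.+ a₀) ℕ.+ (b₃ ℕ.+ a₀) ℕ.+ 0) a₀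
    + X b₀ * ((J⁻² * (cc b₁ a₁ b₀ a₀ * (cc b₂ a₂ b₀ a₀ * cc b₃ a₃ b₀ a₀))) * lam (9 ℕ.+ (a₁ ℕ.+ b₀) ℕ.+ (a₂ ℕ.+ b₀) ℕ.+ (a₃ ℕ.+ b₀) ℕ.+ 9) b₀)

  wsum-R : ∀ {a₀ b₀ a₁ b₁ a₂ b₂ a₃ b₃} (r₀ : Res a₀ b₀) (r₁ : Res a₁ b₁) (r₂ : Res a₂ b₂) (r₃ : Res a₃ b₃) → ∀ M →
    wsum (Bi a₀ b₀ (M ℕ.+ M)) (λ e → (fn (Bi a₁ b₁ (M ℕ.+ M)) (ℤ.- e) * (fn (Bi a₂ b₂ (M ℕ.+ M)) (ℤ.- e) * fn (Bi a₃ b₃ (M ℕ.+ M)) (ℤ.- e))) * U e)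
    ≈[ M ] block-R r₀ r₁ r₂ r₃
  wsum-R {a₀} {b₀} {a₁} {b₁} {a₂} {b₂} {a₃} {b₃} r₀ r₁ r₂ r₃ M = mod-trans (fine (wsum-Bi a₀ b₀ N _)) (mod-+ pos neg)
    where
    N = M ℕ.+ M
    pos : _ ≈[ M ] _
    pos = mod-trans (fine (Σ-cong N (λ n → *-congˡ (*-congˡ (*-cong (*-cong (fnB⁺ a₁ b₁ N _) (*-cong (fnB⁺ a₂ b₂ N _) (fnB⁺ a₃ b₃ N _)))
        (sym (trans (*-congʳ X-zero) (*-identityˡ _))))))))
      (term-R 0 r₀ r₁ r₂ r₃ M)
    neg : _ ≈[ M ] _
    neg = mod-trans (fine (trans (sym (Σ-neg N _)) (trans (Σ-cong N (λ k → trans (-‿cong (*-congˡ (*-congˡ (*-cong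
              (*-cong (fnB⁻ a₁ b₁ N _) (*-cong (fnB⁻ a₂ b₂ N _) (fnB⁻ a₃ b₃ N _)))
              (trans (U-minus (b₀ ℕ.+ 9 ℕ.* k) (ℕP.≤-trans (posʳ r₀) (ℕP.m≤m+n b₀ _))) (-‿cong (*-congʳ (X-+ b₀ (9 ℕ.* k)))))))))
            (solve 6 (λ o c h x y w → :- (o :* (c :* (h :* (:- ((x :* y) :* w))))) := x :* (o :* (c :* (h :* (y :* w))))) refl _ _ _ _ _ _)))
          (Σ-*ˡ N (X b₀) _))))
      (mod-* (fine refl) (term-R 9 (swap r₀) (swap r₁) (swap r₂) (swap r₃) M))

  wsum-4 : ∀ P₀ P₁ P₂ P₃ φ → wsum (mulPF (mulPF (mulPF P₀ P₁) P₂) P₃) φ ≈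
      wsum P₀ (λ e → (fn P₁ (ℤ.- e) * (fn P₂ (ℤ.- e) * fn P₃ (ℤ.- e))) * φ e)
    + wsum P₁ (λ e → (fn P₀ (ℤ.- e) * (fn P₂ (ℤ.- e) * fn P₃ (ℤ.- e))) * φ e)
    + wsum P₂ (λ e → (fn P₀ (ℤ.- e) * (fn P₁ (ℤ.- e) * fn P₃ (ℤ.- e))) * φ e)
    + wsum P₃ (λ e → (fn P₀ (ℤ.- e) * (fn P₁ (ℤ.- e) * fn P₂ (ℤ.- e))) * φ e)
  wsum-4 P₀ P₁ P₂ P₃ φ = trans (wsum-mul (mulPF (mulPF P₀ P₁) P₂) P₃ φ) (+-cong (trans (wsum-mul (mulPF P₀ P₁) P₂ _) (+-cong (trans (wsum-mul P₀ P₁ _) (+-cong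
      (wsum-cong′ P₀ (λ e → solve 4 (λ a b c d → a :* (b :* (c :* d)) := (a :* (b :* c)) :* d) refl _ _ _ _))
      (wsum-cong′ P₁ (λ e → solve 4 (λ a b c d → a :* (b :* (c :* d)) := (a :* (b :* c)) :* d) refl _ _ _ _))))
      (wsum-cong′ P₂ (λ e → solve 4 (λ a b c d → (a :* b) :* (c :* d) := (a :* (b :* c)) :* d) refl _ _ _ _))))
      (wsum-cong′ P₃ (λ e → solve 4 (λ a b c d → ((a :* b) :* c) :* d := (a :* (b :* c)) :* d) refl _ _ _ _)))

  mul-Disjoint : ∀ {P Q R} → Disjoint P R → Disjoint Q R → Disjoint (mulPF P Q) R
  mul-Disjoint p q = AllP.++⁺ (AllP.map⁺ p) (AllP.map⁺ q)

  Bi-Disjoint : ∀ a b m a′ b′ m′ N → a ℕ.+ b ≡ 9 ℕ.* m → a′ ℕ.+ b′ ≡ 9 ℕ.* m′ → Apart a a′ → Disjoint (Bi a b N) (Bi a′ b′ N)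
  Bi-Disjoint a b m a′ b′ m′ N e e′ ap = Disjoint-classes {P = Bi a b N} {Bi a′ b′ N} (Bi-Class a b m N e) (Bi-Class a′ b′ m′ N e′) (apart {a} {a′} ap)

  Bi-Good′ : ∀ {a b} → 1 ℕ.≤ a → 1 ℕ.≤ b → ∀ N → Good (Bi a b N)
  Bi-Good′ {suc a} {suc b} _ _ N = Bi-Good a b N

  Bi-Nonzero′ : ∀ {a b} → 1 ℕ.≤ a → 1 ℕ.≤ b → ∀ N → Nonzero (Bi a b N)
  Bi-Nonzero′ {suc a} {suc b} _ _ N = Bi-Nonzero a b N

  theta⁻¹ : ℕ → ℕ → Carrier
  theta⁻¹ a b = Pr∞ 9 a * Pr∞ 9 b

  Pr²-≈ : ∀ {a b} → 1 ℕ.≤ a → 1 ℕ.≤ b → ∀ M → (Pr 9 a (M ℕ.+ M) * Pr 9 b (M ℕ.+ M)) ≈[ M ] theta⁻¹ a b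
  Pr²-≈ la lb M = mod-* (Pr-≈ 9 _ (s≤s z≤n) la M (M ℕ.+ M) (ℕP.m≤m+n M M)) (Pr-≈ 9 _ (s≤s z≤n) lb M (M ℕ.+ M) (ℕP.m≤m+n M M))

  -- The partial fraction expansion of 1/([q^a₀][q^a₁][q^a₂][q^a₃]).
  expansion : ∀ {a₀ b₀ a₁ b₁ a₂ b₂ a₃ b₃} (r₀ : Res a₀ b₀) (r₁ : Res a₁ b₁) (r₂ : Res a₂ b₂) (r₃ : Res a₃ b₃) →
    Apart a₀ a₁ → Apart a₀ a₂ → Apart a₀ a₃ → Apart a₁ a₂ → Apart a₁ a₃ → Apart a₂ a₃ →
    theta⁻¹ a₀ b₀ * theta⁻¹ a₁ b₁ * theta⁻¹ a₂ b₂ * theta⁻¹ a₃ b₃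
    ≈ block-R r₀ r₁ r₂ r₃ + block-R r₁ r₀ r₂ r₃ + block-R r₂ r₀ r₁ r₃ + block-R r₃ r₀ r₁ r₂
  expansion {a₀} {b₀} {a₁} {b₁} {a₂} {b₂} {a₃} {b₃} r₀ r₁ r₂ r₃ d₀₁ d₀₂ d₀₃ d₁₂ d₁₃ d₂₃ = separated λ M → go M
    where
    go : ∀ M → _ ≈[ M ] _
    go zero = mod-mono (z≤n {1}) (go 1)
    go M@(suc m) = mod-trans (mod-sym (mod-* (mod-* (mod-* (Pr²-≈ (posˡ r₀) (posʳ r₀) M) (Pr²-≈ (posˡ r₁) (posʳ r₁) M)) (Pr²-≈ (posˡ r₂) (posʳ r₂) M)) (Pr²-≈ (posˡ r₃) (posʳ r₃) M)))
      (mod-trans (fine (trans (sym (*-cong (*-cong (*-cong (fnB⁰ a₀ b₀ N) (fnB⁰ a₁ b₁ N)) (fnB⁰ a₂ b₂ N)) (fnB⁰ a₃ b₃ N)))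
        (trans (fn-zero {T} T-Good T-Nonzero) (trans (+-congʳ const-zero) (trans (+-identityˡ _) (wsum-4 B₀ B₁ B₂ B₃ U))))))
      (mod-+ (mod-+ (mod-+ (wsum-R r₀ r₁ r₂ r₃ M) (wsum-R r₁ r₀ r₂ r₃ M)) (wsum-R r₂ r₀ r₁ r₃ M)) (wsum-R r₃ r₀ r₁ r₂ M)))
      where
      N = M ℕ.+ M
      B₀ = Bi a₀ b₀ N
      B₁ = Bi a₁ b₁ N
      B₂ = Bi a₂ b₂ N
      B₃ = Bi a₃ b₃ N
      T = mulPF (mulPF (mulPF B₀ B₁) B₂) B₃
      dis : ∀ {a b a′ b′} → Res a b → Res a′ b′ → Apart a a′ → Disjoint (Bi a b N) (Bi a′ b′ N)
      dis {a} {b} {a′} {b′} r r′ = Bi-Disjoint a b 1 a′ b′ 1 N (sum r) (sum r′)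
      good : ∀ {a b} → Res a b → Good (Bi a b N)
      good r = Bi-Good′ (posˡ r) (posʳ r) N
      nz : ∀ {a b} → Res a b → Nonzero (Bi a b N)
      nz r = Bi-Nonzero′ (posˡ r) (posʳ r) N
      T-Good : Good T
      T-Good = mul-Good {mulPF (mulPF B₀ B₁) B₂} {B₃} (mul-Good {mulPF B₀ B₁} {B₂} (mul-Good {B₀} {B₁} (good r₀) (good r₁) (dis r₀ r₁ d₀₁)) (good r₂)
          (mul-Disjoint {B₀} {B₁} {B₂} (dis r₀ r₂ d₀₂) (dis r₁ r₂ d₁₂))) (good r₃)
        (mul-Disjoint {mulPF B₀ B₁} {B₂} {B₃} (mul-Disjoint {B₀} {B₁} {B₃} (dis r₀ r₃ d₀₃) (dis r₁ r₃ d₁₃)) (dis r₂ r₃ d₂₃))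
      T-Nonzero : Nonzero T
      T-Nonzero = Loc-mul {P = mulPF (mulPF B₀ B₁) B₂} {B₃} (Loc-mul {P = mulPF B₀ B₁} {B₂} (Loc-mul {P = B₀} {B₁} (nz r₀) (nz r₁)) (nz r₂)) (nz r₃)
      const-zero : const T ≈ 0#
      const-zero = trans (*-congʳ (*-congʳ (*-congʳ (trans (*-congʳ (const-famP a₀ (m ℕ.+ suc m))) (zeroˡ _)))))
        (solve 3 (λ x y z → ((:0 :* x) :* y) :* z := :0) refl _ _ _)

  LogDeriv : PF → Carrier → Set
  LogDeriv P d = DSound P (fn P 0ℤ * d)

  mul-LogDeriv : ∀ {P Q x y} → Good P → Good Q → Disjoint P Q → Nonzero P → Nonzero Q → LogDeriv P x → LogDeriv Q y → LogDeriv (mulPF P Q) (x + y)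
  mul-LogDeriv {P} {Q} gP gQ d zP zQ dx dy = trans
    (solve 4 (λ p q x y → (p :* q) :* (x :+ y) := (p :* x) :* q :+ p :* (q :* y)) refl _ _ _ _)
    (mul-DSound {P} {Q} gP gQ d zP zQ dx dy)

  prod-LogDeriv : ∀ {p d} → (∀ i → Good (p i)) → (∀ i j → i ℕ.< j → Disjoint (p i) (p j)) → (∀ i → Nonzero (p i)) → (∀ i → LogDeriv (p i) (d i)) →
    ∀ n → LogDeriv (prodPF p n) (Σ< n d)
  prod-LogDeriv g d z h zero = zeroʳ _
  prod-LogDeriv {p} g d z h (suc n) = mul-LogDeriv {prodPF p n} {p n} (prod-Good {p} g d n) (g n) (prod-Disjoint {p} {p n} n (λ i l → d i n l))
    (Loc-prod {p = p} z n) (z n) (prod-LogDeriv {p} g d z h n) (h n)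

  U′-pos : ∀ x → 1 ℕ.≤ x → U′ (+ x) ≈ X x * (W x * W x)
  U′-pos x l = trans (-‿cong (*-congˡ (U-minus x l))) (solve 2 (λ x w → :- (w :* (:- (x :* w))) := x :* (w :* w)) refl _ _)

  U′-neg : ∀ x → 1 ℕ.≤ x → U′ (ℤ.- + x) ≈ X x * (W x * W x)
  U′-neg x l = trans (-‿cong (*-cong (U-minus x l) (reflexive (≡.cong U (ℤP.neg-involutive (+ x))))))
    (solve 2 (λ x w → :- ((:- (x :* w)) :* w) := x :* (w :* w)) refl _ _)

  pt⁺-LogDeriv : ∀ x → 1 ℕ.≤ x → LogDeriv (pt⁺ (+ x)) (X x * W x)
  pt⁺-LogDeriv x l = trans (trans (*-congʳ (W-cong (ℕP.+-identityʳ x))) (solve 2 (λ x w → w :* (x :* w) := :1 :* (x :* (w :* w)) :+ :0) refl _ _))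
    (+-congʳ (*-congˡ (sym (U′-pos x l))))

  pt⁻-LogDeriv : ∀ x → 1 ℕ.≤ x → LogDeriv (pt⁻ (ℤ.- + x)) (- (X x * W x))
  pt⁻-LogDeriv x l = trans (trans (*-congʳ (reflexive (≡.cong U (ZS.solve 1 (λ z → ZS.:- (ZS.:- z ZS.:+ ZS.con (+ 0)) ZS.:= z) ≡.refl (+ x)))))
      (solve 2 (λ x w → w :* (:- (x :* w)) := (:- :1) :* (x :* (w :* w)) :+ :0) refl _ _))
    (+-congʳ (*-congˡ (sym (U′-neg x l))))

  rhoN : ℕ → ℕ → Carrier
  rhoN a N = Σ< N (λ n → X (a ℕ.+ 9 ℕ.* n) * W (a ℕ.+ 9 ℕ.* n))

  rhoN-≈ : ∀ a → 1 ℕ.≤ a → ∀ M → rhoN a (M ℕ.+ M) ≈[ M ] rho a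
  rhoN-≈ a l M = Σ∞-≈ (λ k → X*-small _ (ℕP.≤-trans (ℕP.n≤1+n k) (≤-index 9 a k (s≤s z≤n) l))) M (M ℕ.+ M) (ℕP.m≤m+n M M)

  Bi-LogDeriv : ∀ {a b} → 1 ℕ.≤ a → 1 ℕ.≤ b → ∀ N → LogDeriv (Bi a b N) (rhoN a N - rhoN b N)
  Bi-LogDeriv {suc a} {suc b} (s≤s _) (s≤s _) N = mul-LogDeriv {famP (suc a) N} {famN (suc b) N} (famP-Good (suc a) N) (famN-Good (suc b) N)
    (Disjoint-classes {P = famP (suc a) N} {famN (suc b) N} (famP-Positive a N) (famN-Negative b N) (λ { e f (m , ≡.refl) (n , ≡.refl) () }))
    (Loc-map {P = famP (suc a) N} (λ { e (n , ≡.refl) () }) (famP-Positive a N))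
    (Loc-map {P = famN (suc b) N} (λ { e (n , ≡.refl) () }) (famN-Negative b N))
    (prod-LogDeriv {λ n → pt⁺ (+ (suc a ℕ.+ 9 ℕ.* n))} (λ n → pt⁺-Good _) (λ i j l → (famP-distinct (suc a) i j l ∷ []) ∷ []) (λ i → (λ ()) ∷ [])
      (λ i → pt⁺-LogDeriv (suc a ℕ.+ 9 ℕ.* i) (s≤s z≤n)) N)
    (trans (*-congˡ (sym (Σ-neg N _))) (prod-LogDeriv {λ n → pt⁻ (ℤ.- + (suc b ℕ.+ 9 ℕ.* n))} (λ n → pt⁻-Good _)
      (λ i j l → ((λ e → famP-distinct (suc b) i j l (ℤP.neg-injective e)) ∷ []) ∷ []) (λ i → (λ ()) ∷ [])
      (λ i → pt⁻-LogDeriv (suc b ℕ.+ 9 ℕ.* i) (s≤s z≤n)) N))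

  Pr-join : ∀ s n N → Pr 9 s n * W (s ℕ.+ 9 ℕ.* n) * Pr 9 (9 ℕ.+ s ℕ.+ 9 ℕ.* n) N ≈ Pr 9 s (suc n ℕ.+ N)
  Pr-join s n N = trans (*-congˡ (reflexive (≡.cong (λ z → Pr 9 z N)
    (NS.solve 2 (λ s n → NS.con 9 NS.:+ s NS.:+ NS.con 9 NS.:* n NS.:= s NS.:+ NS.con 9 NS.:* (NS.con 1 NS.:+ n)) ≡.refl s n)))) (sym (Pr-split s (suc n) N))

  Pr-front : ∀ s k → W s * Pr 9 (9 ℕ.+ s) k ≈ Pr 9 s (suc k)
  Pr-front s k = sym (trans (Π-front k _) (*-cong (W-cong (ℕP.+-identityʳ s)) (Π-cong k (λ j → W-cong
    (NS.solve 2 (λ s j → s NS.:+ NS.con 9 NS.:* (NS.con 1 NS.:+ j) NS.:= NS.con 9 NS.:+ s NS.:+ NS.con 9 NS.:* j) ≡.refl s j)))))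

  -- The class of 0 seen from the other classes; the factor W supplies the missing point 0.
  H-zero : ∀ {a b} → Res a b → ∀ N n → n ℕ.< N → H 9 9 N (a ℕ.+ 9 ℕ.* n) * W (a ℕ.+ 9 ℕ.* n)
    ≈ sgn a n * (Pr 9 b (suc (N ℕ.∸ suc n)) * Pr 9 a (suc n ℕ.+ N))
  H-zero {suc s} {b} r N n l = begin
    _ ≈⟨ *-congʳ (*-cong (row 9 a s (9 ℕ.+ b) N n l (ℕP.+-comm a 9) (≡.trans (ℕP.+-assoc 9 b a) (≡.cong (9 ℕ.+_) (≡.trans (ℕP.+-comm b a) (sum r)))))
           (column 9 a (9 ℕ.+ a) N n ≡.refl)) ⟩
    _ ≈⟨ *-congʳ (*-congʳ (*-congˡ (*-congʳ (U-pos a 9 b (≡.sym (sum r)))))) ⟩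
    _ ≈⟨ solve 6 (λ m p w q c v → (((m :* p) :* (w :* q)) :* c) :* v := m :* ((w :* q) :* (p :* v :* c))) refl _ _ _ _ _ _ ⟩
    _ ≈⟨ *-congˡ (*-cong (Pr-front b (N ℕ.∸ suc n)) (Pr-join a n N)) ⟩
    _ ∎
    where
    open R≈
    a = suc s

  -- The other classes seen from the class of 0.
  H-nine : ∀ {a b} → Res a b → ∀ N n → n ℕ.< N → H a b N (9 ℕ.+ 9 ℕ.* n)
    ≈ sgn b (suc n) * (Pr 9 a (N ℕ.∸ suc n) * Pr 9 b (suc n ℕ.+ N))
  H-nine {a} {suc b} r N n l = begin
    _ ≈⟨ *-cong (row a 9 (b ℕ.+ 9) a N n l (≡.trans (NS.solve 2 (λ a b → NS.con 1 NS.:+ (b NS.:+ NS.con 9) NS.:+ a NS.:= (a NS.:+ (NS.con 1 NS.:+ b)) NS.:+ NS.con 9) ≡.refl a b) (≡.cong (ℕ._+ 9) (sum r))) (ℕP.+-comm a 9))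
           (column (suc b) 9 (9 ℕ.+ suc b) N n (ℕP.+-comm (suc b) 9)) ⟩
    _ ≈⟨ *-congʳ (*-congˡ (*-congʳ (U-below 9 a b (≡.sym (sum r))))) ⟩
    _ ≈⟨ solve 6 (λ m p x w q c → ((m :* p) :* ((:- (x :* w)) :* q)) :* c := ((:- x) :* m) :* (q :* ((w :* p) :* c))) refl _ _ _ _ _ _ ⟩
    _ ≈⟨ *-cong (sym (sgn-front (suc b) n)) (*-congˡ (*-congʳ (trans (*-congˡ (reflexive (≡.cong (λ z → Pr 9 (suc z) n) (ℕP.+-comm b 9)))) (trans (*-congˡ (reflexive (≡.cong (λ z → Pr 9 z n) (≡.sym (ℕP.+-suc 9 b))))) (Pr-front (suc b) n))))) ⟩
    _ ≈⟨ *-congˡ (*-congˡ (Pr-join (suc b) n N)) ⟩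
    _ ∎
    where open R≈

  term-D : ∀ {a₁ b₁ a₂ b₂ a₃ b₃} → Res a₁ b₁ → Res a₂ b₂ → Res a₃ b₃ → ∀ M →
    Σ< (M ℕ.+ M) (λ n → own n (M ℕ.+ M) * (Π< (M ℕ.+ M) (λ k → W (b₁ ℕ.+ 9 ℕ.* k ℕ.+ (a₁ ℕ.+ 9 ℕ.* n)))
      * ((H 9 9 (M ℕ.+ M) (a₁ ℕ.+ 9 ℕ.* n) * (H a₂ b₂ (M ℕ.+ M) (a₁ ℕ.+ 9 ℕ.* n) * H a₃ b₃ (M ℕ.+ M) (a₁ ℕ.+ 9 ℕ.* n)))
         * (X (9 ℕ.* n) * (W (a₁ ℕ.+ 9 ℕ.* n) * W (a₁ ℕ.+ 9 ℕ.* n))))))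
    ≈[ M ] ((J⁻² * (theta⁻¹ b₁ a₁ * (cc a₂ b₂ a₁ b₁ * cc a₃ b₃ a₁ b₁))) * lam (9 ℕ.+ a₁ ℕ.+ (b₂ ℕ.+ a₁) ℕ.+ (b₃ ℕ.+ a₁) ℕ.+ 9) a₁)
  term-D {a₁} {b₁} {a₂} {b₂} {a₃} {b₃} r₁ r₂ r₃ M = series (expo (tot ℕ.+ 9))
    (λ N n → (Pr 9 9 (N ℕ.∸ suc n) * Pr 9 9 (n ℕ.+ N)) * ((Pr 9 b₁ (suc (N ℕ.∸ suc n)) * Pr 9 a₁ (suc n ℕ.+ N)) * (H-factor a₂ b₂ a₁ b₁ N n * H-factor a₃ b₃ a₁ b₁ N n)))
    _ a₁ (n≤E _ (s≤s z≤n))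
    (λ M N n h → mod-* (mod-* (conv-∸ 9 M N n (s≤s z≤n) h) (conv-+ 9 M N n (s≤s z≤n) h))
      (mod-* (mod-* (conv-∸′ b₁ M N n (posʳ r₁) h) (conv-+′ a₁ M N n (posˡ r₁) h))
        (mod-* (H-factor-≈ a₂ b₂ a₁ b₁ M N n (posˡ r₂) (posʳ r₂) h) (H-factor-≈ a₃ b₃ a₁ b₁ M N n (posˡ r₃) (posʳ r₃) h))))
    M _ term
    where
    tot = 9 ℕ.+ a₁ ℕ.+ (b₂ ℕ.+ a₁) ℕ.+ (b₃ ℕ.+ a₁)
    N = M ℕ.+ M
    term : ∀ n → n ℕ.< N → _ ≈ _
    term n l = begin
      _ ≈⟨ *-congˡ (*-cong (column b₁ a₁ 9 N n (≡.trans (ℕP.+-comm b₁ a₁) (sum r₁)))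
             (*-congʳ (*-congˡ (*-cong (H-value a₂ b₂ a₁ b₁ N n l (sum r₂) (sum r₁) (posʳ r₂)) (H-value a₃ b₃ a₁ b₁ N n l (sum r₃) (sum r₁) (posʳ r₃)))))) ⟩
      _ ≈⟨ sym (*-assoc _ _ _) ⟩
      _ ≈⟨ *-cong (own-column n N) (solve 4 (λ h f x w → (h :* f) :* (x :* (w :* w)) := ((h :* w) :* f) :* (x :* w)) refl _ _ _ _) ⟩
      _ ≈⟨ *-congˡ (*-congʳ (*-congʳ (H-zero r₁ N n l))) ⟩
      _ ≈⟨ solve 10 (λ m₀ p m₁ v₁ m₂ v₂ m₃ v₃ x w → (m₀ :* p) :* (((m₁ :* v₁) :* ((m₂ :* v₂) :* (m₃ :* v₃))) :* (x :* w))
             := ((m₀ :* (m₁ :* (m₂ :* m₃))) :* x) :* ((p :* (v₁ :* (v₂ :* v₃))) :* w)) refl _ _ _ _ _ _ _ _ _ _ ⟩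
      _ ≈⟨ *-congʳ (trans (*-congʳ (sgn-4 9 a₁ (b₂ ℕ.+ a₁) (b₃ ℕ.+ a₁) n)) (trans (sym (X-+ _ _)) (X-cong (≡.sym (expo-shift tot 9 n))))) ⟩
      _ ∎
      where open R≈

  term-D₀ : ∀ {a₁ b₁ a₂ b₂ a₃ b₃} → Res a₁ b₁ → Res a₂ b₂ → Res a₃ b₃ → ∀ M →
    Σ< (M ℕ.+ M) (λ n → own n (M ℕ.+ M) * (Π< (M ℕ.+ M) (λ k → W (9 ℕ.+ 9 ℕ.* k ℕ.+ (9 ℕ.+ 9 ℕ.* n)))
      * ((H a₁ b₁ (M ℕ.+ M) (9 ℕ.+ 9 ℕ.* n) * (H a₂ b₂ (M ℕ.+ M) (9 ℕ.+ 9 ℕ.* n) * H a₃ b₃ (M ℕ.+ M) (9 ℕ.+ 9 ℕ.* n)))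
         * (X (9 ℕ.+ 9 ℕ.* n) * (W (9 ℕ.+ 9 ℕ.* n) * W (9 ℕ.+ 9 ℕ.* n))))))
    ≈[ M ] (- (X (9 ℕ.+ b₁ ℕ.+ b₂ ℕ.+ b₃) * ((J⁻² * (theta⁻¹ a₁ b₁ * (theta⁻¹ a₂ b₂ * theta⁻¹ a₃ b₃))) * lam (9 ℕ.+ b₁ ℕ.+ b₂ ℕ.+ b₃ ℕ.+ 36) 9)))
  term-D₀ {a₁} {b₁} {a₂} {b₂} {a₃} {b₃} r₁ r₂ r₃ M = mod-trans (fine (trans (Σ-cong< N term) (trans (Σ-neg N _) (-‿cong (Σ-*ˡ N (X tot) _)))))
    (mod-neg (mod-* (fine refl) (series (expo (tot ℕ.+ 36)) F _ 9 (n≤E _ (s≤s z≤n)) conv M _ (λ _ _ → refl))))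
    where
    tot = 9 ℕ.+ b₁ ℕ.+ b₂ ℕ.+ b₃
    N = M ℕ.+ M
    G : ℕ → ℕ → ℕ → ℕ → Carrier
    G a b N n = Pr 9 a (N ℕ.∸ suc n) * Pr 9 b (suc n ℕ.+ N)
    F : ℕ → ℕ → Carrier
    F N n = G 9 9 N n * (G a₁ b₁ N n * (G a₂ b₂ N n * G a₃ b₃ N n))
    convG : ∀ {a b} → 1 ℕ.≤ a → 1 ℕ.≤ b → ∀ M N n → n ℕ.+ M ℕ.< N → G a b N n ≈[ M ] theta⁻¹ a b
    convG la lb M N n h = mod-* (conv-∸ _ M N n la h) (conv-+′ _ M N n lb h)
    conv : ∀ M N n → n ℕ.+ M ℕ.< N → F N n ≈[ M ] (J⁻² * (theta⁻¹ a₁ b₁ * (theta⁻¹ a₂ b₂ * theta⁻¹ a₃ b₃)))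
    conv M N n h = mod-* (convG {9} {9} (s≤s z≤n) (s≤s z≤n) M N n h) (mod-* (convG (posˡ r₁) (posʳ r₁) M N n h) (mod-* (convG (posˡ r₂) (posʳ r₂) M N n h) (convG (posˡ r₃) (posʳ r₃) M N n h)))
    term : ∀ n → n ℕ.< N → _ ≈ - (X tot * (X (expo (tot ℕ.+ 36) n) * (F N n * W (9 ℕ.+ 9 ℕ.* n))))
    term n l = begin
      _ ≈⟨ *-congˡ (*-cong (column 9 9 18 N n ≡.refl) (*-congʳ (*-cong (H-nine r₁ N n l) (*-cong (H-nine r₂ N n l) (H-nine r₃ N n l))))) ⟩
      _ ≈⟨ solve 12 (λ m p q c m₁ v₁ m₂ v₂ m₃ v₃ x w → (m :* (p :* q)) :* (c :* (((m₁ :* v₁) :* ((m₂ :* v₂) :* (m₃ :* v₃))) :* (x :* (w :* w))))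
             := :- (((m :* (:- x)) :* (m₁ :* (m₂ :* m₃))) :* (((q :* (p :* w :* c)) :* (v₁ :* (v₂ :* v₃))) :* w))) refl _ _ _ _ _ _ _ _ _ _ _ _ ⟩
      _ ≈⟨ -‿cong (*-cong (trans (sgn-4 9 b₁ b₂ b₃ (suc n)) (trans (X-cong (expo-front tot n)) (X-+ tot _))) (*-congʳ (*-congʳ (*-congˡ (Pr-join 9 n N))))) ⟩
      _ ≈⟨ -‿cong (*-assoc _ _ _) ⟩
      _ ∎
      where open R≈

  block-D : ∀ {a₁ b₁ a₂ b₂ a₃ b₃} → Res a₁ b₁ → Res a₂ b₂ → Res a₃ b₃ → Carrier
  block-D {a₁} {b₁} {a₂} {b₂} {a₃} {b₃} _ _ _ =
    X a₁ * ((J⁻² * (theta⁻¹ b₁ a₁ * (cc a₂ b₂ a₁ b₁ * cc a₃ b₃ a₁ b₁))) * lam (9 ℕ.+ a₁ ℕ.+ (b₂ ℕ.+ a₁) ℕ.+ (b₃ ℕ.+ a₁) ℕ.+ 9) a₁)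
    - X b₁ * ((J⁻² * (theta⁻¹ a₁ b₁ * (cc b₂ a₂ b₁ a₁ * cc b₃ a₃ b₁ a₁))) * lam (9 ℕ.+ b₁ ℕ.+ (a₂ ℕ.+ b₁) ℕ.+ (a₃ ℕ.+ b₁) ℕ.+ 9) b₁)

  block-D₀ : ∀ {a₁ b₁ a₂ b₂ a₃ b₃} → Res a₁ b₁ → Res a₂ b₂ → Res a₃ b₃ → Carrier
  block-D₀ {a₁} {b₁} {a₂} {b₂} {a₃} {b₃} _ _ _ =
    - (X (9 ℕ.+ b₁ ℕ.+ b₂ ℕ.+ b₃) * ((J⁻² * (theta⁻¹ a₁ b₁ * (theta⁻¹ a₂ b₂ * theta⁻¹ a₃ b₃))) * lam (9 ℕ.+ b₁ ℕ.+ b₂ ℕ.+ b₃ ℕ.+ 36) 9))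
    - - (X (9 ℕ.+ a₁ ℕ.+ a₂ ℕ.+ a₃) * ((J⁻² * (theta⁻¹ b₁ a₁ * (theta⁻¹ b₂ a₂ * theta⁻¹ b₃ a₃))) * lam (9 ℕ.+ a₁ ℕ.+ a₂ ℕ.+ a₃ ℕ.+ 36) 9))

  wsum-D : ∀ {a₁ b₁ a₂ b₂ a₃ b₃} (r₁ : Res a₁ b₁) (r₂ : Res a₂ b₂) (r₃ : Res a₃ b₃) → ∀ M →
    wsum (Bi a₁ b₁ (M ℕ.+ M)) (λ e → (fn (Bi 9 9 (M ℕ.+ M)) (ℤ.- e) * (fn (Bi a₂ b₂ (M ℕ.+ M)) (ℤ.- e) * fn (Bi a₃ b₃ (M ℕ.+ M)) (ℤ.- e))) * U′ e)
    ≈[ M ] block-D r₁ r₂ r₃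
  wsum-D {a₁} {b₁} {a₂} {b₂} {a₃} {b₃} r₁ r₂ r₃ M = mod-trans (fine (wsum-Bi a₁ b₁ N _)) (mod-+ pos (mod-neg neg))
    where
    N = M ℕ.+ M
    pull : ∀ o c h x y w → o * (c * (h * ((x * y) * w))) ≈ x * (o * (c * (h * (y * w))))
    pull = solve 6 (λ o c h x y w → o :* (c :* (h :* ((x :* y) :* w))) := x :* (o :* (c :* (h :* (y :* w))))) refl
    pos : _ ≈[ M ] _
    pos = mod-trans (fine (trans (Σ-cong N (λ n → trans (*-congˡ (*-congˡ (*-cong (*-cong (fnB⁺ 9 9 N _) (*-cong (fnB⁺ a₂ b₂ N _) (fnB⁺ a₃ b₃ N _)))
        (trans (U′-pos (a₁ ℕ.+ 9 ℕ.* n) (ℕP.≤-trans (posˡ r₁) (ℕP.m≤m+n a₁ _))) (*-congʳ (X-+ a₁ (9 ℕ.* n)))))))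
        (pull _ _ _ _ _ _))) (Σ-*ˡ N (X a₁) _)))
      (mod-* (fine refl) (term-D r₁ r₂ r₃ M))
    neg : _ ≈[ M ] _
    neg = mod-trans (fine (trans (Σ-cong N (λ k → trans (*-congˡ (*-congˡ (*-cong (*-cong (fnB⁻ 9 9 N _) (*-cong (fnB⁻ a₂ b₂ N _) (fnB⁻ a₃ b₃ N _)))
        (trans (U′-neg (b₁ ℕ.+ 9 ℕ.* k) (ℕP.≤-trans (posʳ r₁) (ℕP.m≤m+n b₁ _))) (*-congʳ (X-+ b₁ (9 ℕ.* k)))))))
        (pull _ _ _ _ _ _))) (Σ-*ˡ N (X b₁) _)))
      (mod-* (fine refl) (term-D (swap r₁) (swap r₂) (swap r₃) M))

  wsum-D₀ : ∀ {a₁ b₁ a₂ b₂ a₃ b₃} (r₁ : Res a₁ b₁) (r₂ : Res a₂ b₂) (r₃ : Res a₃ b₃) → ∀ M →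
    wsum (Bi 9 9 (M ℕ.+ M)) (λ e → (fn (Bi a₁ b₁ (M ℕ.+ M)) (ℤ.- e) * (fn (Bi a₂ b₂ (M ℕ.+ M)) (ℤ.- e) * fn (Bi a₃ b₃ (M ℕ.+ M)) (ℤ.- e))) * U′ e)
    ≈[ M ] block-D₀ r₁ r₂ r₃
  wsum-D₀ {a₁} {b₁} {a₂} {b₂} {a₃} {b₃} r₁ r₂ r₃ M = mod-trans (fine (wsum-Bi 9 9 N _)) (mod-+
    (mod-trans (fine (Σ-cong N (λ n → *-congˡ (*-congˡ (*-cong (*-cong (fnB⁺ a₁ b₁ N _) (*-cong (fnB⁺ a₂ b₂ N _) (fnB⁺ a₃ b₃ N _)))
      (U′-pos (9 ℕ.+ 9 ℕ.* n) (s≤s z≤n))))))) (term-D₀ r₁ r₂ r₃ M))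
    (mod-neg (mod-trans (fine (Σ-cong N (λ n → *-congˡ (*-congˡ (*-cong (*-cong (fnB⁻ a₁ b₁ N _) (*-cong (fnB⁻ a₂ b₂ N _) (fnB⁻ a₃ b₃ N _)))
      (U′-neg (9 ℕ.+ 9 ℕ.* n) (s≤s z≤n))))))) (term-D₀ (swap r₁) (swap r₂) (swap r₃) M))))
    where
    N = M ℕ.+ M

  -- The constant term at x = 1 of the partial fraction expansion of 1/([x][x q^a₁][x q^a₂][x q^a₃]).
  degenerate-expansion : ∀ {a₁ b₁ a₂ b₂ a₃ b₃} (r₁ : Res a₁ b₁) (r₂ : Res a₂ b₂) (r₃ : Res a₃ b₃) →
    Apart 9 a₁ → Apart 9 a₂ → Apart 9 a₃ → Apart a₁ a₂ → Apart a₁ a₃ → Apart a₂ a₃ →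
    J⁻² * theta⁻¹ a₁ b₁ * theta⁻¹ a₂ b₂ * theta⁻¹ a₃ b₃ * ((rho a₁ - rho b₁) + (rho a₂ - rho b₂) + (rho a₃ - rho b₃))
    ≈ block-D₀ r₁ r₂ r₃ + block-D r₁ r₂ r₃ + block-D r₂ r₁ r₃ + block-D r₃ r₁ r₂
  degenerate-expansion {a₁} {b₁} {a₂} {b₂} {a₃} {b₃} r₁ r₂ r₃ d₀₁ d₀₂ d₀₃ d₁₂ d₁₃ d₂₃ = separated go
    where
    go : ∀ M → _ ≈[ M ] _
    go M = mod-trans (mod-sym (mod-* (mod-* (mod-* (mod-* (Pr²-≈ {9} {9} (s≤s z≤n) (s≤s z≤n) M) (pr r₁)) (pr r₂)) (pr r₃))
        (mod-+ (mod-+ (rh r₁) (rh r₂)) (rh r₃))))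
      (mod-trans (fine (trans (sym (*-cong (*-cong (*-cong (*-cong (fnB⁰ 9 9 N) (fnB⁰ a₁ b₁ N)) (fnB⁰ a₂ b₂ N)) (fnB⁰ a₃ b₃ N))
          (solve 4 (λ z a b c → ((z :- z) :+ a) :+ b :+ c := a :+ b :+ c) refl (rhoN 9 N) _ _ _)))
          (trans T-LogDeriv (wsum-4 B₀ B₁ B₂ B₃ U′))))
        (mod-+ (mod-+ (mod-+ (wsum-D₀ r₁ r₂ r₃ M) (wsum-D r₁ r₂ r₃ M)) (wsum-D r₂ r₁ r₃ M)) (wsum-D r₃ r₁ r₂ M)))
      where
      N = M ℕ.+ M
      pr : ∀ {a b} → Res a b → (Pr 9 a N * Pr 9 b N) ≈[ M ] theta⁻¹ a b
      pr r = Pr²-≈ (posˡ r) (posʳ r) M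
      rh : ∀ {a b} → Res a b → (rhoN a N - rhoN b N) ≈[ M ] (rho a - rho b)
      rh r = mod-+ (rhoN-≈ _ (posˡ r) M) (mod-neg (rhoN-≈ _ (posʳ r) M))
      B₀ = Bi 9 9 N
      B₁ = Bi a₁ b₁ N
      B₂ = Bi a₂ b₂ N
      B₃ = Bi a₃ b₃ N
      dis : ∀ {a b a′ b′} → Res a b → Res a′ b′ → Apart a a′ → Disjoint (Bi a b N) (Bi a′ b′ N)
      dis {a} {b} {a′} {b′} r r′ = Bi-Disjoint a b 1 a′ b′ 1 N (sum r) (sum r′)
      dis₀ : ∀ {a′ b′} → Res a′ b′ → Apart 9 a′ → Disjoint (Bi 9 9 N) (Bi a′ b′ N)
      dis₀ {a′} {b′} r′ = Bi-Disjoint 9 9 2 a′ b′ 1 N ≡.refl (sum r′)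
      good : ∀ {a b} → Res a b → Good (Bi a b N)
      good r = Bi-Good′ (posˡ r) (posʳ r) N
      nz : ∀ {a b} → Res a b → Nonzero (Bi a b N)
      nz r = Bi-Nonzero′ (posˡ r) (posʳ r) N
      ld : ∀ {a b} → Res a b → LogDeriv (Bi a b N) (rhoN a N - rhoN b N)
      ld r = Bi-LogDeriv (posˡ r) (posʳ r) N
      B₀-Good = Bi-Good 8 8 N
      B₀-Nonzero = Bi-Nonzero 8 8 N
      G₂ : Good (mulPF B₀ B₁)
      G₂ = mul-Good {B₀} {B₁} B₀-Good (good r₁) (dis₀ r₁ d₀₁)
      Z₂ : Nonzero (mulPF B₀ B₁)
      Z₂ = Loc-mul {P = B₀} {B₁} B₀-Nonzero (nz r₁)
      D₂ : Disjoint (mulPF B₀ B₁) B₂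
      D₂ = mul-Disjoint {B₀} {B₁} {B₂} (dis₀ r₂ d₀₂) (dis r₁ r₂ d₁₂)
      T-LogDeriv : LogDeriv (mulPF (mulPF (mulPF B₀ B₁) B₂) B₃) ((((rhoN 9 N - rhoN 9 N) + (rhoN a₁ N - rhoN b₁ N)) + (rhoN a₂ N - rhoN b₂ N)) + (rhoN a₃ N - rhoN b₃ N))
      T-LogDeriv = mul-LogDeriv {mulPF (mulPF B₀ B₁) B₂} {B₃} (mul-Good {mulPF B₀ B₁} {B₂} G₂ (good r₂) D₂) (good r₃)
        (mul-Disjoint {mulPF B₀ B₁} {B₂} {B₃} (mul-Disjoint {B₀} {B₁} {B₃} (dis₀ r₃ d₀₃) (dis r₁ r₃ d₁₃)) (dis r₂ r₃ d₂₃))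
        (Loc-mul {P = mulPF B₀ B₁} {B₂} Z₂ (nz r₂)) (nz r₃)
        (mul-LogDeriv {mulPF B₀ B₁} {B₂} G₂ (good r₂) D₂ Z₂ (nz r₂)
          (mul-LogDeriv {B₀} {B₁} B₀-Good (good r₁) (dis₀ r₁ d₀₁) B₀-Nonzero (nz r₁) (Bi-LogDeriv {9} {9} (s≤s z≤n) (s≤s z≤n) N) (ld r₁)) (ld r₂)) (ld r₃)

  Po : ℕ → ℕ → ℕ → Carrier
  Po c s m = Π< m (λ j → 1# - X (s ℕ.+ c ℕ.* j))

  Po∞ : ℕ → ℕ → Carrier
  Po∞ c s = lim (Po c s)

  Po-≈ : ∀ c s → 1 ℕ.≤ c → 1 ℕ.≤ s → ∀ M m → M ℕ.≤ m → Po c s m ≈[ M ] Po∞ c s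
  Po-≈ c s lc ls = lim-≈ (Po c s) λ k → mod-trans (mod-* (fine refl) (mod-trans
    (mod-+ (fine refl) (mod-neg (X-small′ (ℕP.≤-trans (ℕP.n≤1+n k) (≤-index c s k lc ls))))) (fine (solve 0 (:1 :- :0 := :1) refl)))) (fine (*-identityʳ _))

  private
    -- The product over all integers d ≠ 0 in a window of length 2N, seen from the positions n and -1-k.
    window⁺ : ∀ (g : ℤ → Carrier) N n → n ℕ.< N →
      except (λ i → g (+ i ℤ.- + n)) N n * Π< N (λ k → g (-[1+ k ] ℤ.- + n))
      ≈ Π< (n ℕ.+ N) (λ j → g -[1+ j ]) * Π< (N ℕ.∸ suc n) (λ j → g (+ suc j))
    window⁺ g N n l = begin
      _ ≈⟨ *-cong (*-cong (trans (sym (Π-rev n _)) (Π-cong< n (λ j h → reflexive (≡.cong g (neg-⊖ n (n ℕ.∸ suc j) j (≡.trans (≡.sym (ℕP.m∸n+n≡m h)) ≡.refl))))))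
             (Π-cong (N ℕ.∸ suc n) (λ j → reflexive (≡.cong g (pos-⊖ n (suc n ℕ.+ j) (suc j) (≡.sym (ℕP.+-suc n j)))))))
             (Π-cong N (λ k → reflexive (≡.cong g (sumneg k)))) ⟩
      _ ≈⟨ solve 3 (λ a b c → (a :* b) :* c := (a :* c) :* b) refl _ _ _ ⟩
      _ ≈⟨ *-congʳ (sym (Π-split n N (λ j → g -[1+ j ]))) ⟩
      _ ∎
      where
      open R≈
      sumneg : ∀ k → -[1+ k ] ℤ.- + n ≡ -[1+ n ℕ.+ k ]
      sumneg k = ≡.trans (ZS.solve 2 (λ k n → (ZS.:- (ZS.con (+ 1) ZS.:+ k)) ZS.:- n ZS.:= ZS.:- (ZS.con (+ 1) ZS.:+ (n ZS.:+ k))) ≡.refl (+ k) (+ n)) ≡.refl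

    window⁻ : ∀ (g : ℤ → Carrier) N n → n ℕ.< N →
      except (λ i → g (-[1+ i ] ℤ.- -[1+ n ])) N n * Π< N (λ k → g (+ k ℤ.- -[1+ n ]))
      ≈ Π< (n ℕ.+ N) (λ j → g (+ suc j)) * Π< (N ℕ.∸ suc n) (λ j → g -[1+ j ])
    window⁻ g N n l = begin
      _ ≈⟨ *-cong (*-cong (Π-cong n (λ i → reflexive (≡.cong g (flip i n)))) (Π-cong (N ℕ.∸ suc n) (λ j → reflexive (≡.cong g (flip (suc n ℕ.+ j) n)))))
             (Π-cong N (λ k → reflexive (≡.cong g (sumpos k)))) ⟩
      _ ≈⟨ *-congʳ (*-cong (trans (sym (Π-rev n _)) (Π-cong< n (λ j h → reflexive (≡.cong g (pos-⊖ (n ℕ.∸ suc j) n (suc j) (≡.sym (ℕP.m∸n+n≡m h)))))))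
             (Π-cong (N ℕ.∸ suc n) (λ j → reflexive (≡.cong g (neg-⊖ (suc n ℕ.+ j) n j (≡.sym (ℕP.+-suc n j))))))) ⟩
      _ ≈⟨ solve 3 (λ a b c → (a :* b) :* c := (a :* c) :* b) refl _ _ _ ⟩
      _ ≈⟨ *-congʳ (sym (Π-split n N (λ j → g (+ suc j)))) ⟩
      _ ∎
      where
      open R≈
      flip : ∀ i n → -[1+ i ] ℤ.- -[1+ n ] ≡ + n ℤ.- + i
      flip i n = ZS.solve 2 (λ i n → (ZS.:- (ZS.con (+ 1) ZS.:+ i)) ZS.:- (ZS.:- (ZS.con (+ 1) ZS.:+ n)) ZS.:= n ZS.:- i) ≡.refl (+ i) (+ n)
      sumpos : ∀ k → + k ℤ.- -[1+ n ] ≡ + suc (n ℕ.+ k)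
      sumpos k = ZS.solve 2 (λ k n → k ZS.:- (ZS.:- (ZS.con (+ 1) ZS.:+ n)) ZS.:= ZS.con (+ 1) ZS.:+ (n ZS.:+ k)) ≡.refl (+ k) (+ n)

  -- The regularised bilateral sum of 1/(1 - q^(z + 9m)) over m, with value s.
  record Lattice (z : ℤ) (s : Carrier) : Set where
    field
      regular : ℤ.∣ z ∣ ℕ.% 9 ≢ 0
      small⁺  : ∀ n → U (+ 9 ℤ.* + n ℤ.+ z) ≈[ n ] 1#
      small⁻  : ∀ n → U (+ 9 ℤ.* -[1+ n ] ℤ.+ z) ≈[ n ] 0#
      total   : ∀ M → (Σ< (M ℕ.+ M) (λ n → U (+ 9 ℤ.* + n ℤ.+ z) - 1#) + Σ< (M ℕ.+ M) (λ n → U (+ 9 ℤ.* -[1+ n ] ℤ.+ z))) ≈[ M ] s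
  open Lattice public

  module Quotient (x y c x′ y′ c′ : ℕ) (cxy : x ℕ.+ y ≡ c) (rx : Res x x′) (ry : Res y y′) (rc : Res c c′) where

    A : Carrier
    A = ((1# - X x) * (1# - X y)) * W c

    -- (1 - q^(z+x))(1 - q^(z+y)) / ((1 - q^z)(1 - q^(z+x+y))); it tends to 1 at both ends, so no normalisation is needed.
    β : ℤ → Carrier
    β z = 1# + A * (U z - U (+ c ℤ.+ z))

    W-inv′ : ∀ e → 1 ℕ.≤ e → (1# - X e) * W e ≈ 1#
    W-inv′ (suc e) _ = W-inv e

    private
      ratio : ∀ xx xy xe we wc wec → (1# - xx * xy) * wc ≈ 1# → (1# - xe) * we ≈ 1# → (1# - xe * (xx * xy)) * wec ≈ 1# →
        1# + (((1# - xx) * (1# - xy)) * wc) * (we - wec) ≈ ((1# - xe * xx) * (1# - xe * xy)) * (we * wec)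
      ratio xx xy xe we wc wec hc he hec = begin
        _ ≈⟨ solve 6 (λ x y e w c d → :1 :+ (((:1 :- x) :* (:1 :- y)) :* c) :* (w :- d)
               := :1 :* :1 :+ (((:1 :- x) :* (:1 :- y)) :* c) :* (w :* :1 :- d :* :1)) refl xx xy xe we wc wec ⟩
        _ ≈⟨ +-cong (*-cong (sym he) (sym hec)) (*-congˡ (+-cong (*-congˡ (sym hec)) (-‿cong (*-congˡ (sym he))))) ⟩
        _ ≈⟨ solve 6 (λ x y e w c d → ((:1 :- e) :* w) :* ((:1 :- e :* (x :* y)) :* d) :+ (((:1 :- x) :* (:1 :- y)) :* c) :* (w :* ((:1 :- e :* (x :* y)) :* d) :- d :* ((:1 :- e) :* w))
               := (w :* d) :* ((:1 :- e) :* (:1 :- e :* (x :* y)) :+ (((:1 :- x) :* (:1 :- y)) :* e) :* ((:1 :- x :* y) :* c))) refl xx xy xe we wc wec ⟩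
        _ ≈⟨ *-congˡ (+-congˡ (*-congˡ hc)) ⟩
        _ ≈⟨ solve 6 (λ x y e w c d → (w :* d) :* ((:1 :- e) :* (:1 :- e :* (x :* y)) :+ (((:1 :- x) :* (:1 :- y)) :* e) :* :1)
               := ((:1 :- e :* x) :* (:1 :- e :* y)) :* (w :* d)) refl xx xy xe we wc wec ⟩
        _ ∎
        where open R≈

    A-inv : (1# - X x * X y) * W c ≈ 1#
    A-inv = trans (*-congʳ (+-congˡ (-‿cong (trans (sym (X-+ x y)) (X-cong cxy))))) (W-inv′ c (posˡ rc))

    value : ∀ e → 1 ℕ.≤ e → 1# + A * (W e - W (e ℕ.+ c)) ≈ ((1# - X (e ℕ.+ x)) * (1# - X (e ℕ.+ y))) * (W e * W (e ℕ.+ c))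
    value e l = trans (ratio (X x) (X y) (X e) (W e) (W c) (W (e ℕ.+ c)) A-inv (W-inv′ e l)
        (trans (*-congʳ (+-congˡ (-‿cong (trans (*-congˡ (trans (sym (X-+ x y)) (X-cong cxy))) (sym (X-+ e c)))))) (W-inv′ (e ℕ.+ c) (ℕP.≤-trans l (ℕP.m≤m+n e c)))))
      (*-congʳ (sym (*-cong (+-congˡ (-‿cong (X-+ e x))) (+-congˡ (-‿cong (X-+ e y))))))

    β-pos : ∀ e → 1 ℕ.≤ e → β (+ e) ≈ ((1# - X (e ℕ.+ x)) * (1# - X (e ℕ.+ y))) * (W e * W (e ℕ.+ c))
    β-pos e l = trans (+-congˡ (*-congˡ (+-congˡ (-‿cong (W-cong (ℕP.+-comm c e)))))) (value e l)

    β-neg : ∀ e → 1 ℕ.≤ e → β (ℤ.- + (e ℕ.+ c)) ≈ ((1# - X (e ℕ.+ x)) * (1# - X (e ℕ.+ y))) * (W e * W (e ℕ.+ c))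
    β-neg (suc e) l = trans (+-congˡ (*-congˡ (trans (+-congˡ (-‿cong (reflexive (≡.cong U (ZS.solve 2 (λ c e → c ZS.:+ ZS.:- (e ZS.:+ c) ZS.:= ZS.:- e) ≡.refl (+ c) (+ suc e))))))
        (solve 2 (λ a b → (:1 :- a) :- (:1 :- b) := b :- a) refl _ _)))) (value (suc e) l)

    -- The value between the two poles of a factor, where e + f = x + y.
    β-mid : ∀ e f → 1 ℕ.≤ e → 1 ℕ.≤ f → e ℕ.+ f ≡ c → β (ℤ.- + e) ≈ (W e * W f) * (X x + X y - X e - X f)
    β-mid e f le lf h = begin
      _ ≈⟨ +-congˡ (*-congˡ (+-cong (U-minus e le) (-‿cong (reflexive (≡.cong U (≡.trans (≡.cong (λ z → + z ℤ.- + e) (≡.sym h)) (pos-⊖ e (e ℕ.+ f) f ≡.refl))))))) ⟩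
      _ ≈⟨ solve 6 (λ x y c xe we wf → :1 :+ (((:1 :- x) :* (:1 :- y)) :* c) :* (:- (xe :* we) :- wf)
             := :1 :* :1 :+ (((:1 :- x) :* (:1 :- y)) :* c) :* (:- (xe :* (we :* :1)) :- wf :* :1)) refl (X x) (X y) (W c) (X e) (W e) (W f) ⟩
      _ ≈⟨ +-cong (*-cong (sym he) (sym hf)) (*-congˡ (+-cong (-‿cong (*-congˡ (*-congˡ (sym hf)))) (-‿cong (*-congˡ (sym he))))) ⟩
      _ ≈⟨ solve 7 (λ x y c xe we xf wf → ((:1 :- xe) :* we) :* ((:1 :- xf) :* wf) :+ (((:1 :- x) :* (:1 :- y)) :* c) :* (:- (xe :* (we :* ((:1 :- xf) :* wf))) :- wf :* ((:1 :- xe) :* we))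
             := (we :* wf) :* ((:1 :- xe) :* (:1 :- xf) :- ((:1 :- x) :* (:1 :- y)) :* ((:1 :- xe :* xf) :* c))) refl (X x) (X y) (W c) (X e) (W e) (X f) (W f) ⟩
      _ ≈⟨ *-congˡ (+-congˡ (-‿cong (*-congˡ (trans (*-congʳ (+-congˡ (-‿cong (trans (sym (X-+ e f)) (X-cong h))))) (W-inv′ c (posˡ rc)))))) ⟩
      _ ≈⟨ solve 6 (λ x y xe we xf wf → (we :* wf) :* ((:1 :- xe) :* (:1 :- xf) :- ((:1 :- x) :* (:1 :- y)) :* :1)
             := (we :* wf) :* (x :+ y :- xe :- xf :+ (xe :* xf :- x :* y))) refl (X x) (X y) (X e) (W e) (X f) (W f) ⟩
      _ ≈⟨ *-congˡ (trans (+-congˡ (trans (+-congˡ (-‿cong (trans (sym (X-+ x y)) (X-cong (≡.trans cxy (≡.sym h)))))) (trans (+-congʳ (sym (X-+ e f))) (-‿inverseʳ _)))) (+-identityʳ _)) ⟩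
      _ ∎
      where
      open R≈
      he = W-inv′ e le
      hf = W-inv′ f lf

    β-zero : β (ℤ.- + x) ≈ 0#
    β-zero = trans (β-mid x y (posˡ rx) (posˡ ry) cxy) (solve 3 (λ w a b → w :* (a :+ b :- a :- b) := :0) refl _ _ _)

    D D′ : ℕ → Carrier
    D j = ((1# - X (9 ℕ.+ x ℕ.+ 9 ℕ.* j)) * (1# - X (9 ℕ.+ y ℕ.+ 9 ℕ.* j))) * (W (9 ℕ.+ 9 ℕ.* j) * W (9 ℕ.+ c ℕ.+ 9 ℕ.* j))
    D′ j = ((1# - X (y′ ℕ.+ 9 ℕ.* j)) * (1# - X (x′ ℕ.+ 9 ℕ.* j))) * (W (c′ ℕ.+ 9 ℕ.* j) * W (9 ℕ.+ 9 ℕ.* j))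

    private
      c′x : c′ ℕ.+ x ≡ y′
      c′x = ℕP.+-cancelʳ-≡ y _ _ (≡.trans (ℕP.+-assoc c′ x y) (≡.trans (≡.cong (c′ ℕ.+_) cxy) (≡.trans (ℕP.+-comm c′ c) (≡.trans (sum rc) (≡.trans (≡.sym (sum ry)) (ℕP.+-comm y y′))))))
      c′y : c′ ℕ.+ y ≡ x′
      c′y = ℕP.+-cancelʳ-≡ x _ _ (≡.trans (NS.solve 3 (λ c x y → c NS.:+ y NS.:+ x NS.:= c NS.:+ (x NS.:+ y)) ≡.refl c′ x y) (≡.trans (≡.cong (c′ ℕ.+_) cxy) (≡.trans (ℕP.+-comm c′ c) (≡.trans (sum rc) (≡.trans (≡.sym (sum rx)) (ℕP.+-comm x x′))))))

      move : ∀ a b j → a ℕ.+ 9 ℕ.* j ℕ.+ b ≡ a ℕ.+ b ℕ.+ 9 ℕ.* j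
      move = NS.solve 3 (λ a b j → a NS.:+ NS.con 9 NS.:* j NS.:+ b NS.:= a NS.:+ b NS.:+ NS.con 9 NS.:* j) ≡.refl

      one-X : ∀ {a b} → a ≡ b → 1# - X a ≈ 1# - X b
      one-X e = +-congˡ (-‿cong (X-cong e))

      D-val : ∀ j → ((1# - X (9 ℕ.+ 9 ℕ.* j ℕ.+ x)) * (1# - X (9 ℕ.+ 9 ℕ.* j ℕ.+ y))) * (W (9 ℕ.+ 9 ℕ.* j) * W (9 ℕ.+ 9 ℕ.* j ℕ.+ c)) ≈ D j
      D-val j = *-cong (*-cong (one-X (move 9 x j)) (one-X (move 9 y j))) (*-congˡ (W-cong (move 9 c j)))

      c′+c : ∀ j → c′ ℕ.+ 9 ℕ.* j ℕ.+ c ≡ 9 ℕ.+ 9 ℕ.* j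
      c′+c j = ≡.trans (move c′ c j) (≡.cong (ℕ._+ 9 ℕ.* j) (≡.trans (ℕP.+-comm c′ c) (sum rc)))

      D′-val : ∀ j → ((1# - X (c′ ℕ.+ 9 ℕ.* j ℕ.+ x)) * (1# - X (c′ ℕ.+ 9 ℕ.* j ℕ.+ y))) * (W (c′ ℕ.+ 9 ℕ.* j) * W (c′ ℕ.+ 9 ℕ.* j ℕ.+ c)) ≈ D′ j
      D′-val j = *-cong (*-cong (one-X (≡.trans (move c′ x j) (≡.cong (ℕ._+ 9 ℕ.* j) c′x))) (one-X (≡.trans (move c′ y j) (≡.cong (ℕ._+ 9 ℕ.* j) c′y))))
        (*-congˡ (W-cong (c′+c j)))

      β≡ : ∀ {z w} → z ≡ w → β z ≈ β w
      β≡ e = reflexive (≡.cong β e)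

      nine-suc : ∀ j → + 9 ℤ.* + suc j ≡ + (9 ℕ.+ 9 ℕ.* j)
      nine-suc j = ≡.trans (≡.sym (ℤP.pos-* 9 (suc j))) (≡.cong +_ (ℕP.*-suc 9 j))

      nine-neg : ∀ j → + 9 ℤ.* -[1+ j ] ≡ ℤ.- + (9 ℕ.+ 9 ℕ.* j)
      nine-neg j = ≡.trans (≡.sym (ℤP.neg-distribʳ-* (+ 9) (+ suc j))) (≡.cong ℤ.-_ (nine-suc j))

      pos-D : ∀ j → β (+ 9 ℤ.* + suc j) ≈ D j
      pos-D j = trans (β≡ (nine-suc j)) (trans (β-pos (9 ℕ.+ 9 ℕ.* j) (s≤s z≤n)) (D-val j))

      neg-D′ : ∀ j → β (+ 9 ℤ.* -[1+ j ]) ≈ D′ j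
      neg-D′ j = trans (β≡ (≡.trans (nine-neg j) (≡.cong (λ z → ℤ.- + z) (≡.sym (c′+c j)))))
        (trans (β-neg (c′ ℕ.+ 9 ℕ.* j) (ℕP.≤-trans (posʳ rc) (ℕP.m≤m+n c′ _))) (D′-val j))

      pos-D′ : ∀ j → β (+ 9 ℤ.* + suc j ℤ.- + c) ≈ D′ j
      pos-D′ j = trans (β≡ (≡.trans (≡.cong (λ z → z ℤ.- + c) (nine-suc j)) (pos-⊖ c (9 ℕ.+ 9 ℕ.* j) (c′ ℕ.+ 9 ℕ.* j) (≡.trans (≡.sym (c′+c j)) (ℕP.+-comm _ c)))))
        (trans (β-pos (c′ ℕ.+ 9 ℕ.* j) (ℕP.≤-trans (posʳ rc) (ℕP.m≤m+n c′ _))) (D′-val j))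

      neg-D : ∀ j → β (+ 9 ℤ.* -[1+ j ] ℤ.- + c) ≈ D j
      neg-D j = trans (β≡ (≡.trans (≡.cong (λ z → z ℤ.- + c) (nine-neg j)) (≡.sym (ℤP.neg-distrib-+ (+ (9 ℕ.+ 9 ℕ.* j)) (+ c)))))
        (trans (β-neg (9 ℕ.+ 9 ℕ.* j) (s≤s z≤n)) (D-val j))

    bm : ℤ → PF
    bm m = block A (+ 9 ℤ.* m) (+ c ℤ.+ + 9 ℤ.* m)

    private
      nc : Apart 0 c
      nc = λ e → lem (posˡ rc) (ℕP.m<m+n c (posʳ rc)) e
        where
        lem : 1 ℕ.≤ c → c ℕ.< c ℕ.+ c′ → ℤ.∣ + 0 ℤ.- + c ∣ ℕ.% 9 ≢ 0
        lem l h e = ℕP.<⇒≢ l (≡.sym (≡.trans (≡.sym (ℕD.m<n⇒m%n≡m (≡.subst (c ℕ.<_) (sum rc) h)))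
          (≡.trans (≡.cong (ℕ._% 9) (≡.sym (≡.trans (≡.cong ℤ.∣_∣ (ℤP.+-identityˡ (ℤ.- + c))) (ℤP.∣-i∣≡∣i∣ (+ c))))) e)))

      class₀ : ∀ m → Class 0 (+ 9 ℤ.* m)
      class₀ m = m , ≡.sym (ℤP.+-identityˡ _)

      bm-Disjoint : ∀ m m′ → m ≢ m′ → Disjoint (bm m) (bm m′)
      bm-Disjoint m m′ ne = (same ∷ apart {0} {c} nc _ _ (class₀ m) (m′ , ≡.refl) ∷ [])
        ∷ ((λ e → apart {0} {c} nc _ _ (class₀ m′) (m , ≡.refl) (≡.sym e)) ∷ (λ e → same (cancel-+ (+ c) _ _ e)) ∷ []) ∷ []
        where
        same : + 9 ℤ.* m ≢ + 9 ℤ.* m′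
        same e = ne (ℤP.*-cancelˡ-≡ (+ 9) m m′ e)

    pN nN : ℕ → PF
    pN = prodPF (λ n → bm (+ n))
    nN = prodPF (λ k → bm -[1+ k ])

    private
      pN-Good : ∀ N → Good (pN N)
      pN-Good = prod-Good {λ n → bm (+ n)} (λ n → block-Good _ _ _) (λ i j l → bm-Disjoint (+ i) (+ j) (λ e → ℕP.<⇒≢ l (ℤP.+-injective e)))

      nN-Good : ∀ N → Good (nN N)
      nN-Good = prod-Good {λ n → bm -[1+ n ]} (λ n → block-Good _ _ _) (λ i j l → bm-Disjoint -[1+ i ] -[1+ j ] (λ e → ℕP.<⇒≢ l (ℤP.-[1+-injective e)))

      pn-Disjoint : ∀ N N′ → Disjoint (pN N) (nN N′)
      pn-Disjoint N N′ = prod-Disjoint {λ n → bm (+ n)} {nN N′} N (λ i _ → flip′ (bm (+ i)) (nN N′)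
          (prod-Disjoint {λ n → bm -[1+ n ]} {bm (+ i)} N′ (λ j _ → bm-Disjoint -[1+ j ] (+ i) (λ ()))))
        where
        flip′ : ∀ P Q → Disjoint Q P → Disjoint P Q
        flip′ P Q d = All.tabulate λ i → All.tabulate λ j eq → All.lookup (All.lookup d j) i (≡.sym eq)

      const-prod : ∀ (g : ℕ → ℤ) N → const (prodPF (λ n → bm (g n)) N) ≈ 1#
      const-prod g zero = refl
      const-prod g (suc N) = trans (*-identityʳ _) (const-prod g N)

      fn-pole₀ : ∀ m m′ → fn (bm m) (ℤ.- (+ 9 ℤ.* m′)) ≈ β (+ 9 ℤ.* (m ℤ.- m′))
      fn-pole₀ m m′ = +-congˡ (*-congˡ (+-cong (reflexive (≡.cong U (ZS.solve 2 (λ m m′ → ZS.con (+ 9) ZS.:* m ZS.:+ ZS.:- (ZS.con (+ 9) ZS.:* m′) ZS.:= ZS.con (+ 9) ZS.:* (m ZS.:- m′)) ≡.refl m m′)))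
        (-‿cong (reflexive (≡.cong U (ZS.solve 3 (λ c m m′ → c ZS.:+ ZS.con (+ 9) ZS.:* m ZS.:+ ZS.:- (ZS.con (+ 9) ZS.:* m′) ZS.:= c ZS.:+ ZS.con (+ 9) ZS.:* (m ZS.:- m′)) ≡.refl (+ c) m m′))))))

      fn-poleᶜ : ∀ m m′ → fn (bm m) (ℤ.- (+ c ℤ.+ + 9 ℤ.* m′)) ≈ β (+ 9 ℤ.* (m ℤ.- m′) ℤ.- + c)
      fn-poleᶜ m m′ = +-congˡ (*-congˡ (+-cong (reflexive (≡.cong U (ZS.solve 3 (λ c m m′ → ZS.con (+ 9) ZS.:* m ZS.:+ ZS.:- (c ZS.:+ ZS.con (+ 9) ZS.:* m′) ZS.:= ZS.con (+ 9) ZS.:* (m ZS.:- m′) ZS.:- c) ≡.refl (+ c) m m′)))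
        (-‿cong (reflexive (≡.cong U (ZS.solve 3 (λ c m m′ → c ZS.:+ ZS.con (+ 9) ZS.:* m ZS.:+ ZS.:- (c ZS.:+ ZS.con (+ 9) ZS.:* m′) ZS.:= c ZS.:+ (ZS.con (+ 9) ZS.:* (m ZS.:- m′) ZS.:- c)) ≡.refl (+ c) m m′))))))

      PD PD′ : ℕ → Carrier
      PD m = Π< m D
      PD′ m = Π< m D′

      except-cong : ∀ {f g} N n → (∀ i → f i ≈ g i) → except f N n ≈ except g N n
      except-cong N n h = *-cong (Π-cong n h) (Π-cong (N ℕ.∸ suc n) (λ j → h _))

      coef₀⁺ : ∀ N n → n ℕ.< N → except (λ i → fn (bm (+ i)) (ℤ.- (+ 9 ℤ.* + n))) N n * fn (nN N) (ℤ.- (+ 9 ℤ.* + n)) ≈ PD′ (n ℕ.+ N) * PD (N ℕ.∸ suc n)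
      coef₀⁺ N n l = trans (*-cong (except-cong N n (λ i → fn-pole₀ (+ i) (+ n))) (trans (fn-prod _ N _) (Π-cong N (λ k → fn-pole₀ -[1+ k ] (+ n)))))
        (trans (window⁺ (λ d → β (+ 9 ℤ.* d)) N n l) (*-cong (Π-cong (n ℕ.+ N) neg-D′) (Π-cong (N ℕ.∸ suc n) pos-D)))

      coefᶜ⁺ : ∀ N n → n ℕ.< N → except (λ i → fn (bm (+ i)) (ℤ.- (+ c ℤ.+ + 9 ℤ.* + n))) N n * fn (nN N) (ℤ.- (+ c ℤ.+ + 9 ℤ.* + n)) ≈ PD (n ℕ.+ N) * PD′ (N ℕ.∸ suc n)
      coefᶜ⁺ N n l = trans (*-cong (except-cong N n (λ i → fn-poleᶜ (+ i) (+ n))) (trans (fn-prod _ N _) (Π-cong N (λ k → fn-poleᶜ -[1+ k ] (+ n)))))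
        (trans (window⁺ (λ d → β (+ 9 ℤ.* d ℤ.- + c)) N n l) (*-cong (Π-cong (n ℕ.+ N) neg-D) (Π-cong (N ℕ.∸ suc n) pos-D′)))

      coef₀⁻ : ∀ N n → n ℕ.< N → except (λ i → fn (bm -[1+ i ]) (ℤ.- (+ 9 ℤ.* -[1+ n ]))) N n * fn (pN N) (ℤ.- (+ 9 ℤ.* -[1+ n ])) ≈ PD (n ℕ.+ N) * PD′ (N ℕ.∸ suc n)
      coef₀⁻ N n l = trans (*-cong (except-cong N n (λ i → fn-pole₀ -[1+ i ] -[1+ n ])) (trans (fn-prod _ N _) (Π-cong N (λ k → fn-pole₀ (+ k) -[1+ n ]))))
        (trans (window⁻ (λ d → β (+ 9 ℤ.* d)) N n l) (*-cong (Π-cong (n ℕ.+ N) pos-D) (Π-cong (N ℕ.∸ suc n) neg-D′)))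

      coefᶜ⁻ : ∀ N n → n ℕ.< N → except (λ i → fn (bm -[1+ i ]) (ℤ.- (+ c ℤ.+ + 9 ℤ.* -[1+ n ]))) N n * fn (pN N) (ℤ.- (+ c ℤ.+ + 9 ℤ.* -[1+ n ])) ≈ PD′ (n ℕ.+ N) * PD (N ℕ.∸ suc n)
      coefᶜ⁻ N n l = trans (*-cong (except-cong N n (λ i → fn-poleᶜ -[1+ i ] -[1+ n ])) (trans (fn-prod _ N _) (Π-cong N (λ k → fn-poleᶜ (+ k) -[1+ n ]))))
        (trans (window⁻ (λ d → β (+ 9 ℤ.* d ℤ.- + c)) N n l) (*-cong (Π-cong (n ℕ.+ N) pos-D′) (Π-cong (N ℕ.∸ suc n) neg-D)))

    R : Carrier
    R = ((Po∞ 9 x * Po∞ 9 x′) * (Po∞ 9 y * Po∞ 9 y′)) * (theta⁻¹ c c′ * J⁻²)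

    private
      Po-front : ∀ s k → (1# - X s) * Po 9 (9 ℕ.+ s) k ≈ Po 9 s (suc k)
      Po-front s k = sym (trans (Π-front k _) (*-cong (one-X (ℕP.+-identityʳ s)) (Π-cong k (λ j → one-X
        (NS.solve 2 (λ s j → s NS.:+ NS.con 9 NS.:* (NS.con 1 NS.:+ j) NS.:= NS.con 9 NS.:+ s NS.:+ NS.con 9 NS.:* j) ≡.refl s j)))))

      A*PD : ∀ m → A * PD m ≈ (Po 9 x (suc m) * Po 9 y (suc m)) * (Pr 9 9 m * Pr 9 c (suc m))
      A*PD m = trans (*-congˡ (trans (Π-* m _ _) (*-cong (Π-* m _ _) (Π-* m _ _))))
        (trans (solve 7 (λ x y c p q r s → ((x :* y) :* c) :* ((p :* q) :* (r :* s)) := ((x :* p) :* (y :* q)) :* (r :* (c :* s))) refl _ _ _ _ _ _ _)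
          (*-cong (*-cong (Po-front x m) (Po-front y m)) (*-congˡ (Pr-front c m))))

      PD′-≡ : ∀ m → PD′ m ≈ (Po 9 y′ m * Po 9 x′ m) * (Pr 9 c′ m * Pr 9 9 m)
      PD′-≡ m = trans (Π-* m _ _) (*-cong (Π-* m _ _) (Π-* m _ _))

      A*PD-≈ : ∀ M m → M ℕ.≤ m → (A * PD m) ≈[ M ] ((Po∞ 9 x * Po∞ 9 y) * (Pr∞ 9 9 * Pr∞ 9 c))
      A*PD-≈ M m l = mod-trans (fine (A*PD m)) (mod-* (mod-* (Po-≈ 9 x (s≤s z≤n) (posˡ rx) M _ (ℕP.m≤n⇒m≤1+n l)) (Po-≈ 9 y (s≤s z≤n) (posˡ ry) M _ (ℕP.m≤n⇒m≤1+n l)))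
        (mod-* (Pr-≈ 9 9 (s≤s z≤n) (s≤s z≤n) M _ l) (Pr-≈ 9 c (s≤s z≤n) (posˡ rc) M _ (ℕP.m≤n⇒m≤1+n l))))

      PD′-≈ : ∀ M m → M ℕ.≤ m → PD′ m ≈[ M ] ((Po∞ 9 y′ * Po∞ 9 x′) * (Pr∞ 9 c′ * Pr∞ 9 9))
      PD′-≈ M m l = mod-trans (fine (PD′-≡ m)) (mod-* (mod-* (Po-≈ 9 y′ (s≤s z≤n) (posʳ ry) M _ l) (Po-≈ 9 x′ (s≤s z≤n) (posʳ rx) M _ l))
        (mod-* (Pr-≈ 9 c′ (s≤s z≤n) (posʳ rc) M _ l) (Pr-≈ 9 9 (s≤s z≤n) (s≤s z≤n) M _ l)))

      coef-≈ : ∀ M m m′ → M ℕ.≤ m → M ℕ.≤ m′ → (A * (PD m * PD′ m′)) ≈[ M ] R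
      coef-≈ M m m′ l l′ = mod-trans (fine (sym (*-assoc _ _ _))) (mod-trans (mod-* (A*PD-≈ M m l) (PD′-≈ M m′ l′))
        (fine (solve 7 (λ a b n c d e f → ((a :* b) :* (n :* c)) :* ((d :* e) :* (f :* n)) := ((a :* e) :* (b :* d)) :* ((c :* f) :* (n :* n))) refl _ _ _ _ _ _ _)))

      ≤+ : ∀ M N n → n ℕ.+ M ℕ.< N → M ℕ.≤ n ℕ.+ N
      ≤+ M N n h = ℕP.≤-trans (ℕP.m≤n+m M (suc n)) (ℕP.≤-trans h (ℕP.m≤n+m N n))

      small-zero : ∀ {f g} → f ≈[ 0 ] g
      small-zero {f} {g} = mod-trans (to0 f) (mod-sym (to0 g))
        where
        to0 : ∀ f → f ≈[ 0 ] 0#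
        to0 f = mod-trans (fine (sym (trans (*-congʳ X-zero) (*-identityˡ f)))) (*-small f (X-small 0))

      tannery : ∀ (F : ℕ → ℕ → Carrier) C (φ : ℕ → Carrier) → (∀ M N n → n ℕ.+ M ℕ.< N → F N n ≈[ M ] C) → (∀ n → φ n ≈[ n ] 0#) → ∀ M →
        Σ< (M ℕ.+ M) (λ n → F (M ℕ.+ M) n * φ n) ≈[ M ] (C * Σ< (M ℕ.+ M) φ)
      tannery F C φ hF hφ M = mod-trans (Σ-cong-mod (M ℕ.+ M) term) (fine (Σ-*ˡ (M ℕ.+ M) C φ))
        where
        term : ∀ n → n ℕ.< M ℕ.+ M → (F (M ℕ.+ M) n * φ n) ≈[ M ] (C * φ n)
        term n _ with ℕP.<-≤-connex n M
        ... | inj₁ l = mod-* (hF M (M ℕ.+ M) n (ℕP.+-monoˡ-< M l)) (fine refl)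
        ... | inj₂ l = mod-trans (kill _) (mod-sym (kill _))
          where
          kill : ∀ u → (u * φ n) ≈[ M ] 0#
          kill u = mod-trans (fine (*-comm _ _)) (*-small u (mod-mono l (hφ n)))

      wsum-block : ∀ m (ψ : ℤ → Carrier) → wsum (bm m) ψ ≈ A * ψ (+ 9 ℤ.* m) - A * ψ (+ c ℤ.+ + 9 ℤ.* m)
      wsum-block m ψ = solve 3 (λ a f g → a :* f :+ ((:- a) :* g :+ :0) := a :* f :- a :* g) refl A (ψ (+ 9 ℤ.* m)) (ψ (+ c ℤ.+ + 9 ℤ.* m))

      group : ∀ p q f pq → p * q ≈ pq → A * (p * (q * f)) ≈ (A * pq) * f
      group p q f pq h = trans (*-congˡ (sym (*-assoc p q f))) (trans (sym (*-assoc A (p * q) f)) (*-congʳ (*-congˡ h)))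

      wsum⁺ : ∀ N (φ : ℤ → Carrier) → wsum (pN N) (λ e → fn (nN N) (ℤ.- e) * φ e) ≈
        Σ< N (λ n → (A * (PD (N ℕ.∸ suc n) * PD′ (n ℕ.+ N))) * φ (+ 9 ℤ.* + n)) - Σ< N (λ n → (A * (PD (n ℕ.+ N) * PD′ (N ℕ.∸ suc n))) * φ (+ c ℤ.+ + 9 ℤ.* + n))
      wsum⁺ N φ = trans (wsum-prodPF (λ n → bm (+ n)) N (λ e → fn (nN N) (ℤ.- e) * φ e)) (trans (trans (Σ-cong< N (λ n l →
          trans (wsum-block (+ n) (λ e → except (λ k → fn (bm (+ k)) (ℤ.- e)) N n * (fn (nN N) (ℤ.- e) * φ e)))
          (+-cong (group _ _ (φ (+ 9 ℤ.* + n)) _ (trans (coef₀⁺ N n l) (*-comm _ _))) (-‿cong (group _ _ (φ (+ c ℤ.+ + 9 ℤ.* + n)) _ (coefᶜ⁺ N n l)))))) (Σ-+ N _ _))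
        (+-congˡ (Σ-neg N _)))

      wsum⁻ : ∀ N (φ : ℤ → Carrier) → wsum (nN N) (λ e → fn (pN N) (ℤ.- e) * φ e) ≈
        Σ< N (λ n → (A * (PD (n ℕ.+ N) * PD′ (N ℕ.∸ suc n))) * φ (+ 9 ℤ.* -[1+ n ])) - Σ< N (λ n → (A * (PD (N ℕ.∸ suc n) * PD′ (n ℕ.+ N))) * φ (+ c ℤ.+ + 9 ℤ.* -[1+ n ]))
      wsum⁻ N φ = trans (wsum-prodPF (λ n → bm -[1+ n ]) N (λ e → fn (pN N) (ℤ.- e) * φ e)) (trans (trans (Σ-cong< N (λ n l →
          trans (wsum-block -[1+ n ] (λ e → except (λ k → fn (bm -[1+ k ]) (ℤ.- e)) N n * (fn (pN N) (ℤ.- e) * φ e)))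
          (+-cong (group _ _ (φ (+ 9 ℤ.* -[1+ n ])) _ (coef₀⁻ N n l)) (-‿cong (group _ _ (φ (+ c ℤ.+ + 9 ℤ.* -[1+ n ])) _ (trans (coefᶜ⁻ N n l) (*-comm _ _))))))) (Σ-+ N _ _))
        (+-congˡ (Σ-neg N _)))

      wsum-diff : ∀ P φ ψ → wsum P (λ e → φ e - ψ e) ≈ wsum P φ - wsum P ψ
      wsum-diff P φ ψ = trans (sumL-cong′ (poles P) (λ p → solve 3 (λ r a b → r :* (a :- b) := r :* a :+ (:- :1) :* (r :* b)) refl (proj₁ p) (φ (proj₂ p)) (ψ (proj₂ p))))
        (trans (sumL-+ (poles P) _ _) (+-congˡ (trans (sumL-*ˡ (poles P) _ _) (solve 1 (λ x → (:- :1) :* x := :- x) refl _))))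

    private
      reg : ∀ {z s} → Lattice z s → ∀ m → + 9 ℤ.* m ℤ.+ z ≢ 0ℤ
      reg {z} L m e = regular L (≡.trans (≡.cong (λ w → ℤ.∣ w ∣ ℕ.% 9) z≡)
        (≡.trans (≡.cong (ℕ._% 9) (≡.trans (ℤP.abs-* (+ 9) (ℤ.- m)) (ℕP.*-comm 9 ℤ.∣ ℤ.- m ∣))) (ℕD.m*n%n≡0 ℤ.∣ ℤ.- m ∣ 9)))
        where
        z≡ : z ≡ + 9 ℤ.* ℤ.- m
        z≡ = ≡.trans (ZS.solve 2 (λ m z → z ZS.:= (ZS.con (+ 9) ZS.:* m ZS.:+ z) ZS.:+ ZS.con (+ 9) ZS.:* (ZS.:- m)) ≡.refl m z)
          (≡.trans (≡.cong (λ w → w ℤ.+ + 9 ℤ.* ℤ.- m) e) (ℤP.+-identityˡ _))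

      regc : ∀ {z s} → Lattice (+ c ℤ.+ z) s → ∀ m → (+ c ℤ.+ + 9 ℤ.* m) ℤ.+ z ≢ 0ℤ
      regc {z} L m e = reg L m (≡.trans (ZS.solve 3 (λ c m z → ZS.con (+ 9) ZS.:* m ZS.:+ (c ZS.:+ z) ZS.:= c ZS.:+ ZS.con (+ 9) ZS.:* m ZS.:+ z) ≡.refl (+ c) m z) e)

    -- [x τ][y τ]/([τ][x y τ]), as a product over a window.
    Win : ℕ → ℤ → Carrier
    Win N τ = Π< N (λ n → β (+ 9 ℤ.* + n ℤ.+ τ)) * Π< N (λ n → β (+ 9 ℤ.* -[1+ n ] ℤ.+ τ))

    private
      fn-Win : ∀ N τ → fn (mulPF (pN N) (nN N)) τ ≈ Win N τ
      fn-Win N τ = *-cong (trans (fn-prod _ N τ) (Π-cong N (λ n → shape (+ n)))) (trans (fn-prod _ N τ) (Π-cong N (λ n → shape -[1+ n ])))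
        where
        shape : ∀ m → fn (bm m) τ ≈ β (+ 9 ℤ.* m ℤ.+ τ)
        shape m = +-congˡ (*-congˡ (+-congˡ (-‿cong (reflexive (≡.cong U (ℤP.+-assoc (+ c) (+ 9 ℤ.* m) τ))))))

      Win-sound : ∀ N τ {s s′} → Lattice τ s → Lattice (+ c ℤ.+ τ) s′ → Win N τ ≈ 1# + wsum (mulPF (pN N) (nN N)) (λ e → U (e ℤ.+ τ))
      Win-sound N τ L L′ = trans (sym (fn-Win N τ)) (trans (mul-Good {pN N} {nN N} (pN-Good N) (nN-Good N) (pn-Disjoint N N) τ
          (Loc-mul {P = pN N} {nN N} (Loc-prod {p = λ n → bm (+ n)} (λ n → reg L (+ n) ∷ regc L′ (+ n) ∷ []) N)
            (Loc-prod {p = λ n → bm -[1+ n ]} (λ n → reg L -[1+ n ] ∷ regc L′ -[1+ n ] ∷ []) N)))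
        (+-congʳ (trans (*-cong (const-prod (λ n → + n) N) (const-prod (λ n → -[1+ n ]) N)) (*-identityˡ 1#))))

      Win-zero : ∀ N → Win (suc N) (ℤ.- + x) ≈ 0#
      Win-zero N = trans (*-congʳ (trans (Π-front N _) (trans (*-congʳ (trans (β≡ {+ 9 ℤ.* + 0 ℤ.+ ℤ.- + x} {ℤ.- + x} (ℤP.+-identityˡ (ℤ.- + x))) β-zero)) (zeroˡ _)))) (zeroˡ _)

    window-sum : ∀ τ {s₁ s₂ s₃ s₄} → Lattice τ s₁ → Lattice (ℤ.- + x) s₂ → Lattice (+ c ℤ.+ τ) s₃ → Lattice (+ c ℤ.+ ℤ.- + x) s₄ → ∀ M →
      Win (M ℕ.+ M) τ ≈[ M ] (R * ((s₁ - s₂) - (s₃ - s₄)))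
    window-sum τ L₁ L₂ L₃ L₄ zero = small-zero
    window-sum τ {s₁} {s₂} {s₃} {s₄} L₁ L₂ L₃ L₄ M@(suc m) = mod-trans (fine (trans
        (solve 2 (λ a z → a := a :- :0) refl _ 0#) (trans (+-cong (Win-sound N τ L₁ L₃) (-‿cong (trans (sym (Win-zero (m ℕ.+ suc m))) (Win-sound N (ℤ.- + x) L₂ L₄))))
        (trans (solve 2 (λ a b → (:1 :+ a) :- (:1 :+ b) := a :- b) refl _ _)
        (trans (sym (wsum-diff (mulPF (pN N) (nN N)) (λ e → U (e ℤ.+ τ)) (λ e → U (e ℤ.+ ℤ.- + x)))) (trans (wsum-mul (pN N) (nN N) φ) (+-cong (wsum⁺ N φ) (wsum⁻ N φ))))))))
      (mod-trans (mod-+ (mod-+ (tannery (λ N n → A * (PD (N ℕ.∸ suc n) * PD′ (n ℕ.+ N))) R (λ n → φ (+ 9 ℤ.* + n)) cA sm₀⁺ M)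
          (mod-neg (tannery (λ N n → A * (PD (n ℕ.+ N) * PD′ (N ℕ.∸ suc n))) R (λ n → φ (+ c ℤ.+ + 9 ℤ.* + n)) cB smᶜ⁺ M)))
        (mod-+ (tannery (λ N n → A * (PD (n ℕ.+ N) * PD′ (N ℕ.∸ suc n))) R (λ n → φ (+ 9 ℤ.* -[1+ n ])) cB sm₀⁻ M)
          (mod-neg (tannery (λ N n → A * (PD (N ℕ.∸ suc n) * PD′ (n ℕ.+ N))) R (λ n → φ (+ c ℤ.+ + 9 ℤ.* -[1+ n ])) cA smᶜ⁻ M))))
      (mod-trans (fine (trans (+-cong (+-cong (*-congˡ sum₀⁺) (-‿cong (*-congˡ sumᶜ⁺))) (+-cong (*-congˡ sum₀⁻) (-‿cong (*-congˡ sumᶜ⁻))))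
          (solve 9 (λ r a b c d e f g h → ((r :* (a :- b)) :- (r :* (c :- d))) :+ ((r :* (e :- f)) :- (r :* (g :- h)))
            := r :* (((a :+ e) :- (b :+ f)) :- ((c :+ g) :- (d :+ h)))) refl R _ _ _ _ _ _ _ _)))
        (mod-* (fine refl) (mod-+ (mod-+ (total L₁ M) (mod-neg (total L₂ M))) (mod-neg (mod-+ (total L₃ M) (mod-neg (total L₄ M))))))))
      where
      N = M ℕ.+ M
      φ : ℤ → Carrier
      φ e = U (e ℤ.+ τ) - U (e ℤ.+ ℤ.- + x)
      cA : ∀ M N n → n ℕ.+ M ℕ.< N → (A * (PD (N ℕ.∸ suc n) * PD′ (n ℕ.+ N))) ≈[ M ] R
      cA M N n h = coef-≈ M _ _ (≤-∸ M N n h) (≤+ M N n h)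
      cB : ∀ M N n → n ℕ.+ M ℕ.< N → (A * (PD (n ℕ.+ N) * PD′ (N ℕ.∸ suc n))) ≈[ M ] R
      cB M N n h = coef-≈ M _ _ (≤+ M N n h) (≤-∸ M N n h)
      swapc : ∀ m z → U ((+ c ℤ.+ + 9 ℤ.* m) ℤ.+ z) ≈ U (+ 9 ℤ.* m ℤ.+ (+ c ℤ.+ z))
      swapc m z = reflexive (≡.cong U (ZS.solve 3 (λ c m z → c ZS.:+ m ZS.:+ z ZS.:= m ZS.:+ (c ZS.:+ z)) ≡.refl (+ c) (+ 9 ℤ.* m) z))
      minus : ∀ {M f g h} → f ≈[ M ] h → g ≈[ M ] h → (f - g) ≈[ M ] 0#
      minus p q = mod-trans (mod-+ p (mod-neg q)) (fine (-‿inverseʳ _))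
      sm₀⁺ : ∀ n → φ (+ 9 ℤ.* + n) ≈[ n ] 0#
      sm₀⁺ n = minus (small⁺ L₁ n) (small⁺ L₂ n)
      sm₀⁻ : ∀ n → φ (+ 9 ℤ.* -[1+ n ]) ≈[ n ] 0#
      sm₀⁻ n = minus (small⁻ L₁ n) (small⁻ L₂ n)
      smᶜ⁺ : ∀ n → φ (+ c ℤ.+ + 9 ℤ.* + n) ≈[ n ] 0#
      smᶜ⁺ n = minus (mod-trans (fine (swapc (+ n) τ)) (small⁺ L₃ n)) (mod-trans (fine (swapc (+ n) (ℤ.- + x))) (small⁺ L₄ n))
      smᶜ⁻ : ∀ n → φ (+ c ℤ.+ + 9 ℤ.* -[1+ n ]) ≈[ n ] 0#
      smᶜ⁻ n = minus (mod-trans (fine (swapc -[1+ n ] τ)) (small⁻ L₃ n)) (mod-trans (fine (swapc -[1+ n ] (ℤ.- + x))) (small⁻ L₄ n))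
      split⁺ : ∀ (f g : ℕ → Carrier) → Σ< N (λ n → f n - g n) ≈ Σ< N (λ n → f n - 1#) - Σ< N (λ n → g n - 1#)
      split⁺ f g = trans (Σ-cong N (λ n → solve 2 (λ a b → a :- b := (a :- :1) :+ :- (b :- :1)) refl (f n) (g n))) (trans (Σ-+ N _ _) (+-congˡ (Σ-neg N _)))
      split⁻ : ∀ (f g : ℕ → Carrier) → Σ< N (λ n → f n - g n) ≈ Σ< N f - Σ< N g
      split⁻ f g = trans (Σ-+ N _ _) (+-congˡ (Σ-neg N _))
      sum₀⁺ = split⁺ (λ n → U (+ 9 ℤ.* + n ℤ.+ τ)) (λ n → U (+ 9 ℤ.* + n ℤ.+ ℤ.- + x))
      sum₀⁻ = split⁻ (λ n → U (+ 9 ℤ.* -[1+ n ] ℤ.+ τ)) (λ n → U (+ 9 ℤ.* -[1+ n ] ℤ.+ ℤ.- + x))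
      sumᶜ⁺ = trans (Σ-cong N (λ n → +-cong (swapc (+ n) τ) (-‿cong (swapc (+ n) (ℤ.- + x)))))
        (split⁺ (λ n → U (+ 9 ℤ.* + n ℤ.+ (+ c ℤ.+ τ))) (λ n → U (+ 9 ℤ.* + n ℤ.+ (+ c ℤ.+ ℤ.- + x))))
      sumᶜ⁻ = trans (Σ-cong N (λ n → +-cong (swapc -[1+ n ] τ) (-‿cong (swapc -[1+ n ] (ℤ.- + x)))))
        (split⁻ (λ n → U (+ 9 ℤ.* -[1+ n ] ℤ.+ (+ c ℤ.+ τ))) (λ n → U (+ 9 ℤ.* -[1+ n ] ℤ.+ (+ c ℤ.+ ℤ.- + x))))

  private
    shift-pos : ∀ n p → + 9 ℤ.* + n ℤ.+ + p ≡ + (p ℕ.+ 9 ℕ.* n)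
    shift-pos n p = ≡.trans (≡.cong (ℤ._+ + p) (≡.sym (ℤP.pos-* 9 n))) (≡.cong +_ (ℕP.+-comm (9 ℕ.* n) p))

    nine-neg : ∀ n → + 9 ℤ.* -[1+ n ] ≡ ℤ.- + (9 ℕ.+ 9 ℕ.* n)
    nine-neg n = ≡.trans (≡.sym (ℤP.neg-distribʳ-* (+ 9) (+ suc n))) (≡.cong ℤ.-_ (≡.trans (≡.sym (ℤP.pos-* 9 (suc n))) (≡.cong +_ (ℕP.*-suc 9 n))))

    shift-neg : ∀ n p p′ → p ℕ.+ p′ ≡ 9 → + 9 ℤ.* -[1+ n ] ℤ.+ + p ≡ ℤ.- + (p′ ℕ.+ 9 ℕ.* n)
    shift-neg n p p′ e = ≡.trans (≡.cong (ℤ._+ + p) (≡.trans (nine-neg n) (≡.cong (λ z → ℤ.- + (z ℕ.+ 9 ℕ.* n)) (≡.sym e))))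
      (ZS.solve 3 (λ a b c → (ZS.:- (a ZS.:+ b ZS.:+ c)) ZS.:+ a ZS.:= ZS.:- (b ZS.:+ c)) ≡.refl (+ p) (+ p′) (+ (9 ℕ.* n)))

    shift-suc : ∀ n f f′ → f ℕ.+ f′ ≡ 9 → + 9 ℤ.* + suc n ℤ.+ ℤ.- + f ≡ + (f′ ℕ.+ 9 ℕ.* n)
    shift-suc n f f′ e = ≡.trans (≡.cong (ℤ._+ ℤ.- + f) (≡.trans (≡.sym (ℤP.pos-* 9 (suc n))) (≡.cong +_ (≡.trans (ℕP.*-suc 9 n) (≡.cong (ℕ._+ 9 ℕ.* n) (≡.sym e))))))
      (ZS.solve 3 (λ a b c → (a ZS.:+ b ZS.:+ c) ZS.:+ ZS.:- a ZS.:= b ZS.:+ c) ≡.refl (+ f) (+ f′) (+ (9 ℕ.* n)))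

    shift-far : ∀ n f → + 9 ℤ.* -[1+ n ] ℤ.+ ℤ.- + f ≡ ℤ.- + (f ℕ.+ 9 ℕ.* suc n)
    shift-far n f = ≡.trans (≡.cong (ℤ._+ ℤ.- + f) (nine-neg n))
      (≡.trans (≡.sym (ℤP.neg-distrib-+ (+ (9 ℕ.+ 9 ℕ.* n)) (+ f))) (≡.cong (λ z → ℤ.- + z) (≡.trans (ℕP.+-comm _ f) (≡.cong (f ℕ.+_) (≡.sym (ℕP.*-suc 9 n))))))

    U≡ : ∀ {z w} → z ≡ w → U z ≈ U w
    U≡ e = reflexive (≡.cong U e)

    1≤ : ∀ p n → 1 ℕ.≤ p → 1 ℕ.≤ p ℕ.+ 9 ℕ.* n
    1≤ p n l = ℕP.≤-trans l (ℕP.m≤m+n p _)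

    n≤ : ∀ p n → 1 ℕ.≤ p → n ℕ.≤ p ℕ.+ 9 ℕ.* n
    n≤ p n l = ℕP.≤-trans (ℕP.n≤1+n n) (≤-index 9 p n (s≤s z≤n) l)

    minus-small : ∀ p M → 1 ℕ.≤ p → M ℕ.≤ p → U (ℤ.- + p) ≈[ M ] 0#
    minus-small p M l h = mod-trans (fine (U-minus p l)) (mod-trans (mod-neg (X*-small _ h)) (fine -0#≈0#))

    W-1 : ∀ e → 1 ℕ.≤ e → W e - 1# ≈ X e * W e
    W-1 (suc e) _ = trans (+-congʳ (W-unfold e)) (solve 1 (λ x → (:1 :+ x) :- :1 := x) refl _)

    mod9 : ∀ {p p′} → Res p p′ → p ℕ.% 9 ≢ 0
    mod9 {p} {p′} r e = ℕP.<⇒≢ (posˡ r) (≡.sym (≡.trans (≡.sym (ℕD.m<n⇒m%n≡m (≡.subst (p ℕ.<_) (sum r) (ℕP.m<m+n p (posʳ r))))) e))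

    rho-tail : ∀ f N → Σ< N (λ n → X (f ℕ.+ 9 ℕ.* suc n) * W (f ℕ.+ 9 ℕ.* suc n)) ≈ rhoN f (suc N) - X f * W f
    rho-tail f N = sym (trans (+-congʳ (trans (Σ-front N _) (+-congʳ (*-cong (X-cong (ℕP.+-identityʳ f)) (W-cong (ℕP.+-identityʳ f))))))
      (solve 2 (λ a b → (a :+ b) :- a := b) refl _ _))

    rhoN-≈′ : ∀ a → 1 ℕ.≤ a → ∀ M N → M ℕ.≤ N → rhoN a N ≈[ M ] rho a
    rhoN-≈′ a l M N h = Σ∞-≈ (λ k → X*-small _ (n≤ a k l)) M N h

  small-zero : ∀ {f g} → f ≈[ 0 ] g
  small-zero {f} {g} = mod-trans (to0 f) (mod-sym (to0 g))
    where
    to0 : ∀ f → f ≈[ 0 ] 0#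
    to0 f = mod-trans (fine (sym (trans (*-congʳ X-zero) (*-identityˡ f)))) (*-small f (X-small 0))

  lattice⁺ : ∀ {p p′} → Res p p′ → Lattice (+ p) (rho p - rho p′)
  lattice⁺ {p} {p′} r = record
    { regular = mod9 r
    ; small⁺ = λ n → mod-trans (fine (U≡ (shift-pos n p))) (W-one′ _ n (1≤ p n (posˡ r)) (n≤ p n (posˡ r)))
    ; small⁻ = λ n → mod-trans (fine (U≡ (shift-neg n p p′ (sum r)))) (minus-small _ n (1≤ p′ n (posʳ r)) (n≤ p′ n (posʳ r)))
    ; total = λ M → mod-+
        (mod-trans (fine (Σ-cong (M ℕ.+ M) (λ n → trans (+-congʳ (U≡ (shift-pos n p))) (W-1 _ (1≤ p n (posˡ r)))))) (rhoN-≈ p (posˡ r) M))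
        (mod-trans (fine (trans (Σ-cong (M ℕ.+ M) (λ n → trans (U≡ (shift-neg n p p′ (sum r))) (U-minus _ (1≤ p′ n (posʳ r))))) (Σ-neg (M ℕ.+ M) _)))
          (mod-neg (rhoN-≈ p′ (posʳ r) M))) }

  lattice⁻ : ∀ {f f′} → Res f f′ → Lattice (ℤ.- + f) (- 1# + rho f′ - rho f)
  lattice⁻ {f} {f′} r = record
    { regular = λ e → mod9 r (≡.trans (≡.cong (ℕ._% 9) (≡.sym (ℤP.∣-i∣≡∣i∣ (+ f)))) e)
    ; small⁺ = λ { zero → small-zero ; (suc n) → mod-trans (fine (U≡ (shift-suc n f f′ (sum r)))) (W-one′ _ (suc n) (1≤ f′ n (posʳ r)) (≤-index 9 f′ n (s≤s z≤n) (posʳ r))) }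
    ; small⁻ = λ n → mod-trans (fine (U≡ (shift-far n f))) (minus-small _ n (1≤ f (suc n) (posˡ r)) (ℕP.≤-trans (ℕP.n≤1+n n) (n≤ f (suc n) (posˡ r))))
    ; total = tot }
    where
    tot : ∀ M → _ ≈[ M ] (- 1# + rho f′ - rho f)
    tot zero = small-zero
    tot M@(suc m) = mod-trans (mod-+
        (mod-trans (fine (trans (Σ-front (m ℕ.+ suc m) _) (+-cong
            (trans (+-congʳ (trans (U≡ {+ 9 ℤ.* + 0 ℤ.+ ℤ.- + f} (ℤP.+-identityˡ (ℤ.- + f))) (U-minus f (posˡ r)))) refl)
            (Σ-cong (m ℕ.+ suc m) (λ n → trans (+-congʳ (U≡ (shift-suc n f f′ (sum r)))) (W-1 _ (1≤ f′ n (posʳ r))))))))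
          (mod-+ (fine refl) (rhoN-≈′ f′ (posʳ r) M _ (ℕP.m≤n+m M m))))
        (mod-trans (fine (trans (Σ-cong (M ℕ.+ M) (λ n → trans (U≡ (shift-far n f)) (U-minus _ (1≤ f (suc n) (posˡ r))))) (trans (Σ-neg (M ℕ.+ M) _) (-‿cong (rho-tail f (M ℕ.+ M))))))
          (mod-neg (mod-+ (rhoN-≈′ f (posˡ r) M _ (ℕP.m≤n⇒m≤1+n (ℕP.m≤m+n M M))) (fine refl)))))
      (fine (solve 3 (λ x a b → ((:- x :- :1) :+ a) :+ :- (b :- x) := :- :1 :+ a :- b) refl _ _ _))

  Po*Pr : ∀ s → 1 ℕ.≤ s → Po∞ 9 s * Pr∞ 9 s ≈ 1#
  Po*Pr s l = separated λ M → mod-trans (mod-sym (mod-* (Po-≈ 9 s (s≤s z≤n) l M M ℕP.≤-refl) (Pr-≈ 9 s (s≤s z≤n) l M M ℕP.≤-refl)))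
    (fine (trans (sym (Π-* M _ _)) (trans (Π-cong M (λ j → inv (s ℕ.+ 9 ℕ.* j) (1≤ s j l))) (Π-one M))))
    where
    inv : ∀ e → 1 ℕ.≤ e → (1# - X e) * W e ≈ 1#
    inv (suc e) _ = W-inv e

  Th : ℕ → ℕ → Carrier
  Th a b = Po∞ 9 a * Po∞ 9 b

  Th-inv : ∀ {a b} → Res a b → Th a b * theta⁻¹ a b ≈ 1#
  Th-inv r = trans (solve 4 (λ a b c d → (a :* b) :* (c :* d) := (a :* c) :* (b :* d)) refl _ _ _ _)
    (trans (*-cong (Po*Pr _ (posˡ r)) (Po*Pr _ (posʳ r))) (*-identityˡ 1#))

  Po∞-front : ∀ s → 1 ℕ.≤ s → (1# - X s) * Po∞ 9 (9 ℕ.+ s) ≈ Po∞ 9 s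
  Po∞-front s l = separated λ M → mod-trans (mod-* (fine refl) (mod-sym (Po-≈ 9 (9 ℕ.+ s) (s≤s z≤n) (s≤s z≤n) M M ℕP.≤-refl)))
    (mod-trans (fine (sym (trans (Π-front M _) (*-cong (+-congˡ (-‿cong (X-cong (ℕP.+-identityʳ s)))) (Π-cong M (λ j → +-congˡ (-‿cong (X-cong
        (NS.solve 2 (λ s j → s NS.:+ NS.con 9 NS.:* (NS.con 1 NS.:+ j) NS.:= NS.con 9 NS.:+ s NS.:+ NS.con 9 NS.:* j) ≡.refl s j)))))))))
      (Po-≈ 9 s (s≤s z≤n) l M (suc M) (ℕP.n≤1+n M)))

  Pr∞-front : ∀ s → 1 ℕ.≤ s → W s * Pr∞ 9 (9 ℕ.+ s) ≈ Pr∞ 9 s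
  Pr∞-front s l = separated λ M → mod-trans (mod-* (fine refl) (mod-sym (Pr-≈ 9 (9 ℕ.+ s) (s≤s z≤n) (s≤s z≤n) M M ℕP.≤-refl)))
    (mod-trans (fine (Pr-front s M)) (Pr-≈ 9 s (s≤s z≤n) l M (suc M) (ℕP.n≤1+n M)))

  module Tail (x y c x′ y′ c′ : ℕ) (cxy : x ℕ.+ y ≡ c) (rx : Res x x′) (ry : Res y y′) (rc : Res c c′) where
    open Quotient x y c x′ y′ c′ cxy rx ry rc public

    B : ℕ → Carrier
    B s = (Po∞ 9 (s ℕ.+ x) * Po∞ 9 (s ℕ.+ y)) * (Pr∞ 9 s * Pr∞ 9 (s ℕ.+ c))

    private
      move : ∀ a b j → a ℕ.+ 9 ℕ.* j ℕ.+ b ≡ a ℕ.+ b ℕ.+ 9 ℕ.* j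
      move = NS.solve 3 (λ a b j → a NS.:+ NS.con 9 NS.:* j NS.:+ b NS.:= a NS.:+ b NS.:+ NS.con 9 NS.:* j) ≡.refl

      fact : ℕ → ℕ → Carrier
      fact s j = ((1# - X (s ℕ.+ 9 ℕ.* j ℕ.+ x)) * (1# - X (s ℕ.+ 9 ℕ.* j ℕ.+ y))) * (W (s ℕ.+ 9 ℕ.* j) * W (s ℕ.+ 9 ℕ.* j ℕ.+ c))

      fact-≈ : ∀ s → 1 ℕ.≤ s → ∀ M N → M ℕ.≤ N → Π< N (fact s) ≈[ M ] B s
      fact-≈ s l M N h = mod-trans (fine (trans (Π-cong N (λ j → *-cong (*-cong (+-congˡ (-‿cong (X-cong (move s x j)))) (+-congˡ (-‿cong (X-cong (move s y j))))) (*-congˡ (W-cong (move s c j)))))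
          (trans (Π-* N _ _) (*-cong (Π-* N _ _) (Π-* N _ _)))))
        (mod-* (mod-* (Po-≈ 9 (s ℕ.+ x) (s≤s z≤n) (ℕP.≤-trans l (ℕP.m≤m+n s x)) M N h) (Po-≈ 9 (s ℕ.+ y) (s≤s z≤n) (ℕP.≤-trans l (ℕP.m≤m+n s y)) M N h))
          (mod-* (Pr-≈ 9 s (s≤s z≤n) l M N h) (Pr-≈ 9 (s ℕ.+ c) (s≤s z≤n) (ℕP.≤-trans l (ℕP.m≤m+n s c)) M N h)))

      β≡ : ∀ {z w} → z ≡ w → β z ≈ β w
      β≡ e = reflexive (≡.cong β e)

    Win-limit⁺ : ∀ {p p′} → Res p p′ → ∀ g → 1 ℕ.≤ g → g ℕ.+ c ≡ p′ → ∀ M → Win (M ℕ.+ M) (+ p) ≈[ M ] (B p * B g)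
    Win-limit⁺ {p} {p′} r g lg e M = mod-*
      (mod-trans (fine (Π-cong (M ℕ.+ M) (λ n → trans (β≡ (shift-pos n p)) (β-pos _ (1≤ p n (posˡ r)))))) (fact-≈ p (posˡ r) M _ (ℕP.m≤m+n M M)))
      (mod-trans (fine (Π-cong (M ℕ.+ M) (λ n → trans (β≡ (≡.trans (shift-neg n p p′ (sum r)) (≡.cong (λ z → ℤ.- + z) (≡.trans (≡.cong (ℕ._+ 9 ℕ.* n) (≡.sym e)) (≡.sym (move g c n))))))
        (β-neg _ (1≤ g n lg))))) (fact-≈ g lg M _ (ℕP.m≤m+n M M)))

    Win-limit⁻ : ∀ {f f′} → Res f f′ → ∀ g → 1 ℕ.≤ g → g ℕ.+ c ≡ 9 ℕ.+ f → ∀ M → Win (M ℕ.+ M) (ℤ.- + f) ≈[ M ] ((β (ℤ.- + f) * B f′) * B g)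
    Win-limit⁻ r g lg e zero = small-zero
    Win-limit⁻ {f} {f′} r g lg e M@(suc m) = mod-*
      (mod-trans (fine (trans (Π-front (m ℕ.+ suc m) _) (*-cong (β≡ {+ 9 ℤ.* + 0 ℤ.+ ℤ.- + f} (ℤP.+-identityˡ (ℤ.- + f)))
          (Π-cong (m ℕ.+ suc m) (λ n → trans (β≡ (shift-suc n f f′ (sum r))) (β-pos _ (1≤ f′ n (posʳ r))))))))
        (mod-* (fine refl) (fact-≈ f′ (posʳ r) M _ (ℕP.m≤n+m M m))))
      (mod-trans (fine (Π-cong (M ℕ.+ M) (λ n → trans (β≡ (≡.trans (shift-far n f) (≡.cong (λ z → ℤ.- + z) (≡.trans (≡.trans (≡.cong (f ℕ.+_) (ℕP.*-suc 9 n))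
          (NS.solve 2 (λ f n → f NS.:+ (NS.con 9 NS.:+ n) NS.:= NS.con 9 NS.:+ f NS.:+ n) ≡.refl f (9 ℕ.* n))) (≡.trans (≡.cong (ℕ._+ 9 ℕ.* n) (≡.sym e)) (≡.sym (move g c n)))))))
        (β-neg _ (1≤ g n lg))))) (fact-≈ g lg M _ (ℕP.m≤m+n M M)))

  r18 : Res 1 8
  r18 = res ≡.refl (s≤s z≤n) (s≤s z≤n)
  r27 : Res 2 7
  r27 = res ≡.refl (s≤s z≤n) (s≤s z≤n)
  r36 : Res 3 6
  r36 = res ≡.refl (s≤s z≤n) (s≤s z≤n)
  r45 : Res 4 5
  r45 = res ≡.refl (s≤s z≤n) (s≤s z≤n)

  u v d w iu iv id iw : Carrier
  u = Th 1 8
  v = Th 2 7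
  d = Th 3 6
  w = Th 4 5
  iu = theta⁻¹ 1 8
  iv = theta⁻¹ 2 7
  id = theta⁻¹ 3 6
  iw = theta⁻¹ 4 5

  private
    module T₁ = Tail 2 3 5 7 6 4 ≡.refl r27 r36 (swap r45)
    module T₂ = Tail 2 4 6 7 5 3 ≡.refl r27 r45 (swap r36)
    module T₃ = Tail 4 3 7 5 6 2 ≡.refl r45 r36 (swap r27)

    expand : ∀ a b → a * b ≈ 1# → ∀ f → f ≈ (a * b) * f
    expand a b h f = sym (trans (*-congʳ h) (*-identityˡ f))

  theta-quotient₁ : J⁻² * (((rho 1 - rho 8) - (- 1# + rho 7 - rho 2)) - ((rho 6 - rho 3) - (rho 3 - rho 6))) ≈ (w * w) * (iu * (iv * id))
  theta-quotient₁ = begin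
    J⁻² * s ≈⟨ trans (expand w iw (Th-inv r45) _) (trans (expand v iv (Th-inv r27) _) (expand d id (Th-inv r36) _)) ⟩
    (d * id) * ((v * iv) * ((w * iw) * (J⁻² * s)))
      ≈⟨ solve 14 (λ p2 p7 p3 p6 p4 p5 q4 q5 j q2 q7 q3 q6 s →
           ((p3 :* p6) :* (q3 :* q6)) :* (((p2 :* p7) :* (q2 :* q7)) :* (((p4 :* p5) :* (q4 :* q5)) :* ((j :* j) :* s)))
           := ((((p2 :* p7) :* (p3 :* p6)) :* ((q5 :* q4) :* (j :* j))) :* s) :* (((q3 :* q6) :* (q2 :* q7)) :* (p4 :* p5))) refl _ _ _ _ _ _ _ _ _ _ _ _ _ _ ⟩
    (T₁.R * s) * ((id * iv) * w) ≈⟨ *-congʳ (sym main) ⟩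
    (T₁.B 1 * T₁.B 3) * ((id * iv) * w)
      ≈⟨ solve 12 (λ p3 p4 q1 q6 p5 p6 q3 q8 i v w z → (((p3 :* p4) :* (q1 :* q6)) :* ((p5 :* p6) :* (q3 :* q8))) :* ((i :* v) :* w)
           := ((p3 :* p6) :* (q3 :* q6)) :* ((((p4 :* p5) :* w) :* ((q1 :* q8) :* (v :* i))))) refl _ _ _ _ _ _ _ _ _ _ _ 0# ⟩
    (d * id) * ((w * w) * (iu * (iv * id))) ≈⟨ sym (expand d id (Th-inv r36) _) ⟩
    (w * w) * (iu * (iv * id)) ∎
    where
    open R≈
    s = ((rho 1 - rho 8) - (- 1# + rho 7 - rho 2)) - ((rho 6 - rho 3) - (rho 3 - rho 6))
    main : T₁.B 1 * T₁.B 3 ≈ T₁.R * s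
    main = separated λ M → mod-trans (mod-sym (T₁.Win-limit⁺ r18 3 (s≤s z≤n) ≡.refl M))
      (T₁.window-sum (+ 1) (lattice⁺ r18) (lattice⁻ r27) (lattice⁺ (swap r36)) (lattice⁺ r36) M)

  theta-quotient₂ : J⁻² * (((- 1# + rho 6 - rho 3) - (- 1# + rho 7 - rho 2)) - ((rho 3 - rho 6) - (rho 4 - rho 5))) ≈ X 2 * ((u * u) * (iv * (iw * id)))
  theta-quotient₂ = begin
    J⁻² * s ≈⟨ trans (expand w iw (Th-inv r45) _) (trans (expand v iv (Th-inv r27) _) (expand d id (Th-inv r36) _)) ⟩
    (d * id) * ((v * iv) * ((w * iw) * (J⁻² * s)))
      ≈⟨ solve 11 (λ d q3 q6 p2 p7 iv p4 p5 iw j s → (d :* (q3 :* q6)) :* (((p2 :* p7) :* iv) :* (((p4 :* p5) :* iw) :* ((j :* j) :* s)))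
           := ((((p2 :* p7) :* (p4 :* p5)) :* ((q6 :* q3) :* (j :* j))) :* s) :* (d :* (iv :* iw))) refl _ _ _ _ _ _ _ _ _ _ _ ⟩
    (T₂.R * s) * (d * (iv * iw)) ≈⟨ *-congʳ (sym main) ⟩
    ((T₂.β (ℤ.- + 3) * T₂.B 6) * T₂.B 6) * (d * (iv * iw)) ≈⟨ *-congʳ value₂ ⟩
    (X 2 * ((u * u) * (id * id))) * (d * (iv * iw))
      ≈⟨ solve 6 (λ x u i d v w → (x :* ((u :* u) :* (i :* i))) :* (d :* (v :* w)) := (d :* i) :* (x :* ((u :* u) :* (v :* (w :* i))))) refl _ _ _ _ _ _ ⟩
    (d * id) * (X 2 * ((u * u) * (iv * (iw * id)))) ≈⟨ sym (expand d id (Th-inv r36) _) ⟩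
    X 2 * ((u * u) * (iv * (iw * id))) ∎
    where
    open R≈
    s = ((- 1# + rho 6 - rho 3) - (- 1# + rho 7 - rho 2)) - ((rho 3 - rho 6) - (rho 4 - rho 5))
    main : (T₂.β (ℤ.- + 3) * T₂.B 6) * T₂.B 6 ≈ T₂.R * s
    main = separated λ M → mod-trans (mod-sym (T₂.Win-limit⁻ r36 6 (s≤s z≤n) ≡.refl M))
      (T₂.window-sum (ℤ.- + 3) (lattice⁻ r36) (lattice⁻ r27) (lattice⁺ r36) (lattice⁺ r45) M)
    value₂ : (T₂.β (ℤ.- + 3) * T₂.B 6) * T₂.B 6 ≈ X 2 * ((u * u) * (id * id))
    value₂ = begin
      _ ≈⟨ *-congʳ (*-congʳ (trans (T₂.β-mid 3 3 (s≤s z≤n) (s≤s z≤n) ≡.refl) (*-congˡ (trans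
             (+-cong (+-cong (+-congˡ (trans (X-+ 2 2) (*-congˡ (X-+ 1 1)))) (-‿cong (X-+ 2 1))) (-‿cong (X-+ 2 1)))
             (solve 2 (λ a x → a :+ a :* (x :* x) :- a :* x :- a :* x := a :* ((:1 :- x) :* (:1 :- x))) refl (X 2) (X 1)))))) ⟩
      _ ≈⟨ solve 7 (λ w a x p8 p10 q6 q12 → (((w :* w) :* (a :* ((:1 :- x) :* (:1 :- x)))) :* ((p8 :* p10) :* (q6 :* q12))) :* ((p8 :* p10) :* (q6 :* q12))
             := a :* (((((:1 :- x) :* p10) :* p8) :* (((:1 :- x) :* p10) :* p8)) :* (((w :* q12) :* q6) :* ((w :* q12) :* q6)))) refl (W 3) (X 2) (X 1) (Po∞ 9 8) (Po∞ 9 10) (Pr∞ 9 6) (Pr∞ 9 12) ⟩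
      _ ≈⟨ *-congˡ (*-cong (*-cong (*-congʳ (Po∞-front 1 (s≤s z≤n))) (*-congʳ (Po∞-front 1 (s≤s z≤n)))) (*-cong (*-congʳ (Pr∞-front 3 (s≤s z≤n))) (*-congʳ (Pr∞-front 3 (s≤s z≤n))))) ⟩
      _ ∎

  theta-quotient₃ : J⁻² * (((- 1# + rho 8 - rho 1) - (- 1# + rho 5 - rho 4)) - ((rho 6 - rho 3) - (rho 3 - rho 6))) ≈ - (X 1 * ((v * v) * (iu * (iw * id))))
  theta-quotient₃ = begin
    J⁻² * s ≈⟨ trans (expand w iw (Th-inv r45) _) (trans (expand v iv (Th-inv r27) _) (expand d id (Th-inv r36) _)) ⟩
    (d * id) * ((v * iv) * ((w * iw) * (J⁻² * s)))
      ≈⟨ solve 11 (λ p3 p6 id v q2 q7 p4 p5 iw j s → ((p3 :* p6) :* id) :* ((v :* (q2 :* q7)) :* (((p4 :* p5) :* iw) :* ((j :* j) :* s)))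
           := ((((p4 :* p5) :* (p3 :* p6)) :* ((q7 :* q2) :* (j :* j))) :* s) :* (id :* (v :* iw))) refl _ _ _ _ _ _ _ _ _ _ _ ⟩
    (T₃.R * s) * (id * (v * iw)) ≈⟨ *-congʳ (sym main) ⟩
    ((T₃.β (ℤ.- + 1) * T₃.B 8) * T₃.B 3) * (id * (v * iw)) ≈⟨ *-congʳ value₃ ⟩
    (- (X 1 * ((d * v) * (iu * id)))) * (id * (v * iw))
      ≈⟨ solve 6 (λ x d v u i w → (:- (x :* ((d :* v) :* (u :* i)))) :* (i :* (v :* w)) := (d :* i) :* (:- (x :* ((v :* v) :* (u :* (w :* i)))))) refl _ _ _ _ _ _ ⟩
    (d * id) * (- (X 1 * ((v * v) * (iu * (iw * id))))) ≈⟨ sym (expand d id (Th-inv r36) _) ⟩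
    - (X 1 * ((v * v) * (iu * (iw * id)))) ∎
    where
    open R≈
    s = ((- 1# + rho 8 - rho 1) - (- 1# + rho 5 - rho 4)) - ((rho 6 - rho 3) - (rho 3 - rho 6))
    main : (T₃.β (ℤ.- + 1) * T₃.B 8) * T₃.B 3 ≈ T₃.R * s
    main = separated λ M → mod-trans (mod-sym (T₃.Win-limit⁻ r18 3 (s≤s z≤n) ≡.refl M))
      (T₃.window-sum (ℤ.- + 1) (lattice⁻ r18) (lattice⁻ r45) (lattice⁺ (swap r36)) (lattice⁺ r36) M)
    value₃ : (T₃.β (ℤ.- + 1) * T₃.B 8) * T₃.B 3 ≈ - (X 1 * ((d * v) * (iu * id)))
    value₃ = begin
      _ ≈⟨ *-congʳ (*-congʳ (trans (T₃.β-mid 1 6 (s≤s z≤n) (s≤s z≤n) ≡.refl) (*-congˡ (trans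
             (+-cong (+-congʳ (+-cong (X-+ 1 3) (X-+ 1 2))) (-‿cong (trans (X-+ 1 5) (*-congˡ (X-+ 2 3)))))
             (solve 3 (λ x y z → x :* z :+ x :* y :- x :- x :* (y :* z) := :- (x :* ((:1 :- y) :* (:1 :- z)))) refl (X 1) (X 2) (X 3)))))) ⟩
      _ ≈⟨ solve 13 (λ w1 w6 x1 x2 x3 p12 p11 q8 q15 p7 p6 q3 q10 →
             (((w1 :* w6) :* (:- (x1 :* ((:1 :- x2) :* (:1 :- x3))))) :* ((p12 :* p11) :* (q8 :* q15))) :* ((p7 :* p6) :* (q3 :* q10))
             := :- (x1 :* (((((:1 :- x3) :* p12) :* p6) :* (((:1 :- x2) :* p11) :* p7)) :* (((w1 :* q10) :* q8) :* (q3 :* (w6 :* q15))))))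
             refl (W 1) (W 6) (X 1) (X 2) (X 3) (Po∞ 9 12) (Po∞ 9 11) (Pr∞ 9 8) (Pr∞ 9 15) (Po∞ 9 7) (Po∞ 9 6) (Pr∞ 9 3) (Pr∞ 9 10) ⟩
      _ ≈⟨ -‿cong (*-congˡ (*-cong (*-cong (*-congʳ (Po∞-front 3 (s≤s z≤n))) (*-congʳ (Po∞-front 2 (s≤s z≤n))))
             (*-cong (*-congʳ (Pr∞-front 1 (s≤s z≤n))) (*-congˡ (Pr∞-front 6 (s≤s z≤n)))))) ⟩
      _ ∎

  τ : ℕ → ℕ → ℕ → Carrier
  τ c a n = Π< n (λ k → - X (a ℕ.+ c ℕ.* k))

  module JTP (c₀ a b : ℕ) (ab : suc a ℕ.+ suc b ≡ suc c₀) where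
    private
      c = suc c₀
      a′ = suc a
      b′ = suc b

    -- q^(cj) and Gaussian binomial coefficients in base q^c.
    p : ℕ → Carrier
    p j = X (c ℕ.* j)

    gauss : ℕ → ℕ → Carrier
    gauss zero zero = 1#
    gauss zero (suc j) = 0#
    gauss (suc κ) zero = 1#
    gauss (suc κ) (suc j) = gauss κ j + p (suc j) * gauss κ (suc j)

    private
      F IF : ℕ → Carrier
      F m = Po c c m
      IF m = Pr c c m

      c* : ∀ k → c ℕ.+ c ℕ.* k ≡ c ℕ.* suc k
      c* k = ≡.sym (ℕP.*-suc c k)

      F-suc : ∀ m → F (suc m) ≈ F m * (1# - p (suc m))
      F-suc m = *-congˡ (+-congˡ (-‿cong (X-cong (c* m))))

      IF-step : ∀ m → IF m ≈ IF (suc m) * (1# - p (suc m))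
      IF-step m = sym (trans (*-assoc _ _ _) (trans (*-congˡ (trans (*-congˡ (+-congˡ (-‿cong (X-cong (≡.sym (c* m)))))) (trans (*-comm _ _) (W-inv (c₀ ℕ.+ c ℕ.* m))))) (*-identityʳ _)))

      F*IF : ∀ m → F m * IF m ≈ 1#
      F*IF m = trans (sym (Π-* m _ _)) (trans (Π-cong m (λ j → W-inv (c₀ ℕ.+ c ℕ.* j))) (Π-one m))

      gauss-zero : ∀ κ → gauss κ 0 ≈ 1#
      gauss-zero zero = refl
      gauss-zero (suc κ) = refl

      gauss-big : ∀ κ j → κ ℕ.< j → gauss κ j ≈ 0#
      gauss-big zero (suc j) _ = refl
      gauss-big (suc κ) (suc j) (s≤s l) = trans (+-cong (gauss-big κ j l) (trans (*-congˡ (gauss-big κ (suc j) (ℕP.m≤n⇒m≤1+n l))) (zeroʳ _))) (+-identityʳ _)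

      h : ℕ → ℕ → Carrier
      h i j = F (i ℕ.+ j) * (IF i * IF j)

      h-zeroʳ : ∀ i → h i 0 ≈ 1#
      h-zeroʳ i = trans (*-cong (reflexive (≡.cong F (ℕP.+-identityʳ i))) (*-identityʳ _)) (F*IF i)

      h-zeroˡ : ∀ j → h 0 j ≈ 1#
      h-zeroˡ j = trans (*-congˡ (*-identityˡ _)) (F*IF j)

      p-+ : ∀ i j → p (i ℕ.+ j) ≈ p i * p j
      p-+ i j = trans (X-cong (ℕP.*-distribˡ-+ c i j)) (X-+ _ _)

      h-II : ∀ i j → h (suc i) (suc j) ≈ h (suc i) j + p (suc j) * h i (suc j)
      h-II i j = begin
        _ ≈⟨ *-congʳ (trans (F-suc (i ℕ.+ suc j)) (*-congˡ (+-congˡ (-‿cong (p-+ (suc i) (suc j)))))) ⟩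
        _ ≈⟨ solve 5 (λ f x y pi pj → (f :* (:1 :- pi :* pj)) :* (x :* y) := f :* (x :* (y :* (:1 :- pj))) :+ pj :* (f :* ((x :* (:1 :- pi)) :* y))) refl
               (F (i ℕ.+ suc j)) (IF (suc i)) (IF (suc j)) (p (suc i)) (p (suc j)) ⟩
        _ ≈⟨ +-cong (*-cong (reflexive (≡.cong F (ℕP.+-suc i j))) (*-congˡ (sym (IF-step j)))) (*-congˡ (*-congˡ (*-congʳ (sym (IF-step i))))) ⟩
        _ ∎
        where open R≈

      h-I : ∀ i j → h (suc i) (suc j) ≈ h i (suc j) + p (suc i) * h (suc i) j
      h-I i j = begin
        _ ≈⟨ *-congʳ (trans (F-suc (i ℕ.+ suc j)) (*-congˡ (+-congˡ (-‿cong (p-+ (suc i) (suc j)))))) ⟩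
        _ ≈⟨ solve 5 (λ f x y pi pj → (f :* (:1 :- pi :* pj)) :* (x :* y) := f :* ((x :* (:1 :- pi)) :* y) :+ pi :* (f :* (x :* (y :* (:1 :- pj))))) refl
               (F (i ℕ.+ suc j)) (IF (suc i)) (IF (suc j)) (p (suc i)) (p (suc j)) ⟩
        _ ≈⟨ +-cong (*-congˡ (*-congʳ (sym (IF-step i)))) (*-congˡ (*-cong (reflexive (≡.cong F (ℕP.+-suc i j))) (*-congˡ (sym (IF-step j))))) ⟩
        _ ∎
        where open R≈

      gauss-h : ∀ i j → gauss (i ℕ.+ j) j ≈ h i j
      gauss-h zero zero = sym (h-zeroˡ 0)
      gauss-h zero (suc j) = trans (+-cong (gauss-h zero j) (trans (*-congˡ (gauss-big j (suc j) ℕP.≤-refl)) (zeroʳ _)))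
        (trans (+-identityʳ _) (trans (h-zeroˡ j) (sym (h-zeroˡ (suc j)))))
      gauss-h (suc i) zero = sym (h-zeroʳ (suc i))
      gauss-h (suc i) (suc j) = trans (+-cong (trans (reflexive (≡.cong (λ z → gauss z j) (ℕP.+-suc i j))) (gauss-h (suc i) j)) (*-congˡ (gauss-h i (suc j)))) (sym (h-II i j))

      gauss-I : ∀ i j → gauss (suc (i ℕ.+ j)) (suc j) ≈ gauss (i ℕ.+ j) (suc j) + p i * gauss (i ℕ.+ j) j
      gauss-I zero j = trans (+-comm _ _) (+-cong (trans (*-congˡ (gauss-big j (suc j) ℕP.≤-refl)) (trans (zeroʳ _) (sym (gauss-big j (suc j) ℕP.≤-refl))))
        (sym (trans (*-congʳ (trans (X-cong (ℕP.*-zeroʳ c)) X-zero)) (*-identityˡ _))))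
      gauss-I (suc i) j = trans (trans (reflexive (≡.cong (λ z → gauss (suc z) (suc j)) (≡.sym (ℕP.+-suc i j)))) (gauss-h (suc i) (suc j)))
        (trans (h-I i j) (+-cong (sym (trans (reflexive (≡.cong (λ z → gauss z (suc j)) (≡.sym (ℕP.+-suc i j)))) (gauss-h i (suc j)))) (*-congˡ (sym (gauss-h (suc i) j)))))

    t : ℤ → Carrier
    t (+ n)    = τ c a′ n
    t -[1+ n ] = τ c b′ (suc n)

    private
      t-neg : ∀ n → t (ℤ.- + n) ≈ τ c b′ n
      t-neg zero = refl
      t-neg (suc n) = refl

      ⊖-pos : ∀ N n → (N ℕ.+ n) ℤ.⊖ N ≡ + n
      ⊖-pos N n = ≡.trans (ℤP.⊖-≥ (ℕP.m≤m+n N n)) (≡.cong +_ (ℕP.m+n∸m≡n N n))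

      ⊖-neg : ∀ j n → j ℤ.⊖ (j ℕ.+ n) ≡ ℤ.- + n
      ⊖-neg j n = ≡.trans (≡.sym (ℤP.m-n≡m⊖n j (j ℕ.+ n))) (ZS.solve 2 (λ j n → j ZS.:- (j ZS.:+ n) ZS.:= ZS.:- n) ≡.refl (+ j) (+ n))

      t≡ : ∀ {y z} → y ≡ z → t y ≈ t z
      t≡ e = reflexive (≡.cong t e)

      ab-split : ∀ m n → X (a′ ℕ.+ c ℕ.* m) * X (b′ ℕ.+ c ℕ.* n) ≈ p (suc (m ℕ.+ n))
      ab-split m n = trans (sym (X-+ _ _)) (X-cong (≡.trans (NS.solve 5 (λ a b c m n → (a NS.:+ c NS.:* m) NS.:+ (b NS.:+ c NS.:* n) NS.:= (a NS.:+ b) NS.:+ c NS.:* (m NS.:+ n)) ≡.refl a′ b′ c m n)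
        (≡.trans (≡.cong (ℕ._+ c ℕ.* (m ℕ.+ n)) ab) (≡.sym (ℕP.*-suc c (m ℕ.+ n))))))

      T₁ : ∀ i j N M → i ℕ.+ j ≡ M ℕ.+ N → X (a′ ℕ.+ c ℕ.* M) * t (j ℤ.⊖ N) ≈ - (p i * t (suc j ℤ.⊖ N))
      T₁ i j N M e with ℕP.≤-<-connex N j
      ... | inj₁ l = begin
          _ ≈⟨ *-congˡ (t≡ (≡.trans (≡.cong (ℤ._⊖ N) (≡.sym j≡)) (⊖-pos N n))) ⟩
          X (a′ ℕ.+ c ℕ.* M) * τ c a′ n ≈⟨ *-congʳ (trans (X-cong (≡.trans (≡.cong (λ z → a′ ℕ.+ c ℕ.* z) M≡) (NS.solve 4 (λ a c n i → a NS.:+ c NS.:* (i NS.:+ n) NS.:= c NS.:* i NS.:+ (a NS.:+ c NS.:* n)) ≡.refl a′ c n i))) (X-+ _ _)) ⟩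
          (p i * X (a′ ℕ.+ c ℕ.* n)) * τ c a′ n ≈⟨ solve 3 (λ p x t → (p :* x) :* t := :- (p :* (t :* (:- x)))) refl _ _ _ ⟩
          - (p i * τ c a′ (suc n)) ≈⟨ -‿cong (*-congˡ (sym (t≡ (≡.trans (≡.cong (ℤ._⊖ N) (≡.trans (≡.cong suc (≡.sym j≡)) (≡.sym (ℕP.+-suc N n)))) (⊖-pos N (suc n)))))) ⟩
          _ ∎
        where
        open R≈
        n = j ℕ.∸ N
        j≡ : N ℕ.+ n ≡ j
        j≡ = ℕP.m+[n∸m]≡n l
        M≡ : M ≡ i ℕ.+ n
        M≡ = ℕP.+-cancelʳ-≡ N M (i ℕ.+ n) (≡.trans (≡.sym e) (≡.trans (≡.cong (i ℕ.+_) (≡.sym j≡)) (NS.solve 3 (λ i N n → i NS.:+ (N NS.:+ n) NS.:= (i NS.:+ n) NS.:+ N) ≡.refl i N n)))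
      ... | inj₂ l = begin
          _ ≈⟨ *-congˡ (t≡ (≡.trans (≡.cong (j ℤ.⊖_) (≡.trans (≡.sym N≡) (≡.sym (ℕP.+-suc j n)))) (⊖-neg j (suc n)))) ⟩
          X (a′ ℕ.+ c ℕ.* M) * τ c b′ (suc n) ≈⟨ solve 3 (λ x t y → x :* (t :* (:- y)) := :- ((x :* y) :* t)) refl _ _ _ ⟩
          - ((X (a′ ℕ.+ c ℕ.* M) * X (b′ ℕ.+ c ℕ.* n)) * τ c b′ n) ≈⟨ -‿cong (*-cong (trans (ab-split M n) (reflexive (≡.cong p (≡.sym i≡)))) (sym (trans (t≡ (≡.trans (≡.cong (suc j ℤ.⊖_) (≡.sym N≡)) (⊖-neg (suc j) n))) (t-neg n)))) ⟩
          _ ∎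
        where
        open R≈
        n = N ℕ.∸ suc j
        N≡ : suc j ℕ.+ n ≡ N
        N≡ = ℕP.m+[n∸m]≡n l
        i≡ : i ≡ suc (M ℕ.+ n)
        i≡ = ℕP.+-cancelʳ-≡ j i (suc (M ℕ.+ n)) (≡.trans e (≡.trans (≡.cong (M ℕ.+_) (≡.sym N≡)) (NS.solve 3 (λ M j n → M NS.:+ (NS.con 1 NS.:+ j NS.:+ n) NS.:= NS.con 1 NS.:+ (M NS.:+ n) NS.:+ j) ≡.refl M j n)))

      T₂ : ∀ j N → X (b′ ℕ.+ c ℕ.* N) * t (j ℤ.⊖ N) ≈ - (p j * t (j ℤ.⊖ suc N))
      T₂ j N with ℕP.≤-<-connex j N
      ... | inj₁ l = begin
          _ ≈⟨ *-congˡ (trans (t≡ (≡.trans (≡.cong (j ℤ.⊖_) (≡.sym N≡)) (⊖-neg j n))) (t-neg n)) ⟩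
          X (b′ ℕ.+ c ℕ.* N) * τ c b′ n ≈⟨ *-congʳ (trans (X-cong (≡.trans (≡.cong (λ z → b′ ℕ.+ c ℕ.* z) (≡.sym N≡)) (NS.solve 4 (λ a c n i → a NS.:+ c NS.:* (i NS.:+ n) NS.:= c NS.:* i NS.:+ (a NS.:+ c NS.:* n)) ≡.refl b′ c n j))) (X-+ _ _)) ⟩
          (p j * X (b′ ℕ.+ c ℕ.* n)) * τ c b′ n ≈⟨ solve 3 (λ p x t → (p :* x) :* t := :- (p :* (t :* (:- x)))) refl _ _ _ ⟩
          - (p j * τ c b′ (suc n)) ≈⟨ -‿cong (*-congˡ (sym (t≡ (≡.trans (≡.cong (j ℤ.⊖_) (≡.trans (≡.cong suc (≡.sym N≡)) (≡.sym (ℕP.+-suc j n)))) (⊖-neg j (suc n)))))) ⟩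
          _ ∎
        where
        open R≈
        n = N ℕ.∸ j
        N≡ : j ℕ.+ n ≡ N
        N≡ = ℕP.m+[n∸m]≡n l
      ... | inj₂ l = begin
          _ ≈⟨ *-congˡ (t≡ (≡.trans (≡.cong (ℤ._⊖ N) (≡.trans (≡.sym j≡) (≡.sym (ℕP.+-suc N n)))) (⊖-pos N (suc n)))) ⟩
          X (b′ ℕ.+ c ℕ.* N) * τ c a′ (suc n) ≈⟨ solve 3 (λ x t y → x :* (t :* (:- y)) := :- ((y :* x) :* t)) refl _ _ _ ⟩
          - ((X (a′ ℕ.+ c ℕ.* n) * X (b′ ℕ.+ c ℕ.* N)) * τ c a′ n)
            ≈⟨ -‿cong (*-cong (trans (ab-split n N) (reflexive (≡.cong p (≡.trans (≡.cong suc (ℕP.+-comm n N)) j≡)))) (sym (t≡ (≡.trans (≡.cong (ℤ._⊖ suc N) (≡.sym j≡)) (⊖-pos (suc N) n))))) ⟩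
          _ ∎
        where
        open R≈
        n = j ℕ.∸ suc N
        j≡ : suc N ℕ.+ n ≡ j
        j≡ = ℕP.m+[n∸m]≡n l

    finite : ∀ M N → Po c a′ M * Po c b′ N ≈ Σ< (suc (M ℕ.+ N)) (λ j → gauss (M ℕ.+ N) j * t (j ℤ.⊖ N))
    finite zero zero = solve 0 (:1 :* :1 := :0 :+ :1 :* :1) refl
    finite (suc M) N = begin
      _ ≈⟨ solve 3 (λ x y z → (x :* (:1 :- y)) :* z := x :* z :+ :- (y :* (x :* z))) refl _ _ _ ⟩
      _ ≈⟨ +-cong (finite M N) (-‿cong (*-congˡ (finite M N))) ⟩
      Σ< (suc κ) f + - (y * Σ< (suc κ) f) ≈⟨ +-cong (sym (trans (+-congˡ (trans (*-congʳ (gauss-big κ (suc κ) ℕP.≤-refl)) (zeroˡ _))) (+-identityʳ _)))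
           (trans (-‿cong (sym (Σ-*ˡ (suc κ) y f))) (trans (sym (Σ-neg (suc κ) _)) (Σ-cong< (suc κ) step))) ⟩
      Σ< (suc (suc κ)) f + Σ< (suc κ) g ≈⟨ +-congʳ (Σ-front (suc κ) f) ⟩
      (f 0 + Σ< (suc κ) (λ j → f (suc j))) + Σ< (suc κ) g ≈⟨ trans (+-assoc _ _ _) (+-congˡ (sym (Σ-+ (suc κ) _ _))) ⟩
      f 0 + Σ< (suc κ) (λ j → f (suc j) + g j) ≈⟨ +-cong (*-congʳ (gauss-zero κ)) (Σ-cong< (suc κ) merge) ⟩
      f′ 0 + Σ< (suc κ) (λ j → f′ (suc j)) ≈⟨ sym (Σ-front (suc κ) f′) ⟩
      _ ∎
      where
      open R≈
      κ = M ℕ.+ N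
      y = X (a′ ℕ.+ c ℕ.* M)
      f g f′ : ℕ → Carrier
      f j = gauss κ j * t (j ℤ.⊖ N)
      g j = (p (κ ℕ.∸ j) * gauss κ j) * t (suc j ℤ.⊖ N)
      f′ j = gauss (suc κ) j * t (j ℤ.⊖ N)
      step : ∀ j → j ℕ.< suc κ → - (y * f j) ≈ g j
      step j (s≤s l) = trans (solve 3 (λ y g t → :- (y :* (g :* t)) := :- (g :* (y :* t))) refl _ _ _)
        (trans (-‿cong (*-congˡ (T₁ (κ ℕ.∸ j) j N M (ℕP.m∸n+n≡m l)))) (solve 3 (λ g p t → :- (g :* (:- (p :* t))) := (p :* g) :* t) refl _ _ _))
      merge : ∀ j → j ℕ.< suc κ → f (suc j) + g j ≈ f′ (suc j)
      merge j (s≤s l) = trans (sym (distribʳ _ _ _)) (*-congʳ (sym (≡.subst (λ z → gauss (suc z) (suc j) ≈ gauss z (suc j) + p (κ ℕ.∸ j) * gauss z j) (ℕP.m∸n+n≡m l) (gauss-I (κ ℕ.∸ j) j))))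
    finite zero (suc N) = begin
      _ ≈⟨ solve 2 (λ x y → :1 :* (x :* (:1 :- y)) := :1 :* x :+ :- (y :* (:1 :* x))) refl _ _ ⟩
      _ ≈⟨ +-cong (finite zero N) (-‿cong (*-congˡ (finite zero N))) ⟩
      Σ< (suc N) f + - (y * Σ< (suc N) f) ≈⟨ +-cong (Σ-cong (suc N) (λ j → *-congˡ (t≡ (≡.sym (ℤP.[1+m]⊖[1+n]≡m⊖n j N)))))
           (trans (-‿cong (sym (Σ-*ˡ (suc N) y f))) (trans (sym (Σ-neg (suc N) _)) (trans (Σ-cong (suc N) step)
             (sym (trans (+-congˡ (trans (*-congʳ (trans (*-congˡ (gauss-big N (suc N) ℕP.≤-refl)) (zeroʳ _))) (zeroˡ _))) (+-identityʳ _)))))) ⟩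
      Σ< (suc N) f⁺ + Σ< (suc (suc N)) g ≈⟨ +-congˡ (Σ-front (suc N) g) ⟩
      Σ< (suc N) f⁺ + (g 0 + Σ< (suc N) (λ j → g (suc j))) ≈⟨ solve 3 (λ a b c → a :+ (b :+ c) := b :+ (a :+ c)) refl _ _ _ ⟩
      g 0 + (Σ< (suc N) f⁺ + Σ< (suc N) (λ j → g (suc j))) ≈⟨ +-cong (*-congʳ (trans (*-cong (trans (X-cong (ℕP.*-zeroʳ c)) X-zero) (gauss-zero N)) (*-identityˡ _)))
           (trans (sym (Σ-+ (suc N) _ _)) (Σ-cong (suc N) (λ j → sym (distribʳ _ _ _)))) ⟩
      f′ 0 + Σ< (suc N) (λ j → f′ (suc j)) ≈⟨ sym (Σ-front (suc N) f′) ⟩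
      _ ∎
      where
      open R≈
      y = X (b′ ℕ.+ c ℕ.* N)
      f f⁺ g f′ : ℕ → Carrier
      f j = gauss N j * t (j ℤ.⊖ N)
      f⁺ j = gauss N j * t (suc j ℤ.⊖ suc N)
      g j = (p j * gauss N j) * t (j ℤ.⊖ suc N)
      f′ j = gauss (suc N) j * t (j ℤ.⊖ suc N)
      step : ∀ j → - (y * f j) ≈ g j
      step j = trans (solve 3 (λ y g t → :- (y :* (g :* t)) := :- (g :* (y :* t))) refl _ _ _)
        (trans (-‿cong (*-congˡ (T₂ j N))) (solve 3 (λ g p t → :- (g :* (:- (p :* t))) := (p :* g) :* t) refl _ _ _))

    private
      τ-small : ∀ a n → τ c (suc a) n ≈[ n ] 0#
      τ-small a zero = small-zero
      τ-small a (suc n) = mod-trans (fine (*-comm _ _)) (*-small _ (mod-trans (mod-neg (X-small′ (≤-index c (suc a) n (s≤s z≤n) (s≤s z≤n)))) (fine -0#≈0#)))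

      two-sided : ∀ N (f : ℕ → Carrier) → Σ< (suc (N ℕ.+ N)) f ≈ Σ< N (λ n → f (N ℕ.∸ suc n)) + Σ< (suc N) (λ n → f (N ℕ.+ n))
      two-sided N f = trans (reflexive (≡.cong (λ z → Σ< z f) (≡.sym (ℕP.+-suc N N)))) (trans (Σ-split N (suc N) f) (+-congʳ (sym (Σ-rev N f))))

      tannery′ : ∀ (G : ℕ → Carrier) C (φ : ℕ → Carrier) M N → M ℕ.≤ N → (∀ n → n ℕ.< M → G n ≈[ M ] C) → (∀ n → φ n ≈[ n ] 0#) →
        Σ< N (λ n → G n * φ n) ≈[ M ] (C * Σ∞ φ)
      tannery′ G C φ M N h hG hφ = mod-trans (Σ-cong-mod N term) (mod-trans (fine (Σ-*ˡ N C φ)) (mod-* (fine refl) (Σ∞-≈ hφ M N h)))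
        where
        term : ∀ n → n ℕ.< N → (G n * φ n) ≈[ M ] (C * φ n)
        term n _ with ℕP.<-≤-connex n M
        ... | inj₁ l = mod-* (hG n l) (fine refl)
        ... | inj₂ l = mod-trans (kill _) (mod-sym (kill _))
          where
          kill : ∀ u → (u * φ n) ≈[ M ] 0#
          kill u = mod-trans (fine (*-comm _ _)) (*-small u (mod-mono l (hφ n)))

      h-≈ : ∀ M i j → M ℕ.≤ i → M ℕ.≤ j → h i j ≈[ M ] Pr∞ c c
      h-≈ M i j li lj = mod-trans (mod-* (Po-≈ c c (s≤s z≤n) (s≤s z≤n) M _ (ℕP.≤-trans li (ℕP.m≤m+n i j))) (mod-* (Pr-≈ c c (s≤s z≤n) (s≤s z≤n) M i li) (Pr-≈ c c (s≤s z≤n) (s≤s z≤n) M j lj)))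
        (fine (trans (sym (*-assoc _ _ _)) (trans (*-congʳ inf) (*-identityˡ _))))
        where
        inf : Po∞ c c * Pr∞ c c ≈ 1#
        inf = separated λ M → mod-trans (mod-sym (mod-* (Po-≈ c c (s≤s z≤n) (s≤s z≤n) M M ℕP.≤-refl) (Pr-≈ c c (s≤s z≤n) (s≤s z≤n) M M ℕP.≤-refl))) (fine (F*IF M))

    theta-series : Carrier
    theta-series = Σ∞ (λ n → τ c b′ (suc n)) + Σ∞ (τ c a′)

    triple-product : Po∞ c a′ * Po∞ c b′ ≈ Pr∞ c c * theta-series
    triple-product = separated λ M → mod-trans (mod-sym (mod-* (Po-≈ c a′ (s≤s z≤n) (s≤s z≤n) M (M ℕ.+ M) (ℕP.m≤m+n M M)) (Po-≈ c b′ (s≤s z≤n) (s≤s z≤n) M (M ℕ.+ M) (ℕP.m≤m+n M M))))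
      (mod-trans (fine (trans (finite (M ℕ.+ M) (M ℕ.+ M)) (two-sided (M ℕ.+ M) _)))
      (mod-trans (mod-+ (lo M) (hi M)) (fine (sym (distribˡ _ _ _)))))
      where
      lo : ∀ M → Σ< (M ℕ.+ M) (λ n → gauss ((M ℕ.+ M) ℕ.+ (M ℕ.+ M)) ((M ℕ.+ M) ℕ.∸ suc n) * t (((M ℕ.+ M) ℕ.∸ suc n) ℤ.⊖ (M ℕ.+ M))) ≈[ M ] (Pr∞ c c * Σ∞ (λ n → τ c b′ (suc n)))
      lo M = mod-trans (Σ-cong-mod N term)
        (tannery′ (λ n → gauss (N ℕ.+ N) (N ℕ.∸ suc n)) (Pr∞ c c) (λ n → τ c b′ (suc n)) M N (ℕP.m≤m+n M M) g (λ n → mod-mono (ℕP.n≤1+n n) (τ-small b (suc n))))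
        where
        N = M ℕ.+ M
        term : ∀ n → n ℕ.< N → (gauss (N ℕ.+ N) (N ℕ.∸ suc n) * t ((N ℕ.∸ suc n) ℤ.⊖ N)) ≈[ M ] (gauss (N ℕ.+ N) (N ℕ.∸ suc n) * τ c b′ (suc n))
        term n l = fine (*-congˡ (t≡ (≡.trans (≡.cong ((N ℕ.∸ suc n) ℤ.⊖_) (≡.sym (ℕP.m∸n+n≡m l))) (⊖-neg (N ℕ.∸ suc n) (suc n)))))
        g : ∀ n → n ℕ.< M → gauss (N ℕ.+ N) (N ℕ.∸ suc n) ≈[ M ] Pr∞ c c
        g n l = mod-trans (fine (trans (reflexive (≡.cong (λ z → gauss z (N ℕ.∸ suc n)) eq)) (gauss-h (N ℕ.+ suc n) (N ℕ.∸ suc n))))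
          (h-≈ M _ _ (ℕP.≤-trans (ℕP.m≤m+n M M) (ℕP.m≤m+n N (suc n))) (≤-∸ M N n (ℕP.+-monoˡ-< M l)))
          where
          eq : N ℕ.+ N ≡ (N ℕ.+ suc n) ℕ.+ (N ℕ.∸ suc n)
          eq = ≡.sym (≡.trans (ℕP.+-assoc N (suc n) _) (≡.cong (N ℕ.+_) (ℕP.m+[n∸m]≡n (ℕP.≤-trans l (ℕP.m≤m+n M M)))))
      hi : ∀ M → Σ< (suc (M ℕ.+ M)) (λ n → gauss ((M ℕ.+ M) ℕ.+ (M ℕ.+ M)) ((M ℕ.+ M) ℕ.+ n) * t (((M ℕ.+ M) ℕ.+ n) ℤ.⊖ (M ℕ.+ M))) ≈[ M ] (Pr∞ c c * Σ∞ (τ c a′))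
      hi M = mod-trans (fine (Σ-cong (suc N) (λ n → *-congˡ (t≡ (⊖-pos N n)))))
        (tannery′ (λ n → gauss (N ℕ.+ N) (N ℕ.+ n)) (Pr∞ c c) (τ c a′) M (suc N) (ℕP.m≤n⇒m≤1+n (ℕP.m≤m+n M M)) g (τ-small a))
        where
        N = M ℕ.+ M
        g : ∀ n → n ℕ.< M → gauss (N ℕ.+ N) (N ℕ.+ n) ≈[ M ] Pr∞ c c
        g n l = mod-trans (fine (trans (reflexive (≡.cong (λ z → gauss z (N ℕ.+ n)) eq)) (gauss-h (N ℕ.∸ n) (N ℕ.+ n))))
          (h-≈ M _ _ (ℕP.≤-trans (≤-∸ M N n (ℕP.+-monoˡ-< M l)) (ℕP.∸-monoʳ-≤ N (ℕP.n≤1+n n))) (ℕP.≤-trans (ℕP.m≤m+n M M) (ℕP.m≤m+n N n)))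
          where
          eq : N ℕ.+ N ≡ (N ℕ.∸ n) ℕ.+ (N ℕ.+ n)
          eq = ≡.sym (≡.trans (NS.solve 3 (λ x N n → x NS.:+ (N NS.:+ n) NS.:= N NS.:+ (x NS.:+ n)) ≡.refl (N ℕ.∸ n) N n) (≡.cong (N ℕ.+_) (ℕP.m∸n+n≡m (ℕP.≤-trans (ℕP.<⇒≤ l) (ℕP.m≤m+n M M)))))

  σ-zero : σ 0# ≈ 0#
  σ-zero = trans (σ-cong (sym (-‿inverseʳ 1#))) (trans (σ-+ _ _) (trans (+-congˡ (σ-neg 1#)) (-‿inverseʳ _)))

  σ-W : ∀ e → σ (W (suc e)) ≈ W (3 ℕ.* suc e)
  σ-W e = inverse-unique (1# - X (3 ℕ.* suc e)) _ _
    (trans (*-congʳ (sym (trans (σ-+ _ _) (+-cong σ-one (trans (σ-neg _) (-‿cong (σ-X _))))))) (trans (sym (σ-* _ _)) (trans (σ-cong (W-inv e)) σ-one)))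
    (W-inv (e ℕ.+ (suc e ℕ.+ (suc e ℕ.+ 0))))

  σ-W′ : ∀ e → 1 ℕ.≤ e → σ (W e) ≈ W (3 ℕ.* e)
  σ-W′ (suc e) _ = σ-W e

  σ-Σ : ∀ n f → σ (Σ< n f) ≈ Σ< n (λ i → σ (f i))
  σ-Σ zero f = σ-zero
  σ-Σ (suc n) f = trans (σ-+ _ _) (+-congʳ (σ-Σ n f))

  σ-Σ∞ : ∀ {f} → Summable f → σ (Σ∞ f) ≈ Σ∞ (λ n → σ (f n))
  σ-Σ∞ {f} h = separated λ M → mod-trans (σ-mod (mod-sym (Σ∞-≈ h M M ℕP.≤-refl))) (mod-trans (fine (σ-Σ M f))
    (Σ∞-≈ (λ k → mod-trans (σ-mod (h k)) (fine σ-zero)) M M ℕP.≤-refl))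

  Σ∞-cong : ∀ {f g} → Summable f → Summable g → (∀ n → f n ≈ g n) → Σ∞ f ≈ Σ∞ g
  Σ∞-cong hf hg e = separated λ M → mod-trans (mod-sym (Σ∞-≈ hf M M ℕP.≤-refl)) (mod-trans (fine (Σ-cong M e)) (Σ∞-≈ hg M M ℕP.≤-refl))

  Σ∞-*ˡ : ∀ x {f} → Summable f → Σ∞ (λ n → x * f n) ≈ x * Σ∞ f
  Σ∞-*ˡ x {f} h = separated λ M → mod-trans (mod-sym (Σ∞-≈ (λ k → mod-trans (mod-* (fine refl) (h k)) (fine (zeroʳ x))) M M ℕP.≤-refl))
    (mod-trans (fine (Σ-*ˡ M x f)) (mod-* (fine refl) (Σ∞-≈ h M M ℕP.≤-refl)))

  private
    three-suc : ∀ m → 3 ℕ.* suc m ≡ suc (suc (suc (3 ℕ.* m)))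
    three-suc m = ℕP.*-suc 3 m

    m≤3m : ∀ m → m ℕ.≤ 3 ℕ.* m
    m≤3m m = ℕP.m≤m+n m _

  Σ-3 : ∀ m f → Σ< (3 ℕ.* m) f ≈ Σ< m (λ k → f (3 ℕ.* k)) + Σ< m (λ k → f (suc (3 ℕ.* k))) + Σ< m (λ k → f (suc (suc (3 ℕ.* k))))
  Σ-3 zero f = solve 0 (:0 := :0 :+ :0 :+ :0) refl
  Σ-3 (suc m) f = trans (reflexive (≡.cong (λ z → Σ< z f) (three-suc m))) (trans (+-congʳ (+-congʳ (+-congʳ (Σ-3 m f))))
    (solve 6 (λ a b c x y z → ((((a :+ b) :+ c) :+ x) :+ y) :+ z := ((a :+ x) :+ (b :+ y)) :+ (c :+ z)) refl _ _ _ _ _ _))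

  Σ∞-3 : ∀ {f} → Summable f → Σ∞ f ≈ Σ∞ (λ k → f (3 ℕ.* k)) + Σ∞ (λ k → f (suc (3 ℕ.* k))) + Σ∞ (λ k → f (suc (suc (3 ℕ.* k))))
  Σ∞-3 {f} h = separated λ M → mod-trans (mod-sym (Σ∞-≈ h M (3 ℕ.* M) (m≤3m M))) (mod-trans (fine (Σ-3 M f))
    (mod-+ (mod-+ (Σ∞-≈ (λ k → mod-mono (m≤3m k) (h _)) M M ℕP.≤-refl) (Σ∞-≈ (λ k → mod-mono (ℕP.m≤n⇒m≤1+n (m≤3m k)) (h _)) M M ℕP.≤-refl))
      (Σ∞-≈ (λ k → mod-mono (ℕP.m≤n⇒m≤1+n (ℕP.m≤n⇒m≤1+n (m≤3m k))) (h _)) M M ℕP.≤-refl)))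

  lq : ℕ → ℕ → ℕ → Carrier
  lq B C a = Σ∞ (λ n → X (6 ℕ.* n ℕ.* n ℕ.+ B ℕ.* n ℕ.+ C) * W (9 ℕ.* n ℕ.+ 3 ℕ.* a))

  expo-closed : ∀ B m → expo (18 ℕ.+ B) m ≡ 18 ℕ.* m ℕ.* m ℕ.+ B ℕ.* m
  expo-closed B zero = ≡.sym (ℕP.*-zeroʳ B)
  expo-closed B (suc m) = ≡.trans (≡.cong (ℕ._+ (18 ℕ.+ B ℕ.+ 36 ℕ.* m)) (expo-closed B m))
    (NS.solve 2 (λ B m → NS.con 18 NS.:* m NS.:* m NS.:+ B NS.:* m NS.:+ (NS.con 18 NS.:+ B NS.:+ NS.con 36 NS.:* m) NS.:= NS.con 18 NS.:* (NS.con 1 NS.:+ m) NS.:* (NS.con 1 NS.:+ m) NS.:+ B NS.:* (NS.con 1 NS.:+ m)) ≡.refl B m)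

  lam-Summable : ∀ S a → 1 ℕ.≤ S → Summable (λ n → X (expo S n) * W (a ℕ.+ 9 ℕ.* n))
  lam-Summable S a l k = X*-small _ (n≤E S l k)

  lq-Summable : ∀ B C a → 1 ℕ.≤ B → Summable (λ n → X (6 ℕ.* n ℕ.* n ℕ.+ B ℕ.* n ℕ.+ C) * W (9 ℕ.* n ℕ.+ 3 ℕ.* a))
  lq-Summable (suc B) C a _ k = X*-small _ (ℕP.≤-trans (ℕP.m≤m+n k (B ℕ.* k)) (ℕP.≤-trans (ℕP.m≤n+m (suc B ℕ.* k) (6 ℕ.* k ℕ.* k)) (ℕP.m≤m+n _ C)))

  private
    piece : ∀ (f : ℕ → Carrier) e S a → Summable f → 1 ℕ.≤ S → 1 ℕ.≤ a → (∀ m → f m ≈ X (e ℕ.+ 3 ℕ.* expo S m) * W (3 ℕ.* (a ℕ.+ 9 ℕ.* m))) →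
      Σ∞ f ≈ X e * σ (lam S a)
    piece f e S a hf lS la h = trans (Σ∞-cong hf (λ k → mod-trans (mod-* (fine refl) (hs k)) (fine (zeroʳ _)))
        (λ m → trans (h m) (trans (*-cong (X-+ e _) (sym (σ-W′ _ (ℕP.≤-trans la (ℕP.m≤m+n a _))))) (trans (*-assoc _ _ _) (*-congˡ (trans (*-congʳ (sym (σ-X _))) (sym (σ-* _ _))))))))
      (trans (Σ∞-*ˡ (X e) hs) (*-congˡ (sym (σ-Σ∞ (lam-Summable S a lS)))))
      where
      hs : Summable (λ n → σ (X (expo S n) * W (a ℕ.+ 9 ℕ.* n)))
      hs k = mod-trans (σ-mod (lam-Summable S a lS k)) (fine σ-zero)

  lq-dissection : ∀ B C a → 1 ℕ.≤ B → 1 ℕ.≤ a →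
    lq B C a ≈ X C * σ (lam (18 ℕ.+ B) a) + X (6 ℕ.+ B ℕ.+ C) * σ (lam (30 ℕ.+ B) (3 ℕ.+ a)) + X (24 ℕ.+ (B ℕ.+ B) ℕ.+ C) * σ (lam (42 ℕ.+ B) (6 ℕ.+ a))
  lq-dissection B C a lB la = trans (Σ∞-3 hs) (+-cong (+-cong
      (piece _ C (18 ℕ.+ B) a (λ k → mod-mono (m≤3m k) (hs _)) (s≤s z≤n) la (λ m → *-cong
        (X-cong (≡.trans (NS.solve 3 (λ B C m → NS.con 6 NS.:* (NS.con 3 NS.:* m) NS.:* (NS.con 3 NS.:* m) NS.:+ B NS.:* (NS.con 3 NS.:* m) NS.:+ C NS.:= C NS.:+ NS.con 3 NS.:* (NS.con 18 NS.:* m NS.:* m NS.:+ B NS.:* m)) ≡.refl B C m)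
          (≡.cong (λ z → C ℕ.+ 3 ℕ.* z) (≡.sym (expo-closed B m)))))
        (W-cong (NS.solve 2 (λ a m → NS.con 9 NS.:* (NS.con 3 NS.:* m) NS.:+ NS.con 3 NS.:* a NS.:= NS.con 3 NS.:* (a NS.:+ NS.con 9 NS.:* m)) ≡.refl a m))))
      (piece _ (6 ℕ.+ B ℕ.+ C) (30 ℕ.+ B) (3 ℕ.+ a) (λ k → mod-mono (ℕP.m≤n⇒m≤1+n (m≤3m k)) (hs _)) (s≤s z≤n) (s≤s z≤n) (λ m → *-cong
        (X-cong (≡.trans (NS.solve 3 (λ B C m → NS.con 6 NS.:* (NS.con 1 NS.:+ NS.con 3 NS.:* m) NS.:* (NS.con 1 NS.:+ NS.con 3 NS.:* m) NS.:+ B NS.:* (NS.con 1 NS.:+ NS.con 3 NS.:* m) NS.:+ C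
              NS.:= (NS.con 6 NS.:+ B NS.:+ C) NS.:+ NS.con 3 NS.:* (NS.con 18 NS.:* m NS.:* m NS.:+ (NS.con 12 NS.:+ B) NS.:* m)) ≡.refl B C m)
          (≡.cong (λ z → 6 ℕ.+ B ℕ.+ C ℕ.+ 3 ℕ.* z) (≡.sym (expo-closed (12 ℕ.+ B) m)))))
        (W-cong (NS.solve 2 (λ a m → NS.con 9 NS.:* (NS.con 1 NS.:+ NS.con 3 NS.:* m) NS.:+ NS.con 3 NS.:* a NS.:= NS.con 3 NS.:* (NS.con 3 NS.:+ a NS.:+ NS.con 9 NS.:* m)) ≡.refl a m)))))
      (piece _ (24 ℕ.+ (B ℕ.+ B) ℕ.+ C) (42 ℕ.+ B) (6 ℕ.+ a) (λ k → mod-mono (ℕP.m≤n⇒m≤1+n (ℕP.m≤n⇒m≤1+n (m≤3m k))) (hs _)) (s≤s z≤n) (s≤s z≤n) (λ m → *-cong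
        (X-cong (≡.trans (NS.solve 3 (λ B C m → NS.con 6 NS.:* (NS.con 2 NS.:+ NS.con 3 NS.:* m) NS.:* (NS.con 2 NS.:+ NS.con 3 NS.:* m) NS.:+ B NS.:* (NS.con 2 NS.:+ NS.con 3 NS.:* m) NS.:+ C
              NS.:= (NS.con 24 NS.:+ (B NS.:+ B) NS.:+ C) NS.:+ NS.con 3 NS.:* (NS.con 18 NS.:* m NS.:* m NS.:+ (NS.con 24 NS.:+ B) NS.:* m)) ≡.refl B C m)
          (≡.cong (λ z → 24 ℕ.+ (B ℕ.+ B) ℕ.+ C ℕ.+ 3 ℕ.* z) (≡.sym (expo-closed (24 ℕ.+ B) m)))))
        (W-cong (NS.solve 2 (λ a m → NS.con 9 NS.:* (NS.con 2 NS.:+ NS.con 3 NS.:* m) NS.:+ NS.con 3 NS.:* a NS.:= NS.con 3 NS.:* (NS.con 6 NS.:+ a NS.:+ NS.con 9 NS.:* m)) ≡.refl a m)))))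
    where
    hs = lq-Summable B C a lB

  Tri : Carrier → Carrier → Carrier → Carrier → Set
  Tri f a b c = f ≈ σ a + X 1 * σ b + X 2 * σ c

  Tri-+ : ∀ {f g a b c a′ b′ c′} → Tri f a b c → Tri g a′ b′ c′ → Tri (f + g) (a + a′) (b + b′) (c + c′)
  Tri-+ p q = trans (+-cong p q) (trans (solve 8 (λ a b c d e f x y → (a :+ x :* b :+ y :* c) :+ (d :+ x :* e :+ y :* f) := (a :+ d) :+ x :* (b :+ e) :+ y :* (c :+ f)) refl _ _ _ _ _ _ _ _)
    (+-cong (+-cong (sym (σ-+ _ _)) (*-congˡ (sym (σ-+ _ _)))) (*-congˡ (sym (σ-+ _ _)))))

  Tri-neg : ∀ {g a b c} → Tri g a b c → Tri (- g) (- a) (- b) (- c)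
  Tri-neg q = trans (-‿cong q) (trans (solve 5 (λ a b c x y → :- (a :+ x :* b :+ y :* c) := :- a :+ x :* (:- b) :+ y :* (:- c)) refl _ _ _ _ _)
    (+-cong (+-cong (sym (σ-neg _)) (*-congˡ (sym (σ-neg _)))) (*-congˡ (sym (σ-neg _)))))

  Tri-minus : ∀ {f g a b c a′ b′ c′} → Tri f a b c → Tri g a′ b′ c′ → Tri (f - g) (a - a′) (b - b′) (c - c′)
  Tri-minus p q = Tri-+ p (Tri-neg q)

  Tri-cong : ∀ {f a b c a′ b′ c′} → a ≈ a′ → b ≈ b′ → c ≈ c′ → Tri f a b c → Tri f a′ b′ c′
  Tri-cong p q r h = trans h (+-cong (+-cong (σ-cong p) (*-congˡ (σ-cong q))) (*-congˡ (σ-cong r)))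

  Tri-* : ∀ {f g a b c a′ b′ c′} → Tri f a b c → Tri g a′ b′ c′ →
    Tri (f * g) (a * a′ + X 1 * (b * c′ + c * b′)) (a * b′ + b * a′ + X 1 * (c * c′)) (a * c′ + b * b′ + c * a′)
  Tri-* {a = a} {b} {c} {a′} {b′} {c′} p q = trans (*-cong p q) (trans
    (solve 8 (λ a b c a′ b′ c′ x y → (a :+ x :* b :+ y :* c) :* (a′ :+ x :* b′ :+ y :* c′)
      := (a :* a′ :+ (x :* y) :* (b :* c′ :+ c :* b′)) :+ (x :* (a :* b′ :+ b :* a′) :+ (y :* y) :* (c :* c′)) :+ (y :* (a :* c′ :+ c :* a′) :+ (x :* x) :* (b :* b′)))
      refl _ _ _ _ _ _ _ _)
    (trans (+-cong (+-cong (+-congˡ (*-congʳ x3)) (+-congˡ (*-congʳ x4))) (+-congˡ (*-congʳ x2)))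
    (trans (solve 9 (λ a b c a′ b′ c′ x y s → (a :* a′ :+ s :* (b :* c′ :+ c :* b′)) :+ (x :* (a :* b′ :+ b :* a′) :+ (x :* s) :* (c :* c′)) :+ (y :* (a :* c′ :+ c :* a′) :+ y :* (b :* b′))
        := (a :* a′ :+ s :* (b :* c′ :+ c :* b′)) :+ x :* (a :* b′ :+ b :* a′ :+ s :* (c :* c′)) :+ y :* (a :* c′ :+ b :* b′ :+ c :* a′)) refl _ _ _ _ _ _ _ _ _)
      (sym (+-cong (+-cong (trans (σ-+ _ _) (+-cong (σ-* _ _) (trans (σ-* _ _) (*-congˡ (trans (σ-+ _ _) (+-cong (σ-* _ _) (σ-* _ _)))))))
        (*-congˡ (trans (σ-+ _ _) (+-cong (trans (σ-+ _ _) (+-cong (σ-* _ _) (σ-* _ _))) (trans (σ-* _ _) (*-congˡ (σ-* _ _)))))))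
        (*-congˡ (trans (σ-+ _ _) (+-cong (trans (σ-+ _ _) (+-cong (σ-* _ _) (σ-* _ _))) (σ-* _ _)))))))))
    where
    x3 : X 1 * X 2 ≈ σ (X 1)
    x3 = trans (sym (X-+ 1 2)) (sym (σ-X 1))
    x4 : X 2 * X 2 ≈ X 1 * σ (X 1)
    x4 = trans (trans (sym (X-+ 2 2)) (X-+ 1 3)) (*-congˡ (sym (σ-X 1)))
    x2 : X 1 * X 1 ≈ X 2
    x2 = sym (X-+ 1 1)

  monomial : ∀ i e f → X (i ℕ.+ 3 ℕ.* e) * σ f ≈ X i * σ (X e * f)
  monomial i e f = trans (*-congʳ (X-+ i _)) (trans (*-assoc _ _ _) (*-congˡ (trans (*-congʳ (sym (σ-X e))) (sym (σ-* _ _)))))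

  monomial₀ : ∀ e f → X (3 ℕ.* e) * σ f ≈ σ (X e * f)
  monomial₀ e f = trans (*-congʳ (sym (σ-X e))) (sym (σ-* _ _))

  τ-Summable : ∀ c a → 1 ℕ.≤ c → 1 ℕ.≤ a → Summable (τ c a)
  τ-Summable c a lc la zero = small-zero
  τ-Summable c a lc la (suc n) = mod-trans (fine (*-comm _ _)) (*-small _ (mod-trans (mod-neg (X-small′ (≤-index c a n lc la))) (fine -0#≈0#)))

  private
    τ-3 : ∀ s r m → τ 3 s (3 ℕ.* m ℕ.+ r) ≈ τ 3 s r * σ (τ 9 (s ℕ.+ 3 ℕ.* r ℕ.+ 3) m)
    τ-3 s r zero = sym (trans (*-congˡ σ-one) (*-identityʳ _))
    τ-3 s r (suc m) = begin
      τ 3 s (3 ℕ.* suc m ℕ.+ r) ≈⟨ reflexive (≡.cong (λ z → τ 3 s (z ℕ.+ r)) (three-suc m)) ⟩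
      τ 3 s k * (- X e₀) * (- X e₁) * (- X e₂) ≈⟨ solve 4 (λ t x y z → t :* (:- x) :* (:- y) :* (:- z) := t :* (:- (x :* (y :* z)))) refl _ _ _ _ ⟩
      τ 3 s k * (- (X e₀ * (X e₁ * X e₂))) ≈⟨ *-cong (τ-3 s r m) (-‿cong (trans (sym (trans (X-+ e₀ (e₁ ℕ.+ e₂)) (*-congˡ (X-+ e₁ e₂)))) (trans (X-cong exps) (sym (σ-X _))))) ⟩
      (τ 3 s r * σ (τ 9 s′ m)) * (- σ (X (s′ ℕ.+ 9 ℕ.* m))) ≈⟨ trans (*-assoc _ _ _) (*-congˡ (trans (*-congˡ (sym (σ-neg _))) (sym (σ-* _ _)))) ⟩
      _ ∎
      where
      open R≈
      k = 3 ℕ.* m ℕ.+ r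
      s′ = s ℕ.+ 3 ℕ.* r ℕ.+ 3
      e₀ = s ℕ.+ 3 ℕ.* k
      e₁ = s ℕ.+ 3 ℕ.* suc k
      e₂ = s ℕ.+ 3 ℕ.* suc (suc k)
      exps : e₀ ℕ.+ (e₁ ℕ.+ e₂) ≡ 3 ℕ.* (s′ ℕ.+ 9 ℕ.* m)
      exps = NS.solve 3 (λ s m r → let k = NS.con 3 NS.:* m NS.:+ r in
          (s NS.:+ NS.con 3 NS.:* k) NS.:+ ((s NS.:+ NS.con 3 NS.:* (NS.con 1 NS.:+ k)) NS.:+ (s NS.:+ NS.con 3 NS.:* (NS.con 2 NS.:+ k)))
          NS.:= NS.con 3 NS.:* (s NS.:+ NS.con 3 NS.:* r NS.:+ NS.con 3 NS.:+ NS.con 9 NS.:* m)) ≡.refl s m r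

    τ-front : ∀ s m → τ 9 s (suc m) ≈ (- X s) * τ 9 (s ℕ.+ 9) m
    τ-front s m = sgn-front s m

    σΣ : ∀ {f} → Summable f → Summable (λ n → σ (f n))
    σΣ h k = mod-trans (σ-mod (h k)) (fine σ-zero)

    strip : ∀ (f : ℕ → Carrier) (g : ℕ → Carrier) y → Summable f → Summable g → (∀ m → f m ≈ y * σ (g m)) → Σ∞ f ≈ y * σ (Σ∞ g)
    strip f g y hf hg e = trans (Σ∞-cong hf (λ k → mod-trans (mod-* (fine refl) (σΣ hg k)) (fine (zeroʳ _))) e)
      (trans (Σ∞-*ˡ y (σΣ hg)) (*-congˡ (sym (σ-Σ∞ hg))))

    1≤9 : 1 ℕ.≤ 9
    1≤9 = s≤s z≤n

    suc-Summable : ∀ a → 1 ℕ.≤ a → Summable (λ n → τ 9 a (suc n))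
    suc-Summable a l k = mod-mono (ℕP.n≤1+n k) (τ-Summable 9 a 1≤9 l (suc k))

  module J₃ = JTP 2 0 1 ≡.refl
  module J₄ = JTP 8 3 4 ≡.refl
  module J₂ = JTP 8 6 1 ≡.refl
  module J₁ = JTP 8 7 0 ≡.refl

  pentagonal : Tri J₃.theta-series J₄.theta-series (- J₂.theta-series) (- J₁.theta-series)
  pentagonal = begin
    Σ∞ (λ n → τ 3 2 (suc n)) + Σ∞ (τ 3 1) ≈⟨ +-cong (Σ∞-3 h₂) (Σ∞-3 h₁) ⟩
    _ ≈⟨ +-cong (+-cong (+-cong
           (strip _ (τ 9 8) (- X 2) (λ k → mod-mono (m≤3m k) (h₂ _)) (τ-Summable 9 8 1≤9 (s≤s z≤n))
             (λ m → trans (at 2 1 m) (*-congʳ (*-identityˡ _))))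
           (strip _ (λ n → τ 9 2 (suc n)) (- X 1) (λ k → mod-mono (ℕP.m≤n⇒m≤1+n (m≤3m k)) (h₂ _)) (suc-Summable 2 (s≤s z≤n))
             (λ m → trans (at 2 2 m) (fold 2 1 _ (τ 9 11 m) (trans (solve 2 (λ x y → (:1 :* (:- x)) :* (:- y) := x :* y) refl _ _) (trans (sym (X-+ 2 5)) (trans (X-+ 1 6) (*-congˡ (sym (σ-X 2)))))) (τ-front 2 m)))))
           (strip _ (λ n → τ 9 5 (suc n)) 1# (λ k → mod-mono (ℕP.m≤n⇒m≤1+n (ℕP.m≤n⇒m≤1+n (m≤3m k))) (h₂ _)) (suc-Summable 5 (s≤s z≤n))
             (λ m → trans (at 2 3 m) (trans (*-congʳ (trans (solve 3 (λ x y z → ((:1 :* (:- x)) :* (:- y)) :* (:- z) := :- (x :* (y :* z))) refl _ _ _)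
                 (trans (-‿cong (trans (sym (trans (X-+ 2 13) (*-congˡ (X-+ 5 8)))) (sym (σ-X 5)))) (sym (σ-neg _)))))
               (trans (trans (sym (σ-* _ _)) (σ-cong (sym (τ-front 5 m)))) (sym (*-identityˡ _)))))))
         (+-cong (+-cong
           (strip _ (τ 9 4) 1# (λ k → mod-mono (m≤3m k) (h₁ _)) (τ-Summable 9 4 1≤9 (s≤s z≤n)) (λ m → at 1 0 m))
           (strip _ (τ 9 7) (- X 1) (λ k → mod-mono (ℕP.m≤n⇒m≤1+n (m≤3m k)) (h₁ _)) (τ-Summable 9 7 1≤9 (s≤s z≤n))
             (λ m → trans (at 1 1 m) (*-congʳ (*-identityˡ _)))))
           (strip _ (λ n → τ 9 1 (suc n)) (- X 2) (λ k → mod-mono (ℕP.m≤n⇒m≤1+n (ℕP.m≤n⇒m≤1+n (m≤3m k))) (h₁ _)) (suc-Summable 1 (s≤s z≤n))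
             (λ m → trans (at 1 2 m) (fold 1 2 _ (τ 9 10 m) (trans (solve 2 (λ x y → (:1 :* (:- x)) :* (:- y) := x :* y) refl _ _) (trans (sym (X-+ 1 4)) (trans (X-+ 2 3) (*-congˡ (sym (σ-X 1)))))) (τ-front 1 m))))) ⟩
    _ ≈⟨ solve 8 (λ x y a b c d e f → (((:- y) :* a :+ (:- x) :* b) :+ :1 :* c) :+ ((:1 :* d :+ (:- x) :* e) :+ (:- y) :* f)
           := (c :+ d) :+ x :* (:- (b :+ e)) :+ y :* (:- (f :+ a))) refl (X 1) (X 2) _ _ _ _ _ _ ⟩
    _ ≈⟨ sym (+-cong (+-cong (σ-+ _ _) (*-congˡ (trans (σ-neg _) (-‿cong (σ-+ _ _))))) (*-congˡ (trans (σ-neg _) (-‿cong (σ-+ _ _))))) ⟩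
    _ ∎
    where
    open R≈
    h₁ : Summable (τ 3 1)
    h₁ = τ-Summable 3 1 (s≤s z≤n) (s≤s z≤n)
    h₂ : Summable (λ n → τ 3 2 (suc n))
    h₂ k = mod-mono (ℕP.n≤1+n k) (τ-Summable 3 2 (s≤s z≤n) (s≤s z≤n) (suc k))
    at : ∀ s r m → τ 3 s (r ℕ.+ 3 ℕ.* m) ≈ τ 3 s r * σ (τ 9 (s ℕ.+ 3 ℕ.* r ℕ.+ 3) m)
    at s r m = trans (reflexive (≡.cong (τ 3 s) (ℕP.+-comm r (3 ℕ.* m)))) (τ-3 s r m)
    fold : ∀ s i y t → ∀ {t′} → y ≈ X i * σ (X s) → t′ ≈ (- X s) * t → y * σ t ≈ (- X i) * σ t′
    fold s i y t hy ht = trans (*-congʳ hy) (trans (solve 3 (λ x a b → (x :* a) :* b := (:- x) :* ((:- a) :* b)) refl _ _ _)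
      (*-congˡ (trans (*-congʳ (sym (σ-neg _))) (trans (sym (σ-* _ _)) (σ-cong (sym ht))))))

  X-merge : ∀ a b f → X a * (X b * f) ≈ X (a ℕ.+ b) * f
  X-merge a b f = trans (sym (*-assoc _ _ _)) (*-congʳ (sym (X-+ a b)))

  private
    flip : ∀ a b → theta⁻¹ a b ≈ theta⁻¹ b a
    flip a b = *-comm _ _

    pos-val : ∀ {e e′} → Res e e′ → W e * (Pr∞ 9 (9 ℕ.+ e) * Pr∞ 9 e′) ≈ (1# * X 0) * theta⁻¹ e e′
    pos-val {e} r = trans (sym (*-assoc _ _ _)) (trans (*-congʳ (Pr∞-front e (posˡ r))) (sym (trans (*-congʳ (trans (*-identityˡ _) X-zero)) (*-identityˡ _))))

    neg-val : ∀ {e e′} → Res (suc e) e′ → (1# - W (suc e)) * (Pr∞ 9 e′ * Pr∞ 9 (10 ℕ.+ e)) ≈ ((- 1#) * X (suc e)) * theta⁻¹ (suc e) e′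
    neg-val {e} {e′} r = trans (*-congʳ (U-negative e)) (trans (solve 4 (λ x w p q → (:- (x :* w)) :* (p :* q) := ((:- :1) :* x) :* ((w :* q) :* p)) refl _ _ _ _)
      (*-congˡ (*-congʳ (Pr∞-front (suc e) (posˡ r)))))

    P1 : W 1 * (Pr∞ 9 10 * Pr∞ 9 8) ≈ (1# * X 0) * iu
    P1 = pos-val r18
    P2 : W 2 * (Pr∞ 9 11 * Pr∞ 9 7) ≈ (1# * X 0) * iv
    P2 = pos-val r27
    P3 : W 3 * (Pr∞ 9 12 * Pr∞ 9 6) ≈ (1# * X 0) * id
    P3 = pos-val r36
    P4 : W 4 * (Pr∞ 9 13 * Pr∞ 9 5) ≈ (1# * X 0) * iw
    P4 = pos-val r45
    P5 : W 5 * (Pr∞ 9 14 * Pr∞ 9 4) ≈ (1# * X 0) * iw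
    P5 = trans (pos-val (swap r45)) (*-congˡ (flip 5 4))
    P6 : W 6 * (Pr∞ 9 15 * Pr∞ 9 3) ≈ (1# * X 0) * id
    P6 = trans (pos-val (swap r36)) (*-congˡ (flip 6 3))
    N1 : (1# - W 1) * (Pr∞ 9 8 * Pr∞ 9 10) ≈ ((- 1#) * X 1) * iu
    N1 = neg-val r18
    N2 : (1# - W 2) * (Pr∞ 9 7 * Pr∞ 9 11) ≈ ((- 1#) * X 2) * iv
    N2 = neg-val r27
    N3 : (1# - W 3) * (Pr∞ 9 6 * Pr∞ 9 12) ≈ ((- 1#) * X 3) * id
    N3 = neg-val r36
    N4 : (1# - W 4) * (Pr∞ 9 5 * Pr∞ 9 13) ≈ ((- 1#) * X 4) * iw
    N4 = neg-val r45
    N5 : (1# - W 5) * (Pr∞ 9 4 * Pr∞ 9 14) ≈ ((- 1#) * X 5) * iw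
    N5 = trans (neg-val (swap r45)) (*-congˡ (flip 5 4))
    N6 : (1# - W 6) * (Pr∞ 9 3 * Pr∞ 9 15) ≈ ((- 1#) * X 6) * id
    N6 = trans (neg-val (swap r36)) (*-congˡ (flip 6 3))

    collect : ∀ k₁ k₂ k₃ s₁ s₂ s₃ p₁ p₂ p₃ l →
      (J⁻² * (((s₁ * X k₁) * p₁) * (((s₂ * X k₂) * p₂) * ((s₃ * X k₃) * p₃)))) * l ≈ (J⁻² * (p₁ * (p₂ * p₃))) * ((s₁ * (s₂ * s₃)) * (X (k₁ ℕ.+ (k₂ ℕ.+ k₃)) * l))
    collect k₁ k₂ k₃ s₁ s₂ s₃ p₁ p₂ p₃ l = trans
      (solve 11 (λ j s₁ s₂ s₃ x₁ x₂ x₃ p₁ p₂ p₃ l → (j :* (((s₁ :* x₁) :* p₁) :* (((s₂ :* x₂) :* p₂) :* ((s₃ :* x₃) :* p₃)))) :* l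
        := (j :* (p₁ :* (p₂ :* p₃))) :* ((s₁ :* (s₂ :* s₃)) :* ((x₁ :* (x₂ :* x₃)) :* l))) refl J⁻² s₁ s₂ s₃ (X k₁) (X k₂) (X k₃) p₁ p₂ p₃ l)
      (*-congˡ (*-congˡ (*-congʳ (sym (trans (X-+ k₁ _) (*-congˡ (X-+ k₂ k₃)))))))

    collect′ : ∀ e k₁ k₂ k₃ s₁ s₂ s₃ p₁ p₂ p₃ l →
      X e * ((J⁻² * (((s₁ * X k₁) * p₁) * (((s₂ * X k₂) * p₂) * ((s₃ * X k₃) * p₃)))) * l) ≈ (J⁻² * (p₁ * (p₂ * p₃))) * ((s₁ * (s₂ * s₃)) * (X (e ℕ.+ (k₁ ℕ.+ (k₂ ℕ.+ k₃))) * l))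
    collect′ e k₁ k₂ k₃ s₁ s₂ s₃ p₁ p₂ p₃ l = trans (*-congˡ (collect k₁ k₂ k₃ s₁ s₂ s₃ p₁ p₂ p₃ l))
      (trans (solve 4 (λ x c s m → x :* (c :* (s :* m)) := c :* (s :* (x :* m))) refl _ _ _ _) (*-congˡ (*-congˡ (X-merge e _ l))))

    collect-D : ∀ e k₂ k₃ s₂ s₃ t p₂ p₃ l →
      X e * ((J⁻² * (t * (((s₂ * X k₂) * p₂) * ((s₃ * X k₃) * p₃)))) * l) ≈ (J⁻² * (t * (p₂ * p₃))) * ((s₂ * s₃) * (X (e ℕ.+ (k₂ ℕ.+ k₃)) * l))
    collect-D e k₂ k₃ s₂ s₃ t p₂ p₃ l = trans
      (solve 10 (λ y j s₂ s₃ x₂ x₃ t p₂ p₃ l → y :* ((j :* (t :* (((s₂ :* x₂) :* p₂) :* ((s₃ :* x₃) :* p₃)))) :* l)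
        := (j :* (t :* (p₂ :* p₃))) :* ((s₂ :* s₃) :* ((y :* (x₂ :* x₃)) :* l))) refl (X e) J⁻² s₂ s₃ (X k₂) (X k₃) t p₂ p₃ l)
      (*-congˡ (*-congˡ (*-congʳ (sym (trans (X-+ e _) (*-congˡ (X-+ k₂ k₃)))))))

  eval-R : ∀ {a₀ b₀ a₁ b₁ a₂ b₂ a₃ b₃} (r₀ : Res a₀ b₀) (r₁ : Res a₁ b₁) (r₂ : Res a₂ b₂) (r₃ : Res a₃ b₃) {s₁ s₂ s₃ t₁ t₂ t₃ p₁ p₂ p₃ q₁ q₂ q₃ k₁ k₂ k₃ l₁ l₂ l₃} →
    cc a₁ b₁ a₀ b₀ ≈ (s₁ * X k₁) * p₁ → cc a₂ b₂ a₀ b₀ ≈ (s₂ * X k₂) * p₂ → cc a₃ b₃ a₀ b₀ ≈ (s₃ * X k₃) * p₃ →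
    cc b₁ a₁ b₀ a₀ ≈ (t₁ * X l₁) * q₁ → cc b₂ a₂ b₀ a₀ ≈ (t₂ * X l₂) * q₂ → cc b₃ a₃ b₀ a₀ ≈ (t₃ * X l₃) * q₃ →
    block-R r₀ r₁ r₂ r₃ ≈
      (J⁻² * (p₁ * (p₂ * p₃))) * ((s₁ * (s₂ * s₃)) * (X (k₁ ℕ.+ (k₂ ℕ.+ k₃)) * lam (9 ℕ.+ (b₁ ℕ.+ a₀) ℕ.+ (b₂ ℕ.+ a₀) ℕ.+ (b₃ ℕ.+ a₀) ℕ.+ 0) a₀))
      + (J⁻² * (q₁ * (q₂ * q₃))) * ((t₁ * (t₂ * t₃)) * (X (b₀ ℕ.+ (l₁ ℕ.+ (l₂ ℕ.+ l₃))) * lam (9 ℕ.+ (a₁ ℕ.+ b₀) ℕ.+ (a₂ ℕ.+ b₀) ℕ.+ (a₃ ℕ.+ b₀) ℕ.+ 9) b₀))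
  eval-R {b₀ = b₀} r₀ r₁ r₂ r₃ {k₁ = k₁} {k₂} {k₃} {l₁} {l₂} {l₃} h₁ h₂ h₃ g₁ g₂ g₃ = +-cong
    (trans (*-congʳ (*-congˡ (*-cong h₁ (*-cong h₂ h₃)))) (collect k₁ k₂ k₃ _ _ _ _ _ _ _))
    (trans (*-congˡ (*-congʳ (*-congˡ (*-cong g₁ (*-cong g₂ g₃))))) (collect′ b₀ l₁ l₂ l₃ _ _ _ _ _ _ _))

  eval-D : ∀ {a₁ b₁ a₂ b₂ a₃ b₃} (r₁ : Res a₁ b₁) (r₂ : Res a₂ b₂) (r₃ : Res a₃ b₃) {t s₂ s₃ t₂ t₃ p₂ p₃ q₂ q₃ k₂ k₃ l₂ l₃} →
    theta⁻¹ a₁ b₁ ≈ t → cc a₂ b₂ a₁ b₁ ≈ (s₂ * X k₂) * p₂ → cc a₃ b₃ a₁ b₁ ≈ (s₃ * X k₃) * p₃ →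
    cc b₂ a₂ b₁ a₁ ≈ (t₂ * X l₂) * q₂ → cc b₃ a₃ b₁ a₁ ≈ (t₃ * X l₃) * q₃ →
    block-D r₁ r₂ r₃ ≈
      (J⁻² * (t * (p₂ * p₃))) * ((s₂ * s₃) * (X (a₁ ℕ.+ (k₂ ℕ.+ k₃)) * lam (9 ℕ.+ a₁ ℕ.+ (b₂ ℕ.+ a₁) ℕ.+ (b₃ ℕ.+ a₁) ℕ.+ 9) a₁))
      - (J⁻² * (t * (q₂ * q₃))) * ((t₂ * t₃) * (X (b₁ ℕ.+ (l₂ ℕ.+ l₃)) * lam (9 ℕ.+ b₁ ℕ.+ (a₂ ℕ.+ b₁) ℕ.+ (a₃ ℕ.+ b₁) ℕ.+ 9) b₁))
  eval-D {a₁} {b₁} r₁ r₂ r₃ {k₂ = k₂} {k₃} {l₂} {l₃} ht h₂ h₃ g₂ g₃ = +-cong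
    (trans (*-congˡ (*-congʳ (*-congˡ (*-cong (trans (flip b₁ a₁) ht) (*-cong h₂ h₃))))) (collect-D a₁ k₂ k₃ _ _ _ _ _ _))
    (-‿cong (trans (*-congˡ (*-congʳ (*-congˡ (*-cong ht (*-cong g₂ g₃))))) (collect-D b₁ l₂ l₃ _ _ _ _ _ _)))

  eval-D₀ : ∀ {a₁ b₁ a₂ b₂ a₃ b₃} (r₁ : Res a₁ b₁) (r₂ : Res a₂ b₂) (r₃ : Res a₃ b₃) {t₁ t₂ t₃} → theta⁻¹ a₁ b₁ ≈ t₁ → theta⁻¹ a₂ b₂ ≈ t₂ → theta⁻¹ a₃ b₃ ≈ t₃ →
    block-D₀ r₁ r₂ r₃ ≈ (J⁻² * (t₁ * (t₂ * t₃))) * (X (9 ℕ.+ a₁ ℕ.+ a₂ ℕ.+ a₃) * lam (9 ℕ.+ a₁ ℕ.+ a₂ ℕ.+ a₃ ℕ.+ 36) 9 - X (9 ℕ.+ b₁ ℕ.+ b₂ ℕ.+ b₃) * lam (9 ℕ.+ b₁ ℕ.+ b₂ ℕ.+ b₃ ℕ.+ 36) 9)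
  eval-D₀ {a₁} {b₁} {a₂} {b₂} {a₃} {b₃} r₁ r₂ r₃ h₁ h₂ h₃ = trans (+-cong (-‿cong (*-congˡ (*-congʳ (*-congˡ (*-cong h₁ (*-cong h₂ h₃))))))
      (-‿cong (-‿cong (*-congˡ (*-congʳ (*-congˡ (*-cong (trans (flip b₁ a₁) h₁) (*-cong (trans (flip b₂ a₂) h₂) (trans (flip b₃ a₃) h₃)))))))))
    (solve 5 (λ x c l y m → :- (x :* (c :* l)) :- (:- (y :* (c :* m))) := c :* (y :* m :- x :* l)) refl _ _ _ _ _)

  -- The monomial multiple q^k Σ q^(18n² + Bn)/(1 - q^(9n + a)).
  m : ℕ → ℕ → ℕ → Carrier
  m k B a = X k * lam (18 ℕ.+ B) a

  Xs Ys : Carrier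
  Xs = m 8 26 6 - m 3 19 3 - m 0 10 2 + m 15 35 7
  Ys = m 0 16 3 - m 8 29 6 - m 2 20 4 + m 5 25 5

  J² : Carrier
  J² = Po∞ 9 9 * Po∞ 9 9

  private

    J-inv : J² * J⁻² ≈ 1#
    J-inv = trans (solve 2 (λ a b → (a :* a) :* (b :* b) := (a :* b) :* (a :* b)) refl _ _) (trans (*-cong (Po*Pr 9 (s≤s z≤n)) (Po*Pr 9 (s≤s z≤n))) (*-identityˡ 1#))

    hu : u * iu ≈ 1#
    hu = Th-inv r18
    hv : v * iv ≈ 1#
    hv = Th-inv r27
    hd : d * id ≈ 1#
    hd = Th-inv r36
    hw : w * iw ≈ 1#
    hw = Th-inv r45

    one : ∀ {a b} → a * b ≈ 1# → ∀ f → (a * b) * f ≈ f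
    one h f = trans (*-congʳ h) (*-identityˡ f)

    expansion-A : id * iw * iv * id ≈ J⁻² * ((iu * (iv * id)) * (m 11 31 6 - m 1 14 3 + m 5 22 5 - m 5 23 4) - (iu * (id * iw)) * Xs)
    expansion-A = trans (*-cong (*-congʳ (*-congˡ (flip 4 5))) (flip 3 6))
      (trans (expansion r36 (swap r45) r27 (swap r36) (λ ()) (λ ()) (λ ()) (λ ()) (λ ()) (λ ()))
      (trans (+-cong (+-cong (+-cong (eval-R r36 (swap r45) r27 (swap r36) P2 N1 P3 N2 P1 N3) (eval-R (swap r45) r36 r27 (swap r36) N2 N3 P1 P2 P3 N1))
                             (eval-R r27 r36 (swap r45) (swap r36) P1 P3 P4 N1 N3 N4)) (eval-R (swap r36) r36 (swap r45) r27 N3 N1 N4 P3 P1 P4))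
        (solve 13 (λ j u v d w a b c e f g h k →
          ((((j :* (v :* (u :* d))) :* ((:1 :* ((:- :1) :* :1)) :* a) :+ (j :* (v :* (u :* d))) :* (((:- :1) :* (:1 :* (:- :1))) :* b))
            :+ ((j :* (v :* (d :* u))) :* (((:- :1) :* ((:- :1) :* :1)) :* c) :+ (j :* (v :* (d :* u))) :* ((:1 :* (:1 :* (:- :1))) :* e)))
            :+ ((j :* (u :* (d :* w))) :* ((:1 :* (:1 :* :1)) :* f) :+ (j :* (u :* (d :* w))) :* (((:- :1) :* ((:- :1) :* (:- :1))) :* g)))
            :+ ((j :* (d :* (u :* w))) :* (((:- :1) :* ((:- :1) :* (:- :1))) :* h) :+ (j :* (d :* (u :* w))) :* ((:1 :* (:1 :* :1)) :* k))
          := j :* ((u :* (v :* d)) :* (b :- a :+ c :- e) :- (u :* (d :* w)) :* (h :- k :- f :+ g)))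
          refl J⁻² iu iv id iw (m 1 14 3) (m 11 31 6) (m 5 22 5) (m 5 23 4) (m 0 10 2) (m 15 35 7) (m 8 26 6) (m 3 19 3))))

  private
    expansion-B : iu * id * id * iw ≈ J⁻² * ((iv * (id * iw)) * (m 0 8 1 - m 18 37 8 - m 10 28 6 + m 3 17 3) - (iu * (iv * id)) * (m 2 16 3 - m 10 29 6 - m 4 20 4 + m 7 25 5))
    expansion-B = trans (*-congʳ (*-congʳ (*-congˡ (flip 3 6))))
      (trans (expansion r18 (swap r36) r36 r45 (λ ()) (λ ()) (λ ()) (λ ()) (λ ()) (λ ()))
      (trans (+-cong (+-cong (+-cong (eval-R r18 (swap r36) r36 r45 P5 P2 P3 N5 N2 N3) (eval-R (swap r36) r18 r36 r45 N5 N3 N2 P5 P3 P2))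
                             (eval-R r36 r18 (swap r36) r45 N2 P3 P1 P2 N3 N1)) (eval-R r45 r18 (swap r36) r36 N3 P2 N1 P3 N2 P1))
        (solve 13 (λ j u v d w a b c e f g h k →
          ((((j :* (w :* (v :* d))) :* ((:1 :* (:1 :* :1)) :* a) :+ (j :* (w :* (v :* d))) :* (((:- :1) :* ((:- :1) :* (:- :1))) :* b))
            :+ ((j :* (w :* (d :* v))) :* (((:- :1) :* ((:- :1) :* (:- :1))) :* c) :+ (j :* (w :* (d :* v))) :* ((:1 :* (:1 :* :1)) :* e)))
            :+ ((j :* (v :* (d :* u))) :* (((:- :1) :* (:1 :* :1)) :* f) :+ (j :* (v :* (d :* u))) :* ((:1 :* ((:- :1) :* (:- :1))) :* g)))
            :+ ((j :* (d :* (v :* u))) :* (((:- :1) :* (:1 :* (:- :1))) :* h) :+ (j :* (d :* (v :* u))) :* ((:1 :* ((:- :1) :* :1)) :* k))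
          := j :* ((v :* (d :* w)) :* (a :- b :- c :+ e) :- (u :* (v :* d)) :* (f :- g :- h :+ k)))
          refl J⁻² iu iv id iw (m 0 8 1) (m 18 37 8) (m 10 28 6) (m 3 17 3) (m 2 16 3) (m 10 29 6) (m 4 20 4) (m 7 25 5))))

    expansion-C : J⁻² * ((iu * (iv * id)) * ((rho 8 - rho 1) + (rho 2 - rho 7) + (rho 6 - rho 3)))
      ≈ J⁻² * ((iv * (id * iw)) * (m 2 10 2 - m 17 35 7 - m 10 26 6 + m 5 19 3) - (iu * (iv * id)) * (m 20 38 9 - m 25 43 9 - m 16 34 8 + m 1 11 1))
    expansion-C = trans (trans (solve 5 (λ j a b c s → j :* ((a :* (b :* c)) :* s) := j :* a :* b :* c :* s) refl _ _ _ _ _)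
        (*-congʳ (*-cong (*-congʳ (*-congˡ (flip 1 8))) (flip 3 6))))
      (trans (degenerate-expansion (swap r18) r27 (swap r36) (λ ()) (λ ()) (λ ()) (λ ()) (λ ()) (λ ()))
      (trans (+-cong (+-cong (+-cong (eval-D₀ (swap r18) r27 (swap r36) (flip 8 1) refl (flip 6 3)) (eval-D (swap r18) r27 (swap r36) (flip 8 1) N6 N2 P6 P2))
                             (eval-D r27 (swap r18) (swap r36) refl P6 P4 N6 N4)) (eval-D (swap r36) (swap r18) r27 (flip 6 3) P2 N4 N2 P4))
        (solve 13 (λ j u v d w a b c e f g h k →
          (((j :* (u :* (v :* d))) :* (b :- a)
            :+ ((j :* (u :* (d :* v))) :* (((:- :1) :* (:- :1)) :* c) :- (j :* (u :* (d :* v))) :* ((:1 :* :1) :* e)))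
            :+ ((j :* (v :* (d :* w))) :* ((:1 :* :1) :* f) :- (j :* (v :* (d :* w))) :* (((:- :1) :* (:- :1)) :* g)))
            :+ ((j :* (d :* (v :* w))) :* ((:1 :* (:- :1)) :* h) :- (j :* (d :* (v :* w))) :* (((:- :1) :* :1) :* k))
          := j :* ((v :* (d :* w)) :* (f :- g :- h :+ k) :- (u :* (v :* d)) :* (a :- b :- c :+ e)))
          refl J⁻² iu iv id iw (m 20 38 9) (m 25 43 9) (m 16 34 8) (m 1 11 1) (m 2 10 2) (m 17 35 7) (m 10 26 6) (m 5 19 3))))

    expansion-D : J⁻² * ((iv * (id * iw)) * ((rho 7 - rho 2) + (rho 3 - rho 6) + (rho 4 - rho 5)))
      ≈ J⁻² * ((iu * (id * iw)) * (m 3 16 3 - m 11 29 6 - m 5 20 4 + m 8 25 5) - (iv * (id * iw)) * (m 22 40 9 - m 23 41 9 - m 14 32 7 + m 2 13 2))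
    expansion-D = trans (trans (solve 5 (λ j a b c s → j :* ((a :* (b :* c)) :* s) := j :* a :* b :* c :* s) refl _ _ _ _ _)
        (*-congʳ (*-congʳ (*-congʳ (*-congˡ (flip 2 7))))))
      (trans (degenerate-expansion (swap r27) r36 r45 (λ ()) (λ ()) (λ ()) (λ ()) (λ ()) (λ ()))
      (trans (+-cong (+-cong (+-cong (eval-D₀ (swap r27) r36 r45 (flip 7 2) refl refl) (eval-D (swap r27) r36 r45 (flip 7 2) N4 N3 P4 P3))
                             (eval-D r36 (swap r27) r45 refl P4 P1 N4 N1)) (eval-D r45 (swap r27) r36 refl P3 N1 N3 P1))
        (solve 13 (λ j u v d w a b c e f g h k →
          (((j :* (v :* (d :* w))) :* (b :- a)
            :+ ((j :* (v :* (w :* d))) :* (((:- :1) :* (:- :1)) :* c) :- (j :* (v :* (w :* d))) :* ((:1 :* :1) :* e)))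
            :+ ((j :* (d :* (w :* u))) :* ((:1 :* :1) :* f) :- (j :* (d :* (w :* u))) :* (((:- :1) :* (:- :1)) :* g)))
            :+ ((j :* (w :* (d :* u))) :* ((:1 :* (:- :1)) :* h) :- (j :* (w :* (d :* u))) :* (((:- :1) :* :1) :* k))
          := j :* ((u :* (d :* w)) :* (f :- g :- h :+ k) :- (v :* (d :* w)) :* (a :- b :- c :+ e)))
          refl J⁻² iu iv id iw (m 22 40 9) (m 23 41 9) (m 14 32 7) (m 2 13 2) (m 3 16 3) (m 11 29 6) (m 5 20 4) (m 8 25 5))))

    shift : ∀ k a b c e A B C D′ α β′ γ δ → X k * (m a A α - m b B β′ - m c C γ + m e D′ δ)
      ≈ m (k ℕ.+ a) A α - m (k ℕ.+ b) B β′ - m (k ℕ.+ c) C γ + m (k ℕ.+ e) D′ δ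
    shift k a b c e A B C D′ α β′ γ δ = trans (solve 5 (λ x a b c e → x :* (a :- b :- c :+ e) := x :* a :- x :* b :- x :* c :+ x :* e) refl _ _ _ _ _)
      (+-cong (+-cong (+-cong (X-merge k a _) (-‿cong (X-merge k b _))) (-‿cong (X-merge k c _))) (X-merge k e _))

  shift-Xs : ∀ k → X k * Xs ≈ m (k ℕ.+ 8) 26 6 - m (k ℕ.+ 3) 19 3 - m (k ℕ.+ 0) 10 2 + m (k ℕ.+ 15) 35 7
  shift-Xs k = shift k 8 3 0 15 26 19 10 35 6 3 2 7

  shift-Ys : ∀ k → X k * Ys ≈ m (k ℕ.+ 0) 16 3 - m (k ℕ.+ 8) 29 6 - m (k ℕ.+ 2) 20 4 + m (k ℕ.+ 5) 25 5
  shift-Ys k = shift k 0 8 2 5 16 29 20 25 3 6 4 5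

  private
    unit : ∀ x y z ix iy iz → x * ix ≈ 1# → y * iy ≈ 1# → z * iz ≈ 1# → ∀ f → (J² * (x * (y * z))) * (J⁻² * ((ix * (iy * iz)) * f)) ≈ f
    unit x y z ix iy iz hx hy hz f = trans (solve 9 (λ j i x y z a b c f → (j :* (x :* (y :* z))) :* (i :* ((a :* (b :* c)) :* f)) := (j :* i) :* ((x :* a) :* ((y :* b) :* ((z :* c) :* f)))) refl _ _ _ _ _ _ _ _ _)
      (trans (one J-inv _) (trans (one hx _) (trans (one hy _) (one hz _))))

    unit₂ : ∀ x y z iy iz t → y * iy ≈ 1# → z * iz ≈ 1# → ∀ f → (J² * (x * (y * z))) * (J⁻² * ((iy * (iz * t)) * f)) ≈ (x * t) * f
    unit₂ x y z iy iz t hy hz f = trans (solve 9 (λ j i x y z b c tf f → (j :* (x :* (y :* z))) :* (i :* ((b :* (c :* tf)) :* f)) := (j :* i) :* ((y :* b) :* ((z :* c) :* ((x :* tf) :* f)))) refl J² J⁻² x y z iy iz t f)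
      (trans (one J-inv _) (trans (one hy _) (one hz _)))

  relation-A : m 11 31 6 - m 1 14 3 + m 5 22 5 - m 5 23 4 ≈ (v * iw) * Xs + J² * (u * (id * iw))
  relation-A = begin
    f ≈⟨ sym (unit u v d iu iv id hu hv hd f) ⟩
    F * (J⁻² * ((iu * (iv * id)) * f)) ≈⟨ solve 5 (λ F j a b e → F :* (j :* a) := F :* (j :* (a :- b)) :+ F :* (j :* b)) refl F J⁻² _ ((iu * (id * iw)) * Xs) 0# ⟩
    F * (J⁻² * ((iu * (iv * id)) * f - (iu * (id * iw)) * Xs)) + F * (J⁻² * ((iu * (id * iw)) * Xs))
      ≈⟨ +-cong (trans (*-congˡ (sym expansion-A)) (trans (solve 8 (λ j u v d a b c e → (j :* (u :* (v :* d))) :* (c :* e :* b :* c) := (v :* b) :* ((d :* c) :* (j :* (u :* (c :* e))))) refl J² u v d iu iv id iw) (trans (one hv _) (one hd _))))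
           (trans (*-congʳ (*-congˡ (solve 3 (λ a b c → a :* (b :* c) := b :* (a :* c)) refl u v d))) (unit₂ v u d iu id iw hu hd Xs)) ⟩
    J² * (u * (id * iw)) + (v * iw) * Xs ≈⟨ +-comm _ _ ⟩
    _ ∎
    where
    open R≈
    F = J² * (u * (v * d))
    f = m 11 31 6 - m 1 14 3 + m 5 22 5 - m 5 23 4

  relation-B : m 0 8 1 - m 18 37 8 - m 10 28 6 + m 3 17 3 ≈ (w * iu) * (X 2 * Ys) + J² * (v * (iu * id))
  relation-B = begin
    f ≈⟨ sym (unit v d w iv id iw hv hd hw f) ⟩
    F * (J⁻² * ((iv * (id * iw)) * f)) ≈⟨ solve 4 (λ F j a b → F :* (j :* a) := F :* (j :* (a :- b)) :+ F :* (j :* b)) refl F J⁻² _ ((iu * (iv * id)) * (X 2 * Ys)) ⟩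
    F * (J⁻² * ((iv * (id * iw)) * f - (iu * (iv * id)) * (X 2 * Ys))) + F * (J⁻² * ((iu * (iv * id)) * (X 2 * Ys)))
      ≈⟨ +-cong (trans (*-congˡ (trans (*-congˡ (+-congˡ (-‿cong (*-congˡ (shift-Ys 2))))) (sym expansion-B)))
                  (trans (solve 8 (λ j v d w a b c e → (j :* (v :* (d :* w))) :* (a :* c :* c :* e) := (d :* c) :* ((w :* e) :* (j :* (v :* (a :* c))))) refl J² v d w iu iv id iw) (trans (one hd _) (one hw _))))
           (trans (*-cong (*-congˡ (solve 3 (λ a b c → a :* (b :* c) := c :* (a :* b)) refl v d w)) (*-congˡ (*-congʳ (solve 3 (λ a b c → a :* (b :* c) := b :* (c :* a)) refl iu iv id)))) (unit₂ w v d iv id iu hv hd _)) ⟩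
    J² * (v * (iu * id)) + (w * iu) * (X 2 * Ys) ≈⟨ +-comm _ _ ⟩
    _ ∎
    where
    open R≈
    F = J² * (v * (d * w))
    f = m 0 8 1 - m 18 37 8 - m 10 28 6 + m 3 17 3

  relation-C : m 20 38 9 - m 25 43 9 - m 16 34 8 + m 1 11 1 ≈ - ((rho 8 - rho 1) + (rho 2 - rho 7) + (rho 6 - rho 3)) - (u * iw) * (X 2 * Xs)
  relation-C = begin
    f ≈⟨ solve 3 (λ f r y → f := :- (y :- f) :+ y) refl f 0# y ⟩
    - (y - f) + y ≈⟨ +-cong (-‿cong (trans (+-cong (sym (unit₂ u v d iv id iw hv hd y′)) (-‿cong (sym (unit u v d iu iv id hu hv hd f))))
        (trans (solve 4 (λ F j a b → F :* (j :* a) :- F :* (j :* b) := F :* (j :* (a :- b))) refl F J⁻² _ _) (trans (*-congˡ (sym expansion-C)) (unit u v d iu iv id hu hv hd _)))))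
        (*-congˡ neg) ⟩
    - r + (u * iw) * (- (X 2 * Xs)) ≈⟨ +-congˡ (sym (-‿distribʳ-* _ _)) ⟩
    _ ∎
    where
    open R≈
    F = J² * (u * (v * d))
    f = m 20 38 9 - m 25 43 9 - m 16 34 8 + m 1 11 1
    r = (rho 8 - rho 1) + (rho 2 - rho 7) + (rho 6 - rho 3)
    y′ = m 2 10 2 - m 17 35 7 - m 10 26 6 + m 5 19 3
    y = (u * iw) * y′
    neg : y′ ≈ - (X 2 * Xs)
    neg = trans (solve 4 (λ a b c e → a :- b :- c :+ e := :- (c :- e :- a :+ b)) refl _ _ _ _) (-‿cong (sym (shift-Xs 2)))

  relation-D : m 22 40 9 - m 23 41 9 - m 14 32 7 + m 2 13 2 ≈ - ((rho 7 - rho 2) + (rho 3 - rho 6) + (rho 4 - rho 5)) + (v * iu) * (X 3 * Ys)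
  relation-D = begin
    f ≈⟨ solve 2 (λ f y → f := :- (y :- f) :+ y) refl f y ⟩
    - (y - f) + y ≈⟨ +-cong (-‿cong (trans (+-cong (sym (trans (*-congˡ (*-congˡ (*-congʳ (solve 3 (λ a b c → a :* (b :* c) := b :* (c :* a)) refl iu id iw)))) (unit₂ v d w id iw iu hd hw y′))) (-‿cong (sym (unit v d w iv id iw hv hd hw f))))
        (trans (solve 4 (λ F j a b → F :* (j :* a) :- F :* (j :* b) := F :* (j :* (a :- b))) refl F J⁻² _ _) (trans (*-congˡ (sym expansion-D)) (unit v d w iv id iw hv hd hw _)))))
        (*-congˡ (sym (shift-Ys 3))) ⟩
    _ ∎
    where
    open R≈
    F = J² * (v * (d * w))
    f = m 22 40 9 - m 23 41 9 - m 14 32 7 + m 2 13 2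
    y′ = m 3 16 3 - m 11 29 6 - m 5 20 4 + m 8 25 5
    y = (v * iu) * y′

  Po*Pr-any : ∀ c s → 1 ℕ.≤ c → 1 ℕ.≤ s → Po∞ c s * Pr∞ c s ≈ 1#
  Po*Pr-any c s lc ls = separated λ M → mod-trans (mod-sym (mod-* (Po-≈ c s lc ls M M ℕP.≤-refl) (Pr-≈ c s lc ls M M ℕP.≤-refl)))
    (fine (trans (sym (Π-* M _ _)) (trans (Π-cong M (λ j → inv _ (ℕP.≤-trans (s≤s z≤n) (≤-index c s j lc ls)))) (Π-one M))))
    where
    inv : ∀ e → 1 ℕ.≤ e → (1# - X e) * W e ≈ 1#
    inv (suc e) _ = W-inv e

  Po-3 : ∀ c s m → Po c s (3 ℕ.* m) ≈ Po (3 ℕ.* c) s m * Po (3 ℕ.* c) (s ℕ.+ c) m * Po (3 ℕ.* c) (s ℕ.+ c ℕ.+ c) m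
  Po-3 c s zero = solve 0 (:1 := :1 :* :1 :* :1) refl
  Po-3 c s (suc m) = trans (reflexive (≡.cong (Po c s) (ℕP.*-suc 3 m))) (trans
    (*-cong (*-cong (*-cong (Po-3 c s m)
      (fac (NS.solve 3 (λ c s m → s NS.:+ c NS.:* (NS.con 3 NS.:* m) NS.:= s NS.:+ NS.con 3 NS.:* c NS.:* m) ≡.refl c s m)))
      (fac (NS.solve 3 (λ c s m → s NS.:+ c NS.:* (NS.con 1 NS.:+ NS.con 3 NS.:* m) NS.:= s NS.:+ c NS.:+ NS.con 3 NS.:* c NS.:* m) ≡.refl c s m)))
      (fac (NS.solve 3 (λ c s m → s NS.:+ c NS.:* (NS.con 2 NS.:+ NS.con 3 NS.:* m) NS.:= s NS.:+ c NS.:+ c NS.:+ NS.con 3 NS.:* c NS.:* m) ≡.refl c s m)))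
    (solve 6 (λ a b c x y z → a :* b :* c :* x :* y :* z := (a :* x) :* (b :* y) :* (c :* z)) refl _ _ _ _ _ _))
    where
    fac : ∀ {a b} → a ≡ b → 1# - X a ≈ 1# - X b
    fac e = +-congˡ (-‿cong (X-cong e))

  Po∞-3 : ∀ c s → 1 ℕ.≤ c → 1 ℕ.≤ s → Po∞ c s ≈ Po∞ (3 ℕ.* c) s * Po∞ (3 ℕ.* c) (s ℕ.+ c) * Po∞ (3 ℕ.* c) (s ℕ.+ c ℕ.+ c)
  Po∞-3 c s lc ls = separated λ M → mod-trans (mod-sym (Po-≈ c s lc ls M (3 ℕ.* M) (ℕP.m≤m+n M _))) (mod-trans (fine (Po-3 c s M))
    (mod-* (mod-* (Po-≈ (3 ℕ.* c) s l3 ls M M ℕP.≤-refl) (Po-≈ (3 ℕ.* c) (s ℕ.+ c) l3 (ℕP.≤-trans ls (ℕP.m≤m+n s c)) M M ℕP.≤-refl))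
      (Po-≈ (3 ℕ.* c) (s ℕ.+ c ℕ.+ c) l3 (ℕP.≤-trans ls (ℕP.≤-trans (ℕP.m≤m+n s c) (ℕP.m≤m+n _ c))) M M ℕP.≤-refl)))
    where
    l3 : 1 ℕ.≤ 3 ℕ.* c
    l3 = ℕP.≤-trans lc (ℕP.m≤m+n c _)

  J iJ QQ iQQ : Carrier
  J = Po∞ 9 9
  iJ = Pr∞ 9 9
  QQ = Po∞ 1 1
  iQQ = iJ * (iu * (iv * (id * iw)))

  private
    1≤suc : ∀ {n} → 1 ℕ.≤ suc n
    1≤suc = s≤s z≤n

    hJ : J * iJ ≈ 1#
    hJ = Po*Pr 9 1≤suc

  QQ-product : QQ ≈ J * (u * (v * (d * w)))
  QQ-product = trans (Po∞-3 1 1 1≤suc 1≤suc) (trans (*-cong (*-cong (Po∞-3 3 1 1≤suc 1≤suc) (Po∞-3 3 2 1≤suc 1≤suc)) (Po∞-3 3 3 1≤suc 1≤suc))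
    (solve 9 (λ p1 p4 p7 p2 p5 p8 p3 p6 p9 → (p1 :* p4 :* p7) :* (p2 :* p5 :* p8) :* (p3 :* p6 :* p9)
      := p9 :* ((p1 :* p8) :* ((p2 :* p7) :* ((p3 :* p6) :* (p4 :* p5))))) refl _ _ _ _ _ _ _ _ _))

  QQ-inv : QQ * iQQ ≈ 1#
  QQ-inv = trans (*-congʳ QQ-product) (trans (solve 10 (λ j u v d w ij iu iv id iw → (j :* (u :* (v :* (d :* w)))) :* (ij :* (iu :* (iv :* (id :* iw))))
      := (j :* ij) :* ((u :* iu) :* ((v :* iv) :* ((d :* id) :* (w :* iw))))) refl J u v d w iJ iu iv id iw)
    (trans (one hJ _) (trans (one hu _) (trans (one hv _) (trans (one hd _) hw)))))

  private
    strip-J : ∀ c s t θ → 1 ℕ.≤ c → 1 ℕ.≤ s → t ≈ Pr∞ c s * θ → Po∞ c s * t ≈ θ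
    strip-J c s t θ lc ls h = trans (*-congˡ h) (trans (sym (*-assoc _ _ _)) (one (Po*Pr-any c s lc ls) θ))

  QQ-dissection : Tri QQ (J * w) (- (J * v)) (- (J * u))
  QQ-dissection = Tri-cong
    (sym (strip-J 9 9 w _ 1≤suc 1≤suc J₄.triple-product))
    (-‿cong (sym (strip-J 9 9 v _ 1≤suc 1≤suc (trans (*-comm _ _) J₂.triple-product))))
    (-‿cong (sym (strip-J 9 9 u _ 1≤suc 1≤suc (trans (*-comm _ _) J₁.triple-product))))
    (trans (trans (Po∞-3 1 1 1≤suc 1≤suc) (trans (*-comm _ _) (strip-J 3 3 _ _ 1≤suc 1≤suc J₃.triple-product))) pentagonal)

  qsum : Carrier
  qsum = ((((((((⅓ + lq 14 8 3) - lq 17 11 3) + lq 16 10 3) - lq 19 13 3) - lq 8 2 1) + lq 11 3 1) - lq 10 4 2) + lq 13 6 2)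

  L₀ L₁ L₂ : Carrier
  L₀ = ((((((((⅓ + m 20 38 9) - m 23 41 9) + m 22 40 9) - m 25 43 9) - m 14 32 7) + m 1 11 1) - m 16 34 8) + m 2 13 2)
  L₁ = ((((((((0# + m 9 26 6) - m 11 29 6) + m 3 16 3) - m 4 19 3) - m 5 20 4) + m 16 35 7) - m 1 10 2) + m 8 25 5)
  L₂ = ((((((((0# + m 2 14 3) - m 3 17 3) + m 10 28 6) - m 12 31 6) - m 0 8 1) + m 6 23 4) - m 6 22 5) + m 18 37 8)

  private
    σ-⅓ : σ ⅓ ≈ ⅓
    σ-⅓ = inverse-unique ((1# + 1#) + 1#) _ _
      (trans (solve 1 (λ x → ((:1 :+ :1) :+ :1) :* x := (x :+ x) :+ x) refl _) (trans (sym (trans (σ-+ _ _) (+-congʳ (σ-+ _ _)))) (trans (σ-cong ⅓-inv) σ-one)))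
      (trans (solve 1 (λ x → ((:1 :+ :1) :+ :1) :* x := (x :+ x) :+ x) refl _) ⅓-inv)

    tri-⅓ : Tri ⅓ ⅓ 0# 0#
    tri-⅓ = sym (trans (+-cong (+-cong σ-⅓ (*-congˡ σ-zero)) (*-congˡ σ-zero)) (solve 3 (λ t x y → t :+ x :* :0 :+ y :* :0 := t) refl _ _ _))

    -- The residues modulo 3 of the three leading exponents of lq.
    tri-210 : ∀ {f a b c p q r} → f ≈ p + q + r → p ≈ X 2 * σ c → q ≈ X 1 * σ b → r ≈ σ a → Tri f a b c
    tri-210 h hp hq hr = trans h (trans (+-cong (+-cong hp hq) hr) (solve 3 (λ p q r → p :+ q :+ r := r :+ q :+ p) refl _ _ _))
    tri-120 : ∀ {f a b c p q r} → f ≈ p + q + r → p ≈ X 1 * σ b → q ≈ X 2 * σ c → r ≈ σ a → Tri f a b c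
    tri-120 h hp hq hr = trans h (trans (+-cong (+-cong hp hq) hr) (solve 3 (λ p q r → p :+ q :+ r := r :+ p :+ q) refl _ _ _))
    tri-021 : ∀ {f a b c p q r} → f ≈ p + q + r → p ≈ σ a → q ≈ X 2 * σ c → r ≈ X 1 * σ b → Tri f a b c
    tri-021 h hp hq hr = trans h (trans (+-cong (+-cong hp hq) hr) (solve 3 (λ p q r → p :+ q :+ r := p :+ r :+ q) refl _ _ _))
    tri-012 : ∀ {f a b c p q r} → f ≈ p + q + r → p ≈ σ a → q ≈ X 1 * σ b → r ≈ X 2 * σ c → Tri f a b c
    tri-012 h hp hq hr = trans h (+-cong (+-cong hp hq) hr)

    tri-14 : Tri (lq 14 8 3) _ _ _
    tri-14 = tri-210 (lq-dissection 14 8 3 1≤suc 1≤suc) (monomial 2 2 _) (monomial 1 9 _) (monomial₀ 20 _)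
    tri-17 : Tri (lq 17 11 3) _ _ _
    tri-17 = tri-210 (lq-dissection 17 11 3 1≤suc 1≤suc) (monomial 2 3 _) (monomial 1 11 _) (monomial₀ 23 _)
    tri-16 : Tri (lq 16 10 3) _ _ _
    tri-16 = tri-120 (lq-dissection 16 10 3 1≤suc 1≤suc) (monomial 1 3 _) (monomial 2 10 _) (monomial₀ 22 _)
    tri-19 : Tri (lq 19 13 3) _ _ _
    tri-19 = tri-120 (lq-dissection 19 13 3 1≤suc 1≤suc) (monomial 1 4 _) (monomial 2 12 _) (monomial₀ 25 _)
    tri-8 : Tri (lq 8 2 1) _ _ _
    tri-8 = tri-210 (lq-dissection 8 2 1 1≤suc 1≤suc) (monomial 2 0 _) (monomial 1 5 _) (monomial₀ 14 _)
    tri-11 : Tri (lq 11 3 1) _ _ _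
    tri-11 = tri-021 (lq-dissection 11 3 1 1≤suc 1≤suc) (monomial₀ 1 _) (monomial 2 6 _) (monomial 1 16 _)
    tri-10 : Tri (lq 10 4 2) _ _ _
    tri-10 = tri-120 (lq-dissection 10 4 2 1≤suc 1≤suc) (monomial 1 1 _) (monomial 2 6 _) (monomial₀ 16 _)
    tri-13 : Tri (lq 13 6 2) _ _ _
    tri-13 = tri-012 (lq-dissection 13 6 2 1≤suc 1≤suc) (monomial₀ 2 _) (monomial 1 8 _) (monomial 2 18 _)

  qsum-dissection : Tri qsum L₀ L₁ L₂
  qsum-dissection = (Tri-+ (Tri-minus (Tri-+ (Tri-minus (Tri-minus (Tri-+ (Tri-minus (Tri-+ tri-⅓ tri-14) tri-17) tri-16) tri-19) tri-8) tri-11) tri-10) tri-13)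

  private
    3×⅓ : ∀ f → ⅓ * (f + f + f) ≈ f
    3×⅓ f = trans (solve 2 (λ t f → t :* (f :+ f :+ f) := (t :+ t :+ t) :* f) refl ⅓ f) (one′ ⅓-inv f)
      where
      one′ : ∀ {a} → a ≈ 1# → ∀ f → a * f ≈ f
      one′ h f = trans (*-congʳ h) (*-identityˡ f)

  L₀-value : L₀ ≈ (⅓ - ((rho 8 - rho 1) + (rho 4 - rho 5))) - (u * iw) * (X 2 * Xs) + (v * iu) * (X 3 * Ys)
  L₀-value = begin
    _ ≈⟨ solve 9 (λ t a b c e f g h k → ((((((((t :+ a) :- b) :+ c) :- e) :- f) :+ g) :- h) :+ k) := t :+ (a :- e :- h :+ g) :+ (c :- b :- f :+ k)) refl _ _ _ _ _ _ _ _ _ ⟩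
    _ ≈⟨ +-cong (+-congˡ relation-C) relation-D ⟩
    _ ≈⟨ solve 11 (λ t r1 r2 r3 r4 r5 r6 r7 r8 x y → t :+ (:- ((r8 :- r1) :+ (r2 :- r7) :+ (r6 :- r3)) :- x) :+ (:- ((r7 :- r2) :+ (r3 :- r6) :+ (r4 :- r5)) :+ y)
           := (t :- ((r8 :- r1) :+ (r4 :- r5))) :- x :+ y) refl ⅓ (rho 1) (rho 2) (rho 3) (rho 4) (rho 5) (rho 6) (rho 7) (rho 8) _ _ ⟩
    _ ∎
    where open R≈

  L₁-value : L₁ ≈ X 1 * Xs + X 3 * Ys
  L₁-value = trans (solve 8 (λ a b c e f g h k → ((((((((:0 :+ a) :- b) :+ c) :- e) :- f) :+ g) :- h) :+ k) := (a :- e :- h :+ g) :+ (c :- b :- f :+ k)) refl _ _ _ _ _ _ _ _)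
    (sym (+-cong (shift-Xs 1) (shift-Ys 3)))

  L₂-value : L₂ ≈ - (X 1 * ((v * iw) * Xs + J² * (u * (id * iw)))) - ((w * iu) * (X 2 * Ys) + J² * (v * (iu * id)))
  L₂-value = trans (solve 8 (λ a b c e f g h k → ((((((((:0 :+ a) :- b) :+ c) :- e) :- f) :+ g) :- h) :+ k) := :- (e :- a :+ h :- g) :- (f :- k :- c :+ b)) refl _ _ _ _ _ _ _ _)
    (sym (+-cong (-‿cong (trans (*-congˡ (sym relation-A)) (trans (solve 5 (λ x a b c e → x :* (a :- b :+ c :- e) := x :* a :- x :* b :+ x :* c :- x :* e) refl _ _ _ _ _)
      (+-cong (+-cong (+-cong (X-merge 1 11 _) (-‿cong (X-merge 1 1 _))) (X-merge 1 5 _)) (-‿cong (X-merge 1 5 _)))))) (-‿cong (sym relation-B))))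

  -- Three times the theta quotient is an Eisenstein series of weight one.
  eisenstein : ⅓ * (J² * ((w * w) * (iu * (iv * id)) - X 2 * ((u * u) * (iv * (iw * id))) + (1# + 1#) * (X 1 * ((v * v) * (iu * (iw * id))))))
    ≈ ⅓ - ((rho 8 - rho 1) + (rho 4 - rho 5))
  eisenstein = begin
    _ ≈⟨ *-congˡ (*-congˡ (solve 3 (λ a b c → a :- b :+ (:1 :+ :1) :* c := a :- b :- (:- c :+ :- c)) refl _ _ _)) ⟩
    _ ≈⟨ *-congˡ (*-congˡ (sym (+-cong (+-cong theta-quotient₁ (-‿cong theta-quotient₂)) (-‿cong (+-cong theta-quotient₃ theta-quotient₃))))) ⟩
    _ ≈⟨ *-congˡ (solve 10 (λ n j r1 r2 r3 r4 r5 r6 r7 r8 →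
           (n :* n) :* (((j :* j) :* (((r1 :- r8) :- (:- :1 :+ r7 :- r2)) :- ((r6 :- r3) :- (r3 :- r6)))) :- ((j :* j) :* (((:- :1 :+ r6 :- r3) :- (:- :1 :+ r7 :- r2)) :- ((r3 :- r6) :- (r4 :- r5))))
             :- (((j :* j) :* (((:- :1 :+ r8 :- r1) :- (:- :1 :+ r5 :- r4)) :- ((r6 :- r3) :- (r3 :- r6)))) :+ ((j :* j) :* (((:- :1 :+ r8 :- r1) :- (:- :1 :+ r5 :- r4)) :- ((r6 :- r3) :- (r3 :- r6))))))
           := (n :* j) :* ((n :* j) :* (:1 :- ((((r8 :- r1) :+ (r4 :- r5)) :+ ((r8 :- r1) :+ (r4 :- r5))) :+ ((r8 :- r1) :+ (r4 :- r5))))))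
           refl J iJ (rho 1) (rho 2) (rho 3) (rho 4) (rho 5) (rho 6) (rho 7) (rho 8)) ⟩
    _ ≈⟨ *-congˡ (trans (one hJ _) (one hJ _)) ⟩
    _ ≈⟨ solve 2 (λ t r → t :* (:1 :- (r :+ r :+ r)) := t :- t :* (r :+ r :+ r)) refl ⅓ _ ⟩
    _ ≈⟨ +-congˡ (-‿cong (3×⅓ _)) ⟩
    _ ∎
    where open R≈

  EQ A₀ A₁ A₂ : Carrier
  EQ = J * J * iQQ
  A₀ = ⅓ * (EQ * w * w) + (⅓ + ⅓) * (X 1 * EQ * u * v)
  A₁ = (X 1 * (iJ * iw)) * Xs + (⅓ * (EQ * v * w) + ⅓ * (X 1 * EQ * u * u))
  A₂ = - ((X 2 * (iJ * iu)) * Ys) + (⅓ * (EQ * u * w) - (⅓ + ⅓) * (EQ * v * v))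

  private
    X-12 : ∀ f → X 1 * (X 2 * f) ≈ X 3 * f
    X-12 f = X-merge 1 2 f
    X-11 : ∀ f → X 1 * (X 1 * f) ≈ X 2 * f
    X-11 f = X-merge 1 1 f

    J*EQ : ∀ f → (J * EQ) * f ≈ J² * ((iu * (iv * (id * iw))) * f)
    J*EQ f = trans (solve 4 (λ j i p f → (j :* (j :* j :* (i :* p))) :* f := (j :* i) :* ((j :* j) :* (p :* f))) refl J iJ _ f) (one hJ _)

    L₀-eq : L₀ ≈ (J * w) * A₀ + X 1 * ((- (J * v)) * A₂ + (- (J * u)) * A₁)
    L₀-eq = sym (begin
      _ ≈⟨ solve 13 (λ j ij u v w iu iw t e x y P R →
             (j :* w) :* (t :* (e :* w :* w) :+ (t :+ t) :* (x :* e :* u :* v)) :+ x :* ((:- (j :* v)) :* (:- ((y :* (ij :* iu)) :* R) :+ (t :* (e :* u :* w) :- (t :+ t) :* (e :* v :* v)))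
               :+ (:- (j :* u)) :* ((x :* (ij :* iw)) :* P :+ (t :* (e :* v :* w) :+ t :* (x :* e :* u :* u))))
             := t :* ((j :* e) :* ((w :* w) :* w :- x :* (x :* ((u :* u) :* u)) :+ (:1 :+ :1) :* (x :* ((v :* v) :* v))))
                :- (j :* ij) :* (x :* (x :* ((u :* iw) :* P))) :+ (j :* ij) :* (x :* (y :* ((v :* iu) :* R)))) refl J iJ u v w iu iw ⅓ EQ (X 1) (X 2) Xs Ys ⟩
      _ ≈⟨ +-cong (+-cong (*-congˡ (trans (J*EQ _) (*-congˡ theta-part))) (-‿cong (trans (one hJ _) (X-11 _)))) (trans (one hJ _) (X-12 _)) ⟩
      _ ≈⟨ +-cong (+-cong eisenstein (-‿cong (solve 3 (λ x a b → x :* (a :* b) := a :* (x :* b)) refl _ _ _))) (solve 3 (λ x a b → x :* (a :* b) := a :* (x :* b)) refl _ _ _) ⟩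
      _ ≈⟨ sym L₀-value ⟩
      _ ∎)
      where
      open R≈
      theta-part : (iu * (iv * (id * iw))) * ((w * w) * w - X 1 * (X 1 * ((u * u) * u)) + (1# + 1#) * (X 1 * ((v * v) * v)))
        ≈ (w * w) * (iu * (iv * id)) - X 2 * ((u * u) * (iv * (iw * id))) + (1# + 1#) * (X 1 * ((v * v) * (iu * (iw * id))))
      theta-part = begin
        _ ≈⟨ *-congˡ (+-congʳ (+-congˡ (-‿cong (X-11 _)))) ⟩
        _ ≈⟨ solve 9 (λ u v w iu iv id iw x y → (iu :* (iv :* (id :* iw))) :* ((w :* w) :* w :- y :* ((u :* u) :* u) :+ (:1 :+ :1) :* (x :* ((v :* v) :* v)))
               := (w :* iw) :* ((w :* w) :* (iu :* (iv :* id))) :- (u :* iu) :* (y :* ((u :* u) :* (iv :* (iw :* id)))) :+ (v :* iv) :* ((:1 :+ :1) :* (x :* ((v :* v) :* (iu :* (iw :* id))))))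
               refl u v w iu iv id iw (X 1) (X 2) ⟩
        _ ≈⟨ +-cong (+-cong (one hw _) (-‿cong (one hu _))) (one hv _) ⟩
        _ ∎

    L₁-eq : L₁ ≈ (J * w) * A₁ + (- (J * v)) * A₀ + X 1 * ((- (J * u)) * A₂)
    L₁-eq = sym (begin
      _ ≈⟨ solve 13 (λ j ij u v w iu iw t e x y P R →
             (j :* w) :* ((x :* (ij :* iw)) :* P :+ (t :* (e :* v :* w) :+ t :* (x :* e :* u :* u)))
               :+ (:- (j :* v)) :* (t :* (e :* w :* w) :+ (t :+ t) :* (x :* e :* u :* v))
               :+ x :* ((:- (j :* u)) :* (:- ((y :* (ij :* iu)) :* R) :+ (t :* (e :* u :* w) :- (t :+ t) :* (e :* v :* v))))
             := (j :* ij) :* ((w :* iw) :* (x :* P)) :+ (j :* ij) :* ((u :* iu) :* (x :* (y :* R)))) refl J iJ u v w iu iw ⅓ EQ (X 1) (X 2) Xs Ys ⟩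
      _ ≈⟨ +-cong (trans (one hJ _) (one hw _)) (trans (one hJ _) (trans (one hu _) (X-12 _))) ⟩
      _ ≈⟨ sym L₁-value ⟩
      _ ∎)
      where open R≈

    L₂-eq : L₂ ≈ (J * w) * A₂ + (- (J * v)) * A₁ + (- (J * u)) * A₀
    L₂-eq = sym (begin
      _ ≈⟨ solve 13 (λ j ij u v w iu iw t e x y P R →
             (j :* w) :* (:- ((y :* (ij :* iu)) :* R) :+ (t :* (e :* u :* w) :- (t :+ t) :* (e :* v :* v)))
               :+ (:- (j :* v)) :* ((x :* (ij :* iw)) :* P :+ (t :* (e :* v :* w) :+ t :* (x :* e :* u :* u)))
               :+ (:- (j :* u)) :* (t :* (e :* w :* w) :+ (t :+ t) :* (x :* e :* u :* v))
             := :- ((j :* ij) :* (x :* ((v :* iw) :* P))) :- (j :* ij) :* ((w :* iu) :* (y :* R))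
                :- t :* ((j :* e) :* ((v :* v) :* w :+ x :* ((u :* u) :* v)) :+ (j :* e) :* ((v :* v) :* w :+ x :* ((u :* u) :* v)) :+ (j :* e) :* ((v :* v) :* w :+ x :* ((u :* u) :* v))))
             refl J iJ u v w iu iw ⅓ EQ (X 1) (X 2) Xs Ys ⟩
      _ ≈⟨ +-cong (+-cong (-‿cong (one hJ _)) (-‿cong (one hJ _))) (-‿cong (trans (3×⅓ _) (trans (J*EQ _) (*-congˡ theta-part)))) ⟩
      _ ≈⟨ solve 6 (λ x p r n a b → :- (x :* p) :- r :- n :* (a :+ x :* b) := :- (x :* (p :+ n :* b)) :- (r :+ n :* a)) refl (X 1) _ _ J² _ _ ⟩
      _ ≈⟨ sym L₂-value ⟩
      _ ∎)
      where
      open R≈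
      theta-part : (iu * (iv * (id * iw))) * ((v * v) * w + X 1 * ((u * u) * v)) ≈ v * (iu * id) + X 1 * (u * (id * iw))
      theta-part = begin
        _ ≈⟨ solve 8 (λ u v w iu iv id iw x → (iu :* (iv :* (id :* iw))) :* ((v :* v) :* w :+ x :* ((u :* u) :* v))
               := (v :* iv) :* ((w :* iw) :* (v :* (iu :* id))) :+ (u :* iu) :* ((v :* iv) :* (x :* (u :* (id :* iw))))) refl u v w iu iv id iw (X 1) ⟩
        _ ≈⟨ +-cong (trans (one hv _) (one hw _)) (trans (one hu _) (one hv _)) ⟩
        _ ∎

  main : qsum ≈ QQ * (σ A₀ + X 1 * σ A₁ + X 2 * σ A₂)
  main = trans qsum-dissection (sym (Tri-cong (sym L₀-eq) (sym L₁-eq) (sym L₂-eq) (Tri-* QQ-dissection (refl {σ A₀ + X 1 * σ A₁ + X 2 * σ A₂}))))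

  Po-recursion : ∀ c s (f : ℕ → Carrier) → f 0 ≈ 1# → (∀ k → f (suc k) ≈ (1# - X (s ℕ.+ c ℕ.* k)) * f k) → ∀ k → f k ≈ Po c s k
  Po-recursion c s f f0 fs zero = f0
  Po-recursion c s f f0 fs (suc k) = trans (fs k) (trans (*-comm _ _) (*-congʳ (Po-recursion c s f f0 fs k)))

  geometric-series : ∀ h h′ (pw : ℕ → Carrier) → h ≈ X 1 * h′ → pw 0 ≈ 1# → (∀ k → pw (suc k) ≈ h * pw k) → (1# - h) * Σ∞ pw ≈ 1#
  geometric-series h h′ pw hX p0 ps = separated λ M → mod-trans (mod-* (fine refl) (mod-sym (Σ∞-≈ small M M ℕP.≤-refl)))
    (mod-trans (fine (telescope M)) (mod-trans (mod-+ (fine refl) (mod-neg (small M))) (fine (solve 0 (:1 :- :0 := :1) refl))))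
    where
    factor : ∀ k → Σ Carrier λ g → pw k ≈ X k * g
    factor zero = 1# , trans p0 (sym (trans (*-identityʳ _) X-zero))
    factor (suc k) = h′ * proj₁ (factor k) , trans (ps k) (trans (*-cong hX (proj₂ (factor k)))
        (trans (solve 4 (λ x h y g → (x :* h) :* (y :* g) := (x :* y) :* (h :* g)) refl _ _ _ _) (*-congʳ (sym (X-+ 1 k)))))
    small : ∀ k → pw k ≈[ k ] 0#
    small k = mod-trans (fine (proj₂ (factor k))) (X*-small _ ℕP.≤-refl)
    telescope : ∀ M → (1# - h) * Σ< M pw ≈ 1# - pw M
    telescope zero = trans (zeroʳ _) (sym (trans (+-congˡ (-‿cong p0)) (-‿inverseʳ 1#)))
    telescope (suc M) = trans (distribˡ _ _ _) (trans (+-congʳ (telescope M)) (trans (solve 3 (λ h p q → (:1 :- p) :+ (:1 :- h) :* p := :1 :- h :* p) refl h (pw M) 0#) (+-congˡ (-‿cong (sym (ps M))))))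

  -- (1 - aX)(1 - bX) = 1 + X + X² when a, b are the primitive cube roots of unity.
  module CubeRoots (a b : Carrier) (ab : a * b ≈ 1#) (a+b : a + b ≈ - 1#) (e : ℕ) (Ga Gb : Carrier)
    (hA : (1# - a * X (suc e)) * Ga ≈ 1#) (hB : (1# - b * X (suc e)) * Gb ≈ 1#) where
    private
      x = X (suc e)
      prodW = (1# - x) * W (3 ℕ.* suc e)

      quad : (1# - a * x) * (1# - b * x) ≈ 1# + x + x * x
      quad = trans (solve 3 (λ a b x → (:1 :- a :* x) :* (:1 :- b :* x) := :1 :- (a :+ b) :* x :+ (a :* b) :* (x :* x)) refl a b x)
        (trans (+-cong (+-congˡ (-‿cong (*-congʳ a+b))) (*-congʳ ab)) (solve 1 (λ x → :1 :- (:- :1) :* x :+ :1 :* (x :* x) := :1 :+ x :+ x :* x) refl x))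

      cube : X (3 ℕ.* suc e) ≈ x * (x * x)
      cube = trans (X-+ (suc e) _) (*-congˡ (trans (X-+ (suc e) _) (*-congˡ (X-cong (ℕP.+-identityʳ (suc e))))))

    product⁺ : Ga * Gb ≈ prodW
    product⁺ = inverse-unique ((1# - a * x) * (1# - b * x)) _ _
      (trans (solve 4 (λ p q g h → (p :* q) :* (g :* h) := (p :* g) :* (q :* h)) refl _ _ _ _) (trans (*-cong hA hB) (*-identityˡ 1#)))
      (trans (*-congʳ quad) (trans (solve 2 (λ x w → (:1 :+ x :+ x :* x) :* ((:1 :- x) :* w) := (:1 :- x :* (x :* x)) :* w) refl x _)
        (trans (*-congʳ (+-congˡ (-‿cong (sym cube)))) (W-inv _))))

    product⁻ : (1# - Gb) * (1# - Ga) ≈ X (suc e ℕ.+ suc e) * prodW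
    product⁻ = begin
      (1# - Gb) * (1# - Ga) ≈⟨ *-cong (minus hB) (minus hA) ⟩
      (- (b * x * Gb)) * (- (a * x * Ga)) ≈⟨ solve 5 (λ a b x g h → (:- (b :* x :* h)) :* (:- (a :* x :* g)) := (a :* b) :* ((x :* x) :* (g :* h))) refl a b x Ga Gb ⟩
      (a * b) * ((x * x) * (Ga * Gb)) ≈⟨ trans (*-congʳ ab) (*-identityˡ _) ⟩
      (x * x) * (Ga * Gb) ≈⟨ *-cong (sym (X-+ (suc e) (suc e))) product⁺ ⟩
      _ ∎
      where
      open R≈
      minus : ∀ {c G} → (1# - c * x) * G ≈ 1# → 1# - G ≈ - (c * x * G)
      minus {c} {G} h = trans (+-congʳ (sym h)) (solve 3 (λ c x g → (:1 :- c :* x) :* g :- g := :- (c :* x :* g)) refl c x G)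

  X-Summable : ∀ (s : ℕ → ℕ) (G : ℕ → Carrier) → (∀ k → k ℕ.≤ s k) → Summable (λ k → X (s k) * G k)
  X-Summable s G l k = X*-small _ (l k)

  k≤ : ∀ c B C k → 1 ℕ.≤ B → k ℕ.≤ c ℕ.* k ℕ.* k ℕ.+ B ℕ.* k ℕ.+ C
  k≤ c (suc B) C k _ = ℕP.≤-trans (ℕP.m≤m+n k (B ℕ.* k)) (ℕP.≤-trans (ℕP.m≤n+m (suc B ℕ.* k) (c ℕ.* k ℕ.* k)) (ℕP.m≤m+n _ C))

  private
    Σ∞-minus : ∀ {f g} → Summable f → Summable g → Σ∞ (λ n → f n - g n) ≈ Σ∞ f - Σ∞ g
    Σ∞-minus {f} {g} hf hg = separated λ M → mod-trans (mod-sym (Σ∞-≈ (λ k → mod-trans (mod-+ (hf k) (mod-neg (hg k))) (fine (-‿inverseʳ 0#))) M M ℕP.≤-refl))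
      (mod-trans (fine (trans (Σ-+ M _ _) (+-congˡ (Σ-neg M _)))) (mod-+ (Σ∞-≈ hf M M ℕP.≤-refl) (mod-neg (Σ∞-≈ hg M M ℕP.≤-refl))))

  Σ∞-neg : ∀ {f} → Summable f → Σ∞ (λ n → - f n) ≈ - Σ∞ f
  Σ∞-neg {f} hf = separated λ M → mod-trans (mod-sym (Σ∞-≈ (λ k → mod-trans (mod-neg (hf k)) (fine -0#≈0#)) M M ℕP.≤-refl))
    (mod-trans (fine (Σ-neg M _)) (mod-neg (Σ∞-≈ hf M M ℕP.≤-refl)))

  private
    minus-Summable : ∀ {f g} → Summable f → Summable g → Summable (λ n → f n - g n)
    minus-Summable hf hg k = mod-trans (mod-+ (hf k) (mod-neg (hg k))) (fine (-‿inverseʳ 0#))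

    scale-Summable : ∀ x {f} → Summable f → Summable (λ n → x * f n)
    scale-Summable x hf k = mod-trans (mod-* (fine refl) (hf k)) (fine (zeroʳ x))

    neg-Summable : ∀ {f} → Summable f → Summable (λ n → - f n)
    neg-Summable hf k = mod-trans (mod-neg (hf k)) (fine -0#≈0#)

  Σ∞-front : ∀ {f} → Summable f → f 0 + Σ∞ (λ k → f (suc k)) ≈ Σ∞ f
  Σ∞-front {f} hf = separated λ M → mod-trans (mod-+ (fine refl) (mod-sym (Σ∞-≈ (λ k → mod-mono (ℕP.n≤1+n k) (hf (suc k))) M M ℕP.≤-refl)))
    (mod-trans (fine (sym (Σ-front M f))) (Σ∞-≈ hf M (suc M) (ℕP.n≤1+n M)))

  lq-sum : ∀ B C e (G : ℕ → Carrier) → 1 ℕ.≤ B → (∀ k → G k ≈ (1# - X (3 ℕ.* k ℕ.+ e)) * W (3 ℕ.* (3 ℕ.* k ℕ.+ e))) →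
    Σ∞ (λ k → X (6 ℕ.* k ℕ.* k ℕ.+ B ℕ.* k ℕ.+ C) * G k) ≈ lq B C e - lq (3 ℕ.+ B) (e ℕ.+ C) e
  lq-sum B C e G l h = trans (Σ∞-cong (X-Summable _ G (λ k → k≤ 6 B C k l)) (minus-Summable (lq-Summable B C e l) (lq-Summable (3 ℕ.+ B) (e ℕ.+ C) e (s≤s z≤n))) term)
    (Σ∞-minus (lq-Summable B C e l) (lq-Summable (3 ℕ.+ B) (e ℕ.+ C) e (s≤s z≤n)))
    where
    term : ∀ k → _ ≈ _
    term k = trans (*-congˡ (h k)) (trans (solve 3 (λ x y w → x :* ((:1 :- y) :* w) := x :* w :- (x :* y) :* w) refl _ _ _)
      (+-cong (*-congˡ w≈) (-‿cong (*-cong (trans (sym (X-+ _ _)) (X-cong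
        (NS.solve 4 (λ k B C e → (NS.con 6 NS.:* k NS.:* k NS.:+ B NS.:* k NS.:+ C) NS.:+ (NS.con 3 NS.:* k NS.:+ e) NS.:= NS.con 6 NS.:* k NS.:* k NS.:+ (NS.con 3 NS.:+ B) NS.:* k NS.:+ (e NS.:+ C)) ≡.refl k B C e))) w≈))))
      where
      w≈ : W (3 ℕ.* (3 ℕ.* k ℕ.+ e)) ≈ W (9 ℕ.* k ℕ.+ 3 ℕ.* e)
      w≈ = W-cong (NS.solve 2 (λ k e → NS.con 3 NS.:* (NS.con 3 NS.:* k NS.:+ e) NS.:= NS.con 9 NS.:* k NS.:+ NS.con 3 NS.:* e) ≡.refl k e)

  lq-sum⁻ : ∀ B C e (G : ℕ → Carrier) → 1 ℕ.≤ B → (∀ k → G k ≈ X ((3 ℕ.* k ℕ.+ e) ℕ.+ (3 ℕ.* k ℕ.+ e)) * ((1# - X (3 ℕ.* k ℕ.+ e)) * W (3 ℕ.* (3 ℕ.* k ℕ.+ e)))) →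
    Σ∞ (λ k → X (6 ℕ.* k ℕ.* k ℕ.+ B ℕ.* k ℕ.+ C) * G k) ≈ lq (6 ℕ.+ B) (e ℕ.+ e ℕ.+ C) e - lq (9 ℕ.+ B) (e ℕ.+ (e ℕ.+ e ℕ.+ C)) e
  lq-sum⁻ B C e G l h = trans (Σ∞-cong (X-Summable _ G (λ k → k≤ 6 B C k l)) (X-Summable _ _ (λ k → k≤ 6 (6 ℕ.+ B) (e ℕ.+ e ℕ.+ C) k (s≤s z≤n)))
      (λ k → trans (*-congˡ (h k)) (trans (X-merge _ _ _) (*-congʳ (X-cong
        (NS.solve 4 (λ k B C e → (NS.con 6 NS.:* k NS.:* k NS.:+ B NS.:* k NS.:+ C) NS.:+ ((NS.con 3 NS.:* k NS.:+ e) NS.:+ (NS.con 3 NS.:* k NS.:+ e)) NS.:= NS.con 6 NS.:* k NS.:* k NS.:+ (NS.con 6 NS.:+ B) NS.:* k NS.:+ (e NS.:+ e NS.:+ C)) ≡.refl k B C e))))))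
    (lq-sum (6 ℕ.+ B) (e ℕ.+ e ℕ.+ C) e (λ k → (1# - X (3 ℕ.* k ℕ.+ e)) * W (3 ℕ.* (3 ℕ.* k ℕ.+ e))) (s≤s z≤n) (λ _ → refl))

  lam-sum : ∀ B C a (G : ℕ → Carrier) → 1 ℕ.≤ B → (∀ k → G k ≈ W (a ℕ.+ 9 ℕ.* k)) → Σ∞ (λ k → X (18 ℕ.* k ℕ.* k ℕ.+ B ℕ.* k ℕ.+ C) * G k) ≈ m C B a
  lam-sum B C a G l h = trans (Σ∞-cong (X-Summable _ G (λ k → k≤ 18 B C k l)) (scale-Summable (X C) (lam-Summable (18 ℕ.+ B) a (s≤s z≤n)))
      (λ k → trans (*-cong (trans (X-cong (≡.trans (ℕP.+-comm _ C) (≡.cong (C ℕ.+_) (≡.sym (expo-closed B k))))) (X-+ C _)) (h k)) (*-assoc _ _ _)))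
    (Σ∞-*ˡ (X C) (lam-Summable (18 ℕ.+ B) a (s≤s z≤n)))

  lam-sum⁻ : ∀ B C a (G : ℕ → Carrier) → 1 ℕ.≤ B → (∀ k → G k ≈ - (X (a ℕ.+ 9 ℕ.* k) * W (a ℕ.+ 9 ℕ.* k))) → Σ∞ (λ k → X (18 ℕ.* k ℕ.* k ℕ.+ B ℕ.* k ℕ.+ C) * G k) ≈ - m (a ℕ.+ C) (9 ℕ.+ B) a
  lam-sum⁻ B C a G l h = trans (Σ∞-cong (X-Summable _ G (λ k → k≤ 18 B C k l)) (neg-Summable hs)
      (λ k → trans (*-congˡ (h k)) (trans (sym (-‿distribʳ-* _ _)) (-‿cong (trans (X-merge _ _ _) (*-congʳ (X-cong
        (NS.solve 4 (λ k B C a → (NS.con 18 NS.:* k NS.:* k NS.:+ B NS.:* k NS.:+ C) NS.:+ (a NS.:+ NS.con 9 NS.:* k) NS.:= NS.con 18 NS.:* k NS.:* k NS.:+ (NS.con 9 NS.:+ B) NS.:* k NS.:+ (a NS.:+ C)) ≡.refl k B C a))))))))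
    (trans (Σ∞-neg hs) (-‿cong (lam-sum (9 ℕ.+ B) (a ℕ.+ C) a (λ k → W (a ℕ.+ 9 ℕ.* k)) (s≤s z≤n) (λ _ → refl))))
    where
    hs : Summable (λ k → X (18 ℕ.* k ℕ.* k ℕ.+ (9 ℕ.+ B) ℕ.* k ℕ.+ (a ℕ.+ C)) * W (a ℕ.+ 9 ℕ.* k))
    hs = X-Summable _ _ (λ k → k≤ 18 (9 ℕ.+ B) (a ℕ.+ C) k (s≤s z≤n))

  X-neg-merge : ∀ s e r G W → s ℕ.+ e ≡ r → G ≈ - (X e * W) → X s * G ≈ - (X r * W)
  X-neg-merge s e r G W h g = trans (*-congˡ g) (trans (sym (-‿distribʳ-* _ _)) (-‿cong (trans (X-merge _ _ _) (*-congʳ (X-cong h)))))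

  shift-m : ∀ s c₁ b₁ a₁ c₂ b₂ a₂ → X s * (m c₁ b₁ a₁ - m c₂ b₂ a₂) ≈ m (s ℕ.+ c₁) b₁ a₁ - m (s ℕ.+ c₂) b₂ a₂
  shift-m s c₁ b₁ a₁ c₂ b₂ a₂ = trans (trans (distribˡ _ _ _) (+-congˡ (sym (-‿distribʳ-* _ _)))) (+-cong (X-merge s c₁ _) (-‿cong (X-merge s c₂ _)))

  rep-+ : ∀ L M f g → X M * (X L * f) + X L * (X M * g) ≈ X (L ℕ.+ M) * (f + g)
  rep-+ L M f g = trans (solve 4 (λ x y f g → y :* (x :* f) :+ x :* (y :* g) := (x :* y) :* (f :+ g)) refl (X L) (X M) f g) (*-congʳ (sym (X-+ L M)))

  rep-minus : ∀ L M f g → X M * (X L * f) - X L * (X M * g) ≈ X (L ℕ.+ M) * (f - g)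
  rep-minus L M f g = trans (solve 4 (λ x y f g → y :* (x :* f) :- x :* (y :* g) := (x :* y) :* (f :- g)) refl (X L) (X M) f g) (*-congʳ (sym (X-+ L M)))

  rep-* : ∀ L M f g → (X L * f) * (X M * g) ≈ X (L ℕ.+ M) * (f * g)
  rep-* L M f g = trans (solve 4 (λ x y f g → (x :* f) :* (y :* g) := (x :* y) :* (f :* g)) refl (X L) (X M) f g) (*-congʳ (sym (X-+ L M)))

  rep-σ : ∀ L f → σ (X L * f) ≈ X (L ℕ.* 3) * σ f
  rep-σ L f = trans (σ-* _ _) (*-congʳ (trans (σ-X L) (X-cong (ℕP.*-comm 3 L))))

  Jw Ju : Carrier
  Jw = J * w
  Ju = J * u

  Jw-intro : ∀ j t → j ≈ J → t ≈ w → j * t ≈ Jw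
  Jw-intro j t hj ht = *-cong hj ht

  Ju-intro : ∀ j t → j ≈ J → t ≈ u → j * t ≈ Ju
  Ju-intro j t hj ht = *-cong hj ht

  Th-intro : ∀ a b f g → f ≈ Po∞ 9 a → g ≈ Po∞ 9 b → f * g ≈ Th a b
  Th-intro a b f g hf hg = *-cong hf hg

  EQ-intro : ∀ j iq → j ≈ J → QQ * iq ≈ 1# → j * j * iq ≈ EQ
  EQ-intro j iq hj hq = *-cong (*-cong hj hj) (inverse-unique QQ _ _ hq QQ-inv)

  private
    cofactor : ∀ z iz → z * iz ≈ 1# → ∀ i → (J * z) * i ≈ 1# → i ≈ iJ * iz
    cofactor z iz h i hi = inverse-unique (J * z) _ _ hi (trans (solve 4 (λ j z i k → (j :* z) :* (i :* k) := (j :* i) :* (z :* k)) refl _ _ _ _)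
      (trans (*-cong (Po*Pr 9 (s≤s z≤n)) h) (*-identityˡ 1#)))

  A₀-intro : ∀ e u′ v′ w′ t₁ t₂ → e ≈ EQ → u′ ≈ u → v′ ≈ v → w′ ≈ w → t₁ ≈ ⅓ * (e * w′ * w′) → t₂ ≈ (⅓ + ⅓) * (X 1 * e * u′ * v′) → t₁ + t₂ ≈ A₀
  A₀-intro e u′ v′ w′ t₁ t₂ he hu hv hw h₁ h₂ = +-cong (trans h₁ (*-congˡ (*-cong (*-cong he hw) hw))) (trans h₂ (*-congˡ (*-cong (*-cong (*-congˡ he) hu) hv)))

  A₁-intro : ∀ e u′ v′ w′ i x t₁ t₂ → e ≈ EQ → u′ ≈ u → v′ ≈ v → w′ ≈ w → Jw * i ≈ 1# → x ≈ Xs → t₁ ≈ ⅓ * (e * v′ * w′) → t₂ ≈ ⅓ * (X 1 * e * u′ * u′) →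
    (X 1 * i) * x + (t₁ + t₂) ≈ A₁
  A₁-intro e u′ v′ w′ i x t₁ t₂ he hu hv hw hi hx h₁ h₂ = +-cong (*-cong (*-congˡ (cofactor w iw (Th-inv r45) i hi)) hx)
    (+-cong (trans h₁ (*-congˡ (*-cong (*-cong he hv) hw))) (trans h₂ (*-congˡ (*-cong (*-cong (*-congˡ he) hu) hu))))

  A₂-intro : ∀ e u′ v′ w′ i y p t₁ t₂ → e ≈ EQ → u′ ≈ u → v′ ≈ v → w′ ≈ w → Ju * i ≈ 1# → y ≈ Ys → p ≈ - (X 2 * i) → t₁ ≈ ⅓ * (e * u′ * w′) → t₂ ≈ (⅓ + ⅓) * (e * v′ * v′) →
    p * y + (t₁ - t₂) ≈ A₂
  A₂-intro e u′ v′ w′ i y p t₁ t₂ he hu hv hw hi hy hp h₁ h₂ = +-cong (trans (*-cong (trans hp (-‿cong (*-congˡ (cofactor u iu (Th-inv r18) i hi)))) hy) (sym (-‿distribˡ-* _ _)))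
    (+-cong (trans h₁ (*-congˡ (*-cong (*-cong he hu) hw))) (-‿cong (trans h₂ (*-congˡ (*-cong (*-cong he hv) hv)))))

  assemble : ∀ iq s a₀ a₁ a₂ → QQ * iq ≈ 1# → s ≈ qsum → a₀ ≈ A₀ → a₁ ≈ A₁ → a₂ ≈ A₂ → iq * s ≈ σ a₀ + X 1 * σ a₁ + X 2 * σ a₂
  assemble iq s a₀ a₁ a₂ hq hs h₀ h₁ h₂ = begin
    iq * s ≈⟨ *-congˡ (trans hs main) ⟩
    iq * (QQ * (σ A₀ + X 1 * σ A₁ + X 2 * σ A₂)) ≈⟨ trans (sym (*-assoc _ _ _)) (trans (*-congʳ (trans (*-comm _ _) hq)) (*-identityˡ _)) ⟩
    σ A₀ + X 1 * σ A₁ + X 2 * σ A₂ ≈⟨ sym (+-cong (+-cong (σ-cong h₀) (*-congˡ (σ-cong h₁))) (*-congˡ (σ-cong h₂))) ⟩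
    _ ∎
    where open R≈

module SeriesModel (R : CommutativeRing 0ℓ 0ℓ)
  (_⊛_ : (ℕ → CommutativeRing.Carrier R) → (ℕ → CommutativeRing.Carrier R) → (ℕ → CommutativeRing.Carrier R))
  (⊛-zero : ∀ f g → CommutativeRing._≈_ R ((f ⊛ g) 0) (CommutativeRing._*_ R (f 0) (g 0)))
  (⊛-suc : ∀ f g n → CommutativeRing._≈_ R ((f ⊛ g) (suc n))
     (CommutativeRing._+_ R (CommutativeRing._*_ R (f 0) (g (suc n))) (((λ k → f (suc k)) ⊛ g) n)))
  (X : ℕ → ℕ → CommutativeRing.Carrier R)
  (X-00 : CommutativeRing._≈_ R (X 0 0) (CommutativeRing.1# R))
  (X-0s : ∀ n → CommutativeRing._≈_ R (X 0 (suc n)) (CommutativeRing.0# R))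
  (X-s0 : ∀ e → CommutativeRing._≈_ R (X (suc e) 0) (CommutativeRing.0# R))
  (X-ss : ∀ e n → CommutativeRing._≈_ R (X (suc e) (suc n)) (X e n))
  (W : ℕ → ℕ → CommutativeRing.Carrier R)
  (W-low : ∀ e n → n ℕ.≤ e → CommutativeRing._≈_ R (W (suc e) n) (X 0 n))
  (W-high : ∀ e n → CommutativeRing._≈_ R (W (suc e) (suc e ℕ.+ n)) (W (suc e) n))
  (σ : (ℕ → CommutativeRing.Carrier R) → (ℕ → CommutativeRing.Carrier R))
  (σ-0 : ∀ f → CommutativeRing._≈_ R (σ f 0) (f 0))
  (σ-1 : ∀ f → CommutativeRing._≈_ R (σ f 1) (CommutativeRing.0# R))
  (σ-2 : ∀ f → CommutativeRing._≈_ R (σ f 2) (CommutativeRing.0# R))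
  (σ-3 : ∀ f n → CommutativeRing._≈_ R (σ f (3 ℕ.+ n)) (σ (λ k → f (suc k)) n))
  where
  open Series R _⊛_ ⊛-zero ⊛-suc public
  private
    module C = RingKit R
    open C using (_≈_; 0#; 1#; refl; sym; trans; +-cong; +-congˡ; +-congʳ; *-congʳ; *-congˡ; zeroˡ; zeroʳ; +-identityˡ; +-identityʳ; *-identityˡ)

  ringS : CommutativeRing 0ℓ 0ℓ
  ringS = seriesRing (X 0) X-00 X-0s

  shift-high : ∀ e f n → (X e ⊛ f) (e ℕ.+ n) ≈ f n
  shift-high zero f n = one-⊛ (X 0) X-00 X-0s f n
  shift-high (suc e) f n = trans (⊛-suc (X (suc e)) f (e ℕ.+ n)) (trans (+-congʳ (trans (*-congʳ (X-s0 e)) (zeroˡ _)))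
    (trans (+-identityˡ _) (trans (⊛-cong _ (X e) f f (X-ss e) (λ _ → refl) (e ℕ.+ n)) (shift-high e f n))))

  shift-low : ∀ e f n → n ℕ.< e → (X e ⊛ f) n ≈ 0#
  shift-low (suc e) f zero l = trans (⊛-zero (X (suc e)) f) (trans (*-congʳ (X-s0 e)) (zeroˡ _))
  shift-low (suc e) f (suc n) (s≤s l) = trans (⊛-suc (X (suc e)) f n) (trans (+-congʳ (trans (*-congʳ (X-s0 e)) (zeroˡ _)))
    (trans (+-identityˡ _) (trans (⊛-cong _ (X e) f f (X-ss e) (λ _ → refl) n) (shift-low e f n l))))

  by-shift : ∀ e {f g : Ser} → (∀ n → n ℕ.< e → f n ≈ g n) → (∀ n → f (e ℕ.+ n) ≈ g (e ℕ.+ n)) → f ≈S g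
  by-shift e {f} {g} lo hi n with ℕP.<-≤-connex n e
  ... | inj₁ l = lo n l
  ... | inj₂ l = ≡.subst (λ z → f z ≈ g z) (ℕP.m+[n∸m]≡n l) (hi (n ℕ.∸ e))

  X-add : ∀ a b → X (a ℕ.+ b) ≈S (X a ⊛ X b)
  X-add zero b n = sym (one-⊛ (X 0) X-00 X-0s (X b) n)
  X-add (suc a) b zero = trans (X-s0 (a ℕ.+ b)) (sym (trans (⊛-zero (X (suc a)) (X b)) (trans (*-congʳ (X-s0 a)) (zeroˡ _))))
  X-add (suc a) b (suc n) = trans (X-ss (a ℕ.+ b) n) (trans (X-add a b n) (sym (trans (⊛-suc (X (suc a)) (X b) n)
    (trans (+-congʳ (trans (*-congʳ (X-s0 a)) (zeroˡ _))) (trans (+-identityˡ _) (⊛-cong _ (X a) (X b) (X b) (X-ss a) (λ _ → refl) n))))))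

  X-low : ∀ e n → n ℕ.< e → X e n ≈ 0#
  X-low (suc e) zero l = X-s0 e
  X-low (suc e) (suc n) (s≤s l) = trans (X-ss e n) (X-low e n l)

  limS : (ℕ → Ser) → Ser
  limS F n = F (suc n) n

  lim-stable : ∀ (F : ℕ → Ser) → (∀ k → F (suc k) ≈[ k ] F k) → ∀ n i → F (suc n ℕ.+ i) n ≈ F (suc n) n
  lim-stable F h n zero = C.reflexive (≡.cong (λ z → F z n) (ℕP.+-identityʳ (suc n)))
  lim-stable F h n (suc i) = trans (C.reflexive (≡.cong (λ z → F z n) (ℕP.+-suc (suc n) i))) (trans (h (suc n ℕ.+ i) n (ℕP.m≤m+n (suc n) i)) (lim-stable F h n i))

  limS-≈ : ∀ (F : ℕ → Ser) → (∀ k → F (suc k) ≈[ k ] F k) → ∀ M m → M ℕ.≤ m → F m ≈[ M ] limS F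
  limS-≈ F h M m M≤m n l = ≡.subst (λ z → F z n ≈ F (suc n) n) (ℕP.m+[n∸m]≡n (ℕP.≤-trans l M≤m)) (lim-stable F h n (m ℕ.∸ suc n))

  W-eq : ∀ e → W (suc e) ≈S (λ n → X 0 n C.+ (X (suc e) ⊛ W (suc e)) n)
  W-eq e = by-shift (suc e) (λ { n (s≤s l) → trans (W-low e n l) (sym (trans (+-congˡ (shift-low (suc e) _ n (s≤s l))) (+-identityʳ _))) })
    (λ n → trans (W-high e n) (sym (trans (+-cong (X-0s (e ℕ.+ n)) (shift-high (suc e) _ n)) (+-identityˡ _))))

  model : QSeries
  model = record
    { seriesRing = ringS
    ; _≈[_]_ = _≈[_]_
    ; fine = λ h n _ → h n
    ; mod-sym = λ h n l → sym (h n l)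
    ; mod-trans = λ h k n l → trans (h n l) (k n l)
    ; mod-+ = λ h k n l → +-cong (h n l) (k n l)
    ; mod-* = λ {M} {f} {f′} {g} {g′} → ⊛-cong-M M f f′ g g′
    ; mod-neg = λ h n l → C.-‿cong (h n l)
    ; mod-mono = λ M≤N h n l → h n (ℕP.≤-trans l M≤N)
    ; separated = λ h n → h (suc n) n ℕP.≤-refl
    ; lim = limS
    ; lim-≈ = limS-≈
    ; X = X
    ; X-zero = λ _ → refl
    ; X-+ = X-add
    ; X-small = X-low
    ; X-cancel = λ e f g h n → trans (sym (shift-high e f n)) (trans (h (e ℕ.+ n)) (shift-high e g n))
    ; W = W
    ; W-inv = W-inverse }
    where
    W-inverse : ∀ e → ((λ n → X 0 n C.+ C.- X (suc e) n) ⊛ W (suc e)) ≈S X 0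
    W-inverse e = S.trans (S.distribʳ (W (suc e)) (X 0) (λ n → C.- X (suc e) n))
      (S.trans (S.+-cong (S.*-identityˡ (W (suc e))) (S.sym (S.-‿distribˡ-* (X (suc e)) (W (suc e)))))
      (S.trans (S.+-congʳ {λ n → C.- (X (suc e) ⊛ W (suc e)) n} (W-eq e))
        (λ n → C.solve 2 (λ a b → (a C.:+ b) C.:+ (C.:- b) C.:= a) refl (X 0 n) ((X (suc e) ⊛ W (suc e)) n))))
      where module S = RingKit ringS

  private module Q = QSeries model

  private
    σ-pt : (∀ f g → (∀ n → f n ≈ g n) → ∀ n → σ f n ≈ σ g n)
    σ-pt f g h zero = trans (σ-0 f) (trans (h 0) (sym (σ-0 g)))
    σ-pt f g h (suc zero) = trans (σ-1 f) (sym (σ-1 g))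
    σ-pt f g h (suc (suc zero)) = trans (σ-2 f) (sym (σ-2 g))
    σ-pt f g h (suc (suc (suc n))) = trans (σ-3 f n) (trans (σ-pt (tail f) (tail g) (λ k → h (suc k)) n) (sym (σ-3 g n)))

    σ-M : ∀ M f g → f ≈[ M ] g → σ f ≈[ M ] σ g
    σ-M M f g h zero l = trans (σ-0 f) (trans (h 0 l) (sym (σ-0 g)))
    σ-M M f g h (suc zero) l = trans (σ-1 f) (sym (σ-1 g))
    σ-M M f g h (suc (suc zero)) l = trans (σ-2 f) (sym (σ-2 g))
    σ-M (suc M) f g h (suc (suc (suc n))) (s≤s l) = trans (σ-3 f n) (trans (σ-M M (tail f) (tail g) (λ k m → h (suc k) (s≤s m)) n (ℕP.≤-trans (ℕP.m≤n+m (suc n) 2) l)) (sym (σ-3 g n)))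

    σ-plus : ∀ f g n → σ (λ k → f k C.+ g k) n ≈ σ f n C.+ σ g n
    σ-plus f g zero = trans (σ-0 _) (sym (+-cong (σ-0 f) (σ-0 g)))
    σ-plus f g (suc zero) = trans (σ-1 _) (sym (trans (+-cong (σ-1 f) (σ-1 g)) (+-identityˡ _)))
    σ-plus f g (suc (suc zero)) = trans (σ-2 _) (sym (trans (+-cong (σ-2 f) (σ-2 g)) (+-identityˡ _)))
    σ-plus f g (suc (suc (suc n))) = trans (σ-3 _ n) (trans (σ-plus (tail f) (tail g) n) (sym (+-cong (σ-3 f n) (σ-3 g n))))

    σ-scale : ∀ k f n → σ (λ i → k C.* f i) n ≈ k C.* σ f n
    σ-scale k f zero = trans (σ-0 _) (*-congˡ (sym (σ-0 f)))
    σ-scale k f (suc zero) = trans (σ-1 _) (sym (trans (*-congˡ (σ-1 f)) (zeroʳ _)))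
    σ-scale k f (suc (suc zero)) = trans (σ-2 _) (sym (trans (*-congˡ (σ-2 f)) (zeroʳ _)))
    σ-scale k f (suc (suc (suc n))) = trans (σ-3 _ n) (trans (σ-scale k (tail f) n) (*-congˡ (sym (σ-3 f n))))

    σ-minus : ∀ f n → σ (λ k → C.- f k) n ≈ C.- σ f n
    σ-minus f zero = trans (σ-0 _) (C.-‿cong (sym (σ-0 f)))
    σ-minus f (suc zero) = trans (σ-1 _) (sym (trans (C.-‿cong (σ-1 f)) C.-0#≈0#))
    σ-minus f (suc (suc zero)) = trans (σ-2 _) (sym (trans (C.-‿cong (σ-2 f)) C.-0#≈0#))
    σ-minus f (suc (suc (suc n))) = trans (σ-3 _ n) (trans (σ-minus (tail f) n) (C.-‿cong (sym (σ-3 f n))))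

    σ-z : ∀ f → (∀ n → f n ≈ 0#) → ∀ n → σ f n ≈ 0#
    σ-z f h zero = trans (σ-0 _) (h 0)
    σ-z f h (suc zero) = σ-1 _
    σ-z f h (suc (suc zero)) = σ-2 _
    σ-z f h (suc (suc (suc n))) = trans (σ-3 _ n) (σ-z (tail f) (λ k → h (suc k)) n)

    σ-pow : ∀ e n → σ (X e) n ≈ X (3 ℕ.* e) n
    σ-pow zero zero = σ-0 _
    σ-pow zero (suc zero) = trans (σ-1 _) (sym (X-0s 0))
    σ-pow zero (suc (suc zero)) = trans (σ-2 _) (sym (X-0s 1))
    σ-pow zero (suc (suc (suc n))) = trans (σ-3 _ n) (trans (σ-z (tail (X 0)) X-0s n) (sym (X-0s (2 ℕ.+ n))))
    σ-pow (suc e) n = trans (pw n) (C.reflexive (≡.cong (λ z → X z n) (≡.sym (ℕP.*-suc 3 e))))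
      where
      pw : ∀ n → σ (X (suc e)) n ≈ X (3 ℕ.+ 3 ℕ.* e) n
      pw zero = trans (σ-0 _) (trans (X-s0 e) (sym (X-s0 _)))
      pw (suc zero) = trans (σ-1 _) (sym (trans (X-ss _ 0) (X-s0 _)))
      pw (suc (suc zero)) = trans (σ-2 _) (sym (trans (X-ss _ 1) (trans (X-ss _ 0) (X-s0 _))))
      pw (suc (suc (suc n))) = trans (σ-3 _ n) (trans (σ-pt _ _ (X-ss e) n) (trans (σ-pow e n) (sym (trans (X-ss _ _) (trans (X-ss _ _) (X-ss _ _))))))

    -- σ f = f₀ + q³ σ (tail f); a product is compared coefficient by coefficient through this recursion.
    times : ∀ f g n → (σ f ⊛ g) (3 ℕ.+ n) ≈ f 0 C.* g (3 ℕ.+ n) C.+ (σ (tail f) ⊛ g) n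
    times f g n = trans (⊛-suc (σ f) g (2 ℕ.+ n)) (+-cong (*-congʳ (σ-0 f)) (trans (⊛-suc (tail (σ f)) g (1 ℕ.+ n)) (trans (+-congʳ (trans (*-congʳ (σ-1 f)) (zeroˡ _)))
      (trans (+-identityˡ _) (trans (⊛-suc (tail (tail (σ f))) g n) (trans (+-congʳ (trans (*-congʳ (σ-2 f)) (zeroˡ _))) (trans (+-identityˡ _)
        (⊛-cong (tail (tail (tail (σ f)))) (σ (tail f)) g g (σ-3 f) (λ _ → refl) n))))))))

    σ-times : ∀ f g n → σ (f ⊛ g) n ≈ (σ f ⊛ σ g) n
    σ-times f g zero = trans (σ-0 _) (trans (⊛-zero f g) (sym (trans (⊛-zero (σ f) (σ g)) (C.*-cong (σ-0 f) (σ-0 g)))))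
    σ-times f g (suc zero) = trans (σ-1 _) (sym (trans (⊛-suc (σ f) (σ g) 0) (trans (+-cong (trans (*-congˡ (σ-1 g)) (zeroʳ _))
      (trans (⊛-zero (tail (σ f)) (σ g)) (trans (*-congʳ (σ-1 f)) (zeroˡ _)))) (+-identityˡ _))))
    σ-times f g (suc (suc zero)) = trans (σ-2 _) (sym (trans (⊛-suc (σ f) (σ g) 1) (trans (+-cong (trans (*-congˡ (σ-2 g)) (zeroʳ _))
      (trans (⊛-suc (tail (σ f)) (σ g) 0) (trans (+-cong (trans (*-congʳ (σ-1 f)) (zeroˡ _)) (trans (⊛-zero (tail (tail (σ f))) (σ g)) (trans (*-congʳ (σ-2 f)) (zeroˡ _)))) (+-identityˡ _)))) (+-identityˡ _))))
    σ-times f g (suc (suc (suc n))) = trans (σ-3 _ n) (trans (σ-pt _ _ (⊛-suc f g) n) (trans (σ-plus _ _ n)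
      (trans (+-cong (trans (σ-scale (f 0) (tail g) n) (*-congˡ (sym (σ-3 g n)))) (σ-times (tail f) g n)) (sym (times f (σ g) n)))))

  dilation : Dilation model
  dilation = record
    { σ = σ
    ; σ-cong = λ {f} {g} → σ-pt f g
    ; σ-mod = λ {M} {f} {g} → σ-M M f g
    ; σ-+ = σ-plus
    ; σ-* = σ-times
    ; σ-neg = σ-minus
    ; σ-one = σ-pow 0
    ; σ-X = σ-pow }

δ-yes : ∀ m n → m ≡ n → δ m n ≡ 1K
δ-yes m n e with m ℕ.≟ n
... | yes _ = ≡.refl
... | no ne = ⊥-elim (ne e)

δ-no : ∀ m n → m ≢ n → δ m n ≡ 0K
δ-no m n ne with m ℕ.≟ n
... | yes e = ⊥-elim (ne e)
... | no _ = ≡.refl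

δ-suc : ∀ m n → δ (suc m) (suc n) ≡ δ m n
δ-suc m n with m ℕ.≟ n
... | yes e = δ-yes (suc m) (suc n) (≡.cong suc e)
... | no ne = δ-no (suc m) (suc n) (λ e → ne (ℕP.suc-injective e))

δ-+ : ∀ d m n → δ (d ℕ.+ m) (d ℕ.+ n) ≡ δ m n
δ-+ zero m n = ≡.refl
δ-+ (suc d) m n = ≡.trans (δ-suc (d ℕ.+ m) (d ℕ.+ n)) (δ-+ d m n)

sumK-cong : ∀ n {f g : ℕ → K} → (∀ i → f i ≡ g i) → sumK n f ≡ sumK n g
sumK-cong zero h = ≡.refl
sumK-cong (suc n) h = ≡.cong₂ _+K_ (h n) (sumK-cong n h)

sumK-zero : ∀ n {f : ℕ → K} → (∀ i → i ℕ.< n → f i ≡ 0K) → sumK n f ≡ 0K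
sumK-zero n {f} h = ≡.trans (sumK-Σ n f) (≡.trans (KK.Σ-cong< n h) (KK.Σ-zero n))

-- Both geo and substP are sums of a j q^(d j).
module Sparse (e : ℕ) where
  private d = suc e

  sparse : (ℕ → K) → PS
  sparse a n = sumK (suc n) (λ j → a j *K δ (d ℕ.* j) n)

  private
    front : ∀ (a : ℕ → K) n m → sumK (suc m) (λ j → a j *K δ (d ℕ.* j) n) ≡ a 0 *K δ 0 n +K sumK m (λ j → a (suc j) *K δ (d ℕ.+ d ℕ.* j) n)
    front a n m = ≡.trans (sumK-Σ (suc m) (λ j → a j *K δ (d ℕ.* j) n)) (≡.trans (KK.Σ-front m (λ j → a j *K δ (d ℕ.* j) n))
      (≡.cong₂ _+K_ (≡.cong (λ z → a 0 *K δ z n) (ℕP.*-zeroʳ d))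
        (≡.trans (KK.Σ-cong m (λ j → ≡.cong (λ z → a (suc j) *K δ z n) (ℕP.*-suc d j))) (≡.sym (sumK-Σ m (λ j → a (suc j) *K δ (d ℕ.+ d ℕ.* j) n))))))

    vanish : ∀ (a : K) x n → x ≢ n → a *K δ x n ≡ 0K
    vanish a x n ne = ≡.trans (≡.cong (a *K_) (δ-no x n ne)) (KK.zeroʳ a)

  sparse-low : ∀ a n → n ℕ.≤ e → sparse a n ≡ a 0 *K δ 0 n
  sparse-low a n l = ≡.trans (front a n n) (≡.trans (≡.cong (λ z → a 0 *K δ 0 n +K z) (sumK-zero n (λ j _ → vanish (a (suc j)) (d ℕ.+ d ℕ.* j) n
      (λ eq → ℕP.<⇒≢ (ℕP.≤-trans (s≤s l) (ℕP.m≤m+n d (d ℕ.* j))) (≡.sym eq)))))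
    (KK.+-identityʳ (a 0 *K δ 0 n)))

  sparse-high : ∀ a n → sparse a (d ℕ.+ n) ≡ sparse (λ j → a (suc j)) n
  sparse-high a n = ≡.trans (front a (d ℕ.+ n) (d ℕ.+ n)) (≡.trans (≡.cong₂ _+K_ (vanish (a 0) 0 (d ℕ.+ n) (λ ())) rest) (KK.+-identityˡ (sparse (λ j → a (suc j)) n)))
    where
    f : ℕ → K
    f j = a (suc j) *K δ (d ℕ.* j) n
    rest : sumK (d ℕ.+ n) (λ j → a (suc j) *K δ (d ℕ.+ d ℕ.* j) (d ℕ.+ n)) ≡ sumK (suc n) f
    rest = ≡.trans (sumK-cong (d ℕ.+ n) (λ j → ≡.cong (a (suc j) *K_) (δ-+ d (d ℕ.* j) n)))
      (≡.trans (≡.cong (λ z → sumK z f) (≡.cong suc (ℕP.+-comm e n))) (≡.trans (sumK-Σ (suc n ℕ.+ e) f) (≡.trans (KK.Σ-split (suc n) e f)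
        (≡.trans (≡.cong₂ _+K_ (≡.sym (sumK-Σ (suc n) f)) (≡.trans (KK.Σ-cong e (λ i → vanish (a (suc (suc n ℕ.+ i))) (d ℕ.* (suc n ℕ.+ i)) n
            (λ eq → ℕP.<⇒≢ (ℕP.≤-trans (s≤s (ℕP.m≤m+n n i)) (ℕP.m≤m+n (suc n ℕ.+ i) (e ℕ.* (suc n ℕ.+ i)))) (≡.sym eq)))) (KK.Σ-zero e)))
          (KK.+-identityʳ (sumK (suc n) f))))))

geo-low : ∀ c e n → n ℕ.≤ e → geo c (suc e) n ≡ δ 0 n
geo-low c e n l = ≡.trans (Sparse.sparse-low e (c ^K_) n l) (KK.*-identityˡ (δ 0 n))

geo-high : ∀ c e n → geo c (suc e) (suc e ℕ.+ n) ≡ c *K geo c (suc e) n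
geo-high c e n = ≡.trans (Sparse.sparse-high e (c ^K_) n) (≡.trans (sumK-Σ (suc n) (λ j → (c *K (c ^K j)) *K δ (suc e ℕ.* j) n))
  (≡.trans (KK.Σ-cong (suc n) (λ j → KK.*-assoc c (c ^K j) (δ (suc e ℕ.* j) n))) (≡.trans (KK.Σ-*ˡ (suc n) c (λ j → (c ^K j) *K δ (suc e ℕ.* j) n))
    (≡.cong (c *K_) (≡.sym (sumK-Σ (suc n) (λ j → (c ^K j) *K δ (suc e ℕ.* j) n)))))))

substP-0 : ∀ f → substP 3 f 0 ≡ f 0
substP-0 f = ≡.trans (Sparse.sparse-low 2 f 0 z≤n) (KK.*-identityʳ (f 0))

substP-1 : ∀ f → substP 3 f 1 ≡ 0K
substP-1 f = ≡.trans (Sparse.sparse-low 2 f 1 (s≤s z≤n)) (KK.zeroʳ (f 0))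

substP-2 : ∀ f → substP 3 f 2 ≡ 0K
substP-2 f = ≡.trans (Sparse.sparse-low 2 f 2 (s≤s (s≤s z≤n))) (KK.zeroʳ (f 0))

module PSModel = SeriesModel KRing.ring _*P_ *P-zero *P-suc X^ ≡.refl (λ _ → ≡.refl) (λ _ → ≡.refl) δ-suc
  (geo 1K) (geo-low 1K) (λ e n → ≡.trans (geo-high 1K e n) (KK.*-identityˡ (geo 1K (suc e) n)))
  (substP 3) substP-0 substP-1 substP-2 (Sparse.sparse-high 2)

PSeries : QSeries
PSeries = PSModel.model

constP-third : ((constP third +P constP third) +P constP third) PS′.≈S oneP
constP-third n = KK.trans (KK.solve 2 (λ t x → (t KK.:* x KK.:+ t KK.:* x) KK.:+ t KK.:* x KK.:= ((t KK.:+ t) KK.:+ t) KK.:* x) ≡.refl third (oneP n)) (KK.*-identityˡ (oneP n))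

module M = Theory PSeries PSModel.dilation (constP third) constP-third

infix 4 _≈P_
_≈P_ : PS → PS → Set
f ≈P g = ∀ n → f n ≡ g n

Σ-at : ∀ m (F : ℕ → PS) n → M.Σ< m F n ≡ sumK m (λ k → F k n)
Σ-at zero F n = ≡.refl
Σ-at (suc m) F n = ≡.trans (KK.+-comm (M.Σ< m F n) (F m n)) (≡.cong (F m n +K_) (Σ-at m F n))

poch-≈ : ∀ a b → poch a b ≈P M.Po∞ b a
poch-≈ a b n = M.Po-recursion b a (finPoch a b) (λ _ → ≡.refl) (λ _ _ → ≡.refl) (suc n) n

inv1-inverse : ∀ f → f 0 ≡ 1K → (f *P inv1 f) ≈P oneP
inv1-inverse f f0 = M.trans {f *P inv1 f} {(oneP -P h) *P M.Σ∞ (powP h)} {oneP}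
  (M.*-cong {f} {oneP -P h} {inv1 f} {M.Σ∞ (powP h)} (λ n → KK.solve 2 (λ a b → b KK.:= a KK.:- (a KK.:- b)) ≡.refl (oneP n) (f n)) (λ n → ≡.sym (Σ-at (suc n) (powP h) n)))
  (M.geometric-series h h′ (powP h) h≈ (λ _ → ≡.refl) (λ _ _ → ≡.refl))
  where
  h h′ : PS
  h = oneP -P f
  h′ k = h (suc k)
  h≈ : h ≈P (X^ 1 *P h′)
  h≈ = PSModel.by-shift 1 {h} {X^ 1 *P h′}
    (λ { zero _ → ≡.trans (≡.cong (λ x → 1K -K x) f0) (≡.sym (PSModel.shift-low 1 h′ 0 (s≤s z≤n))) ; (suc n) (s≤s ()) })
    (λ n → ≡.sym (PSModel.shift-high 1 h′ n))

constP-* : ∀ c f → (constP c *P f) ≈P scaleP c f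
constP-* c f = PS′.scalar-⊛ c (constP c) f (KK.*-identityʳ c) (λ n → KK.zeroʳ c)

geo-inverse : ∀ c e → ((oneP -P constP c *P X^ (suc e)) *P geo c (suc e)) ≈P oneP
geo-inverse c e n = ≡.trans (M.solve 3 (λ a x g → (M.:1 M.:- a M.:* x) M.:* g M.:= g M.:- a M.:* (x M.:* g)) (λ _ → ≡.refl) (constP c) (X^ (suc e)) (geo c (suc e)) n)
  (≡.trans (≡.cong (λ z → z -K (constP c *P (X^ (suc e) *P geo c (suc e))) n) (recursion n)) (KK.solve 2 (λ a b → (a KK.:+ b) KK.:- b KK.:= a) ≡.refl (oneP n) ((constP c *P (X^ (suc e) *P geo c (suc e))) n)))
  where
  xg = X^ (suc e) *P geo c (suc e)
  recursion : geo c (suc e) ≈P (oneP +P constP c *P xg)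
  recursion = PSModel.by-shift (suc e) {geo c (suc e)} {oneP +P constP c *P xg}
    (λ { n (s≤s l) → ≡.trans (geo-low c e n l) (≡.sym (≡.trans (≡.cong (oneP n +K_) (≡.trans (constP-* c xg n) (≡.trans (≡.cong (c *K_) (PSModel.shift-low (suc e) (geo c (suc e)) n (s≤s l))) (KK.zeroʳ c)))) (KK.+-identityʳ (oneP n)))) })
    (λ n → ≡.trans (geo-high c e n) (≡.sym (≡.trans (KK.+-identityˡ _) (≡.trans (constP-* c xg (suc e ℕ.+ n)) (≡.cong (c *K_) (PSModel.shift-high (suc e) (geo c (suc e)) n))))))

coeff-at : ∀ L f k n → k ℤ.+ + L ≡ + n → coeffL (lau L f) k ≡ f n
coeff-at L f k n e with k ℤ.+ + L
coeff-at L f k n ≡.refl | .(+ n) = ≡.refl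

coeff-below : ∀ L f k n → k ℤ.+ + L ≡ -[1+ n ] → coeffL (lau L f) k ≡ 0K
coeff-below L f k n e with k ℤ.+ + L
coeff-below L f k n ≡.refl | .(-[1+ n ]) = ≡.refl

private
  coeff-shift : ∀ L M s N f g → L ≡ s ℕ.+ M → (∀ n → f n ≡ g (s ℕ.+ n)) → (∀ n → n ℕ.< s → g n ≡ 0K) → coeffL (lau M f) (+ N ℤ.- + L) ≡ g N
  coeff-shift L M s N f g e hi lo with ℕP.<-≤-connex N s
  ... | inj₁ l = ≡.trans (coeff-below M f (+ N ℤ.- + L) (s ℕ.∸ suc N) (≡.trans eq (neg-⊖ s N (s ℕ.∸ suc N) (≡.sym (≡.trans (ℕP.+-suc N _) (ℕP.m+[n∸m]≡n l)))))) (≡.sym (lo N l))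
    where
    eq : (+ N ℤ.- + L) ℤ.+ + M ≡ + N ℤ.- + s
    eq = ≡.trans (≡.cong (λ z → (+ N ℤ.- + z) ℤ.+ + M) e) (ZS.solve 3 (λ N s M → (N ZS.:- (s ZS.:+ M)) ZS.:+ M ZS.:= N ZS.:- s) ≡.refl (+ N) (+ s) (+ M))
  ... | inj₂ l = ≡.trans (coeff-at M f (+ N ℤ.- + L) (N ℕ.∸ s) (≡.trans eq (pos-⊖ s N (N ℕ.∸ s) (≡.sym (ℕP.m+[n∸m]≡n l))))) (≡.trans (hi (N ℕ.∸ s)) (≡.cong g (ℕP.m+[n∸m]≡n l)))
    where
    eq : (+ N ℤ.- + L) ℤ.+ + M ≡ + N ℤ.- + s
    eq = ≡.trans (≡.cong (λ z → (+ N ℤ.- + z) ℤ.+ + M) e) (ZS.solve 3 (λ N s M → (N ZS.:- (s ZS.:+ M)) ZS.:+ M ZS.:= N ZS.:- s) ≡.refl (+ N) (+ s) (+ M))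

mono-coeff : ∀ z L s g N → z ℤ.+ + L ≡ + s → coeffL (mono z *L fromPS g) (+ N ℤ.- + L) ≡ (X^ s *P g) N
mono-coeff (+ p) L s g N e = coeff-shift L 0 L N (X^ p *P g) (X^ s *P g) (≡.sym (ℕP.+-identityʳ L))
  (λ n → ≡.sym (≡.trans (split (L ℕ.+ n)) (PSModel.shift-high L (X^ p *P g) n)))
  (λ n l → PSModel.shift-low s g n (ℕP.≤-trans l (≡.subst (L ℕ.≤_) s≡ (ℕP.m≤m+n L p))))
  where
  s≡ : L ℕ.+ p ≡ s
  s≡ = ≡.trans (ℕP.+-comm L p) (ℤP.+-injective e)
  split : (X^ s *P g) ≈P (X^ L *P (X^ p *P g))
  split = M.trans {X^ s *P g} {(X^ L *P X^ p) *P g} {X^ L *P (X^ p *P g)} (M.*-congʳ {g} {X^ s} {X^ L *P X^ p} (≡.subst (λ z → X^ z ≈P (X^ L *P X^ p)) s≡ (PSModel.X-add L p))) (M.*-assoc (X^ L) (X^ p) g)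
mono-coeff -[1+ p ] L s g N e = coeff-shift L (suc p ℕ.+ 0) s N (oneP *P g) (X^ s *P g) L≡
  (λ n → ≡.trans (M.*-identityˡ g n) (≡.sym (PSModel.shift-high s g n)))
  (λ n l → PSModel.shift-low s g n l)
  where
  L≡ : L ≡ s ℕ.+ (suc p ℕ.+ 0)
  L≡ = ℤP.+-injective (≡.trans (ZS.solve 2 (λ L p → L ZS.:= (ZS.:- p ZS.:+ L) ZS.:+ p) ≡.refl (+ L) (+ suc p)) (≡.trans (≡.cong (ℤ._+ + suc p) e) (≡.cong (λ z → + (s ℕ.+ z)) (≡.sym (ℕP.+-identityʳ (suc p))))))

bisum-ser : ∀ L t (T : ℤ → PS) → (∀ z N → coeffL (t z) (+ N ℤ.- + L) ≡ T z N) → M.Summable (λ k → T (+ suc k)) → M.Summable (λ k → T -[1+ k ]) →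
  Laurent.ser (bisum L t) ≈P (T (+ 0) +P (M.Σ∞ (λ k → T (+ suc k)) +P M.Σ∞ (λ k → T -[1+ k ])))
bisum-ser L t T h sp sn N = begin
  sumK (suc (Q ℕ.+ Q)) (λ i → coeffL (t (+ i ℤ.- + Q)) (+ N ℤ.- + L)) ≡⟨ sumK-cong (suc (Q ℕ.+ Q)) (λ i → h (+ i ℤ.- + Q) N) ⟩
  sumK (suc (Q ℕ.+ Q)) (λ i → F (+ i ℤ.- + Q)) ≡⟨ sumK-Σ (suc (Q ℕ.+ Q)) (λ i → F (+ i ℤ.- + Q)) ⟩
  KK.Σ< (suc (Q ℕ.+ Q)) (λ i → F (+ i ℤ.- + Q)) ≡⟨ ≡.cong (λ z → KK.Σ< z (λ i → F (+ i ℤ.- + Q))) (≡.sym (ℕP.+-suc Q Q)) ⟩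
  KK.Σ< (Q ℕ.+ suc Q) (λ i → F (+ i ℤ.- + Q)) ≡⟨ KK.Σ-split Q (suc Q) (λ i → F (+ i ℤ.- + Q)) ⟩
  KK.Σ< Q (λ i → F (+ i ℤ.- + Q)) +K KK.Σ< (suc Q) (λ i → F (+ (Q ℕ.+ i) ℤ.- + Q)) ≡⟨ ≡.cong₂ _+K_ lower upper ⟩
  KK.Σ< Q (λ k → F -[1+ k ]) +K (F (+ 0) +K KK.Σ< Q (λ k → F (+ suc k)))
    ≡⟨ KK.solve 3 (λ a b c → a KK.:+ (b KK.:+ c) KK.:= b KK.:+ (c KK.:+ a)) ≡.refl (KK.Σ< Q (λ k → F -[1+ k ])) (F (+ 0)) (KK.Σ< Q (λ k → F (+ suc k))) ⟩
  F (+ 0) +K (KK.Σ< Q (λ k → F (+ suc k)) +K KK.Σ< Q (λ k → F -[1+ k ])) ≡⟨ ≡.cong (F (+ 0) +K_) (≡.cong₂ _+K_ (infinite (λ k → T (+ suc k)) sp) (infinite (λ k → T -[1+ k ]) sn)) ⟩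
  _ ∎
  where
  open ≡.≡-Reasoning
  Q = N ℕ.+ L ℕ.+ 30
  F : ℤ → K
  F z = T z N
  lower : KK.Σ< Q (λ i → F (+ i ℤ.- + Q)) ≡ KK.Σ< Q (λ k → F -[1+ k ])
  lower = ≡.trans (≡.sym (KK.Σ-rev Q (λ i → F (+ i ℤ.- + Q)))) (KK.Σ-cong< Q (λ k l → ≡.cong F (neg-⊖ Q (Q ℕ.∸ suc k) k (≡.sym (ℕP.m∸n+n≡m l)))))
  upper : KK.Σ< (suc Q) (λ i → F (+ (Q ℕ.+ i) ℤ.- + Q)) ≡ F (+ 0) +K KK.Σ< Q (λ k → F (+ suc k))
  upper = ≡.trans (KK.Σ-cong (suc Q) (λ i → ≡.cong F (pos-⊖ Q (Q ℕ.+ i) i ≡.refl))) (KK.Σ-front Q (λ i → F (+ i)))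
  infinite : ∀ (f : ℕ → PS) → M.Summable f → KK.Σ< Q (λ k → f k N) ≡ M.Σ∞ f N
  infinite f hf = ≡.trans (≡.sym (≡.trans (Σ-at Q f N) (sumK-Σ Q (λ k → f k N)))) (M.Σ∞-≈ {f} hf (suc N) Q
    (≡.subst (suc N ℕ.≤_) (≡.sym (ℕP.+-assoc N L 30)) (≡.subst (ℕ._≤ N ℕ.+ (L ℕ.+ 30)) (ℕP.+-comm N 1) (ℕP.+-monoʳ-≤ N (ℕP.≤-trans (s≤s z≤n) (ℕP.m≤n+m 30 L))))) N ℕP.≤-refl)

quadratic : ∀ a b c k → + (a ℕ.* k ℕ.* k ℕ.+ b ℕ.* k ℕ.+ c) ≡ + a ℤ.* + k ℤ.* + k ℤ.+ + b ℤ.* + k ℤ.+ + c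
quadratic a b c k = ≡.cong₂ (λ x y → x ℤ.+ y ℤ.+ + c) (≡.trans (ℤP.pos-* (a ℕ.* k) k) (≡.cong (ℤ._* + k) (ℤP.pos-* a k))) (ℤP.pos-* b k)

linear : ∀ a b k → + (a ℕ.* k ℕ.+ b) ≡ + a ℤ.* + k ℤ.+ + b
linear a b k = ≡.cong (ℤ._+ + b) (ℤP.pos-* a k)

affine : ∀ a b k → + (a ℕ.+ b ℕ.* k) ≡ + a ℤ.+ + b ℤ.* + k
affine a b k = ≡.cong (λ z → + a ℤ.+ z) (ℤP.pos-* b k)

geomInv-pos : ∀ z e → 1 ℕ.≤ e → z ≡ + e → geomInv 1K z ≈P M.W e
geomInv-pos .(+ suc e) (suc e) _ ≡.refl n = ≡.refl

geomInv-neg : ∀ z e → 1 ℕ.≤ e → z ≡ ℤ.- + e → geomInv 1K z ≈P M.-_ (X^ e *P M.W e)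
geomInv-neg .(-[1+ e ]) (suc e) _ ≡.refl n = M.U-negative e n

cube-ab : (constP ζ *P constP ζ⁻¹) ≈P oneP
cube-ab n = ≡.trans (constP-* ζ (constP ζ⁻¹) n) (≡.trans (≡.sym (KK.*-assoc ζ ζ⁻¹ (oneP n))) (KK.*-identityˡ (oneP n)))

cube-a+b : (constP ζ +P constP ζ⁻¹) ≈P M.-_ oneP
cube-a+b n = ≡.trans (≡.sym (KK.distribʳ (oneP n) ζ ζ⁻¹)) (KK.solve 1 (λ x → (KK.:- KK.:1) KK.:* x KK.:= KK.:- x) ≡.refl (oneP n))

module Cube (e : ℕ) = M.CubeRoots (constP ζ) (constP ζ⁻¹) cube-ab cube-a+b e (geo ζ (suc e)) (geo ζ⁻¹ (suc e)) (geo-inverse ζ e) (geo-inverse ζ⁻¹ e)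

cube-pos : ∀ z d → 1 ℕ.≤ d → z ≡ + d → (geomInv ζ z *P geomInv ζ⁻¹ z) ≈P ((oneP -P X^ d) *P M.W (3 ℕ.* d))
cube-pos .(+ suc e) (suc e) _ ≡.refl = Cube.product⁺ e

cube-neg : ∀ z d → 1 ℕ.≤ d → z ≡ ℤ.- + d → (geomInv ζ z *P geomInv ζ⁻¹ z) ≈P (X^ (d ℕ.+ d) *P ((oneP -P X^ d) *P M.W (3 ℕ.* d)))
cube-neg .(-[1+ e ]) (suc e) _ ≡.refl = Cube.product⁻ e

bisum-mono : ∀ L (z : ℤ → ℤ) (G : ℤ → PS) (s : ℤ → ℕ) → (∀ i → z i ℤ.+ + L ≡ + s i) → (∀ k → k ℕ.≤ s (+ suc k)) → (∀ k → k ℕ.≤ s -[1+ k ]) →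
  Laurent.ser (bisum L (λ i → mono (z i) *L fromPS (G i))) ≈P ((X^ (s (+ 0)) *P G (+ 0)) +P (M.Σ∞ (λ k → X^ (s (+ suc k)) *P G (+ suc k)) +P M.Σ∞ (λ k → X^ (s -[1+ k ]) *P G -[1+ k ])))
bisum-mono L z G s h lp ln = bisum-ser L (λ i → mono (z i) *L fromPS (G i)) (λ i → X^ (s i) *P G i) (λ i N → mono-coeff (z i) L (s i) (G i) N (h i))
  (M.X-Summable (λ k → s (+ suc k)) (λ k → G (+ suc k)) lp) (M.X-Summable (λ k → s -[1+ k ]) (λ k → G -[1+ k ]) ln)

sum1-ser : Laurent.ser sum1 ≈P (constP third +P ((M.lq 14 8 3 M.- M.lq 17 11 3) +P (M.lq 16 10 3 M.- M.lq 19 13 3)))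
sum1-ser = M.trans {Laurent.ser sum1} (bisum-mono 0 (λ n → + 6 ℤ.* n ℤ.* n ℤ.+ + 2 ℤ.* n) G s h (λ k → M.k≤ 6 14 8 k (s≤s z≤n)) (λ k → M.k≤ 6 10 4 k (s≤s z≤n)))
  (M.+-cong {X^ 0 *P G (+ 0)} {constP third} front
    (M.+-cong {M.Σ∞ (λ k → X^ (s (+ suc k)) *P G (+ suc k))} {M.lq 14 8 3 M.- M.lq 17 11 3} {M.Σ∞ (λ k → X^ (s -[1+ k ]) *P G -[1+ k ])} {M.lq 16 10 3 M.- M.lq 19 13 3}
      (M.lq-sum 14 8 3 (λ k → G (+ suc k)) (s≤s z≤n) (λ k → cube-pos (+ 3 ℤ.* + suc k) (3 ℕ.* k ℕ.+ 3) (≡.subst (1 ℕ.≤_) (ℕP.+-comm 3 _) (s≤s z≤n))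
        (≡.trans (ZS.solve 1 (λ k → ZS.con (+ 3) ZS.:* (ZS.con (+ 1) ZS.:+ k) ZS.:= ZS.con (+ 3) ZS.:* k ZS.:+ ZS.con (+ 3)) ≡.refl (+ k)) (≡.sym (linear 3 3 k)))))
      (M.lq-sum⁻ 10 4 3 (λ k → G -[1+ k ]) (s≤s z≤n) (λ k → cube-neg (+ 3 ℤ.* -[1+ k ]) (3 ℕ.* k ℕ.+ 3) (≡.subst (1 ℕ.≤_) (ℕP.+-comm 3 _) (s≤s z≤n))
        (≡.trans (ZS.solve 1 (λ k → ZS.con (+ 3) ZS.:* (ZS.:- (ZS.con (+ 1) ZS.:+ k)) ZS.:= ZS.:- (ZS.con (+ 3) ZS.:* k ZS.:+ ZS.con (+ 3))) ≡.refl (+ k)) (≡.cong ℤ.-_ (≡.sym (linear 3 3 k))))))))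
  where
  G : ℤ → PS
  G n = geomInv ζ (+ 3 ℤ.* n) *P geomInv ζ⁻¹ (+ 3 ℤ.* n)
  s : ℤ → ℕ
  s (+ zero) = 0
  s (+ suc k) = 6 ℕ.* k ℕ.* k ℕ.+ 14 ℕ.* k ℕ.+ 8
  s -[1+ k ] = 6 ℕ.* k ℕ.* k ℕ.+ 10 ℕ.* k ℕ.+ 4
  h : ∀ n → + 6 ℤ.* n ℤ.* n ℤ.+ + 2 ℤ.* n ℤ.+ + 0 ≡ + s n
  h (+ zero) = ≡.refl
  h (+ suc k) = ≡.trans (ZS.solve 1 (λ k → ZS.con (+ 6) ZS.:* (ZS.con (+ 1) ZS.:+ k) ZS.:* (ZS.con (+ 1) ZS.:+ k) ZS.:+ ZS.con (+ 2) ZS.:* (ZS.con (+ 1) ZS.:+ k) ZS.:+ ZS.con (+ 0)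
    ZS.:= ZS.con (+ 6) ZS.:* k ZS.:* k ZS.:+ ZS.con (+ 14) ZS.:* k ZS.:+ ZS.con (+ 8)) ≡.refl (+ k)) (≡.sym (quadratic 6 14 8 k))
  h -[1+ k ] = ≡.trans (ZS.solve 1 (λ k → ZS.con (+ 6) ZS.:* (ZS.:- (ZS.con (+ 1) ZS.:+ k)) ZS.:* (ZS.:- (ZS.con (+ 1) ZS.:+ k)) ZS.:+ ZS.con (+ 2) ZS.:* (ZS.:- (ZS.con (+ 1) ZS.:+ k)) ZS.:+ ZS.con (+ 0)
    ZS.:= ZS.con (+ 6) ZS.:* k ZS.:* k ZS.:+ ZS.con (+ 10) ZS.:* k ZS.:+ ZS.con (+ 4)) ≡.refl (+ k)) (≡.sym (quadratic 6 10 4 k))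
  front : (X^ 0 *P G (+ 0)) ≈P constP third
  front n = ≡.trans (M.*-identityˡ (G (+ 0)) n) (≡.trans (constP-* (invK (1K -K ζ)) (constP (invK (1K -K ζ⁻¹))) n) (≡.sym (KK.*-assoc (invK (1K -K ζ)) (invK (1K -K ζ⁻¹)) (oneP n))))

open ZS using (_:*_; _:+_; :-_; _:=_; con)

front⁺ : ∀ (T : ℕ → PS) U → M.Summable T → (T 0 +P (M.Σ∞ (λ k → T (suc k)) +P U)) ≈P (M.Σ∞ T +P U)
front⁺ T U h n = ≡.trans (≡.sym (KK.+-assoc (T 0 n) (M.Σ∞ (λ k → T (suc k)) n) (U n))) (≡.cong (_+K U n) (M.Σ∞-front {T} h n))

front⁻ : ∀ (T : ℕ → PS) U → M.Summable T → (T 0 +P (U +P M.Σ∞ (λ k → T (suc k)))) ≈P (U +P M.Σ∞ T)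
front⁻ T U h n = ≡.trans (KK.solve 3 (λ a b c → a KK.:+ (b KK.:+ c) KK.:= b KK.:+ (a KK.:+ c)) ≡.refl (T 0 n) (U n) (M.Σ∞ (λ k → T (suc k)) n)) (≡.cong (U n +K_) (M.Σ∞-front {T} h n))

sum2-ser : Laurent.ser sum2 ≈P ((M.lq 8 2 1 M.- M.lq 11 3 1) +P (M.lq 10 4 2 M.- M.lq 13 6 2))
sum2-ser = M.trans {Laurent.ser sum2} (bisum-mono 0 (λ n → + 6 ℤ.* n ℤ.* n ℤ.+ + 8 ℤ.* n ℤ.+ + 2) G s h (λ k → ℕP.≤-trans (ℕP.n≤1+n k) (M.k≤ 6 8 2 (suc k) (s≤s z≤n))) (λ k → M.k≤ 6 4 0 k (s≤s z≤n)))
  (M.trans (front⁺ (λ k → X^ (s (+ k)) *P G (+ k)) (M.Σ∞ (λ k → X^ (s -[1+ k ]) *P G -[1+ k ])) (M.X-Summable (λ k → s (+ k)) (λ k → G (+ k)) (λ k → M.k≤ 6 8 2 k (s≤s z≤n))))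
    (M.+-cong {M.Σ∞ (λ k → X^ (s (+ k)) *P G (+ k))} {M.lq 8 2 1 M.- M.lq 11 3 1} {M.Σ∞ (λ k → X^ (s -[1+ k ]) *P G -[1+ k ])} {M.lq 10 4 2 M.- M.lq 13 6 2}
      (M.lq-sum 8 2 1 (λ k → G (+ k)) (s≤s z≤n) (λ k → cube-pos (+ 3 ℤ.* + k ℤ.+ + 1) (3 ℕ.* k ℕ.+ 1) (≡.subst (1 ℕ.≤_) (ℕP.+-comm 1 _) (s≤s z≤n)) (≡.sym (linear 3 1 k))))
      (M.lq-sum⁻ 4 0 2 (λ k → G -[1+ k ]) (s≤s z≤n) (λ k → cube-neg (+ 3 ℤ.* -[1+ k ] ℤ.+ + 1) (3 ℕ.* k ℕ.+ 2) (≡.subst (1 ℕ.≤_) (ℕP.+-comm 2 _) (s≤s z≤n))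
        (≡.trans (ZS.solve 1 (λ k → con (+ 3) :* (:- (con (+ 1) :+ k)) :+ con (+ 1) := :- (con (+ 3) :* k :+ con (+ 2))) ≡.refl (+ k)) (≡.cong ℤ.-_ (≡.sym (linear 3 2 k))))))))
  where
  G : ℤ → PS
  G n = geomInv ζ (+ 3 ℤ.* n ℤ.+ + 1) *P geomInv ζ⁻¹ (+ 3 ℤ.* n ℤ.+ + 1)
  s : ℤ → ℕ
  s (+ k) = 6 ℕ.* k ℕ.* k ℕ.+ 8 ℕ.* k ℕ.+ 2
  s -[1+ k ] = 6 ℕ.* k ℕ.* k ℕ.+ 4 ℕ.* k ℕ.+ 0
  h : ∀ n → + 6 ℤ.* n ℤ.* n ℤ.+ + 8 ℤ.* n ℤ.+ + 2 ℤ.+ + 0 ≡ + s n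
  h (+ k) = ≡.trans (ℤP.+-identityʳ _) (≡.sym (quadratic 6 8 2 k))
  h -[1+ k ] = ≡.trans (ZS.solve 1 (λ k → let n = :- (con (+ 1) :+ k) in con (+ 6) :* n :* n :+ con (+ 8) :* n :+ con (+ 2) :+ con (+ 0)
    := con (+ 6) :* k :* k :+ con (+ 4) :* k :+ con (+ 0)) ≡.refl (+ k)) (≡.sym (quadratic 6 4 0 k))

sums-difference : (Laurent.ser sum1 -P Laurent.ser sum2) ≈P M.qsum
sums-difference n = ≡.trans (≡.cong₂ _-K_ (sum1-ser n) (sum2-ser n))
  (KK.solve 9 (λ t a b c d e f g h → (t KK.:+ ((a KK.:- b) KK.:+ (c KK.:- d))) KK.:- ((e KK.:- f) KK.:+ (g KK.:- h))
    KK.:= (((((((t KK.:+ a) KK.:- b) KK.:+ c) KK.:- d) KK.:- e) KK.:+ f) KK.:- g) KK.:+ h) ≡.refl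
    (constP third n) (M.lq 14 8 3 n) (M.lq 17 11 3 n) (M.lq 16 10 3 n) (M.lq 19 13 3 n) (M.lq 8 2 1 n) (M.lq 11 3 1 n) (M.lq 10 4 2 n) (M.lq 13 6 2 n))

S-3-28-ser : Laurent.ser (S 0 (ℤ.- + 3) (ℤ.- + 28) (+ 9)) ≈P (M.m 8 26 6 M.- M.m 3 19 3)
S-3-28-ser = M.trans {Laurent.ser (S 0 (ℤ.- + 3) (ℤ.- + 28) (+ 9))} (bisum-mono 0 (λ n → + 9 ℤ.* (+ 2 ℤ.* n ℤ.* (n ℤ.+ + 1)) ℤ.+ (ℤ.- + 28) ℤ.* n) G s h (λ k → M.k≤ 18 26 8 k (s≤s z≤n)) (λ k → l k))
  (M.trans (front⁻ (λ k → X^ (18 ℕ.* k ℕ.* k ℕ.+ 10 ℕ.* k ℕ.+ 0) *P G (ℤ.- + k)) (M.Σ∞ (λ k → X^ (s (+ suc k)) *P G (+ suc k)))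
      (M.X-Summable (λ k → 18 ℕ.* k ℕ.* k ℕ.+ 10 ℕ.* k ℕ.+ 0) (λ k → G (ℤ.- + k)) (λ k → M.k≤ 18 10 0 k (s≤s z≤n))))
    (M.+-cong {M.Σ∞ (λ k → X^ (s (+ suc k)) *P G (+ suc k))} {M.m 8 26 6} {M.Σ∞ (λ k → X^ (18 ℕ.* k ℕ.* k ℕ.+ 10 ℕ.* k ℕ.+ 0) *P G (ℤ.- + k))} {M.- M.m 3 19 3}
      (M.lam-sum 26 8 6 (λ k → G (+ suc k)) (s≤s z≤n) (λ k → geomInv-pos (ℤ.- + 3 ℤ.+ + 9 ℤ.* + suc k) (6 ℕ.+ 9 ℕ.* k) (s≤s z≤n)
        (≡.trans (ZS.solve 1 (λ k → con (ℤ.- + 3) :+ con (+ 9) :* (con (+ 1) :+ k) := con (+ 6) :+ con (+ 9) :* k) ≡.refl (+ k)) (≡.sym (affine 6 9 k)))))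
      (M.lam-sum⁻ 10 0 3 (λ k → G (ℤ.- + k)) (s≤s z≤n) (λ k → geomInv-neg (ℤ.- + 3 ℤ.+ + 9 ℤ.* (ℤ.- + k)) (3 ℕ.+ 9 ℕ.* k) (s≤s z≤n)
        (≡.trans (ZS.solve 1 (λ k → con (ℤ.- + 3) :+ con (+ 9) :* (:- k) := :- (con (+ 3) :+ con (+ 9) :* k)) ≡.refl (+ k)) (≡.cong ℤ.-_ (≡.sym (affine 3 9 k))))))))
  where
  G : ℤ → PS
  G n = geomInv 1K (ℤ.- + 3 ℤ.+ + 9 ℤ.* n)
  s : ℤ → ℕ
  s (+ zero) = 0
  s (+ suc k) = 18 ℕ.* k ℕ.* k ℕ.+ 26 ℕ.* k ℕ.+ 8
  s -[1+ k ] = 18 ℕ.* suc k ℕ.* suc k ℕ.+ 10 ℕ.* suc k ℕ.+ 0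
  l : ∀ k → k ℕ.≤ s -[1+ k ]
  l k = ℕP.≤-trans (ℕP.n≤1+n k) (M.k≤ 18 10 0 (suc k) (s≤s z≤n))
  h : ∀ n → + 9 ℤ.* (+ 2 ℤ.* n ℤ.* (n ℤ.+ + 1)) ℤ.+ (ℤ.- + 28) ℤ.* n ℤ.+ + 0 ≡ + s n
  h (+ zero) = ≡.refl
  h (+ suc k) = ≡.trans (ZS.solve 1 (λ k → let n = con (+ 1) :+ k in con (+ 9) :* (con (+ 2) :* n :* (n :+ con (+ 1))) :+ con (ℤ.- + 28) :* n :+ con (+ 0)
    := con (+ 18) :* k :* k :+ con (+ 26) :* k :+ con (+ 8)) ≡.refl (+ k)) (≡.sym (quadratic 18 26 8 k))
  h -[1+ k ] = ≡.trans (ZS.solve 1 (λ k → let n = :- (con (+ 1) :+ k) ; k⁺ = con (+ 1) :+ k in con (+ 9) :* (con (+ 2) :* n :* (n :+ con (+ 1))) :+ con (ℤ.- + 28) :* n :+ con (+ 0)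
    := con (+ 18) :* k⁺ :* k⁺ :+ con (+ 10) :* k⁺ :+ con (+ 0)) ≡.refl (+ k)) (≡.sym (quadratic 18 10 0 (suc k)))

S-11-28-ser : Laurent.ser (S 28 (+ 11) (+ 28) (+ 9)) ≈P (M.m 0 10 2 M.- M.m 15 35 7)
S-11-28-ser = M.trans {Laurent.ser (S 28 (+ 11) (+ 28) (+ 9))} (bisum-ser 28 (λ n → mono (+ 9 ℤ.* (+ 2 ℤ.* n ℤ.* (n ℤ.+ + 1)) ℤ.+ + 28 ℤ.* n) *L fromPS (G n)) (λ n → X^ (s n) *P G n) (λ n N → mono-coeff (+ 9 ℤ.* (+ 2 ℤ.* n ℤ.* (n ℤ.+ + 1)) ℤ.+ + 28 ℤ.* n) 28 (s n) (G n) N (h n))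
    (M.X-Summable (λ k → s (+ suc k)) (λ k → G (+ suc k)) l⁺) (λ k → M.X*-small (G -[1+ k ]) (l⁻ k)))
  (M.trans regroup
    (M.+-cong {M.Σ∞ (λ j → f j)} {M.m 0 10 2} {M.Σ∞ (λ k → X^ (s -[1+ suc k ]) *P G -[1+ suc k ])} {M.- M.m 15 35 7}
      (M.lam-sum 10 0 2 (λ j → G (ℤ.- + 1 ℤ.+ + j)) (s≤s z≤n) (λ k → geomInv-pos (+ 11 ℤ.+ + 9 ℤ.* (ℤ.- + 1 ℤ.+ + k)) (2 ℕ.+ 9 ℕ.* k) (s≤s z≤n)
        (≡.trans (ZS.solve 1 (λ k → con (+ 11) :+ con (+ 9) :* (con (ℤ.- + 1) :+ k) := con (+ 2) :+ con (+ 9) :* k) ≡.refl (+ k)) (≡.sym (affine 2 9 k)))))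
      (M.lam-sum⁻ 26 8 7 (λ k → G -[1+ suc k ]) (s≤s z≤n) (λ k → geomInv-neg (+ 11 ℤ.+ + 9 ℤ.* -[1+ suc k ]) (7 ℕ.+ 9 ℕ.* k) (s≤s z≤n)
        (≡.trans (ZS.solve 1 (λ k → con (+ 11) :+ con (+ 9) :* (:- (con (+ 2) :+ k)) := :- (con (+ 7) :+ con (+ 9) :* k)) ≡.refl (+ k)) (≡.cong ℤ.-_ (≡.sym (affine 7 9 k))))))))
  where
  G : ℤ → PS
  G n = geomInv 1K (+ 11 ℤ.+ + 9 ℤ.* n)
  f : ℕ → PS
  f j = X^ (18 ℕ.* j ℕ.* j ℕ.+ 10 ℕ.* j ℕ.+ 0) *P G (ℤ.- + 1 ℤ.+ + j)
  s : ℤ → ℕ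
  s (+ k) = 18 ℕ.* suc k ℕ.* suc k ℕ.+ 10 ℕ.* suc k ℕ.+ 0
  s -[1+ zero ] = 0
  s -[1+ suc k ] = 18 ℕ.* k ℕ.* k ℕ.+ 26 ℕ.* k ℕ.+ 8
  l⁺ : ∀ k → k ℕ.≤ s (+ suc k)
  l⁺ k = ℕP.≤-trans (ℕP.m≤n+m k 2) (M.k≤ 18 10 0 (2 ℕ.+ k) (s≤s z≤n))
  l⁻ : ∀ k → k ℕ.≤ s -[1+ k ]
  l⁻ zero = z≤n
  l⁻ (suc k) = ≡.subst (suc k ℕ.≤_) (ℕP.+-assoc (18 ℕ.* k ℕ.* k ℕ.+ 26 ℕ.* k) 1 7)
    (ℕP.≤-trans (≡.subst (ℕ._≤ 18 ℕ.* k ℕ.* k ℕ.+ 26 ℕ.* k ℕ.+ 1) (ℕP.+-comm k 1) (ℕP.+-monoˡ-≤ 1 (ℕP.≤-trans (M.k≤ 18 26 0 k (s≤s z≤n)) (ℕP.≤-reflexive (ℕP.+-identityʳ _))))) (ℕP.m≤m+n _ 7))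
  h : ∀ n → + 9 ℤ.* (+ 2 ℤ.* n ℤ.* (n ℤ.+ + 1)) ℤ.+ + 28 ℤ.* n ℤ.+ + 28 ≡ + s n
  h (+ k) = ≡.trans (ZS.solve 1 (λ k → let k⁺ = con (+ 1) :+ k in con (+ 9) :* (con (+ 2) :* k :* (k :+ con (+ 1))) :+ con (+ 28) :* k :+ con (+ 28)
    := con (+ 18) :* k⁺ :* k⁺ :+ con (+ 10) :* k⁺ :+ con (+ 0)) ≡.refl (+ k)) (≡.sym (quadratic 18 10 0 (suc k)))
  h -[1+ zero ] = ≡.refl
  h -[1+ suc k ] = ≡.trans (ZS.solve 1 (λ k → let n = :- (con (+ 2) :+ k) in con (+ 9) :* (con (+ 2) :* n :* (n :+ con (+ 1))) :+ con (+ 28) :* n :+ con (+ 28)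
    := con (+ 18) :* k :* k :+ con (+ 26) :* k :+ con (+ 8)) ≡.refl (+ k)) (≡.sym (quadratic 18 26 8 k))
  f-Summable : M.Summable f
  f-Summable = M.X-Summable (λ k → 18 ℕ.* k ℕ.* k ℕ.+ 10 ℕ.* k ℕ.+ 0) (λ k → G (ℤ.- + 1 ℤ.+ + k)) (λ k → M.k≤ 18 10 0 k (s≤s z≤n))
  T⁻ : ℕ → PS
  T⁻ k = X^ (s -[1+ k ]) *P G -[1+ k ]
  regroup : (f 1 +P (M.Σ∞ (λ k → f (suc (suc k))) +P M.Σ∞ T⁻)) ≈P (M.Σ∞ f +P M.Σ∞ (λ k → T⁻ (suc k)))
  regroup n = ≡.trans (≡.cong (λ z → f 1 n +K (M.Σ∞ (λ k → f (suc (suc k))) n +K z)) (≡.sym (M.Σ∞-front {T⁻} (λ k → M.X*-small (G -[1+ k ]) (l⁻ k)) n)))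
    (≡.trans (KK.solve 4 (λ a b c d → a KK.:+ (b KK.:+ (c KK.:+ d)) KK.:= (c KK.:+ (a KK.:+ b)) KK.:+ d) ≡.refl (f 1 n) (M.Σ∞ (λ k → f (suc (suc k))) n) (f 0 n) (M.Σ∞ (λ k → T⁻ (suc k)) n))
    (≡.cong (_+K M.Σ∞ (λ k → T⁻ (suc k)) n) (≡.trans (≡.cong (f 0 n +K_) (M.Σ∞-front {λ k → f (suc k)} (λ k → M.mod-mono (ℕP.n≤1+n k) (f-Summable (suc k))) n)) (M.Σ∞-front {f} f-Summable n))))

S-3-2-ser : Laurent.ser (S 0 (+ 3) (ℤ.- + 2) (+ 9)) ≈P (M.m 0 16 3 M.- M.m 8 29 6)
S-3-2-ser = M.trans {Laurent.ser (S 0 (+ 3) (ℤ.- + 2) (+ 9))} (bisum-mono 0 (λ n → + 9 ℤ.* (+ 2 ℤ.* n ℤ.* (n ℤ.+ + 1)) ℤ.+ (ℤ.- + 2) ℤ.* n) G s h (λ k → ℕP.≤-trans (ℕP.n≤1+n k) (M.k≤ 18 16 0 (suc k) (s≤s z≤n))) (λ k → M.k≤ 18 20 2 k (s≤s z≤n)))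
  (M.trans (front⁺ (λ k → X^ (s (+ k)) *P G (+ k)) (M.Σ∞ (λ k → X^ (s -[1+ k ]) *P G -[1+ k ])) (M.X-Summable (λ k → s (+ k)) (λ k → G (+ k)) (λ k → M.k≤ 18 16 0 k (s≤s z≤n))))
    (M.+-cong {M.Σ∞ (λ k → X^ (s (+ k)) *P G (+ k))} {M.m 0 16 3} {M.Σ∞ (λ k → X^ (s -[1+ k ]) *P G -[1+ k ])} {M.- M.m 8 29 6}
      (M.lam-sum 16 0 3 (λ k → G (+ k)) (s≤s z≤n) (λ k → geomInv-pos (+ 3 ℤ.+ + 9 ℤ.* + k) (3 ℕ.+ 9 ℕ.* k) (s≤s z≤n) (≡.sym (affine 3 9 k))))
      (M.lam-sum⁻ 20 2 6 (λ k → G -[1+ k ]) (s≤s z≤n) (λ k → geomInv-neg (+ 3 ℤ.+ + 9 ℤ.* -[1+ k ]) (6 ℕ.+ 9 ℕ.* k) (s≤s z≤n)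
        (≡.trans (ZS.solve 1 (λ k → con (+ 3) :+ con (+ 9) :* (:- (con (+ 1) :+ k)) := :- (con (+ 6) :+ con (+ 9) :* k)) ≡.refl (+ k)) (≡.cong ℤ.-_ (≡.sym (affine 6 9 k))))))))
  where
  G : ℤ → PS
  G n = geomInv 1K (+ 3 ℤ.+ + 9 ℤ.* n)
  s : ℤ → ℕ
  s (+ k) = 18 ℕ.* k ℕ.* k ℕ.+ 16 ℕ.* k ℕ.+ 0
  s -[1+ k ] = 18 ℕ.* k ℕ.* k ℕ.+ 20 ℕ.* k ℕ.+ 2
  h : ∀ n → + 9 ℤ.* (+ 2 ℤ.* n ℤ.* (n ℤ.+ + 1)) ℤ.+ (ℤ.- + 2) ℤ.* n ℤ.+ + 0 ≡ + s n
  h (+ k) = ≡.trans (ZS.solve 1 (λ n → con (+ 9) :* (con (+ 2) :* n :* (n :+ con (+ 1))) :+ con (ℤ.- + 2) :* n :+ con (+ 0)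
    := con (+ 18) :* n :* n :+ con (+ 16) :* n :+ con (+ 0)) ≡.refl (+ k)) (≡.sym (quadratic 18 16 0 k))
  h -[1+ k ] = ≡.trans (ZS.solve 1 (λ k → let n = :- (con (+ 1) :+ k) in con (+ 9) :* (con (+ 2) :* n :* (n :+ con (+ 1))) :+ con (ℤ.- + 2) :* n :+ con (+ 0)
    := con (+ 18) :* k :* k :+ con (+ 20) :* k :+ con (+ 2)) ≡.refl (+ k)) (≡.sym (quadratic 18 20 2 k))

S-4-2-ser : Laurent.ser (S 0 (+ 4) (+ 2) (+ 9)) ≈P (M.m 0 20 4 M.- M.m 3 25 5)
S-4-2-ser = M.trans {Laurent.ser (S 0 (+ 4) (+ 2) (+ 9))} (bisum-ser 0 (λ n → mono (e n) *L fromPS (G n)) T h (λ k → M.X*-small (G (+ suc k)) (ℕP.≤-trans (ℕP.n≤1+n k) (M.k≤ 18 20 0 (suc k) (s≤s z≤n)))) T⁻-Summable)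
  (M.trans (front⁺ (λ k → T (+ k)) (M.Σ∞ (λ k → T -[1+ k ])) (M.X-Summable (λ k → 18 ℕ.* k ℕ.* k ℕ.+ 20 ℕ.* k ℕ.+ 0) (λ k → G (+ k)) (λ k → M.k≤ 18 20 0 k (s≤s z≤n))))
    (M.+-cong {M.Σ∞ (λ k → T (+ k))} {M.m 0 20 4} {M.Σ∞ (λ k → T -[1+ k ])} {M.- M.m 3 25 5}
      (M.lam-sum 20 0 4 (λ k → G (+ k)) (s≤s z≤n) (λ k → geomInv-pos (+ 4 ℤ.+ + 9 ℤ.* + k) (4 ℕ.+ 9 ℕ.* k) (s≤s z≤n) (≡.sym (affine 4 9 k))))
      negative))
  where
  G : ℤ → PS
  G n = geomInv 1K (+ 4 ℤ.+ + 9 ℤ.* n)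
  -- The term of index -1 has exponent -2; the other negative terms fit the same closed form.
  T : ℤ → PS
  T (+ k) = X^ (18 ℕ.* k ℕ.* k ℕ.+ 20 ℕ.* k ℕ.+ 0) *P G (+ k)
  T -[1+ k ] = M.- (X^ (18 ℕ.* k ℕ.* k ℕ.+ 25 ℕ.* k ℕ.+ 3) *P M.W (5 ℕ.+ 9 ℕ.* k))
  T⁻-Summable : M.Summable (λ k → T -[1+ k ])
  T⁻-Summable k = M.mod-trans (M.mod-neg (M.X*-small (M.W (5 ℕ.+ 9 ℕ.* k)) (M.k≤ 18 25 3 k (s≤s z≤n)))) (M.fine M.-0#≈0#)
  negative : M.Σ∞ (λ k → T -[1+ k ]) ≈P (M.- M.m 3 25 5)
  negative = M.trans (M.Σ∞-neg {λ k → X^ (18 ℕ.* k ℕ.* k ℕ.+ 25 ℕ.* k ℕ.+ 3) *P M.W (5 ℕ.+ 9 ℕ.* k)} (λ k → M.X*-small (M.W (5 ℕ.+ 9 ℕ.* k)) (M.k≤ 18 25 3 k (s≤s z≤n))))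
    (λ n → ≡.cong -K_ (M.lam-sum 25 3 5 (λ k → M.W (5 ℕ.+ 9 ℕ.* k)) (s≤s z≤n) (λ _ _ → ≡.refl) n))
  e : ℤ → ℤ
  e n = + 9 ℤ.* (+ 2 ℤ.* n ℤ.* (n ℤ.+ + 1)) ℤ.+ + 2 ℤ.* n
  h : ∀ n N → coeffL (mono (e n) *L fromPS (G n)) (+ N ℤ.- + 0) ≡ T n N
  h (+ k) N = mono-coeff (e (+ k)) 0 (18 ℕ.* k ℕ.* k ℕ.+ 20 ℕ.* k ℕ.+ 0) (G (+ k)) N
    (≡.trans (ZS.solve 1 (λ n → con (+ 9) :* (con (+ 2) :* n :* (n :+ con (+ 1))) :+ con (+ 2) :* n :+ con (+ 0)
      := con (+ 18) :* n :* n :+ con (+ 20) :* n :+ con (+ 0)) ≡.refl (+ k)) (≡.sym (quadratic 18 20 0 k)))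
  h -[1+ zero ] N = ≡.trans (coeff-at 2 (oneP *P G -[1+ 0 ]) (+ N ℤ.- + 0) (2 ℕ.+ N) (ZS.solve 1 (λ N → (N :+ (:- con (+ 0))) :+ con (+ 2) := con (+ 2) :+ N) ≡.refl (+ N)))
    (≡.trans (M.*-identityˡ (G -[1+ 0 ]) (2 ℕ.+ N)) (≡.trans (M.U-negative 4 (2 ℕ.+ N)) (≡.cong -K_ (≡.trans (M.*-congʳ {M.W 5} {X^ 5} {X^ 2 *P X^ 3} (PSModel.X-add 2 3) (2 ℕ.+ N))
      (≡.trans (M.*-assoc (X^ 2) (X^ 3) (M.W 5) (2 ℕ.+ N)) (PSModel.shift-high 2 (X^ 3 *P M.W 5) N))))))
  h -[1+ suc k ] N = ≡.trans (mono-coeff (e -[1+ suc k ]) 0 r (G -[1+ suc k ]) N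
    (≡.trans (ZS.solve 1 (λ k → let n = :- (con (+ 2) :+ k) in con (+ 9) :* (con (+ 2) :* n :* (n :+ con (+ 1))) :+ con (+ 2) :* n :+ con (+ 0)
      := con (+ 18) :* k :* k :+ con (+ 52) :* k :+ con (+ 32)) ≡.refl (+ k)) (≡.sym (quadratic 18 52 32 k))))
    (M.X-neg-merge r (5 ℕ.+ 9 ℕ.* suc k) (18 ℕ.* suc k ℕ.* suc k ℕ.+ 25 ℕ.* suc k ℕ.+ 3) (G -[1+ suc k ]) (M.W (5 ℕ.+ 9 ℕ.* suc k))
      (NS.solve 1 (λ k → (NS.con 18 NS.:* k NS.:* k NS.:+ NS.con 52 NS.:* k NS.:+ NS.con 32) NS.:+ (NS.con 5 NS.:+ NS.con 9 NS.:* (NS.con 1 NS.:+ k))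
        NS.:= NS.con 18 NS.:* (NS.con 1 NS.:+ k) NS.:* (NS.con 1 NS.:+ k) NS.:+ NS.con 25 NS.:* (NS.con 1 NS.:+ k) NS.:+ NS.con 3) ≡.refl k)
      (geomInv-neg (+ 4 ℤ.+ + 9 ℤ.* -[1+ suc k ]) (5 ℕ.+ 9 ℕ.* suc k) (s≤s z≤n)
        (≡.trans (ZS.solve 1 (λ k → con (+ 4) :+ con (+ 9) :* (:- (con (+ 1) :+ k)) := :- (con (+ 5) :+ con (+ 9) :* k)) ≡.refl (+ suc k)) (≡.cong ℤ.-_ (≡.sym (affine 5 9 (suc k)))))) N)
    where
    r = 18 ℕ.* k ℕ.* k ℕ.+ 52 ℕ.* k ℕ.+ 32

record IsPS (l : Laurent) (f : PS) : Set where
  constructor isPS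
  field shifted : Laurent.ser l ≈P (X^ (Laurent.low l) *P f)
open Laurent using (ser)

ser-isPS : ∀ l → Laurent.low l ≡ 0 → IsPS l (ser l)
ser-isPS (lau .0 f) ≡.refl = isPS (M.sym {X^ 0 *P f} {f} (M.*-identityˡ f))

shift-isPS : ∀ n l → Laurent.low l ≡ n → IsPS (mono (+ n) *L l) (ser l)
shift-isPS n (lau .n f) ≡.refl = isPS (λ _ → ≡.refl)

fromPS-isPS : ∀ f → IsPS (fromPS f) f
fromPS-isPS f = ser-isPS (fromPS f) ≡.refl

+L-isPS : ∀ {l l′ f f′} → IsPS l f → IsPS l′ f′ → IsPS (l +L l′) (f +P f′)
+L-isPS {lau L g} {lau L′ g′} {f} {f′} (isPS p) (isPS p′) = isPS (M.trans {X^ L′ *P g +P X^ L *P g′} {X^ L′ *P (X^ L *P f) +P X^ L *P (X^ L′ *P f′)}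
  (M.+-cong {X^ L′ *P g} {X^ L′ *P (X^ L *P f)} {X^ L *P g′} {X^ L *P (X^ L′ *P f′)} (M.*-congˡ {X^ L′} {g} {X^ L *P f} p) (M.*-congˡ {X^ L} {g′} {X^ L′ *P f′} p′)) (M.rep-+ L L′ f f′))

-L-isPS : ∀ {l l′ f f′} → IsPS l f → IsPS l′ f′ → IsPS (l -L l′) (f -P f′)
-L-isPS {lau L g} {lau L′ g′} {f} {f′} (isPS p) (isPS p′) = isPS (M.trans {X^ L′ *P g -P X^ L *P g′} {X^ L′ *P (X^ L *P f) -P X^ L *P (X^ L′ *P f′)}
  (λ n → ≡.cong₂ _-K_ (M.*-congˡ {X^ L′} {g} {X^ L *P f} p n) (M.*-congˡ {X^ L} {g′} {X^ L′ *P f′} p′ n)) (M.rep-minus L L′ f f′))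

*L-isPS : ∀ {l l′ f f′} → IsPS l f → IsPS l′ f′ → IsPS (l *L l′) (f *P f′)
*L-isPS {lau L g} {lau L′ g′} {f} {f′} (isPS p) (isPS p′) = isPS (M.trans {g *P g′} {(X^ L *P f) *P (X^ L′ *P f′)} (M.*-cong {g} {X^ L *P f} {g′} {X^ L′ *P f′} p p′) (M.rep-* L L′ f f′))

substL-isPS : ∀ {l f} → IsPS l f → IsPS (substL 3 l) (substP 3 f)
substL-isPS {lau L g} {f} (isPS p) = isPS (M.trans {substP 3 g} {substP 3 (X^ L *P f)} (M.σ-cong {g} {X^ L *P f} p) (M.rep-σ L f))

coeff-isPS⁺ : ∀ {l f} → IsPS l f → ∀ n → coeffL l (+ n) ≡ f n
coeff-isPS⁺ {lau L g} {f} (isPS p) n = ≡.trans (p (n ℕ.+ L)) (≡.trans (≡.cong (X^ L *P f) (ℕP.+-comm n L)) (PSModel.shift-high L f n))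

coeff-isPS⁻ : ∀ {l f} → IsPS l f → ∀ n → coeffL l -[1+ n ] ≡ 0K
coeff-isPS⁻ {lau L g} {f} (isPS p) n with ℕP.<-≤-connex n L
... | inj₁ l = ≡.trans (coeff-at L g -[1+ n ] (L ℕ.∸ suc n) (ℤP.⊖-≥ l)) (≡.trans (p (L ℕ.∸ suc n)) (PSModel.shift-low L f (L ℕ.∸ suc n) (ℕP.∸-monoʳ-< (s≤s z≤n) l)))
... | inj₂ l = coeff-below L g -[1+ n ] (n ℕ.∸ L) (≡.trans (ℤP.+-comm -[1+ n ] (+ L)) (neg-⊖ (suc n) L (n ℕ.∸ L) (≡.sym (≡.trans (ℕP.+-suc L _) (≡.cong suc (ℕP.m+[n∸m]≡n l))))))

isPS-≈L : ∀ {l l′ f f′} → IsPS l f → IsPS l′ f′ → f ≈P f′ → l ≈L l′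
isPS-≈L p p′ h (+ n) = ≡.trans (coeff-isPS⁺ p n) (≡.trans (h n) (≡.sym (coeff-isPS⁺ p′ n)))
isPS-≈L p p′ h -[1+ n ] = ≡.trans (coeff-isPS⁻ p n) (≡.sym (coeff-isPS⁻ p′ n))

theta-≈ : ∀ a b → 9 ℕ.∸ a ≡ b → theta a 9 ≈P M.Th a b
theta-≈ a .(9 ℕ.∸ a) ≡.refl = M.Th-intro a (9 ℕ.∸ a) (poch a 9) (poch (9 ℕ.∸ a) 9) (poch-≈ a 9) (poch-≈ (9 ℕ.∸ a) 9)

inverse-of : ∀ f g → f ≈P g → f 0 ≡ 1K → (g *P inv1 f) ≈P oneP
inverse-of f g h f0 = M.trans {g *P inv1 f} {f *P inv1 f} {oneP} (M.*-congʳ {inv1 f} {g} {f} (M.sym {f} {g} h)) (inv1-inverse f f0)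

x₁-x₂ : (ser (S 0 (ℤ.- + 3) (ℤ.- + 28) (+ 9)) -P ser (S 28 (+ 11) (+ 28) (+ 9))) ≈P M.Xs
x₁-x₂ n = ≡.trans (≡.cong₂ _-K_ (S-3-28-ser n) (S-11-28-ser n))
  (KK.solve 4 (λ a b c d → (a KK.:- b) KK.:- (c KK.:- d) KK.:= a KK.:- b KK.:- c KK.:+ d) ≡.refl (M.m 8 26 6 n) (M.m 3 19 3 n) (M.m 0 10 2 n) (M.m 15 35 7 n))

y₁-y₂ : (ser (S 0 (+ 3) (ℤ.- + 2) (+ 9)) -P X^ 2 *P ser (S 0 (+ 4) (+ 2) (+ 9))) ≈P M.Ys
y₁-y₂ n = ≡.trans (≡.cong₂ _-K_ (S-3-2-ser n) (≡.trans (M.*-congˡ {X^ 2} {ser (S 0 (+ 4) (+ 2) (+ 9))} {M.m 0 20 4 M.- M.m 3 25 5} S-4-2-ser n) (M.shift-m 2 0 20 4 3 25 5 n)))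
  (KK.solve 4 (λ a b c d → (a KK.:- b) KK.:- (c KK.:- d) KK.:= a KK.:- b KK.:- c KK.:+ d) ≡.refl (M.m 0 16 3 n) (M.m 8 29 6 n) (M.m 2 20 4 n) (M.m 5 25 5 n))

third-≈ : ∀ f → scaleP third f ≈P (constP third *P f)
third-≈ f = M.sym {constP third *P f} {scaleP third f} (constP-* third f)

twoThirds-≈ : ∀ f → scaleP twoThirds f ≈P ((constP third +P constP third) *P f)
twoThirds-≈ f = M.sym {(constP third +P constP third) *P f} {scaleP twoThirds f} (M.trans {(constP third +P constP third) *P f} (M.*-congʳ {f} {constP third +P constP third} {constP twoThirds} (λ n → ≡.sym (KK.distribʳ (oneP n) third third))) (constP-* twoThirds f))

minus-≈ : ∀ f → scaleP (-K 1K) f ≈P (M.- f)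
minus-≈ f n = KK.solve 1 (λ x → (KK.:- KK.:1) KK.:* x KK.:= KK.:- x) ≡.refl (f n)

E-≈ : ∀ j iq → j ≈P M.J → (M.QQ *P iq) ≈P oneP → (j *P j *P iq) ≈P M.EQ
E-≈ = M.EQ-intro

A₀-≈ : ∀ e u v w → e ≈P M.EQ → u ≈P M.u → v ≈P M.v → w ≈P M.w → (scaleP third (e *P w *P w) +P scaleP twoThirds (X^ 1 *P e *P u *P v)) ≈P M.A₀
A₀-≈ e u v w he hu hv hw = M.A₀-intro e u v w (scaleP third (e *P w *P w)) (scaleP twoThirds (X^ 1 *P e *P u *P v)) he hu hv hw (third-≈ (e *P w *P w)) (twoThirds-≈ (X^ 1 *P e *P u *P v))

A₁-≈ : ∀ e u v w i x → e ≈P M.EQ → u ≈P M.u → v ≈P M.v → w ≈P M.w → (M.Jw *P i) ≈P oneP → x ≈P M.Xs →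
  (X^ 1 *P i *P x +P (scaleP third (e *P v *P w) +P scaleP third (X^ 1 *P e *P u *P u))) ≈P M.A₁
A₁-≈ e u v w i x he hu hv hw hi hx = M.A₁-intro e u v w i x (scaleP third (e *P v *P w)) (scaleP third (X^ 1 *P e *P u *P u)) he hu hv hw hi hx (third-≈ (e *P v *P w)) (third-≈ (X^ 1 *P e *P u *P u))

A₂-≈ : ∀ e u v w i y → e ≈P M.EQ → u ≈P M.u → v ≈P M.v → w ≈P M.w → (M.Ju *P i) ≈P oneP → y ≈P M.Ys →
  (scaleP (-K 1K) (X^ 2 *P i) *P y +P (scaleP third (e *P u *P w) -P scaleP twoThirds (e *P v *P v))) ≈P M.A₂
A₂-≈ e u v w i y he hu hv hw hi hy = M.A₂-intro e u v w i y (scaleP (-K 1K) (X^ 2 *P i)) (scaleP third (e *P u *P w)) (scaleP twoThirds (e *P v *P v)) he hu hv hw hi hy (minus-≈ (X^ 2 *P i)) (third-≈ (e *P u *P w)) (twoThirds-≈ (e *P v *P v))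

assembled : ∀ iq s a₀ a₁ a₂ → (M.QQ *P iq) ≈P oneP → s ≈P M.qsum → a₀ ≈P M.A₀ → a₁ ≈P M.A₁ → a₂ ≈P M.A₂ →
  (iq *P s) ≈P (substP 3 a₀ +P X^ 1 *P substP 3 a₁ +P X^ 2 *P substP 3 a₂)
assembled = M.assemble


q-inverse : (M.QQ *P invQQ) ≈P oneP
q-inverse = inverse-of (poch 1 1) M.QQ (poch-≈ 1 1) ≡.refl

w-inverse : (M.Jw *P inv1 (poch 9 9 *P theta 4 9)) ≈P oneP
w-inverse = inverse-of (poch 9 9 *P theta 4 9) M.Jw (M.Jw-intro (poch 9 9) (theta 4 9) (poch-≈ 9 9) (theta-≈ 4 5 ≡.refl)) ≡.refl

u-inverse : (M.Ju *P inv1 (poch 9 9 *P theta 1 9)) ≈P oneP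
u-inverse = inverse-of (poch 9 9 *P theta 1 9) M.Ju (M.Ju-intro (poch 9 9) (theta 1 9) (poch-≈ 9 9) (theta-≈ 1 8 ≡.refl)) ≡.refl

E-EQ : E ≈P M.EQ
E-EQ = E-≈ (poch 9 9) invQQ (poch-≈ 9 9) q-inverse

a₀ a₁ a₂ : PS
a₀ = scaleP third (E *P theta 4 9 *P theta 4 9) +P scaleP twoThirds (X^ 1 *P E *P theta 1 9 *P theta 2 9)
a₁ = X^ 1 *P inv1 (poch 9 9 *P theta 4 9) *P (ser (S 0 (ℤ.- + 3) (ℤ.- + 28) (+ 9)) -P ser (S 28 (+ 11) (+ 28) (+ 9)))
  +P (scaleP third (E *P theta 2 9 *P theta 4 9) +P scaleP third (X^ 1 *P E *P theta 1 9 *P theta 1 9))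
a₂ = scaleP (-K 1K) (X^ 2 *P inv1 (poch 9 9 *P theta 1 9)) *P (ser (S 0 (+ 3) (ℤ.- + 2) (+ 9)) -P X^ 2 *P ser (S 0 (+ 4) (+ 2) (+ 9)))
  +P (scaleP third (E *P theta 1 9 *P theta 4 9) -P scaleP twoThirds (E *P theta 2 9 *P theta 2 9))

a₀-≈ : a₀ ≈P M.A₀
a₀-≈ = A₀-≈ E (theta 1 9) (theta 2 9) (theta 4 9) E-EQ (theta-≈ 1 8 ≡.refl) (theta-≈ 2 7 ≡.refl) (theta-≈ 4 5 ≡.refl)

a₁-≈ : a₁ ≈P M.A₁
a₁-≈ = A₁-≈ E (theta 1 9) (theta 2 9) (theta 4 9) (inv1 (poch 9 9 *P theta 4 9)) (ser (S 0 (ℤ.- + 3) (ℤ.- + 28) (+ 9)) -P ser (S 28 (+ 11) (+ 28) (+ 9)))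
  E-EQ (theta-≈ 1 8 ≡.refl) (theta-≈ 2 7 ≡.refl) (theta-≈ 4 5 ≡.refl) w-inverse x₁-x₂

a₂-≈ : a₂ ≈P M.A₂
a₂-≈ = A₂-≈ E (theta 1 9) (theta 2 9) (theta 4 9) (inv1 (poch 9 9 *P theta 1 9)) (ser (S 0 (+ 3) (ℤ.- + 2) (+ 9)) -P X^ 2 *P ser (S 0 (+ 4) (+ 2) (+ 9)))
  E-EQ (theta-≈ 1 8 ≡.refl) (theta-≈ 2 7 ≡.refl) (theta-≈ 4 5 ≡.refl) u-inverse y₁-y₂

identity : (invQQ *P (ser sum1 -P ser sum2)) ≈P (substP 3 a₀ +P X^ 1 *P substP 3 a₁ +P X^ 2 *P substP 3 a₂)
identity = assembled invQQ (ser sum1 -P ser sum2) a₀ a₁ a₂ q-inverse sums-difference a₀-≈ a₁-≈ a₂-≈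

product-shape : ∀ p {l l′ f f′} → IsPS l f → IsPS l′ f′ → IsPS (fromPS p *L (l -L l′)) (p *P (f -P f′))
product-shape p h h′ = *L-isPS (fromPS-isPS p) (-L-isPS h h′)

LHS-isPS : IsPS LHS (invQQ *P (ser sum1 -P ser sum2))
LHS-isPS = product-shape invQQ {sum1} {sum2} {ser sum1} {ser sum2} (ser-isPS sum1 ≡.refl) (ser-isPS sum2 ≡.refl)

A130-isPS : IsPS A130 a₀
A130-isPS = fromPS-isPS a₀

sum-shape : ∀ p t {l l′ f f′} → IsPS l f → IsPS l′ f′ → IsPS ((fromPS p *L (l -L l′)) +L fromPS t) (p *P (f -P f′) +P t)
sum-shape p t h h′ = +L-isPS (product-shape p h h′) (fromPS-isPS t)

A131-isPS : IsPS A131 a₁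
A131-isPS = sum-shape (X^ 1 *P inv1 (poch 9 9 *P theta 4 9)) (scaleP third (E *P theta 2 9 *P theta 4 9) +P scaleP third (X^ 1 *P E *P theta 1 9 *P theta 1 9))
  {S 0 (ℤ.- + 3) (ℤ.- + 28) (+ 9)} {mono (+ 28) *L S 28 (+ 11) (+ 28) (+ 9)} {ser (S 0 (ℤ.- + 3) (ℤ.- + 28) (+ 9))} {ser (S 28 (+ 11) (+ 28) (+ 9))} (ser-isPS (S 0 (ℤ.- + 3) (ℤ.- + 28) (+ 9)) ≡.refl) (shift-isPS 28 (S 28 (+ 11) (+ 28) (+ 9)) ≡.refl)

A132-isPS : IsPS A132 a₂
A132-isPS = sum-shape (scaleP (-K 1K) (X^ 2 *P inv1 (poch 9 9 *P theta 1 9))) (scaleP third (E *P theta 1 9 *P theta 4 9) -P scaleP twoThirds (E *P theta 2 9 *P theta 2 9))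
  {S 0 (+ 3) (ℤ.- + 2) (+ 9)} {mono (+ 2) *L S 0 (+ 4) (+ 2) (+ 9)} {ser (S 0 (+ 3) (ℤ.- + 2) (+ 9))} {X^ 2 *P ser (S 0 (+ 4) (+ 2) (+ 9))} (ser-isPS (S 0 (+ 3) (ℤ.- + 2) (+ 9)) ≡.refl) (*L-isPS {mono (+ 2)} {S 0 (+ 4) (+ 2) (+ 9)} {X^ 2} {ser (S 0 (+ 4) (+ 2) (+ 9))} (fromPS-isPS (X^ 2)) (ser-isPS (S 0 (+ 4) (+ 2) (+ 9)) ≡.refl))

triple-shape : ∀ {l₀ l₁ l₂ f₀ f₁ f₂} → IsPS l₀ f₀ → IsPS l₁ f₁ → IsPS l₂ f₂ →
  IsPS (substL 3 l₀ +L mono (+ 1) *L substL 3 l₁ +L mono (+ 2) *L substL 3 l₂) (substP 3 f₀ +P X^ 1 *P substP 3 f₁ +P X^ 2 *P substP 3 f₂)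
triple-shape h₀ h₁ h₂ = +L-isPS (+L-isPS (substL-isPS h₀) (*L-isPS (fromPS-isPS (X^ 1)) (substL-isPS h₁))) (*L-isPS (fromPS-isPS (X^ 2)) (substL-isPS h₂))

RHS-isPS : IsPS RHS (substP 3 a₀ +P X^ 1 *P substP 3 a₁ +P X^ 2 *P substP 3 a₂)
RHS-isPS = triple-shape {A130} {A131} {A132} {a₀} {a₁} {a₂} A130-isPS A131-isPS A132-isPS

theorem2 : LHS ≈L RHS
theorem2 = isPS-≈L {LHS} {RHS} {invQQ *P (ser sum1 -P ser sum2)} {substP 3 a₀ +P X^ 1 *P substP 3 a₁ +P X^ 2 *P substP 3 a₂} LHS-isPS RHS-isPS identity
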